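{- Let $\Delta$ be a positive integer. Then there exists a constant $C=C(\Delta)$ such that for any (finite) graph $G$ with maximum degree $\Delta$ and any finite abelian group $\Gamma_0$ such that $|\Gamma_0|$ divides $e(G)$, we have $$R(G,\Gamma_0)\le C\cdot v(G).$$
   Context: For a finite graph $G$ and a finite abelian group $\Gamma$ such that $|\Gamma|$ divides the number of edges $e(G)$, the zero-sum Ramsey number $R(G,\Gamma)$ is the minimum positive integer $t$ such that for every edge-colouring $c:E(K_t)\to\Gamma$ of the complete graph $K_t$ there is a copy of $G$ in $K_t$ with $\sum_{e\in E(G)}c(e)=0_\Gamma$ (a zero-sum copy). Here $v(G)$ denotes the number of vertices of $G$. -}

module Defs where

open import Level using (0ℓ)
open import Data.Nat using (ℕ; suc; _≤_; _<ᵇ_)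
open import Data.Nat.Divisibility using (_∣_)
open import Data.Bool using (Bool; true; false; if_then_else_; _∧_)
open import Data.Fin using (Fin; toℕ)
open import Data.List using (List; []; _∷_; [_]; concatMap; length; filter; allFin; foldr)
open import Data.Product using (_×_; _,_; ∃)
open import Relation.Binary.PropositionalEquality using (_≡_; _≢_; setoid)
open import Relation.Nullary using (¬_)
open import Algebra.Bundles using (AbelianGroup)
open import Function.Bundles using (Inverse)
open import Function.Definitions using (Injective)

record Graph : Set where
  field
    n      : ℕ
    adj    : Fin n → Fin n → Bool
    sym    : ∀ i j → adj i j ≡ adj j i
    irrefl : ∀ i → adj i i ≡ false
open Graph public

v : Graph → ℕ
v G = n G

edges : (G : Graph) → List (Fin (n G) × Fin (n G))
edges G = concatMap (λ i → concatMap (λ j →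
            if adj G i j ∧ (toℕ i <ᵇ toℕ j) then [ (i , j) ] else [])
            (allFin (n G))) (allFin (n G))

e : Graph → ℕ
e G = length (edges G)

deg : (G : Graph) → Fin (n G) → ℕ
deg G i = foldr (λ j k → if adj G i j then suc k else k) 0 (allFin (n G))

MaxDegree : Graph → ℕ → Set
MaxDegree G Δ = (∀ i → deg G i ≤ Δ) × ∃ λ i → deg G i ≡ Δ

record FiniteAbelianGroup : Set₁ where
  field
    abelianGroup : AbelianGroup 0ℓ 0ℓ
    order : ℕ
    enum  : Inverse (setoid (Fin order)) (AbelianGroup.setoid abelianGroup)
  open AbelianGroup abelianGroup public

module _ (Γ : FiniteAbelianGroup) where
  open FiniteAbelianGroup Γ

  -- An edge-colouring of K_t by Γ: a colour for every unordered pair,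
  -- given as a symmetric function on ordered pairs.
  record Colouring (t : ℕ) : Set where
    field
      col    : Fin t → Fin t → Carrier
      colSym : ∀ x y → col x y ≈ col y x
  open Colouring public

  copySum : (G : Graph) {t : ℕ} → Colouring t → (Fin (n G) → Fin t) → Carrier
  copySum G c f = foldr (λ { (i , j) acc → col c (f i) (f j) ∙ acc }) ε (edges G)

  ZeroSumProperty : Graph → ℕ → Set
  ZeroSumProperty G t =
    (c : Colouring t) → ∃ λ (f : Fin (n G) → Fin t) →
      Injective _≡_ _≡_ f × (copySum G c f ≈ ε)

  -- R(G,Γ) ≤ N : the least positive t with the zero-sum property is ≤ N,
  -- i.e. some positive t ≤ N has the zero-sum property.
  ZeroSumRamseyAtMost : Graph → ℕ → Set
  ZeroSumRamseyAtMost G N = ∃ λ t → 1 ≤ t × t ≤ N × ZeroSumProperty G t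

{-# OPTIONS --safe #-}
-- The proof is by contradiction: suppose that c admits no zero-sum copy of G. A gadget in a set W of hosts consists of vertices x, y, u₁, …, u_d,
-- where d is the degree of many far-apart vertices of G; its difference δ = Σ c(x,uⱼ) − Σ c(y,uⱼ) is the effect of moving one vertex of degree d.
-- If all gadgets of W have their differences in a subgroup J, then c(x,y) ≡ κ + τ(x) + τ(y) modulo J on W, with d τ ≡ 0. If moreover disjoint
-- gadgets inside W realise every element of J, then a copy whose sum lies in J can be corrected to have sum zero. So one descends along
-- subgroups J with such sets W until the gadgets of W cannot be confined to a smaller subgroup on a large subset. Sets of achievable corrections
-- grow by Dyson's transform: adding a gadget either enlarges the set or makes it periodic, which doubles the subgroup already covered.
--
-- If J has small index then τ is constant modulo J on a large set, where the whole neighbourhood of a moved vertex can be relocated too; this yields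
-- moves with many values unless all differences lie in a bounded set D. In that case either all elements of D have small order, and multiples
-- of single differences cover a subgroup, or some element of large order bounds the number of values of τ, hence the number of colours, and
-- the linear Ramsey theorem gives a monochromatic copy, whose sum e(G) q vanishes.
-- If J has large index then J is small and few gadgets suffice; here a copy is made to sum to 0 modulo J by putting vertices of equal degree into
-- common classes of τ in groups of d.
module Submission where

open import Level using (0ℓ)
open import Data.Nat using (ℕ; zero; suc; _<ᵇ_; _+_; _*_; _∸_; _^_; _≤_; _<_; z≤n; s≤s; _≤?_; pred; >-nonZero) renaming (_≟_ to _≟ⁿ_)
open import Data.Nat.Properties using (≤-refl; ≤-trans; ≤-reflexive; <⇒≤; ≰⇒>; <⇒≱; ≤-<-trans; <-cmp; n≤1+n; m≤m+n; m≤n+m; suc-injective; n≢0⇒n>0;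
  +-comm; +-assoc; +-identityʳ; +-suc; *-comm; *-assoc; *-identityʳ; *-identityˡ; *-zeroʳ; *-distribʳ-+; *-distribˡ-+;
  +-mono-≤; +-monoˡ-≤; +-monoʳ-≤; +-monoʳ-<; *-mono-≤; *-monoˡ-≤; *-monoʳ-≤; *-mono-<; *-monoʳ-<; +-cancelˡ-≤; +-cancelʳ-≤; *-cancelˡ-≤; *-cancelʳ-≤; *-cancelˡ-<;
  ≤-total; ≤-pred; m≤n⇒m≤1+n; m∸n+n≡m; m∸n≤m; m≤n+m∸n; m<n⇒0<n∸m; m^n>0; ^-monoʳ-≤; +-0-isCommutativeMonoid; module ≤-Reasoning)
open import Data.Nat.DivMod using (_/_; _%_; m≡m%n+[m/n]*n; m%n<n; m/n*n≤m)
open import Data.Nat.Induction using (<-wellFounded)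
open import Data.Nat.Tactic.RingSolver using (solve-∀)
open import Data.Nat.Divisibility using (_∣_; divides; ∣⇒≤)
open import Data.Bool using (Bool; true; false; if_then_else_; _∧_; _∨_; not)
open import Data.Bool.Properties using (∨-comm) renaming (_≟_ to _≟ᵇ_)
open import Data.Fin using (Fin; toℕ; fromℕ<; funToFin; finToFun) renaming (zero to fzero; suc to fsuc)
open import Data.Fin.Properties using (_≟_; any?; all?; finToFun-funToFin; toℕ-injective; toℕ-fromℕ<; toℕ<n)
open import Data.List using (List; []; _∷_; [_]; _++_; map; concat; concatMap; length; filter; allFin; foldr; take; drop; zip; _ʳ++_; upTo; replicate)
open import Data.List.Properties using (length-++; length-map; length-filter; length-tabulate; length-replicate; length-upTo; length-drop; map-++; map-∘; map-cong-local; ++-assoc; ∷-injectiveˡ; ∷-injectiveʳ; take++drop≡id; filter-reject) renaming (≡-dec to list-≡-dec)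
open import Data.List.Membership.Propositional using (_∈_; _∉_; find; lose)
open import Data.List.Membership.Propositional.Properties using (∈-filter⁺; ∈-filter⁻; ∈-map⁺; ∈-map⁻; ∈-++⁺ˡ; ∈-++⁺ʳ; ∈-++⁻; ∈-∃++; ∈-allFin; ∈-upTo⁺; ∈-concatMap⁺; ∈-concatMap⁻)
open import Data.List.Membership.DecPropositional using () renaming (_∈?_ to mem?)
open import Data.List.Relation.Unary.Any using (Any; here; there) renaming (any? to anyL?)
open import Data.List.Relation.Unary.All using (All; []; _∷_) renaming (map to mapAll; lookup to lookupAll; tabulate to tabAll)
open import Data.List.Relation.Unary.AllPairs using ([]; _∷_)
open import Data.List.Relation.Unary.Unique.Propositional using (Unique)
open import Data.List.Relation.Unary.Unique.Propositional.Properties using (allFin⁺; Unique[x∷xs]⇒x∉xs) renaming (filter⁺ to unique-filter; ++⁺ to unique-++; take⁺ to unique-take; drop⁺ to unique-drop; map⁻ to unique-map⁻)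
open import Data.List.Relation.Binary.Subset.Propositional using (_⊆_)
open import Data.List.Relation.Binary.Disjoint.Propositional using (Disjoint)
open import Data.Vec using (Vec; lookup; zipWith) renaming ([] to []ᵛ; _∷_ to _∷ᵛ_)
open import Data.Product using (Σ; ∃; ∃₂; _×_; _,_; proj₁; proj₂)
open import Data.Sum using (_⊎_; inj₁; inj₂)
open import Data.Empty using (⊥; ⊥-elim)
open import Function using (_∘_; id; case_of_)
open import Function.Bundles using (Inverse)
open import Function.Definitions using (Injective)
open import Induction.WellFounded using (Acc; acc)
open import Relation.Nullary using (¬_; Dec; yes; no; does)
open import Relation.Nullary.Decidable using (decidable-stable; ¬?; _×-dec_; _→-dec_)
open import Relation.Binary using (tri<; tri≈; tri>)
open import Relation.Binary.PropositionalEquality using (_≡_; _≢_; refl; sym; trans; cong; cong₂; subst; subst₂; module ≡-Reasoning) renaming (isEquivalence to ≡-isEquivalence)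
open import Algebra.Structures using (IsCommutativeMonoid; IsAbelianGroup)
open import Algebra.Bundles using (CommutativeMonoid)
import Algebra.Properties.CommutativeSemigroup as CSP
import Defs

-- The obstacle is the count of corrections. Only `k` far-apart vertices can be moved, whereas the
-- group may have `K₁` * `k` elements, so moves with two values each fall short by the factor `K₁`.
-- Hence, for bounded index, one unit offers both ends of many gadgets. Their differences are
-- distinct modulo `H`, so the ends take at least the square root of that many values. This lasts
-- until `H` has `ℓ` = 9 `K₁` elements; from then on two cosets of `H` per unit are enough. Offering
-- unrelated places to a whole neighbourhood is harmless only because the colouring is constant
-- modulo `J`; otherwise the values could differ outside `J`. For large index a unit therefore moves
-- one vertex while the hosts of its neighbours stay fixed, and 3 |J| bundles of `d` vertices fit
-- into the `k` available ones. Divisibility enters twice: `e G` annihilates the group, and the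
-- order is at most `e G`, hence at most `K₁` * `k`. Whether a suitable gadget exists is never
-- decided: intermediate results end in `⊥`, which permits excluded middle, and a finite search
-- recovers the copy at the end.

slack : ∀ {a b} s → a + s ≡ b → a ≤ b
slack {a} s eq = subst (a ≤_) eq (m≤m+n a s)

-- Finite sums, duplicate-free lists and the choice of fresh vertices.

b2n : Bool → ℕ
b2n true = 1
b2n false = 0

fil : {X : Set} → (X → Bool) → List X → List X
fil p = filter (λ x → p x ≟ᵇ true)

module _ {X : Set} {p : X → Bool} where
  ∈-fil⁺ : ∀ {x xs} → x ∈ xs → p x ≡ true → x ∈ fil p xs
  ∈-fil⁺ = ∈-filter⁺ (λ x → p x ≟ᵇ true)

  ∈-fil⁻ : ∀ {x} xs → x ∈ fil p xs → x ∈ xs × p x ≡ true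
  ∈-fil⁻ xs = ∈-filter⁻ (λ x → p x ≟ᵇ true) {xs = xs}

  fil-unique : ∀ {xs} → Unique xs → Unique (fil p xs)
  fil-unique = unique-filter (λ x → p x ≟ᵇ true)

  fil⊆ : ∀ xs → fil p xs ⊆ xs
  fil⊆ xs = proj₁ ∘ ∈-fil⁻ xs

T⇒F⇒⊥ : ∀ {b : Bool} → b ≡ true → b ≡ false → ⊥
T⇒F⇒⊥ refl ()

bool : (b : Bool) → b ≡ true ⊎ b ≡ false
bool true = inj₁ refl
bool false = inj₂ refl

¬T⇒F : ∀ {b} → ¬ (b ≡ true) → b ≡ false
¬T⇒F {true} h = ⊥-elim (h refl)
¬T⇒F {false} h = refl

module ListSum {A : Set} {_∙_ : A → A → A} {ε : A} (isCM : IsCommutativeMonoid _≡_ _∙_ ε) where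
  open IsCommutativeMonoid isCM using (assoc; identityˡ; identityʳ; comm)

  cMonoid : CommutativeMonoid 0ℓ 0ℓ
  cMonoid = record { isCommutativeMonoid = isCM }

  open CSP (CommutativeMonoid.commutativeSemigroup cMonoid) using (interchange)

  ∑ : {X : Set} → List X → (X → A) → A
  ∑ [] f = ε
  ∑ (x ∷ xs) f = f x ∙ ∑ xs f

  module _ {X : Set} where
    ∑-cong : ∀ (xs : List X) {f g : X → A} → (∀ {x} → x ∈ xs → f x ≡ g x) → ∑ xs f ≡ ∑ xs g
    ∑-cong [] h = refl
    ∑-cong (x ∷ xs) h = cong₂ _∙_ (h (here refl)) (∑-cong xs (h ∘ there))

    ∑-++ : ∀ (xs ys : List X) f → ∑ (xs ++ ys) f ≡ ∑ xs f ∙ ∑ ys f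
    ∑-++ [] ys f = sym (identityˡ _)
    ∑-++ (x ∷ xs) ys f = trans (cong (f x ∙_) (∑-++ xs ys f)) (sym (assoc _ _ _))

    ∑-∙ : ∀ (xs : List X) f g → ∑ xs (λ x → f x ∙ g x) ≡ ∑ xs f ∙ ∑ xs g
    ∑-∙ [] f g = sym (identityˡ ε)
    ∑-∙ (x ∷ xs) f g = trans (cong ((f x ∙ g x) ∙_) (∑-∙ xs f g)) (interchange _ _ _ _)

    ∑-ε : ∀ (xs : List X) {f} → (∀ {x} → x ∈ xs → f x ≡ ε) → ∑ xs f ≡ ε
    ∑-ε [] h = refl
    ∑-ε (x ∷ xs) h = trans (cong₂ _∙_ (h (here refl)) (∑-ε xs (h ∘ there))) (identityˡ ε)

    ∑-concatMap : {Y : Set} (ys : List Y) (h : Y → List X) (f : X → A) → ∑ (concatMap h ys) f ≡ ∑ ys (λ y → ∑ (h y) f)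
    ∑-concatMap [] h f = refl
    ∑-concatMap (y ∷ ys) h f = trans (∑-++ (h y) _ f) (cong (∑ (h y) f ∙_) (∑-concatMap ys h f))

    ∑-map : {Y : Set} (ys : List Y) (h : Y → X) (f : X → A) → ∑ (map h ys) f ≡ ∑ ys (f ∘ h)
    ∑-map [] h f = refl
    ∑-map (y ∷ ys) h f = cong (f (h y) ∙_) (∑-map ys h f)

    ∑-fil : ∀ (p : X → Bool) xs f → ∑ (fil p xs) f ≡ ∑ xs (λ x → if p x then f x else ε)
    ∑-fil p [] f = refl
    ∑-fil p (x ∷ xs) f with p x
    ... | true = cong (f x ∙_) (∑-fil p xs f)
    ... | false = trans (∑-fil p xs f) (sym (identityˡ _))

    ∑-swap : {Y : Set} (xs : List X) (ys : List Y) (f : X → Y → A) →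
      ∑ xs (λ x → ∑ ys (f x)) ≡ ∑ ys (λ y → ∑ xs (λ x → f x y))
    ∑-swap [] ys f = sym (∑0 ys)
      where
        ∑0 : ∀ {Y : Set} (ys : List Y) → ∑ ys (λ _ → ε) ≡ ε
        ∑0 [] = refl
        ∑0 (_ ∷ ys) = trans (identityˡ _) (∑0 ys)
    ∑-swap {Y} (x ∷ xs) ys f = trans (cong (∑ ys (f x) ∙_) (∑-swap xs ys f)) (sym (dist ys))
      where
        dist : ∀ ys → ∑ ys (λ y → f x y ∙ ∑ xs (λ x → f x y)) ≡ ∑ ys (f x) ∙ ∑ ys (λ y → ∑ xs (λ x → f x y))
        dist [] = sym (identityˡ ε)
        dist (y ∷ ys) = trans (cong ((f x y ∙ ∑ xs (λ x → f x y)) ∙_) (dist ys)) (interchange _ _ _ _)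

  ∑-single : ∀ {k} (xs : List (Fin k)) (y : Fin k) (f : Fin k → A) → Unique xs → y ∈ xs →
    ∑ xs (λ x → if does (x ≟ y) then f x else ε) ≡ f y
  ∑-single (x ∷ xs) y f (x∉ ∷ u) y∈ with x ≟ y
  ... | yes refl = trans (cong (f x ∙_) (∑-ε xs λ {z} z∈ → lem z z∈)) (identityʳ _)
    where
      lem : ∀ z → z ∈ xs → (if does (z ≟ x) then f z else ε) ≡ ε
      lem z z∈ with z ≟ x
      ... | yes refl = ⊥-elim (lookupAll x∉ z∈ refl)
      ... | no _ = refl
  ... | no x≢y with y∈
  ...   | here refl = ⊥-elim (x≢y refl)
  ...   | there y∈' = trans (identityˡ _) (∑-single xs y f u y∈')

open ListSum +-0-isCommutativeMonoid public using () renaming (∑ to sumN; ∑-cong to sumN-cong; ∑-++ to sumN-++; ∑-∙ to sumN-+; ∑-ε to sumN-0; ∑-fil to sumN-fil; ∑-swap to sumN-swap; ∑-single to sumN-single)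

module _ {X : Set} where
  sumN-mono : ∀ (xs : List X) {f g : X → ℕ} → (∀ {x} → x ∈ xs → f x ≤ g x) → sumN xs f ≤ sumN xs g
  sumN-mono [] h = z≤n
  sumN-mono (x ∷ xs) h = +-mono-≤ (h (here refl)) (sumN-mono xs (h ∘ there))

  sumN-const : ∀ (xs : List X) c → sumN xs (λ _ → c) ≡ length xs * c
  sumN-const [] c = refl
  sumN-const (x ∷ xs) c = cong (c +_) (sumN-const xs c)

  sumN-bound : ∀ (xs : List X) {f : X → ℕ} c → (∀ {x} → x ∈ xs → f x ≤ c) → sumN xs f ≤ length xs * c
  sumN-bound xs c h = ≤-trans (sumN-mono xs h) (≤-reflexive (sumN-const xs c))

  sumN-*ˡ : ∀ (xs : List X) c (f : X → ℕ) → sumN xs (λ x → c * f x) ≡ c * sumN xs f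
  sumN-*ˡ [] c f = sym (*-zeroʳ c)
  sumN-*ˡ (x ∷ xs) c f = trans (cong (c * f x +_) (sumN-*ˡ xs c f)) (sym (*-distribˡ-+ c (f x) _))

  sumN-*ʳ : ∀ (xs : List X) c (f : X → ℕ) → sumN xs (λ x → f x * c) ≡ sumN xs f * c
  sumN-*ʳ [] c f = refl
  sumN-*ʳ (x ∷ xs) c f = trans (cong (f x * c +_) (sumN-*ʳ xs c f)) (sym (*-distribʳ-+ c (f x) _))

  length-fil : ∀ (p : X → Bool) xs → length (fil p xs) ≡ sumN xs (b2n ∘ p)
  length-fil p [] = refl
  length-fil p (x ∷ xs) with p x
  ... | true = cong suc (length-fil p xs)
  ... | false = length-fil p xs

  length-fil-not : ∀ (p : X → Bool) xs → length (fil p xs) + length (fil (not ∘ p) xs) ≡ length xs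
  length-fil-not p [] = refl
  length-fil-not p (x ∷ xs) with p x
  ... | true = cong suc (length-fil-not p xs)
  ... | false = trans (+-suc _ _) (cong suc (length-fil-not p xs))

  sumN-member : ∀ {xs : List X} {x} (f : X → ℕ) → x ∈ xs → f x ≤ sumN xs f
  sumN-member f (here refl) = m≤m+n _ _
  sumN-member f (there h) = ≤-trans (sumN-member f h) (m≤n+m _ _)

  -- A maximiser of `f` works; head and tail are separate arguments because the list must be
  -- nonempty.
  averaging : ∀ (f : X → ℕ) x xs → ∃ λ y → y ∈ x ∷ xs × sumN (x ∷ xs) f ≤ suc (length xs) * f y
  averaging f x [] = x , here refl , ≤-refl
  averaging f x (x' ∷ xs) with averaging f x' xs
  ... | y , y∈ , h with ≤-total (f x) (f y)
  ...   | inj₁ le = y , there y∈ , +-mono-≤ le h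
  ...   | inj₂ le = x , here refl , +-monoʳ-≤ (f x) (≤-trans h (*-monoʳ-≤ (suc (length xs)) le))

  unique-⊆-length : ∀ {xs ys : List X} → Unique xs → xs ⊆ ys → length xs ≤ length ys
  unique-⊆-length {[]} u s = z≤n
  unique-⊆-length {x ∷ xs} {ys} (x∉ ∷ u) s with ∈-∃++ (s (here refl))
  ... | as , bs , refl = ≤-trans (s≤s (unique-⊆-length u s')) (≤-reflexive eq)
    where
      s' : xs ⊆ as ++ bs
      s' {z} z∈ with ∈-++⁻ as (s (there z∈))
      ... | inj₁ z∈as = ∈-++⁺ˡ z∈as
      ... | inj₂ (here refl) = ⊥-elim (lookupAll x∉ z∈ refl)
      ... | inj₂ (there z∈bs) = ∈-++⁺ʳ as z∈bs
      eq : suc (length (as ++ bs)) ≡ length (as ++ x ∷ bs)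
      eq = trans (cong suc (length-++ as)) (trans (sym (+-suc _ _)) (sym (length-++ as)))

  take⊆ : ∀ k (xs : List X) → take k xs ⊆ xs
  take⊆ k xs {z} z∈ = subst (z ∈_) (take++drop≡id k xs) (∈-++⁺ˡ z∈)

  length-take≤ : ∀ k (xs : List X) → k ≤ length xs → length (take k xs) ≡ k
  length-take≤ zero xs h = refl
  length-take≤ (suc k) (x ∷ xs) (s≤s h) = cong suc (length-take≤ k xs h)

  unique-++⁻ˡ : ∀ (xs : List X) {ys} → Unique (xs ++ ys) → Unique xs
  unique-++⁻ˡ [] u = []
  unique-++⁻ˡ (x ∷ xs) (h ∷ u) = tabAll (λ z∈ → lookupAll h (∈-++⁺ˡ z∈)) ∷ unique-++⁻ˡ xs u

  unique-++⁻ʳ : ∀ (xs : List X) {ys} → Unique (xs ++ ys) → Unique ys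
  unique-++⁻ʳ [] u = u
  unique-++⁻ʳ (x ∷ xs) (h ∷ u) = unique-++⁻ʳ xs u

  unique-++-disj : ∀ (xs : List X) {ys} → Unique (xs ++ ys) → Disjoint xs ys
  unique-++-disj (x ∷ xs) (h ∷ u) (here refl , q) = lookupAll h (∈-++⁺ʳ xs q) refl
  unique-++-disj (x ∷ xs) (h ∷ u) (there p , q) = unique-++-disj xs u (p , q)

  unique-cons : ∀ {x : X} {xs} → x ∉ xs → Unique xs → Unique (x ∷ xs)
  unique-cons x∉ u = tabAll (λ z∈ eq → x∉ (subst (_∈ _) (sym eq) z∈)) ∷ u

module _ {k : ℕ} where
  infixl 6 _∖_
  _∈ᵇ_ : Fin k → List (Fin k) → Bool
  x ∈ᵇ R = does (mem? _≟_ x R)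

  ∈ᵇ⇒∈ : ∀ {x R} → x ∈ᵇ R ≡ true → x ∈ R
  ∈ᵇ⇒∈ {x} {R} h with mem? _≟_ x R
  ... | yes p = p

  ∈⇒∈ᵇ : ∀ {x R} → x ∈ R → x ∈ᵇ R ≡ true
  ∈⇒∈ᵇ {x} {R} h with mem? _≟_ x R
  ... | yes p = refl
  ... | no ¬p = ⊥-elim (¬p h)

  _∖_ : List (Fin k) → List (Fin k) → List (Fin k)
  W ∖ R = fil (λ x → not (x ∈ᵇ R)) W

  ∈-∖⁺ : ∀ {x W R} → x ∈ W → x ∉ R → x ∈ W ∖ R
  ∈-∖⁺ {x} {W} {R} x∈ x∉ = ∈-fil⁺ x∈ (lem (bool (x ∈ᵇ R)))
    where
      lem : _ → not (x ∈ᵇ R) ≡ true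
      lem (inj₁ h) = ⊥-elim (x∉ (∈ᵇ⇒∈ h))
      lem (inj₂ h) = cong not h

  ∈-∖⁻ : ∀ {x} W R → x ∈ W ∖ R → x ∈ W × x ∉ R
  ∈-∖⁻ {x} W R x∈ with ∈-fil⁻ {p = λ x → not (x ∈ᵇ R)} W x∈
  ... | x∈W , h = x∈W , λ x∈R → T⇒F⇒⊥ h (cong not (∈⇒∈ᵇ x∈R))

  ∖-unique : ∀ {W} R → Unique W → Unique (W ∖ R)
  ∖-unique R u = fil-unique u

  ∖⊆ : ∀ W R → W ∖ R ⊆ W
  ∖⊆ W R = fil⊆ W

  length-∖ : ∀ {W} R → Unique W → length W ≤ length (W ∖ R) + length R
  length-∖ {W} R u = ≤-trans (≤-reflexive (sym (length-fil-not (λ x → x ∈ᵇ R) W)))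
    (≤-trans (+-monoˡ-≤ _ (unique-⊆-length (fil-unique u) (λ {z} z∈ → ∈ᵇ⇒∈ {R = R} (proj₂ (∈-fil⁻ W z∈)))))
      (≤-reflexive (+-comm (length R) _)))

  fresh : ∀ {W} R → Unique W → length R < length W → ∃ λ x → x ∈ W × x ∉ R
  fresh {W} R u lt with W ∖ R in eq
  ... | [] = ⊥-elim (<⇒≱ lt (≤-trans (length-∖ R u) (≤-reflexive (cong (λ l → length l + length R) eq))))
  ... | x ∷ xs = x , ∈-∖⁻ W R (subst (x ∈_) (sym eq) (here refl))

  freshes : ∀ {W} R j → Unique W → length R + j ≤ length W →
    ∃ λ us → length us ≡ j × Unique us × us ⊆ W × Disjoint us R
  freshes {W} R j u le = take j (W ∖ R) ,
    length-take≤ j _ (+-cancelʳ-≤ (length R) _ _ (≤-trans (≤-trans (≤-reflexive (+-comm j _)) le) (length-∖ R u))) ,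
    unique-take j (∖-unique R u) ,
    (λ z∈ → ∖⊆ W R (take⊆ j _ z∈)) ,
    λ { (z∈ , z∈R) → proj₂ (∈-∖⁻ W R (take⊆ j _ z∈)) z∈R }

-- Excluded middle is available for the goal `⊥`. This is how the proof asks whether a gadget with
-- some property exists without a decision procedure.
em : ∀ {P : Set} → (P ⊎ ¬ P → ⊥) → ⊥
em h = h (inj₂ (λ p → h (inj₁ p)))

does⁻ : ∀ {P : Set} (d : Dec P) → does d ≡ true → P
does⁻ (yes p) h = p

does⁺ : ∀ {P : Set} (d : Dec P) → P → does d ≡ true
does⁺ (yes _) p = refl
does⁺ (no ¬p) p = ⊥-elim (¬p p)

-- Sums over the edges of a graph

module GraphSums (G : Defs.Graph) where
  open Defs.Graph G using (n; adj) renaming (sym to adj-sym; irrefl to adj-irrefl)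

  VG : Set
  VG = Fin n

  nbrs : VG → List VG
  nbrs a = fil (adj a) (allFin n)

  degree : VG → ℕ
  degree a = length (nbrs a)

  degree≡deg : ∀ a → degree a ≡ Defs.deg G a
  degree≡deg a = go (allFin n)
    where
      go : (xs : List VG) → length (fil (adj a) xs) ≡ foldr (λ j k → if adj a j then suc k else k) 0 xs
      go [] = refl
      go (x ∷ xs) with adj a x
      ... | true = cong suc (go xs)
      ... | false = go xs

  ∈-nbrs⁺ : ∀ {a b} → adj a b ≡ true → b ∈ nbrs a
  ∈-nbrs⁺ {a} {b} h = ∈-fil⁺ (∈-allFin b) h

  ∈-nbrs⁻ : ∀ {a b} → b ∈ nbrs a → adj a b ≡ true
  ∈-nbrs⁻ {a} h = proj₂ (∈-fil⁻ (allFin n) h)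

  adj⇒≢ : ∀ {a b} → adj a b ≡ true → a ≢ b
  adj⇒≢ {a} h refl = T⇒F⇒⊥ h (adj-irrefl a)

  nbrs-unique : ∀ a → Unique (nbrs a)
  nbrs-unique a = fil-unique (allFin⁺ n)

  isEdge : VG → VG → Bool
  isEdge a b = adj a b ∧ (toℕ a <ᵇ toℕ b)

  module EdgeSums {B : Set} {_+'_ : B → B → B} {o : B} (cm : IsCommutativeMonoid _≡_ _+'_ o) where
    open ListSum cm
    open IsCommutativeMonoid cm using (identityˡ; identityʳ)

    ∑-edges : (F : VG × VG → B) → ∑ (Defs.edges G) F ≡ ∑ (allFin n) (λ a → ∑ (allFin n) (λ b → if isEdge a b then F (a , b) else o))
    ∑-edges F = trans (∑-concatMap (allFin n) _ F) (∑-cong (allFin n) (λ {a} _ → trans (∑-concatMap (allFin n) _ F) (∑-cong (allFin n) (λ {b} _ → one a b))))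
      where
        one : ∀ a b → ∑ (if isEdge a b then [ (a , b) ] else []) F ≡ (if isEdge a b then F (a , b) else o)
        one a b with isEdge a b
        ... | true = identityʳ _
        ... | false = refl

    if-∙ : ∀ (b : Bool) {x y : B} → (if b then x +' y else o) ≡ (if b then x else o) +' (if b then y else o)
    if-∙ true = refl
    if-∙ false = sym (identityˡ o)

    -- Every edge is listed once, smaller endpoint first. Adding both orientations makes the summand
    -- symmetric, so the sum can be rearranged by vertices.
    handshake : (g : VG → VG → B) → ∑ (Defs.edges G) (λ e → g (proj₁ e) (proj₂ e) +' g (proj₂ e) (proj₁ e)) ≡ ∑ (allFin n) (λ a → ∑ (nbrs a) (g a))
    handshake g = begin
      ∑ (Defs.edges G) (λ e → g (proj₁ e) (proj₂ e) +' g (proj₂ e) (proj₁ e)) ≡⟨ ∑-edges _ ⟩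
      ∑ U (λ a → ∑ U (λ b → if isEdge a b then g a b +' g b a else o)) ≡⟨ ∑-cong U (λ {a} _ → trans (∑-cong U (λ {b} _ → if-∙ (isEdge a b))) (∑-∙ U (λ b → if isEdge a b then g a b else o) (λ b → if isEdge a b then g b a else o))) ⟩
      ∑ U (λ a → ∑ U (λ b → if isEdge a b then g a b else o) +' ∑ U (λ b → if isEdge a b then g b a else o)) ≡⟨ ∑-∙ U _ _ ⟩
      ∑ U (λ a → ∑ U (λ b → if isEdge a b then g a b else o)) +' ∑ U (λ a → ∑ U (λ b → if isEdge a b then g b a else o)) ≡⟨ cong (∑ U (λ a → ∑ U (λ b → if isEdge a b then g a b else o)) +'_) (∑-swap U U _) ⟩
      ∑ U (λ a → ∑ U (λ b → if isEdge a b then g a b else o)) +' ∑ U (λ a → ∑ U (λ b → if isEdge b a then g a b else o)) ≡⟨ sym (∑-∙ U _ _) ⟩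
      ∑ U (λ a → ∑ U (λ b → if isEdge a b then g a b else o) +' ∑ U (λ b → if isEdge b a then g a b else o)) ≡⟨ ∑-cong U (λ {a} _ → trans (sym (∑-∙ U _ _)) (trans (∑-cong U (λ {b} _ → pointwise a b)) (sym (∑-fil (adj a) U (g a))))) ⟩
      ∑ U (λ a → ∑ (nbrs a) (g a)) ∎
      where
        open ≡-Reasoning
        U = allFin n
        tri : ∀ x y → x ≢ y → ((x <ᵇ y) ≡ true × (y <ᵇ x) ≡ false) ⊎ ((x <ᵇ y) ≡ false × (y <ᵇ x) ≡ true)
        tri zero zero h = ⊥-elim (h refl)
        tri zero (suc y) h = inj₁ (refl , refl)
        tri (suc x) zero h = inj₂ (refl , refl)
        tri (suc x) (suc y) h = tri x y (h ∘ cong suc)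
        pointwise : ∀ a b → (if isEdge a b then g a b else o) +' (if isEdge b a then g a b else o) ≡ (if adj a b then g a b else o)
        pointwise a b rewrite adj-sym b a with adj a b in eq
        ... | false = identityˡ o
        ... | true with tri (toℕ a) (toℕ b) (λ h → adj⇒≢ eq (toℕ-injective h))
        ...   | inj₁ (p , q) rewrite p | q = identityʳ _
        ...   | inj₂ (p , q) rewrite p | q = identityˡ _

    -- Typically `D` is the change of weight when only the host of `v` changes. Orienting the edges
    -- at `v` away from it, which is what `g` does, reduces the claim to `handshake`.
    star : ∀ v (D : VG → VG → B) → (∀ a b → D a b ≡ D b a) → (∀ a b → adj a b ≡ true → a ≢ v → b ≢ v → D a b ≡ o) →
      ∑ (Defs.edges G) (λ e → D (proj₁ e) (proj₂ e)) ≡ ∑ (nbrs v) (D v)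
    star v D Dsym supp = begin
      ∑ (Defs.edges G) (λ e → D (proj₁ e) (proj₂ e)) ≡⟨ ∑-edges _ ⟩
      ∑ U (λ a → ∑ U (λ b → if isEdge a b then D a b else o)) ≡⟨ ∑-cong U (λ {a} _ → ∑-cong U (λ {b} _ → pointwise a b)) ⟩
      ∑ U (λ a → ∑ U (λ b → if isEdge a b then g a b +' g b a else o)) ≡⟨ sym (∑-edges _) ⟩
      ∑ (Defs.edges G) (λ e → g (proj₁ e) (proj₂ e) +' g (proj₂ e) (proj₁ e)) ≡⟨ handshake g ⟩
      ∑ U (λ a → ∑ (nbrs a) (g a)) ≡⟨ ∑-cong U (λ {a} _ → outer a) ⟩
      ∑ U (λ a → if does (a ≟ v) then ∑ (nbrs a) (D a) else o) ≡⟨ ∑-single U v (λ a → ∑ (nbrs a) (D a)) (allFin⁺ n) (∈-allFin v) ⟩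
      ∑ (nbrs v) (D v) ∎
      where
        open ≡-Reasoning
        U = allFin n
        g : VG → VG → B
        g a b = if does (a ≟ v) then D a b else o
        outer : ∀ a → ∑ (nbrs a) (g a) ≡ (if does (a ≟ v) then ∑ (nbrs a) (D a) else o)
        outer a with a ≟ v
        ... | yes _ = refl
        ... | no _ = ∑-ε (nbrs a) (λ _ → refl)
        pointwise : ∀ a b → (if isEdge a b then D a b else o) ≡ (if isEdge a b then g a b +' g b a else o)
        pointwise a b with adj a b in eq | toℕ a <ᵇ toℕ b
        ... | false | _ = refl
        ... | true | false = refl
        ... | true | true with a ≟ v | b ≟ v
        ...   | yes refl | yes refl = ⊥-elim (adj⇒≢ eq refl)
        ...   | yes refl | no _ = sym (identityʳ _)
        ...   | no _ | yes refl = trans (Dsym a b) (sym (identityˡ _))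
        ...   | no p | no q = trans (supp a b eq p q) (sym (identityˡ o))

  edge⇒adj : ∀ {a b} → (a , b) ∈ Defs.edges G → adj a b ≡ true
  edge⇒adj {a} {b} h with find (∈-concatMap⁻ (λ i → concatMap (λ j → if isEdge i j then [ (i , j) ] else []) (allFin n)) {xs = allFin n} h)
  ... | i , _ , h' with find (∈-concatMap⁻ (λ j → if isEdge i j then [ (i , j) ] else []) {xs = allFin n} h')
  ...   | j , _ , h'' = go i j h''
    where
      go : ∀ i j → (a , b) ∈ (if isEdge i j then [ (i , j) ] else []) → adj a b ≡ true
      go i j h with adj i j in eq | toℕ i <ᵇ toℕ j
      go i j (here refl) | true | true = eq

  degree-sum : sumN (allFin n) degree ≡ 2 * Defs.e G
  degree-sum = trans (sumN-cong (allFin n) (λ {a} _ → sym (trans (sumN-const (nbrs a) 1) (*-identityʳ _))))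
    (trans (sym (EdgeSums.handshake +-0-isCommutativeMonoid (λ _ _ → 1)))
      (trans (sumN-const (Defs.edges G) 2) (*-comm (Defs.e G) 2)))

-- Monochromatic copies of graphs of bounded degree

sumN-⊆ : {X : Set} {xs ys : List X} (f : X → ℕ) → Unique xs → xs ⊆ ys → sumN xs f ≤ sumN ys f
sumN-⊆ {xs = []} f u s = z≤n
sumN-⊆ {xs = x ∷ xs} {ys} f (x∉ ∷ u) s with ∈-∃++ (s (here refl))
... | as , bs , refl = ≤-trans (+-monoʳ-≤ (f x) (sumN-⊆ f u s')) (≤-reflexive eq)
  where
    s' : xs ⊆ as ++ bs
    s' {z} z∈ with ∈-++⁻ as (s (there z∈))
    ... | inj₁ z∈as = ∈-++⁺ˡ z∈as
    ... | inj₂ (here refl) = ⊥-elim (lookupAll x∉ z∈ refl)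
    ... | inj₂ (there z∈bs) = ∈-++⁺ʳ as z∈bs
    comm3 : ∀ a b c → a + (b + c) ≡ b + (a + c)
    comm3 = solve-∀
    eq : f x + sumN (as ++ bs) f ≡ sumN (as ++ x ∷ bs) f
    eq = trans (cong (f x +_) (sumN-++ as bs f)) (trans (comm3 (f x) (sumN as f) (sumN bs f)) (sym (sumN-++ as (x ∷ bs) f)))

update : ∀ {n} {B : Set} → (Fin n → B) → Fin n → B → Fin n → B
update f v x a = if does (a ≟ v) then x else f a

update-same : ∀ {n} {B : Set} (f : Fin n → B) v x → update f v x v ≡ x
update-same f v x with v ≟ v
... | yes _ = refl
... | no ¬p = ⊥-elim (¬p refl)

update-other : ∀ {n} {B : Set} (f : Fin n → B) {v a} x → a ≢ v → update f v x a ≡ f a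
update-other f {v} {a} x ne with a ≟ v
... | yes p = ⊥-elim (ne p)
... | no _ = refl

n<2^n : ∀ k → k < 2 ^ k
n<2^n zero = s≤s z≤n
n<2^n (suc k) = begin
  2 + k ≤⟨ s≤s (n<2^n k) ⟩
  1 + 2 ^ k ≤⟨ +-monoˡ-≤ (2 ^ k) (m^n>0 2 k) ⟩
  2 ^ k + 2 ^ k ≡⟨ cong (2 ^ k +_) (sym (+-identityʳ _)) ⟩
  2 * 2 ^ k ∎
  where open ≤-Reasoning

module Density {t : ℕ} (Q : Fin t → Fin t → Bool) where
  V : Set
  V = Fin t

  count : V → List V → ℕ
  count x B = length (fil (Q x) B)

  pairs : List V → ℕ
  pairs Y = sumN Y (λ x → count x Y)

  -- A one-sided density condition on sets of at least |U| / r vertices: some vertex of `A` sees a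
  -- proportion 1 / p of `B`. It is phrased as a refutation, so that an argument against `Good` is
  -- handed a sparse pair `A`, `B` to continue with.
  Good : (p r : ℕ) → List V → Set
  Good p r U = ∀ A B → Unique A → Unique B → A ⊆ U → B ⊆ U → length U ≤ r * length A → length U ≤ r * length B →
    (∀ {x} → x ∈ A → p * count x B < length B) → ⊥

  count≡ : ∀ x B → count x B ≡ sumN B (λ b → b2n (Q x b))
  count≡ x B = length-fil (Q x) B

  count-⊆ : ∀ x {A B} → Unique A → A ⊆ B → count x A ≤ count x B
  count-⊆ x {A} {B} u s = subst₂ _≤_ (sym (count≡ x A)) (sym (count≡ x B)) (sumN-⊆ (λ b → b2n (Q x b)) u s)

  pairs-⊆ : ∀ {A B} → Unique A → A ⊆ B → pairs A ≤ pairs B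
  pairs-⊆ {A} {B} u s = ≤-trans (sumN-mono A (λ {x} _ → count-⊆ x u s)) (sumN-⊆ (λ x → count x B) u s)

module Embedding (G : Defs.Graph) {t : ℕ} (Q : Fin t → Fin t → Bool) (Q-sym : ∀ x y → Q x y ≡ Q y x) where
  open Defs.Graph G using (n; adj) renaming (sym to adj-sym)
  open GraphSums G
  open Density Q

  module Greedy (Δ p : ℕ) (1≤p : 1 ≤ p) (1≤Δ : 1 ≤ Δ) (deg≤Δ : ∀ a → degree a ≤ Δ) (U : List V) where
    P r : ℕ
    P = p ^ Δ
    -- Candidate sets keep at least |U| / P vertices. At most Δ unplaced neighbours spoil at most
    -- |U| / r each, half of the candidates in all; the other half exceeds the number of hosts in
    -- use.
    r = 2 * (Δ * P)

    module _ (good : Good p r U) (big : 2 * (P * n) < length U) where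
      ok? : (w : List V) (x : V) → Dec (length w ≤ p * count x w)
      ok? w x = length w ≤? p * count x w

      -- The vertices of `X` with too few neighbours in one `B` form a sparse pair with it, so by
      -- `Good` they number at most |U| / r; they are discarded for one `B` after the other.
      thin : (Bs : List (List V)) → All (λ B → Unique B × B ⊆ U × length U ≤ r * length B) Bs → (X : List V) → Unique X → X ⊆ U →
        ∃ λ X' → X' ⊆ X × (∀ {x} → x ∈ X' → All (λ B → length B ≤ p * count x B) Bs) × r * length X ≤ r * length X' + length Bs * length U
      thin [] [] X uX X⊆ = X , id , (λ _ → []) , m≤m+n _ _
      thin (B ∷ Bs) ((uB , B⊆ , bB) ∷ hs) X uX X⊆ with thin Bs hs (fil (λ x → does (ok? B x)) X) (fil-unique uX) (X⊆ ∘ fil⊆ X)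
      ... | X' , X'⊆ , oks , le = X' , fil⊆ X ∘ X'⊆ , (λ x∈ → does⁻ (ok? B _) (proj₂ (∈-fil⁻ X (X'⊆ x∈))) ∷ oks x∈) , bound
        where
          X₁ X₂ : List V
          X₁ = fil (λ x → does (ok? B x)) X
          X₂ = fil (λ x → not (does (ok? B x))) X
          bad : ∀ {x} → x ∈ X₂ → p * count x B < length B
          bad {x} x∈ with ok? B x in eq | proj₂ (∈-fil⁻ X x∈)
          ... | no ¬p | _ = ≰⇒> ¬p
          ... | yes q | h = ⊥-elim (T⇒F⇒⊥ h (cong (not ∘ does) eq))
          small : r * length X₂ ≤ length U
          small with length U ≤? r * length X₂
          ... | yes le = ⊥-elim (good X₂ B (fil-unique uX) uB (X⊆ ∘ fil⊆ X) B⊆ le bB bad)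
          ... | no gt = <⇒≤ (≰⇒> gt)
          open ≤-Reasoning
          rearr : ∀ a b c → (a + b) + c ≡ a + (c + b)
          rearr = solve-∀
          bound : r * length X ≤ r * length X' + suc (length Bs) * length U
          bound = begin
            r * length X ≡⟨ cong (r *_) (sym (length-fil-not (λ x → does (ok? B x)) X)) ⟩
            r * (length X₁ + length X₂) ≡⟨ *-distribˡ-+ r (length X₁) (length X₂) ⟩
            r * length X₁ + r * length X₂ ≤⟨ +-mono-≤ le small ⟩
            (r * length X' + length Bs * length U) + length U ≡⟨ rearr (r * length X') (length Bs * length U) (length U) ⟩
            r * length X' + suc (length Bs) * length U ∎

      -- `k w` counts the neighbours of `w` already placed. Each of them divides the candidates of
      -- `w` by at most `p`, and together with the neighbours still to come there are at most Δ of
      -- them.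
      record Partial (todo : List VG) : Set where
        field
          done : List VG
          f : VG → V
          cand : VG → List V
          k : VG → ℕ
          total : length done + length todo ≤ n
          todo-unique : Unique todo
          fresh-todo : Disjoint todo done
          edges-ok : ∀ {a b} → a ∈ done → b ∈ done → adj a b ≡ true → Q (f a) (f b) ≡ true
          inj : ∀ {a b} → a ∈ done → b ∈ done → f a ≡ f b → a ≡ b
          cand-unique : ∀ {w} → w ∈ todo → Unique (cand w)
          cand-⊆ : ∀ {w} → w ∈ todo → cand w ⊆ U
          cand-size : ∀ {w} → w ∈ todo → length U ≤ p ^ k w * length (cand w)
          cand-deg : ∀ {w} → w ∈ todo → k w + length (fil (adj w) todo) ≤ Δ
          cand-adj : ∀ {w x a} → w ∈ todo → x ∈ cand w → a ∈ done → adj w a ≡ true → Q x (f a) ≡ true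

      p^≤P : ∀ {j} → j ≤ Δ → p ^ j ≤ P
      p^≤P {j} le = ^-monoʳ-≤ p {{>-nonZero 1≤p}} le

      cand-big : ∀ {todo} (S : Partial todo) {w} → w ∈ todo → length U ≤ P * length (Partial.cand S w)
      cand-big S {w} w∈ = ≤-trans (Partial.cand-size S w∈) (*-monoˡ-≤ (length (Partial.cand S w)) (p^≤P {Partial.k S w} (≤-trans (m≤m+n (Partial.k S w) _) (Partial.cand-deg S w∈))))

      extend : ∀ {v todo} → Partial (v ∷ todo) → Partial todo
      extend {v} {todo} S = record
        { done = v ∷ done ; f = f' ; cand = cand' ; k = k' ; total = subst (_≤ n) (+-suc (length done) (length todo)) total
        ; todo-unique = utail todo-unique
        ; fresh-todo = λ { (a∈ , here refl) → Unique[x∷xs]⇒x∉xs todo-unique a∈ ; (a∈ , there b∈) → fresh-todo (there a∈ , b∈) }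
        ; edges-ok = edges-ok' ; inj = inj' ; cand-unique = cand-unique' ; cand-⊆ = cand-⊆' ; cand-size = cand-size' ; cand-deg = cand-deg' ; cand-adj = cand-adj' }
        where
          open Partial S
          open ≤-Reasoning
          utail : ∀ {v} {todo : List VG} → Unique (v ∷ todo) → Unique todo
          utail (_ ∷ u) = u
          v∉done : v ∉ done
          v∉done h = fresh-todo (here refl , h)
          ws : List VG
          ws = fil (adj v) todo
          used X : List V
          used = map f done
          X = cand v ∖ used
          ws≤Δ : length ws ≤ Δ
          ws≤Δ = ≤-trans (unique-⊆-length (fil-unique (utail todo-unique)) (λ {b} b∈ → ∈-nbrs⁺ (proj₂ (∈-fil⁻ todo b∈)))) (deg≤Δ v)
          hyp : ∀ (ws : List VG) → ws ⊆ todo → All (λ B → Unique B × B ⊆ U × length U ≤ r * length B) (map cand ws)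
          hyp [] s = []
          hyp (w ∷ ws) s = (cand-unique w∈ , cand-⊆ w∈ , ≤-trans (cand-big S w∈) (*-monoˡ-≤ (length (cand w)) P≤r)) ∷ hyp ws (s ∘ there)
            where
              w∈ = there (s (here refl))
              P≤r : P ≤ r
              P≤r = ≤-trans (≤-reflexive (sym (*-identityˡ P))) (≤-trans (*-monoˡ-≤ P 1≤Δ) (m≤m+n _ _))
          thinned = thin (map cand ws) (hyp ws (fil⊆ todo)) X (∖-unique used (cand-unique (here refl))) (λ z → cand-⊆ (here refl) (∖⊆ (cand v) used z))
          X' = proj₁ thinned
          -- If nothing survived, the spoiled vertices and the at most `n` used hosts would exhaust
          -- |U| / P candidates, against `big`.
          nonempty : 0 < r * length X'
          nonempty with r * length X' in eq
          ... | suc _ = s≤s z≤n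
          ... | zero = ⊥-elim (<⇒≱ lt (begin
                  2 * (Δ * length U) ≤⟨ *-monoʳ-≤ 2 (*-monoʳ-≤ Δ (cand-big S (here refl))) ⟩
                  2 * (Δ * (P * length (cand v))) ≤⟨ *-monoʳ-≤ 2 (*-monoʳ-≤ Δ (*-monoʳ-≤ P (length-∖ used (cand-unique (here refl))))) ⟩
                  2 * (Δ * (P * (length X + length used))) ≡⟨ e1 Δ P (length X) (length used) ⟩
                  r * length X + r * length used ≤⟨ +-mono-≤ rX (*-monoʳ-≤ r used≤) ⟩
                  Δ * length U + r * n ∎))
            where
              e1 : ∀ Δ P x u → 2 * (Δ * (P * (x + u))) ≡ 2 * (Δ * P) * x + 2 * (Δ * P) * u
              e1 = solve-∀
              used≤ : length used ≤ n
              used≤ = ≤-trans (≤-reflexive (length-map f done)) (≤-trans (m≤m+n _ _) total)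
              rX : r * length X ≤ Δ * length U
              rX = ≤-trans (proj₂ (proj₂ (proj₂ thinned))) (subst (λ z → z + length (map cand ws) * length U ≤ Δ * length U) (sym eq)
                     (*-monoˡ-≤ (length U) (≤-trans (≤-reflexive (length-map cand ws)) ws≤Δ)))
              lt : Δ * length U + r * n < 2 * (Δ * length U)
              lt = begin-strict
                Δ * length U + r * n ≡⟨ e2 Δ P n (length U) ⟩
                Δ * length U + Δ * (2 * (P * n)) <⟨ +-monoʳ-< (Δ * length U) (*-monoʳ-< Δ {{>-nonZero 1≤Δ}} big) ⟩
                Δ * length U + Δ * length U ≡⟨ e3 (Δ * length U) ⟩
                2 * (Δ * length U) ∎
                where
                  e2 : ∀ Δ P n u → Δ * u + 2 * (Δ * P) * n ≡ Δ * u + Δ * (2 * (P * n))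
                  e2 = solve-∀
                  e3 : ∀ a → a + a ≡ 2 * a
                  e3 = solve-∀
          head : ∀ (l : List V) → 0 < r * length l → ∃ λ x → x ∈ l
          head [] h = ⊥-elim (<⇒≱ h (≤-reflexive (*-zeroʳ r)))
          head (x ∷ l) h = x , here refl
          x = proj₁ (head X' nonempty)
          x∈X' = proj₂ (head X' nonempty)
          x∈X : x ∈ X
          x∈X = proj₁ (proj₂ thinned) x∈X'
          x∈cand : x ∈ cand v
          x∈cand = ∖⊆ (cand v) used x∈X
          x∉used : x ∉ used
          x∉used = proj₂ (∈-∖⁻ (cand v) used x∈X)
          x-ok : All (λ B → length B ≤ p * count x B) (map cand ws)
          x-ok = proj₁ (proj₂ (proj₂ thinned)) x∈X'
          f' = update f v x
          cand' : VG → List V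
          cand' w = if adj w v then fil (Q x) (cand w) else cand w
          k' : VG → ℕ
          k' w = if adj w v then suc (k w) else k w
          f'-old : ∀ {a} → a ∈ done → f' a ≡ f a
          f'-old a∈ = update-other f x (λ { refl → v∉done a∈ })
          edges-ok' : ∀ {a b} → a ∈ v ∷ done → b ∈ v ∷ done → adj a b ≡ true → Q (f' a) (f' b) ≡ true
          edges-ok' (here refl) (here refl) h = ⊥-elim (adj⇒≢ h refl)
          edges-ok' (here refl) (there b∈) h = subst₂ (λ y z → Q y z ≡ true) (sym (update-same f v x)) (sym (f'-old b∈)) (cand-adj (here refl) x∈cand b∈ h)
          edges-ok' {a} (there a∈) (here refl) h = subst₂ (λ y z → Q y z ≡ true) (sym (f'-old a∈)) (sym (update-same f v x)) (trans (Q-sym _ _) (cand-adj (here refl) x∈cand a∈ (trans (adj-sym v a) h)))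
          edges-ok' (there a∈) (there b∈) h = subst₂ (λ y z → Q y z ≡ true) (sym (f'-old a∈)) (sym (f'-old b∈)) (edges-ok a∈ b∈ h)
          inj' : ∀ {a b} → a ∈ v ∷ done → b ∈ v ∷ done → f' a ≡ f' b → a ≡ b
          inj' (here refl) (here refl) h = refl
          inj' (here refl) (there b∈) h = ⊥-elim (x∉used (subst (_∈ used) (trans (sym (f'-old b∈)) (trans (sym h) (update-same f v x))) (∈-map⁺ f b∈)))
          inj' (there a∈) (here refl) h = ⊥-elim (x∉used (subst (_∈ used) (trans (sym (f'-old a∈)) (trans h (update-same f v x))) (∈-map⁺ f a∈)))
          inj' (there a∈) (there b∈) h = inj a∈ b∈ (trans (sym (f'-old a∈)) (trans h (f'-old b∈)))
          cand-unique' : ∀ {w} → w ∈ todo → Unique (cand' w)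
          cand-unique' {w} w∈ with adj w v
          ... | true = fil-unique (cand-unique (there w∈))
          ... | false = cand-unique (there w∈)
          cand-⊆' : ∀ {w} → w ∈ todo → cand' w ⊆ U
          cand-⊆' {w} w∈ {z} z∈ with adj w v
          ... | true = cand-⊆ (there w∈) (fil⊆ (cand w) z∈)
          ... | false = cand-⊆ (there w∈) z∈
          cand-size' : ∀ {w} → w ∈ todo → length U ≤ p ^ k' w * length (cand' w)
          cand-size' {w} w∈ with adj w v in eq
          ... | false = cand-size (there w∈)
          ... | true = begin
            length U ≤⟨ cand-size (there w∈) ⟩
            p ^ k w * length (cand w) ≤⟨ *-monoʳ-≤ (p ^ k w) (lookupAll x-ok (∈-map⁺ cand (∈-fil⁺ w∈ (trans (adj-sym v w) eq)))) ⟩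
            p ^ k w * (p * count x (cand w)) ≡⟨ e4 (p ^ k w) p (count x (cand w)) ⟩
            p * p ^ k w * length (fil (Q x) (cand w)) ∎
            where
              e4 : ∀ a b c → a * (b * c) ≡ b * a * c
              e4 = solve-∀
          cand-deg' : ∀ {w} → w ∈ todo → k' w + length (fil (adj w) todo) ≤ Δ
          cand-deg' {w} w∈ with adj w v in eq | cand-deg (there w∈)
          ... | false | h = h
          ... | true | h = ≤-trans (≤-reflexive (sym (+-suc (k w) _))) h
          cand-adj' : ∀ {w y a} → w ∈ todo → y ∈ cand' w → a ∈ v ∷ done → adj w a ≡ true → Q y (f' a) ≡ true
          cand-adj' {w} {y} w∈ y∈ (here refl) h = subst (λ z → Q y z ≡ true) (sym (update-same f v x)) (trans (Q-sym _ _) (proj₂ (∈-fil⁻ (cand w) (subst (λ b → y ∈ (if b then fil (Q x) (cand w) else cand w)) h y∈))))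
          cand-adj' {w} {y} w∈ y∈ (there a∈) h = subst (λ z → Q y z ≡ true) (sym (f'-old a∈)) (cand-adj (there w∈) (lem y∈) a∈ h)
            where
              lem : y ∈ cand' w → y ∈ cand w
              lem y∈ with adj w v
              ... | true = fil⊆ (cand w) y∈
              ... | false = y∈

      run : ∀ todo (S : Partial todo) → (∀ {a} → a ∈ Partial.done S ⊎ a ∈ todo) → Σ (Partial []) λ S' → ∀ {a} → a ∈ Partial.done S'
      run [] S cov = S , λ {a} → case cov {a} of λ { (inj₁ h) → h }
      run (v ∷ todo) S cov = run todo (extend S) (λ {a} → case cov {a} of λ { (inj₁ h) → inj₁ (there h) ; (inj₂ (here refl)) → inj₁ (here refl) ; (inj₂ (there h)) → inj₂ h })

      embed : Unique U → ∃ λ (f : VG → V) → Injective _≡_ _≡_ f × (∀ a b → adj a b ≡ true → Q (f a) (f b) ≡ true)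
      embed uU = f , (λ {a} {b} → inj cov cov) , (λ a b → edges-ok cov cov)
        where
          head : ∀ (l : List V) → 0 < length l → V
          head (x ∷ l) h = x
          start : Partial (allFin n)
          start = record
            { done = [] ; f = λ _ → head U (≤-trans (s≤s z≤n) big) ; cand = λ _ → U ; k = λ _ → 0
            ; total = ≤-reflexive (length-tabulate {n = n} id) ; todo-unique = allFin⁺ n ; fresh-todo = λ { (_ , ()) }
            ; edges-ok = λ () ; inj = λ () ; cand-unique = λ _ → uU ; cand-⊆ = λ _ → id
            ; cand-size = λ _ → ≤-reflexive (sym (*-identityˡ _)) ; cand-deg = λ {w} _ → deg≤Δ w ; cand-adj = λ _ _ () }
          final = run (allFin n) start (λ {a} → inj₂ (∈-allFin a))
          open Partial (proj₁ final)
          cov = proj₂ final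

-- Sparse sets where the greedy embedding is impossible.

module Sparse {t : ℕ} (Q : Fin t → Fin t → Bool) (Q-sym : ∀ x y → Q x y ≡ Q y x) where
  open Density Q

  Fails : (p r y : ℕ) → List V → Set
  Fails p r y W = ∀ U → Unique U → U ⊆ W → y ≤ length U → Good p r U → ⊥

  cross : List V → List V → ℕ
  cross A B = sumN A (λ x → count x B)

  cross-sym : ∀ A B → cross A B ≡ cross B A
  cross-sym A B = begin
    sumN A (λ x → count x B) ≡⟨ sumN-cong A (λ {x} _ → count≡ x B) ⟩
    sumN A (λ x → sumN B (λ b → b2n (Q x b))) ≡⟨ sumN-swap A B _ ⟩
    sumN B (λ b → sumN A (λ x → b2n (Q x b))) ≡⟨ sumN-cong B (λ {b} _ → trans (sumN-cong A (λ {x} _ → cong b2n (Q-sym x b))) (sym (count≡ b A))) ⟩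
    sumN B (λ b → count b A) ∎
    where open ≡-Reasoning

  cross-++ : ∀ A B C → cross A (B ++ C) ≡ cross A B + cross A C
  cross-++ A B C = trans (sumN-cong A (λ {x} _ → trans (count≡ x (B ++ C)) (trans (sumN-++ B C _) (cong₂ _+_ (sym (count≡ x B)) (sym (count≡ x C))))))
    (sumN-+ A _ _)

  pairs-++ : ∀ A B → pairs (A ++ B) ≡ pairs A + pairs B + 2 * cross B A
  pairs-++ A B = begin
    cross (A ++ B) (A ++ B) ≡⟨ sumN-++ A B (λ x → count x (A ++ B)) ⟩
    cross A (A ++ B) + cross B (A ++ B) ≡⟨ cong₂ _+_ (cross-++ A A B) (cross-++ B A B) ⟩
    (pairs A + cross A B) + (cross B A + pairs B) ≡⟨ cong (λ z → (pairs A + z) + (cross B A + pairs B)) (cross-sym A B) ⟩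
    (pairs A + cross B A) + (cross B A + pairs B) ≡⟨ eq (pairs A) (pairs B) (cross B A) ⟩
    pairs A + pairs B + 2 * cross B A ∎
    where
      open ≡-Reasoning
      eq : ∀ a b c → (a + c) + (c + b) ≡ a + b + 2 * c
      eq = solve-∀

  -- Markov's inequality for the pairs between `A` and `B`, counted from both sides: a vertex of `B`
  -- with more than 2 |A| / p neighbours in `A` has over twice the average.
  sparse-half : ∀ p A B → 1 ≤ length A → (∀ {x} → x ∈ A → p * count x B < length B) →
    length B ≤ 2 * length (fil (λ b → does (p * count b A ≤? 2 * length A)) B)
  sparse-half p A B 1≤A h = begin
    length B ≡⟨ sym (length-fil-not good? B) ⟩
    length B₁ + length B₂ ≤⟨ +-monoʳ-≤ (length B₁) B₂≤B₁ ⟩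
    length B₁ + length B₁ ≡⟨ cong (length B₁ +_) (sym (+-identityʳ _)) ⟩
    2 * length B₁ ∎
    where
      open ≤-Reasoning
      good? : V → Bool
      good? b = does (p * count b A ≤? 2 * length A)
      B₁ B₂ : List V
      B₁ = fil good? B
      B₂ = fil (not ∘ good?) B
      each : ∀ {b} → b ∈ B → (if not (good? b) then 2 * length A else 0) ≤ p * count b A
      each {b} b∈ = from (p * count b A ≤? 2 * length A)
        where
          from : (d : Dec (p * count b A ≤ 2 * length A)) → (if not (does d) then 2 * length A else 0) ≤ p * count b A
          from (yes _) = z≤n
          from (no ¬p) = <⇒≤ (≰⇒> ¬p)
      total : length B₂ * (2 * length A) ≤ length A * length B
      total = begin
        length B₂ * (2 * length A) ≡⟨ sym (sumN-const B₂ _) ⟩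
        sumN B₂ (λ _ → 2 * length A) ≡⟨ sumN-fil (not ∘ good?) B _ ⟩
        sumN B (λ b → if not (good? b) then 2 * length A else 0) ≤⟨ sumN-mono B each ⟩
        sumN B (λ b → p * count b A) ≡⟨ sumN-*ˡ B p _ ⟩
        p * cross B A ≡⟨ cong (p *_) (cross-sym B A) ⟩
        p * cross A B ≡⟨ sym (sumN-*ˡ A p _) ⟩
        sumN A (λ x → p * count x B) ≤⟨ sumN-bound A (length B) (λ x∈ → <⇒≤ (h x∈)) ⟩
        length A * length B ∎
      B₂≤B₁ : length B₂ ≤ length B₁
      B₂≤B₁ = +-cancelˡ-≤ (length B₂) _ _ (*-cancelˡ-≤ (length A) {{>-nonZero 1≤A}} (begin
        length A * (length B₂ + length B₂) ≡⟨ eq (length A) (length B₂) ⟩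
        length B₂ * (2 * length A) ≤⟨ total ⟩
        length A * length B ≡⟨ cong (length A *_) (trans (sym (length-fil-not good? B)) (+-comm (length B₁) (length B₂))) ⟩
        length A * (length B₂ + length B₁) ∎))
        where
          eq : ∀ a b → a * (b + b) ≡ b * (2 * a)
          eq = solve-∀

  -- Room for one round: a sparse pair keeps 1 / r of the set, half of `B` survives `sparse-half`,
  -- and the set already found is deleted from it.
  sparse-constant : ℕ → ℕ → ℕ
  sparse-constant r zero = 1
  sparse-constant r (suc k) = suc (2 * (r * (sparse-constant r k + 2 ^ k)))

  -- Failure of `Good` yields a sparse pair `A`, `B`. Induction gives `Y₁` inside `A` and then `Y₂`
  -- inside the half of `B` that is sparse towards `Y₁`. Each round doubles both the size and the
  -- bound on `pairs`, so the density halves; the extra `y * y` on the left absorbs the pairs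
  -- between the two halves.
  sparse : ∀ k p r y → 4 * 2 ^ k * 2 ^ k ≤ p → 1 ≤ r → 1 ≤ y → ∀ W → Unique W → sparse-constant r k * y ≤ length W → Fails p r y W →
    (∀ Y → Unique Y → Y ⊆ W → length Y ≡ 2 ^ k * y → pairs Y + y * y ≤ 2 * 2 ^ k * (y * y) → ⊥) → ⊥
  sparse zero p r y _ _ _ W uW big fails ret = ret (take y W) (unique-take y uW) (take⊆ y W) (trans len (sym (+-identityʳ y)))
    (≤-trans (+-monoˡ-≤ (y * y) (≤-trans (sumN-bound (take y W) y (λ {x} _ → ≤-trans (length-filter (λ b → Q x b ≟ᵇ true) (take y W)) (≤-reflexive len))) (≤-reflexive (cong (_* y) len))))
      (≤-reflexive (cong (y * y +_) (sym (+-identityʳ _)))))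
    where
      len : length (take y W) ≡ y
      len = length-take≤ y W (≤-trans (≤-reflexive (sym (+-identityʳ y))) big)
  sparse (suc k) p r y hp 1≤r 1≤y W uW big fails ret =
    fails W uW id y≤W λ A B uA uB A⊆ B⊆ A-big B-big AB →
    sparse k p r y hp' 1≤r 1≤y A uA (A-large A A-big) (λ U uU U⊆ → fails U uU (A⊆ ∘ U⊆)) λ Y₁ uY₁ Y₁⊆ lenY₁ sparseY₁ →
    let B₁ = fil (λ b → does (p * count b Y₁ ≤? 2 * length Y₁)) B
        B₂ = B₁ ∖ Y₁
        half = sparse-half p Y₁ B (≤-trans (*-mono-≤ (m^n>0 2 k) 1≤y) (≤-reflexive (sym lenY₁))) (AB ∘ Y₁⊆)
    in
    sparse k p r y hp' 1≤r 1≤y B₂ (∖-unique Y₁ (fil-unique uB)) (B₂-large B Y₁ lenY₁ uB B-big half)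
      (λ U uU U⊆ → fails U uU (λ z → B⊆ (fil⊆ B (∖⊆ B₁ Y₁ (U⊆ z))))) λ Y₂ uY₂ Y₂⊆ lenY₂ sparseY₂ →
    ret (Y₁ ++ Y₂) (unique-++ uY₁ uY₂ (λ { (p , q) → proj₂ (∈-∖⁻ B₁ Y₁ (Y₂⊆ q)) p }))
      (λ z → case ∈-++⁻ Y₁ z of λ { (inj₁ q) → A⊆ (Y₁⊆ q) ; (inj₂ q) → B⊆ (fil⊆ B (∖⊆ B₁ Y₁ (Y₂⊆ q))) })
      (trans (length-++ Y₁) (trans (cong₂ _+_ lenY₁ lenY₂) (double (2 ^ k) y)))
      (combine Y₁ Y₂ lenY₁ lenY₂ sparseY₁ sparseY₂ (λ {b} b∈ → does⁻ (p * count b Y₁ ≤? 2 * length Y₁) (proj₂ (∈-fil⁻ B (∖⊆ B₁ Y₁ (Y₂⊆ b∈))))))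
    where
      open ≤-Reasoning
      a = sparse-constant r k
      double : ∀ x y → x * y + x * y ≡ 2 * x * y
      double = solve-∀
      y≤W : y ≤ length W
      y≤W = ≤-trans (m≤m+n y _) big
      hp' : 4 * 2 ^ k * 2 ^ k ≤ p
      hp' = ≤-trans (≤-trans (m≤m+n _ _) (≤-reflexive (e (2 ^ k)))) hp
        where
          e : ∀ x → 4 * x * x + 12 * x * x ≡ 4 * (2 * x) * (2 * x)
          e = solve-∀
      core : 2 * (r * (a + 2 ^ k)) * y ≤ length W
      core = ≤-trans (m≤n+m _ y) big
      large : ∀ (A : List V) → length W ≤ r * length A → 2 * ((a + 2 ^ k) * y) ≤ length A
      large A h = *-cancelˡ-≤ r {{>-nonZero 1≤r}} (≤-trans (≤-trans (≤-reflexive (e r a (2 ^ k) y)) core) h)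
        where
          e : ∀ r a k y → r * (2 * ((a + k) * y)) ≡ 2 * (r * (a + k)) * y
          e = solve-∀
      A-large : ∀ A → length W ≤ r * length A → a * y ≤ length A
      A-large A h = ≤-trans (≤-trans (m≤m+n (a * y) _) (≤-reflexive (e a (2 ^ k) y))) (large A h)
        where
          e : ∀ a k y → a * y + (a * y + 2 * (k * y)) ≡ 2 * ((a + k) * y)
          e = solve-∀
      B₂-large : ∀ B Y₁ → length Y₁ ≡ 2 ^ k * y → Unique B → length W ≤ r * length B →
        length B ≤ 2 * length (fil (λ b → does (p * count b Y₁ ≤? 2 * length Y₁)) B) →
        a * y ≤ length (fil (λ b → does (p * count b Y₁ ≤? 2 * length Y₁)) B ∖ Y₁)
      B₂-large B Y₁ lenY₁ uB h half = +-cancelʳ-≤ (2 ^ k * y) _ _ (begin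
        a * y + 2 ^ k * y ≡⟨ sym (*-distribʳ-+ y a (2 ^ k)) ⟩
        (a + 2 ^ k) * y ≤⟨ *-cancelˡ-≤ 2 (≤-trans (large B h) half) ⟩
        length (fil (λ b → does (p * count b Y₁ ≤? 2 * length Y₁)) B) ≤⟨ length-∖ Y₁ (fil-unique uB) ⟩
        length (fil (λ b → does (p * count b Y₁ ≤? 2 * length Y₁)) B ∖ Y₁) + length Y₁ ≡⟨ cong (length (fil (λ b → does (p * count b Y₁ ≤? 2 * length Y₁)) B ∖ Y₁) +_) lenY₁ ⟩
        length (fil (λ b → does (p * count b Y₁ ≤? 2 * length Y₁)) B ∖ Y₁) + 2 ^ k * y ∎)
      combine : ∀ Y₁ Y₂ → length Y₁ ≡ 2 ^ k * y → length Y₂ ≡ 2 ^ k * y → pairs Y₁ + y * y ≤ 2 * 2 ^ k * (y * y) → pairs Y₂ + y * y ≤ 2 * 2 ^ k * (y * y) →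
        (∀ {b} → b ∈ Y₂ → p * count b Y₁ ≤ 2 * length Y₁) → pairs (Y₁ ++ Y₂) + y * y ≤ 2 * 2 ^ suc k * (y * y)
      combine Y₁ Y₂ l₁ l₂ s₁ s₂ deg = begin
        pairs (Y₁ ++ Y₂) + y * y ≡⟨ cong (_+ y * y) (pairs-++ Y₁ Y₂) ⟩
        pairs Y₁ + pairs Y₂ + 2 * cross Y₂ Y₁ + y * y ≤⟨ +-monoˡ-≤ (y * y) (+-monoʳ-≤ (pairs Y₁ + pairs Y₂) few) ⟩
        pairs Y₁ + pairs Y₂ + y * y + y * y ≡⟨ e1 (pairs Y₁) (pairs Y₂) (y * y) ⟩
        (pairs Y₁ + y * y) + (pairs Y₂ + y * y) ≤⟨ +-mono-≤ s₁ s₂ ⟩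
        2 * 2 ^ k * (y * y) + 2 * 2 ^ k * (y * y) ≡⟨ e2 (2 ^ k) (y * y) ⟩
        2 * 2 ^ suc k * (y * y) ∎
        where
          e1 : ∀ a b c → a + b + c + c ≡ (a + c) + (b + c)
          e1 = solve-∀
          e2 : ∀ a b → 2 * a * b + 2 * a * b ≡ 2 * (2 * a) * b
          e2 = solve-∀
          e3 : ∀ p c → p * (2 * c) ≡ 2 * (p * c)
          e3 = solve-∀
          e4 : ∀ k y → 2 * (k * y * (2 * (k * y))) ≡ 4 * k * k * (y * y)
          e4 = solve-∀
          1≤p : 1 ≤ p
          1≤p = ≤-trans (*-mono-≤ {1} {4 * 2 ^ k} (*-mono-≤ {1} {4} (s≤s z≤n) (m^n>0 2 k)) (m^n>0 2 k)) hp'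
          -- The lower bound on `p` serves this estimate: at most 2 |Y₁| |Y₂| / p pairs run between
          -- the halves.
          few : 2 * cross Y₂ Y₁ ≤ y * y
          few = *-cancelˡ-≤ p {{>-nonZero 1≤p}} (begin
            p * (2 * cross Y₂ Y₁) ≡⟨ e3 p (cross Y₂ Y₁) ⟩
            2 * (p * cross Y₂ Y₁) ≡⟨ cong (2 *_) (sym (sumN-*ˡ Y₂ p _)) ⟩
            2 * sumN Y₂ (λ b → p * count b Y₁) ≤⟨ *-monoʳ-≤ 2 (sumN-bound Y₂ (2 * length Y₁) deg) ⟩
            2 * (length Y₂ * (2 * length Y₁)) ≡⟨ cong₂ (λ u v → 2 * (u * (2 * v))) l₂ l₁ ⟩
            2 * (2 ^ k * y * (2 * (2 ^ k * y))) ≡⟨ e4 (2 ^ k) y ⟩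
            4 * 2 ^ k * 2 ^ k * (y * y) ≤⟨ *-monoˡ-≤ (y * y) hp' ⟩
            p * (y * y) ∎)

ceiling : ∀ x d → 1 ≤ d → ∃ λ y → x ≤ d * y × d * y ≤ x + d
ceiling x (suc d) _ = suc (x / suc d) , lower , upper
  where
    open ≤-Reasoning
    lower : x ≤ suc d * suc (x / suc d)
    lower = begin
      x ≡⟨ m≡m%n+[m/n]*n x (suc d) ⟩
      x % suc d + x / suc d * suc d ≤⟨ +-monoˡ-≤ _ (<⇒≤ (m%n<n x (suc d))) ⟩
      suc d + x / suc d * suc d ≡⟨ *-comm (suc (x / suc d)) (suc d) ⟩
      suc d * suc (x / suc d) ∎
    upper : suc d * suc (x / suc d) ≤ x + suc d
    upper = begin
      suc d * suc (x / suc d) ≡⟨ *-comm (suc d) (suc (x / suc d)) ⟩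
      suc d + x / suc d * suc d ≤⟨ +-monoʳ-≤ (suc d) (m/n*n≤m x (suc d)) ⟩
      suc d + x ≡⟨ +-comm (suc d) x ⟩
      x + suc d ∎

-- Sets that are sparse in several colours at once.

module Multicolour (rr κ : ℕ → ℕ) (1≤rr : ∀ p → 1 ≤ p → 1 ≤ rr p) where

  AllFail : ∀ {t} → (Fin t → Fin t → Bool) → ℕ → List (Fin t) → Set
  AllFail Q N W = ∀ p → 1 ≤ p → ∀ U → Unique U → U ⊆ W → κ p * N ≤ length U → Density.Good Q p (rr p) U → ⊥

  Symmetric : ∀ {t} → (Fin t → Fin t → Bool) → Set
  Symmetric Q = ∀ x y → Q x y ≡ Q y x

  -- The size `ν` is prescribed rather than found, so that the colours can be treated one inside the
  -- sparse set of another.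
  Simultaneous : (s θ a c₀ : ℕ) → Set
  Simultaneous s θ a c₀ = ∀ {t} N → 1 ≤ N → (Qs : List (Fin t → Fin t → Bool)) → length Qs ≡ s → All Symmetric Qs →
    ∀ ν (W : List (Fin t)) → Unique W → c₀ * N ≤ ν → a * ν ≤ length W → All (λ Q → AllFail Q N W) Qs →
    (∀ Y → Unique Y → Y ⊆ W → length Y ≡ ν → All (λ Q → θ * Density.pairs Q Y ≤ ν * ν) Qs → ⊥) → ⊥

  simultaneous : ∀ s θ → ∃₂ λ a c₀ → 1 ≤ a × Simultaneous s θ a c₀
  simultaneous zero θ = 1 , 0 , ≤-refl , λ { N _ [] refl _ ν W uW _ big _ ret → ret (take ν W) (unique-take ν uW) (take⊆ ν W) (length-take≤ ν W (≤-trans (≤-reflexive (sym (+-identityʳ ν))) big)) [] }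
  simultaneous (suc s) θ with simultaneous s θ
  ... | a , c₀ , 1≤a , rec = a' , c₀' , ≤-trans 1≤a (≤-trans (m≤m+n a _) (≤-trans (≤-reflexive (sym (*-identityʳ (2 * a)))) (*-monoʳ-≤ (2 * a) (≤-trans (s≤s z≤n) (m≤m+n 1 A))))) , result
    where
      open ≤-Reasoning
      k K p A a' c₀' : ℕ
      -- `Y` has `ν` vertices inside a set of at most 2 a ν vertices and density at most 2 / K. The
      -- passage may raise the density by the factor (2 a)², so K ≥ 8 θ a² leaves at most 1 / θ.
      k = 8 * θ * a * a
      K = 2 ^ k
      p = 4 * K * K
      A = Sparse.sparse-constant {0} (λ _ _ → true) (λ _ _ → refl) (rr p) k
      a' = 2 * a * (1 + A)
      c₀' = K * κ p + K + c₀
      1≤K : 1 ≤ K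
      1≤K = m^n>0 2 k
      1≤p : 1 ≤ p
      1≤p = *-mono-≤ {1} {4 * K} (*-mono-≤ {1} {4} (s≤s z≤n) 1≤K) 1≤K
      A≡ : ∀ {t} (Q : Fin t → Fin t → Bool) (Qs : Symmetric Q) k → Sparse.sparse-constant {0} (λ _ _ → true) (λ _ _ → refl) (rr p) k ≡ Sparse.sparse-constant Q Qs (rr p) k
      A≡ Q Qs zero = refl
      A≡ Q Qs (suc k) = cong (λ z → suc (2 * (rr p * (z + 2 ^ k)))) (A≡ Q Qs k)
      result : Simultaneous (suc s) θ a' c₀'
      result {t} N 1≤N (Q ∷ Qs) refl (Qsym ∷ syms) ν W uW ν-big W-big (failQ ∷ fails) ret = go (ceiling (a * ν) K 1≤K)
        where
          e0 : ∀ K κ c N → K * (κ * N) + (K * N + c * N) ≡ (K * κ + K + c) * N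
          e0 = solve-∀
          ν-big' : K * (κ p * N) + (K * N + c₀ * N) ≤ ν
          ν-big' = ≤-trans (≤-reflexive (e0 K (κ p) c₀ N)) ν-big
          ν≤aν : ν ≤ a * ν
          ν≤aν = ≤-trans (≤-reflexive (sym (*-identityˡ ν))) (*-monoˡ-≤ ν 1≤a)
          K≤ν : K ≤ ν
          K≤ν = begin
            K ≡⟨ sym (*-identityʳ K) ⟩
            K * 1 ≤⟨ *-monoʳ-≤ K 1≤N ⟩
            K * N ≤⟨ ≤-trans (m≤m+n (K * N) (c₀ * N)) (m≤n+m _ (K * (κ p * N))) ⟩
            K * (κ p * N) + (K * N + c₀ * N) ≤⟨ ν-big' ⟩
            ν ∎
          go : (∃ λ y → a * ν ≤ K * y × K * y ≤ a * ν + K) → ⊥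
          go (y , lower , upper) = Sparse.sparse Q Qsym k p (rr p) y ≤-refl (1≤rr p 1≤p) 1≤y W uW W-big'
            (λ U uU U⊆ y≤U → failQ p 1≤p U uU U⊆ (≤-trans κN≤y y≤U)) λ Y₀ uY₀ Y₀⊆ lenY₀ sparse₀ →
            rec N 1≤N Qs refl syms ν Y₀ uY₀ (≤-trans (≤-trans (m≤n+m (c₀ * N) (K * N)) (m≤n+m _ (K * (κ p * N)))) ν-big') (≤-trans lower (≤-reflexive (sym lenY₀)))
              (mapAll (λ f p 1≤p U uU U⊆ → f p 1≤p U uU (λ z → Y₀⊆ (U⊆ z))) fails) λ Y uY Y⊆ lenY sparseY →
            ret Y uY (λ z → Y₀⊆ (Y⊆ z)) lenY (final Y Y₀ uY Y⊆ sparse₀ ∷ sparseY)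
            where
              Ky≤ : K * y ≤ 2 * a * ν
              Ky≤ = begin
                K * y ≤⟨ upper ⟩
                a * ν + K ≤⟨ +-monoʳ-≤ (a * ν) (≤-trans K≤ν ν≤aν) ⟩
                a * ν + a * ν ≡⟨ e1 a ν ⟩
                2 * a * ν ∎
                where
                  e1 : ∀ a ν → a * ν + a * ν ≡ 2 * a * ν
                  e1 = solve-∀
              κN≤y : κ p * N ≤ y
              κN≤y = *-cancelˡ-≤ K {{>-nonZero 1≤K}} (begin
                K * (κ p * N) ≤⟨ m≤m+n _ _ ⟩
                K * (κ p * N) + (K * N + c₀ * N) ≤⟨ ν-big' ⟩
                ν ≤⟨ ν≤aν ⟩
                a * ν ≤⟨ lower ⟩
                K * y ∎)
              1≤y : 1 ≤ y
              1≤y = *-cancelˡ-≤ K {{>-nonZero 1≤K}} (begin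
                K * 1 ≡⟨ *-identityʳ K ⟩
                K ≤⟨ K≤ν ⟩
                ν ≤⟨ ν≤aν ⟩
                a * ν ≤⟨ lower ⟩
                K * y ∎)
              W-big' : Sparse.sparse-constant Q Qsym (rr p) k * y ≤ length W
              W-big' = begin
                Sparse.sparse-constant Q Qsym (rr p) k * y ≡⟨ cong (_* y) (sym (A≡ Q Qsym k)) ⟩
                A * y ≤⟨ *-monoʳ-≤ A (≤-trans (≤-trans (≤-reflexive (sym (*-identityˡ y))) (*-monoˡ-≤ y 1≤K)) Ky≤) ⟩
                A * (2 * a * ν) ≤⟨ slack (2 * a * ν) (e2 A a ν) ⟩
                a' * ν ≤⟨ W-big ⟩
                length W ∎
                where
                  e2 : ∀ A a ν → A * (2 * a * ν) + 2 * a * ν ≡ 2 * a * (1 + A) * ν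
                  e2 = solve-∀
              final : ∀ Y Y₀ → Unique Y → Y ⊆ Y₀ → Density.pairs Q Y₀ + y * y ≤ 2 * K * (y * y) → θ * Density.pairs Q Y ≤ ν * ν
              final Y Y₀ uY Y⊆ sp = *-cancelˡ-≤ K {{>-nonZero 1≤K}} (begin
                K * (θ * Density.pairs Q Y) ≤⟨ *-monoʳ-≤ K (*-monoʳ-≤ θ (≤-trans (Density.pairs-⊆ Q uY Y⊆) (≤-trans (m≤m+n _ (y * y)) sp))) ⟩
                K * (θ * (2 * K * (y * y))) ≡⟨ e3 K θ y ⟩
                2 * θ * (K * y * (K * y)) ≤⟨ *-monoʳ-≤ (2 * θ) (*-mono-≤ Ky≤ Ky≤) ⟩
                2 * θ * (2 * a * ν * (2 * a * ν)) ≡⟨ e4 θ a ν ⟩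
                k * (ν * ν) ≤⟨ *-monoˡ-≤ (ν * ν) (<⇒≤ (n<2^n k)) ⟩
                K * (ν * ν) ∎)
                where
                  e3 : ∀ K θ y → K * (θ * (2 * K * (y * y))) ≡ 2 * θ * (K * y * (K * y))
                  e3 = solve-∀
                  e4 : ∀ θ a ν → 2 * θ * (2 * a * ν * (2 * a * ν)) ≡ 8 * θ * a * a * (ν * ν)
                  e4 = solve-∀

-- The linear Ramsey theorem of Chvátal, Rödl, Szemerédi and Trotter, for s colours.
RamseyBound : (Δ s C : ℕ) → Set
RamseyBound Δ s C = ∀ {C'} → C ≤ C' → (G : Defs.Graph) → 1 ≤ Defs.n G → (∀ a → GraphSums.degree G a ≤ Δ) →
  ∀ {t k} (c : Fin t → Fin t → Fin k) → (∀ x y → c x y ≡ c y x) → (U : List (Fin t)) → Unique U → C' * Defs.n G ≤ length U →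
  (qs : List (Fin k)) → length qs ≡ s → (∀ {x y} → x ∈ U → y ∈ U → x ≢ y → c x y ∈ qs) →
  (∀ q (f : Fin (Defs.n G) → Fin t) → Injective _≡_ _≡_ f → (∀ a b → Defs.adj G a b ≡ true → c (f a) (f b) ≡ q) → ⊥) → ⊥

-- Without a monochromatic copy no large set is `Good` in any colour, so some set of `ν` vertices is
-- sparse in all `s` colours. This cannot be, as the colours cover all its pairs.
ramsey-bound : ∀ Δ → 1 ≤ Δ → ∀ s → ∃ (RamseyBound Δ s)
ramsey-bound Δ 1≤Δ s = C , λ {C'} C≤C' G 1≤n deg≤Δ {t} {k} c c-sym U uU big qs len-qs coloured none → 
    M.simultaneous-copy G 1≤n deg≤Δ c c-sym U uU (≤-trans (*-monoˡ-≤ (Defs.n G) C≤C') big) qs len-qs coloured none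
  where
    open ≤-Reasoning
    rr κ : ℕ → ℕ
    rr p = 2 * (Δ * p ^ Δ)
    κ p = 2 * p ^ Δ + 1
    1≤rr : ∀ p → 1 ≤ p → 1 ≤ rr p
    1≤rr p 1≤p = *-mono-≤ {1} {2} (s≤s z≤n) (*-mono-≤ 1≤Δ (m^n>0 p {{>-nonZero 1≤p}} Δ))
    sim : ∃₂ λ a c₀ → 1 ≤ a × Multicolour.Simultaneous rr κ 1≤rr s (2 * s + 1) a c₀
    -- With θ = 2 s + 1 the `s` colours cover less than half of ν², whereas the pairs of distinct
    -- vertices are at least half of ν² once ν ≥ 2.
    sim = Multicolour.simultaneous rr κ 1≤rr s (2 * s + 1)
    a c₀ C : ℕ
    a = proj₁ sim
    c₀ = proj₁ (proj₂ sim)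
    C = a * (c₀ + 2)
    module M where
      simultaneous-copy : (G : Defs.Graph) → 1 ≤ Defs.n G → (∀ a → GraphSums.degree G a ≤ Δ) →
        ∀ {t k} (c : Fin t → Fin t → Fin k) → (∀ x y → c x y ≡ c y x) → (U : List (Fin t)) → Unique U → C * Defs.n G ≤ length U →
        (qs : List (Fin k)) → length qs ≡ s → (∀ {x y} → x ∈ U → y ∈ U → x ≢ y → c x y ∈ qs) →
        (∀ q (f : Fin (Defs.n G) → Fin t) → Injective _≡_ _≡_ f → (∀ a b → Defs.adj G a b ≡ true → c (f a) (f b) ≡ q) → ⊥) → ⊥
      simultaneous-copy G 1≤N deg≤Δ {t} {k} c c-sym U uU big qs len-qs coloured none =
        proj₂ (proj₂ (proj₂ sim)) N 1≤N Qs (trans (length-map Q qs) len-qs) (syms qs) ν U uU (*-monoˡ-≤ N (m≤m+n c₀ 2)) (≤-trans (≤-reflexive (sym (*-assoc a (c₀ + 2) N))) big) (fails qs) dense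
        where
          N ν : ℕ
          N = Defs.n G
          ν = (c₀ + 2) * N
          Q : Fin k → Fin t → Fin t → Bool
          Q q x y = does (c x y ≟ q)
          Q-sym : ∀ q x y → Q q x y ≡ Q q y x
          Q-sym q x y = cong (λ z → does (z ≟ q)) (c-sym x y)
          Qs : List (Fin t → Fin t → Bool)
          Qs = map Q qs
          syms : ∀ qs → All (Multicolour.Symmetric rr κ 1≤rr) (map Q qs)
          syms [] = []
          syms (q ∷ qs) = Q-sym q ∷ syms qs
          fails : ∀ qs → All (λ Q → Multicolour.AllFail rr κ 1≤rr Q N U) (map Q qs)
          fails [] = []
          fails (q ∷ qs) = (λ p 1≤p U' uU' U'⊆ big' good →
            let (f , inj , mono) = Embedding.Greedy.embed G (Q q) (Q-sym q) Δ p 1≤p 1≤Δ deg≤Δ U' good (≤-trans (s≤' (p ^ Δ)) big') uU'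
            in none q f inj (λ a b h → does⁻ (c (f a) (f b) ≟ q) (mono a b h))) ∷ fails qs
            where
              e : ∀ P N → 2 * (P * N) + N ≡ (2 * P + 1) * N
              e = solve-∀
              s≤' : ∀ P → suc (2 * (P * N)) ≤ (2 * P + 1) * N
              s≤' P = ≤-trans (≤-trans (≤-reflexive (+-comm 1 (2 * (P * N)))) (+-monoʳ-≤ (2 * (P * N)) 1≤N)) (≤-reflexive (e P N))
          2≤ν : 2 ≤ ν
          2≤ν = *-mono-≤ {2} {c₀ + 2} (m≤n+m 2 c₀) 1≤N
          dense : ∀ Y → Unique Y → Y ⊆ U → length Y ≡ ν → All (λ Q → (2 * s + 1) * Density.pairs Q Y ≤ ν * ν) Qs → ⊥
          dense Y uY Y⊆ lenY sparse = <⇒≱ 2≤ν (≤-trans small ≤-refl)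
            where
              -- The summand 1 stands for `x` itself, since `coloured` speaks of distinct vertices.
              cover : ∀ x → x ∈ Y → ν ≤ 1 + sumN qs (λ q → Density.count (Q q) x Y)
              cover x x∈ = begin
                ν ≡⟨ trans (sym lenY) (trans (sym (*-identityʳ (length Y))) (sym (sumN-const Y 1))) ⟩
                sumN Y (λ _ → 1) ≤⟨ sumN-mono Y (λ {y} y∈ → each y y∈) ⟩
                sumN Y (λ y → (if does (y ≟ x) then 1 else 0) + sumN qs (λ q → b2n (Q q x y))) ≡⟨ sumN-+ Y _ _ ⟩
                sumN Y (λ y → if does (y ≟ x) then 1 else 0) + sumN Y (λ y → sumN qs (λ q → b2n (Q q x y))) ≡⟨ cong₂ _+_ (sumN-single Y x (λ _ → 1) uY x∈) (trans (sumN-swap Y qs _) (sumN-cong qs (λ {q} _ → sym (Density.count≡ (Q q) x Y)))) ⟩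
                1 + sumN qs (λ q → Density.count (Q q) x Y) ∎
                where
                  each : ∀ y → y ∈ Y → 1 ≤ (if does (y ≟ x) then 1 else 0) + sumN qs (λ q → b2n (Q q x y))
                  each y y∈ with y ≟ x
                  ... | yes _ = s≤s z≤n
                  ... | no ne = ≤-trans (≤-reflexive (cong b2n (sym (does⁺ (c x y ≟ c x y) refl)))) (sumN-member (λ q → b2n (Q q x y)) (coloured (Y⊆ x∈) (Y⊆ y∈) (ne ∘ sym)))
              total : ν * ν ≤ ν + sumN qs (λ q → Density.pairs (Q q) Y)
              total = begin
                ν * ν ≡⟨ cong (_* ν) (sym lenY) ⟩
                length Y * ν ≡⟨ sym (sumN-const Y ν) ⟩
                sumN Y (λ _ → ν) ≤⟨ sumN-mono Y (λ {x} → cover x) ⟩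
                sumN Y (λ x → 1 + sumN qs (λ q → Density.count (Q q) x Y)) ≡⟨ sumN-+ Y _ _ ⟩
                sumN Y (λ _ → 1) + sumN Y (λ x → sumN qs (λ q → Density.count (Q q) x Y)) ≡⟨ cong₂ _+_ (trans (sumN-const Y 1) (trans (*-identityʳ _) lenY)) (sumN-swap Y qs _) ⟩
                ν + sumN qs (λ q → Density.pairs (Q q) Y) ∎
              bound : ∀ qs → All (λ Q → (2 * s + 1) * Density.pairs Q Y ≤ ν * ν) (map Q qs) → (2 * s + 1) * sumN qs (λ q → Density.pairs (Q q) Y) ≤ length qs * (ν * ν)
              bound [] [] = ≤-reflexive (*-zeroʳ (2 * s + 1))
              bound (q ∷ qs) (h ∷ hs) = ≤-trans (≤-reflexive (*-distribˡ-+ (2 * s + 1) _ _)) (+-mono-≤ h (bound qs hs))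
              small : ν ≤ 1
              small = ≤-pred (*-cancelˡ-< (suc s) _ _ (begin-strict
                suc s * ν ≤⟨ *-cancelʳ-≤ _ _ ν {{>-nonZero (≤-trans (s≤s z≤n) 2≤ν)}} (+-cancelʳ-≤ (s * (ν * ν)) _ _ (begin
                   suc s * ν * ν + s * (ν * ν) ≡⟨ e1 s ν ⟩
                   (2 * s + 1) * (ν * ν) ≤⟨ *-monoʳ-≤ (2 * s + 1) total ⟩
                   (2 * s + 1) * (ν + sumN qs (λ q → Density.pairs (Q q) Y)) ≡⟨ *-distribˡ-+ (2 * s + 1) ν _ ⟩
                   (2 * s + 1) * ν + (2 * s + 1) * sumN qs (λ q → Density.pairs (Q q) Y) ≤⟨ +-monoʳ-≤ ((2 * s + 1) * ν) (≤-trans (bound qs sparse) (≤-reflexive (cong (_* (ν * ν)) len-qs))) ⟩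
                   (2 * s + 1) * ν + s * (ν * ν) ∎)) ⟩
                2 * s + 1 <⟨ ≤-reflexive (e2 s) ⟩
                suc s * 2 ∎))
                where
                  e1 : ∀ s ν → suc s * ν * ν + s * (ν * ν) ≡ (2 * s + 1) * (ν * ν)
                  e1 = solve-∀
                  e2 : ∀ s → suc (2 * s + 1) ≡ suc s * 2
                  e2 = solve-∀

abstract
  monochromatic-copy : ∀ Δ → 1 ≤ Δ → ∀ s → ∃ (RamseyBound Δ s)
  monochromatic-copy = ramsey-bound

sumN-atMost1 : {X : Set} (xs : List X) (p : X → Bool) → Unique xs → (∀ {x y} → p x ≡ true → p y ≡ true → x ≡ y) → sumN xs (b2n ∘ p) ≤ 1
sumN-atMost1 [] p u h = z≤n
sumN-atMost1 (x ∷ xs) p (x∉ ∷ u) h with p x in eq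
... | false = sumN-atMost1 xs p u h
... | true = ≤-reflexive (cong suc (sumN-0 xs (λ {y} y∈ → cong b2n (¬T⇒F (λ q → lookupAll x∉ y∈ (h eq q))))))

sumN-positive : {X : Set} (xs : List X) (f : X → ℕ) → 1 ≤ sumN xs f → ∃ λ x → x ∈ xs × 1 ≤ f x
sumN-positive (x ∷ xs) f h with f x in eq
... | suc _ = x , here refl , ≤-trans (s≤s z≤n) (≤-reflexive (sym eq))
... | zero with sumN-positive xs f h
...   | y , y∈ , q = y , there y∈ , q

b2n-positive : ∀ {b} → 1 ≤ b2n b → b ≡ true
b2n-positive {true} h = refl

-- Far-apart vertices of equal degree

module Classes {X B : Set} (_≟ᴮ_ : (a b : B) → Dec (a ≡ b)) where
  classOf : (X → B) → B → List X → List X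
  classOf φ v U = fil (λ x → does (φ x ≟ᴮ v)) U

  ∈-classOf : ∀ φ v U {x} → x ∈ classOf φ v U → x ∈ U × φ x ≡ v
  ∈-classOf φ v U {x} h = proj₁ (∈-fil⁻ U h) , does⁻ (φ x ≟ᴮ v) (proj₂ (∈-fil⁻ U h))

  pigeonhole : B → ∀ (φ : X → B) (E : List B) (U : List X) → (∀ {x} → x ∈ U → φ x ∈ E) → ∃ λ v → length U ≤ length E * length (classOf φ v U)
  pigeonhole b₀ φ E [] h = b₀ , z≤n
  pigeonhole b₀ φ [] (x ∷ U) h = case h (here refl) of λ ()
  pigeonhole b₀ φ (e ∷ E) U@(_ ∷ _) h with averaging (λ v → length (classOf φ v U)) e E
  ... | v , _ , le = v , ≤-trans count le
    where
      open ≤-Reasoning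
      count : length U ≤ sumN (e ∷ E) (λ v → length (classOf φ v U))
      count = begin
        length U ≡⟨ sym (trans (sumN-const U 1) (*-identityʳ _)) ⟩
        sumN U (λ _ → 1) ≤⟨ sumN-mono U (λ {x} x∈ → ≤-trans (≤-reflexive (cong b2n (sym (does⁺ (φ x ≟ᴮ φ x) refl)))) (sumN-member (λ v → b2n (does (φ x ≟ᴮ v))) (h x∈))) ⟩
        sumN U (λ x → sumN (e ∷ E) (λ v → b2n (does (φ x ≟ᴮ v)))) ≡⟨ sumN-swap U (e ∷ E) _ ⟩
        sumN (e ∷ E) (λ v → sumN U (λ x → b2n (does (φ x ≟ᴮ v)))) ≡⟨ sumN-cong (e ∷ E) (λ {v} _ → sym (length-fil _ U)) ⟩
        sumN (e ∷ E) (λ v → length (classOf φ v U)) ∎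

module Balls (G : Defs.Graph) (Δ : ℕ) (1≤Δ : 1 ≤ Δ) where
  open Defs.Graph G using (n; adj) renaming (sym to adj-sym)
  open GraphSums G

  N[_] : VG → List VG
  N[ a ] = a ∷ nbrs a

  -- Beyond disjointness no edge joins the two closed neighbourhoods. An edge then meets at most one
  -- of them, and they can be placed independently.
  Far : VG → VG → Set
  Far a b = ∀ {a' b'} → a' ∈ N[ a ] → b' ∈ N[ b ] → a' ≢ b' × adj a' b' ≡ false

  Far-sym : ∀ {a b} → Far a b → Far b a
  Far-sym far p q with far q p
  ... | ne , h = ne ∘ sym , trans (adj-sym _ _) h

  expand : List VG → List VG
  expand l = concatMap N[_] l

  ∈-expand : ∀ {x y l} → x ∈ l → y ∈ N[ x ] → y ∈ expand l
  ∈-expand x∈ y∈ = ∈-concatMap⁺ N[_] (lose x∈ y∈)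

  N-sym : ∀ {a b} → b ∈ N[ a ] → a ∈ N[ b ]
  N-sym (here refl) = here refl
  N-sym (there h) = there (∈-nbrs⁺ (trans (adj-sym _ _) (∈-nbrs⁻ h)))

  ball₃ : VG → List VG
  ball₃ a = expand (expand (expand [ a ]))

  ∉ball⇒Far : ∀ {a b} → b ∉ ball₃ a → Far a b
  ∉ball⇒Far {a} {b} b∉ {a'} {b'} a'∈ b'∈ = (λ { refl → b∉ (within (here refl) b'∈) }) ,
    ¬T⇒F (λ h → b∉ (within (there (∈-nbrs⁺ h)) b'∈))
    where
      within : ∀ {b'} → b' ∈ N[ a' ] → b' ∈ N[ b ] → b ∈ ball₃ a
      within p q = ∈-expand {l = expand (expand [ a ])} (∈-expand {l = expand [ a ]} (∈-expand {l = [ a ]} (here refl) a'∈) p) (N-sym q)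

  module _ (deg≤Δ : ∀ a → degree a ≤ Δ) where
    length-expand : ∀ l → length (expand l) ≤ length l * suc Δ
    length-expand [] = z≤n
    length-expand (a ∷ l) = ≤-trans (≤-reflexive (length-++ N[ a ])) (+-mono-≤ (s≤s (deg≤Δ a)) (length-expand l))

    q : ℕ
    q = suc Δ * suc Δ * suc Δ

    length-ball : ∀ a → length (ball₃ a) ≤ q
    length-ball a = ≤-trans (length-expand (expand (expand [ a ]))) (*-monoˡ-≤ (suc Δ) (≤-trans (length-expand (expand [ a ])) (*-monoˡ-≤ (suc Δ) (≤-trans (length-expand [ a ]) (≤-reflexive (*-identityˡ (suc Δ)))))))

    -- Greedy choice: keeping `x` discards `ball₃ x`, which has at most `q` vertices. Recursion is
    -- on `fuel` because the remainder is a filtered list.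
    select : ∀ fuel (xs : List VG) → length xs ≤ fuel → Unique xs →
      ∃ λ ys → ys ⊆ xs × Unique ys × length xs ≤ q * length ys × (∀ {a b} → a ∈ ys → b ∈ ys → a ≢ b → Far a b)
    select fuel [] _ u = [] , id , [] , z≤n , λ ()
    select (suc fuel) (x ∷ xs) (s≤s le) (x∉ ∷ u) with select fuel (xs ∖ ball₃ x) (≤-trans (length-filter _ xs) le) (∖-unique (ball₃ x) u)
    ... | ys , ys⊆ , uys , bound , far = x ∷ ys , sub , unique-cons (λ h → lookupAll x∉ (∖⊆ xs (ball₃ x) (ys⊆ h)) refl) uys , bound' , far'
      where
        sub : x ∷ ys ⊆ x ∷ xs
        sub (here e) = here e
        sub (there h) = there (∖⊆ xs (ball₃ x) (ys⊆ h))
        x∈ball : x ∈ ball₃ x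
        x∈ball = ∈-expand {l = expand (expand [ x ])} (∈-expand {l = expand [ x ]} (∈-expand {l = [ x ]} (here refl) (here refl)) (here refl)) (here refl)
        bound' : suc (length xs) ≤ q * suc (length ys)
        bound' = begin
          length (x ∷ xs) ≤⟨ length-∖ (ball₃ x) (x∉ ∷ u) ⟩
          length ((x ∷ xs) ∖ ball₃ x) + length (ball₃ x) ≤⟨ +-mono-≤ (≤-reflexive (cong length (filter-reject (λ z → not (z ∈ᵇ ball₃ x) ≟ᵇ true) {x} {xs} (λ h → T⇒F⇒⊥ h (cong not (∈⇒∈ᵇ {R = ball₃ x} x∈ball)))))) (length-ball x) ⟩
          length (xs ∖ ball₃ x) + q ≤⟨ +-monoˡ-≤ q bound ⟩
          q * length ys + q ≡⟨ e q (length ys) ⟩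
          q * suc (length ys) ∎
          where
            open ≤-Reasoning
            e : ∀ q y → q * y + q ≡ q * suc y
            e = solve-∀
        x-far : ∀ {b} → b ∈ ys → Far x b
        x-far b∈ = ∉ball⇒Far (proj₂ (∈-∖⁻ xs (ball₃ x) (ys⊆ b∈)))
        far' : ∀ {a b} → a ∈ x ∷ ys → b ∈ x ∷ ys → a ≢ b → Far a b
        far' (here refl) (here refl) ne = ⊥-elim (ne refl)
        far' (here refl) (there b∈) ne = x-far b∈
        far' (there a∈) (here refl) ne = Far-sym (x-far a∈)
        far' (there a∈) (there b∈) ne = far a∈ b∈ ne

    pattern-of : VG → List ℕ
    pattern-of a = map degree (nbrs a)

    -- The common pattern of neighbour degrees lets the neighbourhoods of `d` selected vertices
    -- cancel modulo `J`: a host is counted with the degree of the vertex placed on it.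
    record Selection (K₁ d' : ℕ) : Set where
      field
        vs : List VG
        pat : List ℕ
        vs-unique : Unique vs
        vs-degree : ∀ {a} → a ∈ vs → degree a ≡ suc d'
        vs-pattern : ∀ {a} → a ∈ vs → pattern-of a ≡ pat
        vs-far : ∀ {a b} → a ∈ vs → b ∈ vs → a ≢ b → Far a b
        many : Defs.e G ≤ K₁ * length vs

shortLists : ℕ → ℕ → List (List ℕ)
shortLists b zero = [ [] ]
shortLists b (suc k) = [] ∷ concatMap (λ a → map (a ∷_) (shortLists b k)) (upTo (suc b))

∈-shortLists : ∀ b k xs → length xs ≤ k → All (_≤ b) xs → xs ∈ shortLists b k
∈-shortLists b zero [] _ _ = here refl
∈-shortLists b (suc k) [] _ _ = here refl
∈-shortLists b (suc k) (x ∷ xs) (s≤s le) (h ∷ hs) = there (∈-concatMap⁺ (λ a → map (a ∷_) (shortLists b k)) (lose (∈-upTo⁺ (s≤s h)) (∈-map⁺ (x ∷_) (∈-shortLists b k xs le hs))))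

-- The factors account for the edges per non-isolated vertex, the possible degree patterns, and the
-- size of a ball.
selection-constant : ℕ → ℕ
selection-constant Δ = Δ * (length (shortLists Δ Δ) * (suc Δ * suc Δ * suc Δ))

selection : ∀ (G : Defs.Graph) (Δ : ℕ) (1≤Δ : 1 ≤ Δ) (deg≤Δ : ∀ a → GraphSums.degree G a ≤ Δ) → 1 ≤ Defs.e G → ∃ λ d' → Balls.Selection G Δ 1≤Δ deg≤Δ (selection-constant Δ) d'
selection G Δ 1≤Δ deg≤Δ 1≤e = result
  where
    open Defs.Graph G using (n)
    open GraphSums G
    open Balls G Δ 1≤Δ
    open Classes {VG} {List ℕ} (list-≡-dec _≟ⁿ_)
    open ≤-Reasoning
    K : ℕ
    K = selection-constant Δ
    U : List VG
    U = fil (λ a → does (1 ≤? degree a)) (allFin n)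
    edges≤ : Defs.e G ≤ Δ * length U
    edges≤ = begin
      Defs.e G ≤⟨ m≤m+n _ _ ⟩
      2 * Defs.e G ≡⟨ sym degree-sum ⟩
      sumN (allFin n) degree ≤⟨ sumN-mono (allFin n) (λ {a} _ → each a (1 ≤? degree a)) ⟩
      sumN (allFin n) (λ a → Δ * b2n (does (1 ≤? degree a))) ≡⟨ sumN-*ˡ (allFin n) Δ _ ⟩
      Δ * sumN (allFin n) (λ a → b2n (does (1 ≤? degree a))) ≡⟨ cong (Δ *_) (sym (length-fil _ (allFin n))) ⟩
      Δ * length U ∎
      where
        each : ∀ a (d : Dec (1 ≤ degree a)) → degree a ≤ Δ * b2n (does d)
        each a (yes _) = ≤-trans (deg≤Δ a) (≤-reflexive (sym (*-identityʳ Δ)))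
        each a (no ¬p) = ≤-trans (≤-pred (≰⇒> ¬p)) z≤n
    bounded : ∀ (xs : List VG) → All (_≤ Δ) (map degree xs)
    bounded [] = []
    bounded (x ∷ xs) = deg≤Δ x ∷ bounded xs
    hole = pigeonhole [] (pattern-of deg≤Δ) (shortLists Δ Δ) U (λ {a} _ → ∈-shortLists Δ Δ _ (≤-trans (≤-reflexive (length-map degree (nbrs a))) (deg≤Δ a)) (bounded (nbrs a)))
    pat : List ℕ
    pat = proj₁ hole
    C : List VG
    C = classOf (pattern-of deg≤Δ) pat U
    sel = select deg≤Δ (length C) C ≤-refl (fil-unique (fil-unique (allFin⁺ n)))
    vs : List VG
    vs = proj₁ sel
    vs⊆ : vs ⊆ C
    vs⊆ = proj₁ (proj₂ sel)
    many : Defs.e G ≤ K * length vs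
    many = begin
      Defs.e G ≤⟨ edges≤ ⟩
      Δ * length U ≤⟨ *-monoʳ-≤ Δ (proj₂ hole) ⟩
      Δ * (length (shortLists Δ Δ) * length C) ≤⟨ *-monoʳ-≤ Δ (*-monoʳ-≤ (length (shortLists Δ Δ)) (proj₁ (proj₂ (proj₂ (proj₂ sel))))) ⟩
      Δ * (length (shortLists Δ Δ) * (q deg≤Δ * length vs)) ≡⟨ e Δ (length (shortLists Δ Δ)) (q deg≤Δ) (length vs) ⟩
      K * length vs ∎
      where
        e : ∀ a b c d → a * (b * (c * d)) ≡ a * (b * c) * d
        e = solve-∀
    has-pattern : ∀ {a} → a ∈ vs → pattern-of deg≤Δ a ≡ pat
    has-pattern a∈ = proj₂ (∈-classOf (pattern-of deg≤Δ) pat U (vs⊆ a∈))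
    degree-pat : ∀ {a} → a ∈ vs → degree a ≡ length pat
    degree-pat {a} a∈ = trans (sym (length-map degree (nbrs a))) (cong length (has-pattern a∈))
    positive : ∀ {a} → a ∈ vs → 1 ≤ degree a
    positive {a} a∈ = does⁻ (1 ≤? degree a) (proj₂ (∈-fil⁻ (allFin n) (proj₁ (∈-classOf (pattern-of deg≤Δ) pat U (vs⊆ a∈)))))
    nonempty : ∃ λ a → a ∈ vs
    nonempty = from vs (≤-trans 1≤e many)
      where
        from : ∀ (l : List VG) → 1 ≤ K * length l → ∃ λ a → a ∈ l
        from [] h = ⊥-elim (<⇒≱ h (≤-reflexive (*-zeroʳ K)))
        from (a ∷ _) h = a , here refl
    predecessor : ∀ k → 1 ≤ k → suc (pred k) ≡ k
    predecessor (suc k) _ = refl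
    result : ∃ λ d' → Selection deg≤Δ K d'
    result = pred (length pat) , record
      { vs = vs ; pat = pat ; vs-unique = proj₁ (proj₂ (proj₂ sel))
      ; vs-degree = λ a∈ → trans (degree-pat a∈) (sym (predecessor (length pat) (subst (1 ≤_) (degree-pat (proj₂ nonempty)) (positive (proj₂ nonempty)))))
      ; vs-pattern = has-pattern ; vs-far = proj₂ (proj₂ (proj₂ (proj₂ sel))) ; many = many }

-- Embeddings prescribed block by block.

module _ {n : ℕ} {B : Set} where
  -- The first occurrence of a vertex wins, so blocks of vertices and hosts can be concatenated and
  -- still be read off separately.
  overlay : (Fin n → B) → List (Fin n) → List B → Fin n → B
  overlay f (a ∷ as) (x ∷ xs) = update (overlay f as xs) a x
  overlay f _ _ = f

  overlay-++ˡ : ∀ f f' as xs {as' xs'} → length as ≡ length xs → ∀ {a} → a ∈ as → overlay f (as ++ as') (xs ++ xs') a ≡ overlay f' as xs a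
  overlay-++ˡ f f' (a ∷ as) (x ∷ xs) len {b} b∈ with b ≟ a
  ... | yes _ = refl
  ... | no ne with b∈
  ...   | here e = ⊥-elim (ne e)
  ...   | there h = overlay-++ˡ f f' as xs (suc-injective len) h

  overlay-++ʳ : ∀ f as xs {as' xs'} → length as ≡ length xs → ∀ {a} → a ∉ as → overlay f (as ++ as') (xs ++ xs') a ≡ overlay f as' xs' a
  overlay-++ʳ f [] [] len a∉ = refl
  overlay-++ʳ f (a ∷ as) (x ∷ xs) len {b} b∉ with b ≟ a
  ... | yes e = ⊥-elim (b∉ (here e))
  ... | no ne = overlay-++ʳ f as xs (suc-injective len) (b∉ ∘ there)

  overlay-∉ : ∀ f as xs {a} → a ∉ as → overlay f as xs a ≡ f a
  overlay-∉ f [] xs a∉ = refl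
  overlay-∉ f (a ∷ as) [] a∉ = refl
  overlay-∉ f (a ∷ as) (x ∷ xs) {b} b∉ with b ≟ a
  ... | yes e = ⊥-elim (b∉ (here e))
  ... | no ne = overlay-∉ f as xs (b∉ ∘ there)

  map-overlay : ∀ f as xs → length as ≡ length xs → Unique as → map (overlay f as xs) as ≡ xs
  map-overlay f [] [] len u = refl
  map-overlay f (a ∷ as) (x ∷ xs) len (a∉ ∷ u) = cong₂ _∷_ (update-same (overlay f as xs) a x)
    (trans (map-cong-∈ as (λ {b} b∈ → update-other (overlay f as xs) x (λ { refl → lookupAll a∉ b∈ refl }))) (map-overlay f as xs (suc-injective len) u))
    where
      map-cong-∈ : ∀ {X Y : Set} (l : List X) {g h : X → Y} → (∀ {b} → b ∈ l → g b ≡ h b) → map g l ≡ map h l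
      map-cong-∈ [] e = refl
      map-cong-∈ (b ∷ l) e = cong₂ _∷_ (e (here refl)) (map-cong-∈ l (e ∘ there))

unique-map-injective : ∀ {X Y : Set} (f : X → Y) {xs a b} → Unique (map f xs) → a ∈ xs → b ∈ xs → f a ≡ f b → a ≡ b
unique-map-injective f (h ∷ u) (here refl) (here refl) e = refl
unique-map-injective f (h ∷ u) (here refl) (there q) e = ⊥-elim (lookupAll h (∈-map⁺ f q) e)
unique-map-injective f (h ∷ u) (there p) (here refl) e = ⊥-elim (lookupAll h (∈-map⁺ f p) (sym e))
unique-map-injective f (h ∷ u) (there p) (there q) e = unique-map-injective f u p q e

∈-ʳ++ : ∀ {X : Set} (xs : List X) {ys x} → x ∈ xs ʳ++ ys → x ∈ xs ⊎ x ∈ ys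
∈-ʳ++ [] h = inj₂ h
∈-ʳ++ (x ∷ xs) h with ∈-ʳ++ xs h
... | inj₁ p = inj₁ (there p)
... | inj₂ (here e) = inj₁ (here e)
... | inj₂ (there q) = inj₂ q

∈-ʳ++⁺ʳ : ∀ {X : Set} (xs : List X) {ys x} → x ∈ ys → x ∈ xs ʳ++ ys
∈-ʳ++⁺ʳ [] h = h
∈-ʳ++⁺ʳ (x ∷ xs) h = ∈-ʳ++⁺ʳ xs (there h)

∈-ʳ++⁺ˡ : ∀ {X : Set} (xs : List X) {ys x} → x ∈ xs → x ∈ xs ʳ++ ys
∈-ʳ++⁺ˡ (x ∷ xs) (here refl) = ∈-ʳ++⁺ʳ xs (here refl)
∈-ʳ++⁺ˡ (x ∷ xs) (there h) = ∈-ʳ++⁺ˡ xs h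

unique-ʳ++ : ∀ {X : Set} (xs : List X) {ys} → Unique (xs ʳ++ ys) → Unique xs × Unique ys × Disjoint xs ys
unique-ʳ++ [] u = [] , u , λ { (() , _) }
unique-ʳ++ (x ∷ xs) {ys} u with unique-ʳ++ xs u
... | uxs , (x∉ys ∷ uys) , dis = unique-cons (λ h → dis (h , here refl)) uxs , uys , λ { (here refl , q) → lookupAll x∉ys q refl ; (there p , q) → dis (p , there q) }

length-ʳ++ : ∀ {X : Set} (xs : List X) {ys} → length (xs ʳ++ ys) ≡ length xs + length ys
length-ʳ++ [] = refl
length-ʳ++ (x ∷ xs) {ys} = trans (length-ʳ++ xs) (+-suc (length xs) (length ys))

unique-concatMap : ∀ {X Y : Set} (h : X → List Y) (xs : List X) → Unique xs → (∀ x → Unique (h x)) → (∀ {x y z} → x ∈ xs → y ∈ xs → x ≢ y → z ∈ h x → z ∈ h y → ⊥) → Unique (concatMap h xs)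
unique-concatMap h [] u uh dis = []
unique-concatMap h (x ∷ xs) (x∉ ∷ u) uh dis = unique-++ (uh x) (unique-concatMap h xs u uh (λ p q → dis (there p) (there q)))
  (λ { (p , q) → case find (∈-concatMap⁻ h {xs = xs} q) of λ { (y , y∈ , z∈) → dis (here refl) (there y∈) (lookupAll x∉ y∈) p z∈ } })

module _ {X Y : Set} where
  map-split : ∀ (f : X → Y) as {bs} xs {ys} → length as ≡ length xs → map f (as ++ bs) ≡ xs ++ ys → map f as ≡ xs × map f bs ≡ ys
  map-split f [] [] len e = refl , e
  map-split f (a ∷ as) (x ∷ xs) len e with map-split f as xs (suc-injective len) (∷-injectiveʳ e)
  ... | p , q = cong₂ _∷_ (∷-injectiveˡ e) p , q

  map-split-concat : ∀ {Z : Set} (f : X → Y) (zs : List Z) (g : Z → List X) (h : Z → List Y) → (∀ {z} → z ∈ zs → length (g z) ≡ length (h z)) →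
    map f (concatMap g zs) ≡ concatMap h zs → ∀ {z} → z ∈ zs → map f (g z) ≡ h z
  map-split-concat f (z ∷ zs) g h len e z∈ with map-split f (g z) (h z) (len (here refl)) e
  map-split-concat f (z ∷ zs) g h len e (here refl) | p , q = p
  map-split-concat f (z ∷ zs) g h len e (there z∈) | p , q = map-split-concat f zs g h (len ∘ there) q z∈

length-concatMap : ∀ {X Y Z : Set} (zs : List Z) (g : Z → List X) (h : Z → List Y) → (∀ {z} → z ∈ zs → length (g z) ≡ length (h z)) → length (concatMap g zs) ≡ length (concatMap h zs)
length-concatMap [] g h len = refl
length-concatMap (z ∷ zs) g h len = trans (length-++ (g z)) (trans (cong₂ _+_ (len (here refl)) (length-concatMap zs g h (len ∘ there))) (sym (length-++ (h z))))

-- A realisation lists each moved host followed by its rows, whereas the final copy lists all moved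
-- hosts first and all rows afterwards.
unique-separate : ∀ {X Y : Set} (ps : List X) (x : X → Y) (R : X → List Y) → Unique (concatMap (λ p → x p ∷ R p) ps) → Unique (map x ps ++ concatMap R ps)
unique-separate [] x R u = []
unique-separate {X} {Y} (p ∷ ps) x R (h ∷ u) = unique-cons (λ q → lookupAll h (back q) refl) (unique-++ (unique-++⁻ˡ xs ih) (unique-++ (unique-++⁻ˡ (R p) u) (unique-++⁻ʳ xs ih) (λ { (a , b) → dis (a , later (∈-++⁺ʳ xs b)) }))
    (λ { (a , b) → case ∈-++⁻ (R p) b of λ { (inj₁ q) → dis (q , later (∈-++⁺ˡ a)) ; (inj₂ q) → unique-++-disj xs ih (a , q) } }))
  where
    xs : List Y
    xs = map x ps
    ih : Unique (xs ++ concatMap R ps)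
    ih = unique-separate ps x R (unique-++⁻ʳ (R p) u)
    dis : Disjoint (R p) (concatMap (λ p → x p ∷ R p) ps)
    dis = unique-++-disj (R p) u
    later : xs ++ concatMap R ps ⊆ concatMap (λ p → x p ∷ R p) ps
    later q with ∈-++⁻ xs q
    ... | inj₁ a with ∈-map⁻ x a
    ...   | p' , p'∈ , refl = ∈-concatMap⁺ (λ p → x p ∷ R p) (lose p'∈ (here refl))
    later q | inj₂ b with find (∈-concatMap⁻ R {xs = ps} b)
    ...   | p' , p'∈ , r = ∈-concatMap⁺ (λ p → x p ∷ R p) (lose p'∈ (there r))
    back : xs ++ (R p ++ concatMap R ps) ⊆ R p ++ concatMap (λ p → x p ∷ R p) ps
    back q with ∈-++⁻ xs q
    ... | inj₁ a = ∈-++⁺ʳ (R p) (later (∈-++⁺ˡ a))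
    ... | inj₂ b with ∈-++⁻ (R p) b
    ...   | inj₁ r = ∈-++⁺ˡ r
    ...   | inj₂ r = ∈-++⁺ʳ (R p) (later (∈-++⁺ʳ xs r))

firstRow : {X : Set} → List (List X) → List X
firstRow [] = []
firstRow (r ∷ _) = r

concatMap-map : {X Y Z : Set} (g : Y → List Z) (h : X → Y) (xs : List X) → concatMap g (map h xs) ≡ concatMap (g ∘ h) xs
concatMap-map g h [] = refl
concatMap-map g h (x ∷ xs) = cong (g (h x) ++_) (concatMap-map g h xs)

concatMap-[] : {X Y : Set} (h : X → Y) (xs : List X) → concatMap (λ x → h x ∷ []) xs ≡ map h xs
concatMap-[] h [] = refl
concatMap-[] h (x ∷ xs) = cong (h x ∷_) (concatMap-[] h xs)

module Chunks {X : Set} (d' : ℕ) where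
  d : ℕ
  d = suc d'

  chunk : ℕ → List X → List (List X)
  chunk zero l = []
  chunk (suc b) l = take d l ∷ chunk b (drop d l)

  drop⊆ : ∀ j (l : List X) → drop j l ⊆ l
  drop⊆ j l {x} h = subst (x ∈_) (take++drop≡id j l) (∈-++⁺ʳ (take j l) h)

  length-chunk : ∀ b l → length (chunk b l) ≡ b
  length-chunk zero l = refl
  length-chunk (suc b) l = cong suc (length-chunk b (drop d l))

  chunk-length : ∀ b l → b * d ≤ length l → ∀ {B} → B ∈ chunk b l → length B ≡ d
  chunk-length (suc b) l le (here refl) = length-take≤ d l (≤-trans (m≤m+n d (b * d)) le)
  chunk-length (suc b) l le (there h) = chunk-length b (drop d l) (≤-trans (+-cancelˡ-≤ d _ _ (≤-trans le (≤-trans (m≤n+m∸n (length l) d) ≤-refl))) (≤-reflexive (sym (length-drop d l)))) h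

  chunk-⊆ : ∀ b l {B} → B ∈ chunk b l → B ⊆ l
  chunk-⊆ (suc b) l (here refl) x = take⊆ d l x
  chunk-⊆ (suc b) l (there h) x = drop⊆ d l (chunk-⊆ b (drop d l) h x)

  chunk-unique : ∀ b l → Unique l → ∀ {B} → B ∈ chunk b l → Unique B
  chunk-unique (suc b) l u (here refl) = unique-take d u
  chunk-unique (suc b) l u (there h) = chunk-unique b (drop d l) (unique-drop d u) h

  take-drop-disjoint : ∀ (l : List X) → Unique l → Disjoint (take d l) (drop d l)
  take-drop-disjoint l u = unique-++-disj (take d l) (subst Unique (sym (take++drop≡id d l)) u)

  chunk-disjoint : ∀ b l → Unique l → ∀ {B B' v} → B ∈ chunk b l → B' ∈ chunk b l → v ∈ B → v ∈ B' → B ≡ B'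
  chunk-disjoint (suc b) l u (here refl) (here refl) p q = refl
  chunk-disjoint (suc b) l u (here refl) (there h) p q = ⊥-elim (take-drop-disjoint l u (p , chunk-⊆ b (drop d l) h q))
  chunk-disjoint (suc b) l u (there h) (here refl) p q = ⊥-elim (take-drop-disjoint l u (q , chunk-⊆ b (drop d l) h p))
  chunk-disjoint (suc b) l u (there h) (there h') p q = chunk-disjoint b (drop d l) (unique-drop d u) h h' p q

  chunks-unique : ∀ b l → b * d ≤ length l → Unique l → Unique (chunk b l)
  chunks-unique zero l le u = []
  chunks-unique (suc b) l le u = unique-cons (λ h → clash (take d l) refl h (length-take≤ d l (≤-trans (m≤m+n d (b * d)) le)))
      (chunks-unique b (drop d l) (≤-trans (+-cancelˡ-≤ d _ _ (≤-trans le (m≤n+m∸n (length l) d))) (≤-reflexive (sym (length-drop d l)))) (unique-drop d u))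
    where
      clash : ∀ B → B ≡ take d l → B ∈ chunk b (drop d l) → length B ≡ d → ⊥
      clash (x ∷ B) eq h _ = take-drop-disjoint l u (subst (x ∈_) eq (here refl) , chunk-⊆ b (drop d l) h (here refl))

-- The constants of the main argument.

module Constants (d K₁ : ℕ) where
  -- With |J| ≤ `K₁` k, a third of the k units worth `ℓ` each pays for 3 |J|. `L` gadgets with
  -- distinct differences give 4 ℓ + 2 values and occupy `φ` hosts. Fewer than `L` cosets of a
  -- subgroup with fewer than `ℓ` elements have at most `B` elements in all.
  ℓ L φ B : ℕ
  ℓ = 9 * K₁
  L = (4 * ℓ + 2) * (4 * ℓ + 2)
  φ = L * (2 + d)
  B = suc (L * ℓ)

  2+d≤φ : 2 + d ≤ φ
  2+d≤φ = ≤-trans (≤-reflexive (sym (*-identityˡ (2 + d)))) (*-monoˡ-≤ (2 + d) (*-mono-≤ {1} {4 * ℓ + 2} (≤-trans (s≤s z≤n) (m≤n+m 2 (4 * ℓ))) (≤-trans (s≤s z≤n) (m≤n+m 2 (4 * ℓ)))))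

square-root-≤ : ∀ {a b} → a * a ≤ b * b → a ≤ b
square-root-≤ {a} {b} h with a ≤? b
... | yes p = p
... | no ¬p = ⊥-elim (<⇒≱ (*-mono-< (≰⇒> ¬p) (≰⇒> ¬p)) h)

pad : {X : Set} (xs : List X) (x : X) {k : ℕ} → length xs ≤ k → ∃ λ ys → length ys ≡ k × xs ⊆ ys
pad xs x {k} le = xs ++ replicate (k ∸ length xs) x ,
  trans (length-++ xs) (trans (cong (length xs +_) (length-replicate (k ∸ length xs))) (trans (+-comm (length xs) _) (m∸n+n≡m le))) , ∈-++⁺ˡ

module BoundedConstants (Δ : ℕ) (1≤Δ : 1 ≤ Δ) (d K₁ : ℕ) where
  open Constants d K₁ public
  -- `Kc` bounds m / s, where s counts the free multiples of an element of large order. `X` is the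
  -- factor lost each time one of the values c x p, c x q is fixed, and `Cm` belongs to the Ramsey
  -- theorem with B² colours.
  Kc X Cm : ℕ
  Kc = K₁ * (B * d)
  X = B * ((B * B) * (B * B)) ^ d * Kc
  Cm = proj₁ (monochromatic-copy Δ 1≤Δ (B * B))

  -- The first summand feeds the gadgets collected in `small-orders`, the second the passage to few
  -- colours and the monochromatic copy.
  reserve : ℕ → ℕ
  reserve n = n * (2 + d) + (10 + d + X * X * (Cm * n))

  CA : ℕ
  CA = 1 + φ + φ + (2 + d) + (10 + d) + X * X * Cm

module MainConstants (Δ : ℕ) (1≤Δ : 1 ≤ Δ) (d K₁ : ℕ) where
  CA CB K' : ℕ
  CA = BoundedConstants.CA Δ 1≤Δ d K₁
  CB = ((5 + d) + (2 + K₁ * (suc Δ * d))) + 2 * (2 + 3 * (2 + d * d)) * K₁ + K₁ * (3 + d * d)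
  K' = 3 * d * K₁

  -- Some class of `τ` has at least 1 / K' of the vertices other than the two base points, and must
  -- leave room for `CA` and for the next stage. The summand `CB` permits an immediate change to the
  -- case of large index.
  stage : ℕ → ℕ
  stage zero = CB
  stage (suc j) = K' * (CA + stage j) + (2 + CB)

  C : ℕ
  -- The descent starts at the full group, where 3 d m ≤ K' k ≤ 2 ^ K' * k; every stage uses up one
  -- factor 2.
  C = stage K'

-- Subgroups and sumsets of finite abelian groups

-- The carrier is `Fin ord` with propositional equality, so that subsets are Boolean functions and
-- can be counted. The given group is transported here at the end.
record FinAb : Set where
  field
    ord   : ℕ
    _∙ᶠ_  : Fin ord → Fin ord → Fin ord
    εᶠ    : Fin ord
    _⁻¹ᶠ  : Fin ord → Fin ord
    isAbelianGroup : IsAbelianGroup _≡_ _∙ᶠ_ εᶠ _⁻¹ᶠ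

module Group (Γ : FinAb) where
  open FinAb Γ using (isAbelianGroup)
  open IsAbelianGroup isAbelianGroup public using (isCommutativeMonoid) renaming (assoc to ∙-assoc; comm to ∙-comm; identityˡ to ∙-idˡ; identityʳ to ∙-idʳ; inverseˡ to ∙-invˡ; inverseʳ to ∙-invʳ)
  open FinAb Γ public using () renaming (ord to m; _∙ᶠ_ to infixl 7 _∙_; εᶠ to ε; _⁻¹ᶠ to infix 8 _⁻¹)

  A : Set
  A = Fin m

  open ListSum isCommutativeMonoid public
  open CSP (CommutativeMonoid.commutativeSemigroup cMonoid) public using (interchange)

  infixr 8 _·_
  _·_ : ℕ → A → A
  zero · a = ε
  suc k · a = a ∙ k · a

  ·-+ : ∀ j k a → (j + k) · a ≡ j · a ∙ k · a
  ·-+ zero k a = sym (∙-idˡ _)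
  ·-+ (suc j) k a = trans (cong (a ∙_) (·-+ j k a)) (sym (∙-assoc _ _ _))

  ·-∙ : ∀ k a b → k · (a ∙ b) ≡ k · a ∙ k · b
  ·-∙ zero a b = sym (∙-idˡ ε)
  ·-∙ (suc k) a b = trans (cong ((a ∙ b) ∙_) (·-∙ k a b)) (interchange _ _ _ _)

  ·-* : ∀ j k a → (j * k) · a ≡ j · (k · a)
  ·-* zero k a = refl
  ·-* (suc j) k a = trans (·-+ k (j * k) a) (cong (k · a ∙_) (·-* j k a))

  ·-ε : ∀ k → k · ε ≡ ε
  ·-ε zero = refl
  ·-ε (suc k) = trans (∙-idˡ _) (·-ε k)

  ∙-cancelʳ : ∀ {a b} c → a ∙ c ≡ b ∙ c → a ≡ b
  ∙-cancelʳ {a} {b} c h = trans (sym (lem a)) (trans (cong (_∙ c ⁻¹) h) (lem b))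
    where
      lem : ∀ x → (x ∙ c) ∙ c ⁻¹ ≡ x
      lem x = trans (∙-assoc _ _ _) (trans (cong (x ∙_) (∙-invʳ c)) (∙-idʳ x))

  infixl 6 _⊕_
  infix 7 ⊖_
  data Expr (k : ℕ) : Set where
    var : Fin k → Expr k
    _⊕_ : Expr k → Expr k → Expr k
    ⊖_ : Expr k → Expr k
    𝟎 : Expr k

  v0 : ∀ {k} → Expr (1 + k)
  v0 = var fzero
  v1 : ∀ {k} → Expr (2 + k)
  v1 = var (fsuc fzero)
  v2 : ∀ {k} → Expr (3 + k)
  v2 = var (fsuc (fsuc fzero))
  v3 : ∀ {k} → Expr (4 + k)
  v3 = var (fsuc (fsuc (fsuc fzero)))
  v4 : ∀ {k} → Expr (5 + k)
  v4 = var (fsuc (fsuc (fsuc (fsuc fzero))))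
  v5 : ∀ {k} → Expr (6 + k)
  v5 = var (fsuc (fsuc (fsuc (fsuc (fsuc fzero)))))
  v6 : ∀ {k} → Expr (7 + k)
  v6 = var (fsuc (fsuc (fsuc (fsuc (fsuc (fsuc fzero))))))

  evalE : ∀ {k} → Vec A k → Expr k → A
  evalE ρ (var i) = lookup ρ i
  evalE ρ (e ⊕ f) = evalE ρ e ∙ evalE ρ f
  evalE ρ (⊖ e) = evalE ρ e ⁻¹
  evalE ρ 𝟎 = ε

  zeros : ∀ k → Vec ℕ k
  zeros zero = []ᵛ
  zeros (suc k) = 0 ∷ᵛ zeros k

  basis : ∀ {k} → Fin k → Vec ℕ k
  basis {suc k} fzero = 1 ∷ᵛ zeros k
  basis (fsuc i) = 0 ∷ᵛ basis i

  -- The value of an expression is the difference of these two combinations of the variables.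
  pos neg : ∀ {k} → Expr k → Vec ℕ k
  pos (var i) = basis i
  pos (e ⊕ f) = zipWith _+_ (pos e) (pos f)
  pos (⊖ e) = neg e
  pos 𝟎 = zeros _
  neg (var i) = zeros _
  neg (e ⊕ f) = zipWith _+_ (neg e) (neg f)
  neg (⊖ e) = pos e
  neg 𝟎 = zeros _

  combination : ∀ {k} → Vec A k → Vec ℕ k → A
  combination []ᵛ []ᵛ = ε
  combination (a ∷ᵛ ρ) (j ∷ᵛ v) = j · a ∙ combination ρ v

  combination-zeros : ∀ {k} (ρ : Vec A k) → combination ρ (zeros k) ≡ ε
  combination-zeros []ᵛ = refl
  combination-zeros (a ∷ᵛ ρ) = trans (∙-idˡ _) (combination-zeros ρ)

  combination-basis : ∀ {k} (ρ : Vec A k) i → combination ρ (basis i) ≡ lookup ρ i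
  combination-basis (a ∷ᵛ ρ) fzero = trans (cong₂ _∙_ (∙-idʳ a) (combination-zeros ρ)) (∙-idʳ a)
  combination-basis (a ∷ᵛ ρ) (fsuc i) = trans (∙-idˡ _) (combination-basis ρ i)

  combination-+ : ∀ {k} (ρ : Vec A k) u w → combination ρ (zipWith _+_ u w) ≡ combination ρ u ∙ combination ρ w
  combination-+ []ᵛ []ᵛ []ᵛ = sym (∙-idˡ ε)
  combination-+ (a ∷ᵛ ρ) (i ∷ᵛ u) (j ∷ᵛ w) = trans (cong₂ _∙_ (·-+ i j a) (combination-+ ρ u w)) (interchange _ _ _ _)

  evalE-correct : ∀ {k} (ρ : Vec A k) e → evalE ρ e ∙ combination ρ (neg e) ≡ combination ρ (pos e)
  evalE-correct ρ (var i) = trans (cong (lookup ρ i ∙_) (combination-zeros ρ)) (trans (∙-idʳ _) (sym (combination-basis ρ i)))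
  evalE-correct ρ (e ⊕ f) = trans (cong (evalE ρ e ∙ evalE ρ f ∙_) (combination-+ ρ (neg e) (neg f))) (trans (interchange _ _ _ _)
    (trans (cong₂ _∙_ (evalE-correct ρ e) (evalE-correct ρ f)) (sym (combination-+ ρ (pos e) (pos f)))))
  evalE-correct ρ (⊖ e) = trans (cong (evalE ρ e ⁻¹ ∙_) (sym (evalE-correct ρ e)))
    (trans (sym (∙-assoc _ _ _)) (trans (cong (_∙ combination ρ (neg e)) (∙-invˡ _)) (∙-idˡ _)))
  evalE-correct ρ 𝟎 = trans (∙-idˡ _) refl

  -- Equality of integer coefficients, written crosswise in natural numbers, so that for concrete
  -- expressions it is proved by `refl`.
  solveG : ∀ {k} (ρ : Vec A k) (e f : Expr k) → zipWith _+_ (pos e) (neg f) ≡ zipWith _+_ (pos f) (neg e) → evalE ρ e ≡ evalE ρ f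
  solveG ρ e f h = ∙-cancelʳ (combination ρ (neg e) ∙ combination ρ (neg f)) (begin
    evalE ρ e ∙ (combination ρ (neg e) ∙ combination ρ (neg f)) ≡⟨ sym (∙-assoc _ _ _) ⟩
    evalE ρ e ∙ combination ρ (neg e) ∙ combination ρ (neg f) ≡⟨ cong (_∙ _) (evalE-correct ρ e) ⟩
    combination ρ (pos e) ∙ combination ρ (neg f) ≡⟨ sym (combination-+ ρ (pos e) (neg f)) ⟩
    combination ρ (zipWith _+_ (pos e) (neg f)) ≡⟨ cong (combination ρ) h ⟩
    combination ρ (zipWith _+_ (pos f) (neg e)) ≡⟨ combination-+ ρ (pos f) (neg e) ⟩
    combination ρ (pos f) ∙ combination ρ (neg e) ≡⟨ cong (_∙ _) (sym (evalE-correct ρ f)) ⟩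
    evalE ρ f ∙ combination ρ (neg f) ∙ combination ρ (neg e) ≡⟨ ∙-assoc _ _ _ ⟩
    evalE ρ f ∙ (combination ρ (neg f) ∙ combination ρ (neg e)) ≡⟨ cong (evalE ρ f ∙_) (∙-comm _ _) ⟩
    evalE ρ f ∙ (combination ρ (neg e) ∙ combination ρ (neg f)) ∎)
    where open ≡-Reasoning

  ·-⁻¹ : ∀ k a → k · (a ⁻¹) ≡ (k · a) ⁻¹
  ·-⁻¹ zero a = solveG []ᵛ 𝟎 (⊖ 𝟎) refl
  ·-⁻¹ (suc k) a = trans (cong (a ⁻¹ ∙_) (·-⁻¹ k a)) (solveG (a ∷ᵛ (k · a) ∷ᵛ []ᵛ) (⊖ v0 ⊕ ⊖ v1) (⊖ (v0 ⊕ v1)) refl)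

  ∑-const : {X : Set} (xs : List X) (a : A) → ∑ xs (λ _ → a) ≡ length xs · a
  ∑-const [] a = refl
  ∑-const (x ∷ xs) a = cong (a ∙_) (∑-const xs a)

  ∑-⁻¹ : {X : Set} (xs : List X) (f : X → A) → ∑ xs (λ x → f x ⁻¹) ≡ ∑ xs f ⁻¹
  ∑-⁻¹ [] f = solveG []ᵛ 𝟎 (⊖ 𝟎) refl
  ∑-⁻¹ (x ∷ xs) f = trans (cong (f x ⁻¹ ∙_) (∑-⁻¹ xs f)) (solveG (f x ∷ᵛ ∑ xs f ∷ᵛ []ᵛ) (⊖ v0 ⊕ ⊖ v1) (⊖ (v0 ⊕ v1)) refl)

  module Shift {B : Set} {_+'_ : B → B → B} {o : B} (cm : IsCommutativeMonoid _≡_ _+'_ o) where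
    module S = ListSum cm
    -- Translation is a bijection: each `f (g ∙ e)` is written as a sum over k supported at k = g ∙
    -- e, and the two sums are exchanged.
    shift : ∀ (f : A → B) e → S.∑ (allFin m) (λ g → f (g ∙ e)) ≡ S.∑ (allFin m) f
    shift f e = begin
      S.∑ U (λ g → f (g ∙ e)) ≡⟨ S.∑-cong U (λ {g} _ → sym (S.∑-single U (g ∙ e) f (allFin⁺ m) (∈-allFin _))) ⟩
      S.∑ U (λ g → S.∑ U (λ k → if does (k ≟ g ∙ e) then f k else o)) ≡⟨ S.∑-swap U U _ ⟩
      S.∑ U (λ k → S.∑ U (λ g → if does (k ≟ g ∙ e) then f k else o)) ≡⟨ S.∑-cong U (λ {k} _ → S.∑-cong U (λ {g} _ → swapif k g)) ⟩
      S.∑ U (λ k → S.∑ U (λ g → if does (g ≟ k ∙ e ⁻¹) then f k else o)) ≡⟨ S.∑-cong U (λ {k} _ → S.∑-single U (k ∙ e ⁻¹) (λ _ → f k) (allFin⁺ m) (∈-allFin _)) ⟩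
      S.∑ U f ∎
      where
        open ≡-Reasoning
        U = allFin m
        swapif : ∀ k g → (if does (k ≟ g ∙ e) then f k else o) ≡ (if does (g ≟ k ∙ e ⁻¹) then f k else o)
        swapif k g with k ≟ g ∙ e | g ≟ k ∙ e ⁻¹
        ... | yes _ | yes _ = refl
        ... | no _ | no _ = refl
        ... | yes refl | no ¬p = ⊥-elim (¬p (solveG (g ∷ᵛ e ∷ᵛ []ᵛ) v0 (v0 ⊕ v1 ⊕ ⊖ v1) refl))
        ... | no ¬p | yes refl = ⊥-elim (¬p (solveG (k ∷ᵛ e ∷ᵛ []ᵛ) v0 (v0 ⊕ ⊖ v1 ⊕ v1) refl))

  -- Adding `a` to every element permutes the group and hence preserves the sum of all elements.
  order-annihilates : ∀ a → m · a ≡ ε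
  order-annihilates a = ∙-cancelʳ (∑ (allFin m) id) (begin
    m · a ∙ ∑ (allFin m) id ≡⟨ cong (λ j → j · a ∙ ∑ (allFin m) id) (sym (length-tabulate {n = m} id)) ⟩
    length (allFin m) · a ∙ ∑ (allFin m) id ≡⟨ ∙-comm _ _ ⟩
    ∑ (allFin m) id ∙ length (allFin m) · a ≡⟨ cong (∑ (allFin m) id ∙_) (sym (∑-const (allFin m) a)) ⟩
    ∑ (allFin m) id ∙ ∑ (allFin m) (λ _ → a) ≡⟨ sym (∑-∙ (allFin m) id (λ _ → a)) ⟩
    ∑ (allFin m) (λ x → x ∙ a) ≡⟨ Shift.shift isCommutativeMonoid id a ⟩
    ∑ (allFin m) id ≡⟨ sym (∙-idˡ _) ⟩
    ε ∙ ∑ (allFin m) id ∎)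
    where open ≡-Reasoning

  ∣⇒annihilates : ∀ {k} a → m ∣ k → k · a ≡ ε
  ∣⇒annihilates a (divides q refl) = trans (·-* q m a) (trans (cong (q ·_) (order-annihilates a)) (·-ε q))

  -- Subgroups, their sizes, and stabilizers of sets.

  record Sub : Set where
    field
      mem : A → Bool
      mem-ε : mem ε ≡ true
      mem-∙ : ∀ {a b} → mem a ≡ true → mem b ≡ true → mem (a ∙ b) ≡ true
  open Sub public

  infix 4 _∈ₛ_ _⊆ₛ_
  _∈ₛ_ : A → Sub → Set
  a ∈ₛ H = mem H a ≡ true

  _⊆ₛ_ : Sub → Sub → Set
  H ⊆ₛ J = ∀ {a} → a ∈ₛ H → a ∈ₛ J

  mem-· : ∀ H k {a} → a ∈ₛ H → k · a ∈ₛ H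
  mem-· H zero h = mem-ε H
  mem-· H (suc k) h = mem-∙ H h (mem-· H k h)

  -- In a finite group the inverse of `a` is the multiple (m - 1) · a.
  mem-⁻¹ : ∀ H {a} → a ∈ₛ H → a ⁻¹ ∈ₛ H
  mem-⁻¹ H {a} h = subst (_∈ₛ H) (lem m (order-annihilates a) ε) (mem-· H (pred m) h)
    where
      lem : ∀ k → k · a ≡ ε → Fin k → pred k · a ≡ a ⁻¹
      lem (suc k) eq _ = ∙-cancelʳ a (trans (∙-comm _ _) (trans eq (sym (∙-invˡ a))))

  mem-∙⁻¹ : ∀ H {a b} → a ∈ₛ H → b ∈ₛ H → a ∙ b ⁻¹ ∈ₛ H
  mem-∙⁻¹ H h k = mem-∙ H h (mem-⁻¹ H k)

  mem-∑ : ∀ H {X : Set} (xs : List X) {f : X → A} → (∀ {x} → x ∈ xs → f x ∈ₛ H) → ∑ xs f ∈ₛ H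
  mem-∑ H [] h = mem-ε H
  mem-∑ H (x ∷ xs) h = mem-∙ H (h (here refl)) (mem-∑ H xs (h ∘ there))

  full trivial : Sub
  full = record { mem = λ _ → true ; mem-ε = refl ; mem-∙ = λ _ _ → refl }
  trivial = record { mem = λ a → does (a ≟ ε) ; mem-ε = lem ; mem-∙ = λ {a} {b} → lem2 a b }
    where
      lem : does (ε ≟ ε) ≡ true
      lem with ε ≟ ε
      ... | yes _ = refl
      ... | no ¬p = ⊥-elim (¬p refl)
      lem2 : ∀ a b → does (a ≟ ε) ≡ true → does (b ≟ ε) ≡ true → does (a ∙ b ≟ ε) ≡ true
      lem2 a b p q with a ≟ ε | b ≟ ε | a ∙ b ≟ ε
      ... | yes refl | yes refl | yes _ = refl
      ... | yes refl | yes refl | no ¬p = ⊥-elim (¬p (∙-idˡ ε))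

  ∈-trivial : ∀ {a} → a ∈ₛ trivial → a ≡ ε
  ∈-trivial {a} h with a ≟ ε
  ... | yes p = p

  size : (A → Bool) → ℕ
  size P = sumN (allFin m) (b2n ∘ P)

  size-⊆ : ∀ {P Q : A → Bool} → (∀ g → P g ≡ true → Q g ≡ true) → size P ≤ size Q
  size-⊆ {P} {Q} h = sumN-mono (allFin m) (λ {g} _ → lem (P g) (Q g) (h g))
    where
      lem : ∀ a b → (a ≡ true → b ≡ true) → b2n a ≤ b2n b
      lem false b h = z≤n
      lem true b h rewrite h refl = ≤-refl

  size-shift : ∀ (P : A → Bool) e → size (λ g → P (g ∙ e)) ≡ size P
  size-shift P e = Shift.shift +-0-isCommutativeMonoid (b2n ∘ P) e

  size≤m : ∀ P → size P ≤ m
  size≤m P = ≤-trans (sumN-bound (allFin m) 1 (λ {g} _ → lem (P g))) (≤-reflexive (trans (*-identityʳ _) (length-tabulate id)))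
    where
      lem : ∀ b → b2n b ≤ 1
      lem true = ≤-refl
      lem false = z≤n

  size>0 : ∀ {P g} → P g ≡ true → 1 ≤ size P
  size>0 {P} {g} h = ≤-trans (≤-reflexive (cong b2n (sym h))) (sumN-member (b2n ∘ P) (∈-allFin g))

  size-reflect : ∀ P a → size (λ g → P (a ∙ g ⁻¹)) ≡ size P
  size-reflect P a = begin
      sumN U (λ g → b2n (P (a ∙ g ⁻¹))) ≡⟨ sumN-cong U (λ {g} _ → sym (sumN-single U (a ∙ g ⁻¹) (b2n ∘ P) (allFin⁺ m) (∈-allFin _))) ⟩
      sumN U (λ g → sumN U (λ k → if does (k ≟ a ∙ g ⁻¹) then b2n (P k) else 0)) ≡⟨ sumN-swap U U _ ⟩
      sumN U (λ k → sumN U (λ g → if does (k ≟ a ∙ g ⁻¹) then b2n (P k) else 0)) ≡⟨ sumN-cong U (λ {k} _ → sumN-cong U (λ {g} _ → swapif k g)) ⟩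
      sumN U (λ k → sumN U (λ g → if does (g ≟ a ∙ k ⁻¹) then b2n (P k) else 0)) ≡⟨ sumN-cong U (λ {k} _ → sumN-single U (a ∙ k ⁻¹) (λ _ → b2n (P k)) (allFin⁺ m) (∈-allFin _)) ⟩
      sumN U (b2n ∘ P) ∎
      where
        open ≡-Reasoning
        U = allFin m
        swapif : ∀ k g → (if does (k ≟ a ∙ g ⁻¹) then b2n (P k) else 0) ≡ (if does (g ≟ a ∙ k ⁻¹) then b2n (P k) else 0)
        swapif k g with k ≟ a ∙ g ⁻¹ | g ≟ a ∙ k ⁻¹
        ... | yes _ | yes _ = refl
        ... | no _ | no _ = refl
        ... | yes refl | no ¬p = ⊥-elim (¬p (solveG (a ∷ᵛ g ∷ᵛ []ᵛ) v1 (v0 ⊕ ⊖ (v0 ⊕ ⊖ v1)) refl))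
        ... | no ¬p | yes refl = ⊥-elim (¬p (solveG (a ∷ᵛ k ∷ᵛ []ᵛ) v1 (v0 ⊕ ⊖ (v0 ⊕ ⊖ v1)) refl))

  ⊆ₛ-or-witness : ∀ H J → H ⊆ₛ J ⊎ ∃ λ g → g ∈ₛ H × mem J g ≡ false
  ⊆ₛ-or-witness H J with any? (λ g → (mem H g ≟ᵇ true) ×-dec (mem J g ≟ᵇ false))
  ... | yes w = inj₂ w
  ... | no ¬w = inj₁ (λ {a} h → lem a h (bool (mem J a)))
    where
      lem : ∀ a → a ∈ₛ H → _ → a ∈ₛ J
      lem a h (inj₁ p) = p
      lem a h (inj₂ p) = ⊥-elim (¬w (a , h , p))

  -- `H` and its translate by `g` are disjoint subsets of `J`. Every strict step of a descent
  -- therefore halves the subgroup at least.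
  lagrange₂ : ∀ {H J g} → H ⊆ₛ J → g ∈ₛ J → mem H g ≡ false → 2 * size (mem H) ≤ size (mem J)
  lagrange₂ {H} {J} {g} H⊆J gJ gH = begin
    size (mem H) + (size (mem H) + 0) ≡⟨ cong (size (mem H) +_) (trans (+-identityʳ _) (sym (size-shift (mem H) (g ⁻¹)))) ⟩
    size (mem H) + size (λ a → mem H (a ∙ g ⁻¹)) ≡⟨ sym (sumN-+ (allFin m) _ _) ⟩
    sumN (allFin m) (λ a → b2n (mem H a) + b2n (mem H (a ∙ g ⁻¹))) ≤⟨ sumN-mono (allFin m) (λ {a} _ → lem a) ⟩
    size (mem J) ∎
    where
      open ≤-Reasoning
      b≤ : ∀ {b} → b ≡ true → 1 ≤ b2n b
      b≤ refl = ≤-refl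
      lem : ∀ a → b2n (mem H a) + b2n (mem H (a ∙ g ⁻¹)) ≤ b2n (mem J a)
      lem a with mem H a in p | mem H (a ∙ g ⁻¹) in q
      ... | false | false = z≤n
      ... | true | false = b≤ (H⊆J p)
      ... | false | true = b≤ (subst (_∈ₛ J) (solveG (a ∷ᵛ g ∷ᵛ []ᵛ) (v0 ⊕ ⊖ v1 ⊕ v1) v0 refl) (mem-∙ J (H⊆J q) gJ))
      ... | true | true = ⊥-elim (T⇒F⇒⊥ (subst (_∈ₛ H) (solveG (a ∷ᵛ g ∷ᵛ []ᵛ) (v0 ⊕ ⊖ (v0 ⊕ ⊖ v1)) v1 refl) (mem-∙⁻¹ H p q)) gH)

  Invariant : (A → Bool) → Sub → Set
  Invariant X H = ∀ {x h} → X x ≡ true → h ∈ₛ H → X (x ∙ h) ≡ true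

  size-invariant : ∀ {X H x} → Invariant X H → X x ≡ true → size (mem H) ≤ size X
  size-invariant {X} {H} {x} inv Xx = ≤-trans (≤-reflexive (sym (size-shift (mem H) (x ⁻¹))))
    (size-⊆ (λ g h → subst (λ z → X z ≡ true) (solveG (x ∷ᵛ g ∷ᵛ []ᵛ) (v0 ⊕ (v1 ⊕ ⊖ v0)) v1 refl) (inv Xx h)))

  stabilizes? : (X : A → Bool) (g : A) → Dec (∀ x → X x ≡ true → X (x ∙ g) ≡ true)
  stabilizes? X g = all? (λ x → (X x ≟ᵇ true) →-dec (X (x ∙ g) ≟ᵇ true))

  stabilizer : (A → Bool) → Sub
  stabilizer X = record
    { mem = λ g → does (stabilizes? X g)
    ; mem-ε = does⁺ (stabilizes? X ε) (λ x Xx → subst (λ z → X z ≡ true) (sym (∙-idʳ x)) Xx)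
    ; mem-∙ = λ {a} {b} p q → does⁺ (stabilizes? X (a ∙ b)) (λ x Xx → subst (λ z → X z ≡ true) (∙-assoc x a b) (does⁻ (stabilizes? X b) q _ (does⁻ (stabilizes? X a) p x Xx))) }

  module _ {X : A → Bool} where
    stabilizer-sound : ∀ {g x} → g ∈ₛ stabilizer X → X x ≡ true → X (x ∙ g) ≡ true
    stabilizer-sound {g} {x} h = does⁻ (stabilizes? X g) h x

    stabilizer-complete : ∀ {g} → (∀ {x} → X x ≡ true → X (x ∙ g) ≡ true) → g ∈ₛ stabilizer X
    stabilizer-complete {g} p = does⁺ (stabilizes? X g) (λ x → p)

  -- A weak form of Kneser's theorem: the bound |X| + |Y| - |K| is asserted for a K-periodic part of
  -- the sumset, which suffices since its elements only have to be attainable.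
  record PeriodicPart (X Y : A → Bool) (H : Sub) : Set where
    field
      K : Sub
      Z : A → Bool
      H⊆K : H ⊆ₛ K
      Z-inv : Invariant Z K
      Z-point : ∃ λ z → Z z ≡ true
      Z⊆X+Y : ∀ {g} → Z g ≡ true → ∃₂ λ x y → X x ≡ true × Y y ≡ true × g ≡ x ∙ y
      large : size X + size Y ≤ size Z + size (mem K)

  ∨-elim : ∀ {a b} → a ∨ b ≡ true → a ≡ true ⊎ b ≡ true
  ∨-elim {true} h = inj₁ refl
  ∨-elim {false} h = inj₂ h
  ∨-introˡ : ∀ {a b} → a ≡ true → a ∨ b ≡ true
  ∨-introˡ refl = refl
  ∨-introʳ : ∀ {a b} → b ≡ true → a ∨ b ≡ true
  ∨-introʳ {true} h = refl
  ∨-introʳ {false} h = h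
  ∧-elimˡ : ∀ {a b} → a ∧ b ≡ true → a ≡ true
  ∧-elimˡ {true} h = refl
  ∧-elimʳ : ∀ {a b} → a ∧ b ≡ true → b ≡ true
  ∧-elimʳ {true} h = h
  ∧-intro : ∀ {a b} → a ≡ true → b ≡ true → a ∧ b ≡ true
  ∧-intro refl refl = refl

  -- Dyson's transform: replace (X , Y) by (X ∪ (Y + e) , Y ∩ (X − e)) for some e ∈ X as long as this shrinks Y.
  -- When it no longer does, X + Y ⊆ X, so that Y lies in the stabilizer of X.
  abstract
    dyson : ∀ (fuel : ℕ) (X Y : A → Bool) (H : Sub) {x₀ : A} → size Y ≤ fuel → Invariant X H → Invariant Y H → X x₀ ≡ true → Y ε ≡ true → PeriodicPart X Y H
    dyson zero X Y H le iX iY Xx Yε = ⊥-elim (<⇒≱ (size>0 Yε) le)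
    dyson (suc fuel) X Y H {x₀} le iX iY Xx Yε
      with any? (λ e → any? (λ y → (X e ≟ᵇ true) ×-dec (Y y ≟ᵇ true) ×-dec (X (e ∙ y) ≟ᵇ false)))
    ... | no none = record
      { K = stabilizer X ; Z = X
      ; H⊆K = λ h → stabilizer-complete {X} (λ Xx → iX Xx h)
      ; Z-inv = λ Xx h → stabilizer-sound {X} h Xx
      ; Z-point = x₀ , Xx
      ; Z⊆X+Y = λ {g} Xg → g , ε , Xg , Yε , sym (∙-idʳ g)
      ; large = +-monoʳ-≤ (size X) (size-⊆ (λ y Yy → stabilizer-complete {X} (λ {x} Xx → lem x y Xx Yy (bool (X (x ∙ y)))))) }
      where
        lem : ∀ x y → X x ≡ true → Y y ≡ true → X (x ∙ y) ≡ true ⊎ X (x ∙ y) ≡ false → X (x ∙ y) ≡ true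
        lem x y Xx Yy (inj₁ h) = h
        lem x y Xx Yy (inj₂ h) = ⊥-elim (none (x , y , Xx , Yy , h))
    ... | yes (e , y , Xe , Yy , Xey) = record
      { K = P.K ; Z = P.Z ; H⊆K = P.H⊆K ; Z-inv = P.Z-inv ; Z-point = P.Z-point
      ; Z⊆X+Y = λ Zg → conv (P.Z⊆X+Y Zg)
      ; large = ≤-trans (≤-reflexive (sym sizes)) P.large }
      where
        X₁ Y₁ Y₂ : A → Bool
        Y₂ g = Y (g ∙ e ⁻¹)
        X₁ g = X g ∨ Y₂ g
        Y₁ g = Y g ∧ X (g ∙ e)
        swap : ∀ a b c → a ∙ b ∙ c ≡ a ∙ c ∙ b
        swap a b c = solveG (a ∷ᵛ b ∷ᵛ c ∷ᵛ []ᵛ) (v0 ⊕ v1 ⊕ v2) (v0 ⊕ v2 ⊕ v1) refl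
        iX₁ : Invariant X₁ H
        iX₁ {x} {h} p Hh with ∨-elim {X x} p
        ... | inj₁ q = ∨-introˡ (iX q Hh)
        ... | inj₂ q = ∨-introʳ {X (x ∙ h)} (subst (λ z → Y z ≡ true) (swap x (e ⁻¹) h) (iY q Hh))
        iY₁ : Invariant Y₁ H
        iY₁ {x} {h} p Hh = ∧-intro (iY (∧-elimˡ p) Hh) (subst (λ z → X z ≡ true) (swap x e h) (iX (∧-elimʳ {Y x} p) Hh))
        Y₁ε : Y₁ ε ≡ true
        Y₁ε = ∧-intro Yε (subst (λ z → X z ≡ true) (sym (∙-idˡ e)) Xe)
        -- `y` drops out, as `e ∙ y` is not in `X`.
        shrinks : size Y₁ < size Y
        shrinks = begin-strict
          size Y₁ <⟨ ≤-refl ⟩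
          1 + size Y₁ ≤⟨ +-monoˡ-≤ (size Y₁) (size>0 {λ g → Y g ∧ not (X (g ∙ e))} {y} (∧-intro Yy (cong not (trans (cong X (∙-comm y e)) Xey)))) ⟩
          size (λ g → Y g ∧ not (X (g ∙ e))) + size Y₁ ≡⟨ sym (sumN-+ (allFin m) _ _) ⟩
          sumN (allFin m) (λ g → b2n (Y g ∧ not (X (g ∙ e))) + b2n (Y₁ g)) ≤⟨ sumN-mono (allFin m) (λ {g} _ → lem (Y g) (X (g ∙ e))) ⟩
          size Y ∎
          where
            open ≤-Reasoning
            lem : ∀ a b → b2n (a ∧ not b) + b2n (a ∧ b) ≤ b2n a
            lem true true = ≤-refl
            lem true false = ≤-refl
            lem false b = z≤n
        sizes : size X₁ + size Y₁ ≡ size X + size Y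
        sizes = begin
          size X₁ + size Y₁ ≡⟨ cong (size X₁ +_) (sym (size-shift Y₁ (e ⁻¹))) ⟩
          size X₁ + size (λ g → Y₁ (g ∙ e ⁻¹)) ≡⟨ cong (size X₁ +_) (sumN-cong (allFin m) (λ {g} _ → cong (λ z → b2n (Y₂ g ∧ X z)) (solveG (g ∷ᵛ e ∷ᵛ []ᵛ) (v0 ⊕ ⊖ v1 ⊕ v1) v0 refl))) ⟩
          size X₁ + size (λ g → Y₂ g ∧ X g) ≡⟨ sym (sumN-+ (allFin m) _ _) ⟩
          sumN (allFin m) (λ g → b2n (X₁ g) + b2n (Y₂ g ∧ X g)) ≡⟨ sumN-cong (allFin m) (λ {g} _ → lem (X g) (Y₂ g)) ⟩
          sumN (allFin m) (λ g → b2n (X g) + b2n (Y₂ g)) ≡⟨ sumN-+ (allFin m) _ _ ⟩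
          size X + size Y₂ ≡⟨ cong (size X +_) (size-shift Y (e ⁻¹)) ⟩
          size X + size Y ∎
          where
            open ≡-Reasoning
            lem : ∀ a b → b2n (a ∨ b) + b2n (b ∧ a) ≡ b2n a + b2n b
            lem true true = refl
            lem true false = refl
            lem false true = refl
            lem false false = refl
        module P = PeriodicPart (dyson fuel X₁ Y₁ H {x₀} (≤-pred (≤-trans shrinks le)) iX₁ iY₁ (∨-introˡ Xx) Y₁ε)
        conv : ∀ {g} → (∃₂ λ x y → X₁ x ≡ true × Y₁ y ≡ true × g ≡ x ∙ y) → ∃₂ λ x y → X x ≡ true × Y y ≡ true × g ≡ x ∙ y
        conv {g} (x , y , p , q , eq) with ∨-elim {X x} p
        ... | inj₁ Xx = x , y , Xx , ∧-elimˡ q , eq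
        -- The element `e` changes sides: `y ∙ e` lies in `X` and `x ∙ e ⁻¹` in `Y`.
        ... | inj₂ Y₂x = y ∙ e , x ∙ e ⁻¹ , ∧-elimʳ {Y y} q , Y₂x , trans eq (solveG (x ∷ᵛ y ∷ᵛ e ∷ᵛ []ᵛ) (v0 ⊕ v1) (v1 ⊕ v2 ⊕ (v0 ⊕ ⊖ v2)) refl)

  -- A unit consumes an index and fixes a label; its options then place the label on certain vertices.
  module Process {t : ℕ} {Idx Lab Opt : Set} (verts : Lab → Opt → List (Fin t)) (Valid : Lab → Opt → Set)
    (val : Lab → Opt → A) (Order : List Lab → List Idx → Set) where

    -- One set `F` of hosts serves whichever value is wanted later, so that further units can avoid
    -- it before the options are chosen.
    record Real (ls : List Lab) (F : List (Fin t)) (g : A) : Set where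
      field
        choice : List (Lab × Opt)
        indices : map proj₁ choice ≡ ls
        valid : All (λ p → Valid (proj₁ p) (proj₂ p)) choice
        distinct : Unique (concatMap (λ p → verts (proj₁ p) (proj₂ p)) choice)
        within : concatMap (λ p → verts (proj₁ p) (proj₂ p)) choice ⊆ F
        total : ∑ choice (λ p → val (proj₁ p) (proj₂ p)) ≡ g

    real-∷ : ∀ {ls F F' g i o} → Valid i o → Unique (verts i o) → verts i o ⊆ F' → Disjoint F' F → Real ls F g → Real (i ∷ ls) (F' ++ F) (val i o ∙ g)
    real-∷ {F = F} {F' = F'} {i = i} {o} vo uo o⊆ dis r = record
      { choice = (i , o) ∷ R.choice
      ; indices = cong (i ∷_) R.indices
      ; valid = vo ∷ R.valid
      ; distinct = unique-++ uo R.distinct (λ { (p , q) → dis (o⊆ p , R.within q) })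
      ; within = λ z∈ → case ∈-++⁻ (verts i o) z∈ of λ { (inj₁ p) → ∈-++⁺ˡ (o⊆ p) ; (inj₂ q) → ∈-++⁺ʳ F' (R.within q) }
      ; total = cong (val i o ∙_) R.total }
      where module R = Real r

    record Unit (J : Sub) (φ : ℕ) (F : List (Fin t)) (i : Idx) : Set where
      field
        label : Lab
        advance : ∀ {ls is} → Order ls (i ∷ is) → Order (label ∷ ls) is
        o₀ : Opt
        os : List Opt
        F' : List (Fin t)
        F'-size : length F' ≤ φ
        F'-disjoint : Disjoint F' F
        ok : ∀ {o} → o ∈ o₀ ∷ os → Valid label o × Unique (verts label o) × verts label o ⊆ F'
        diff : ∀ {o} → o ∈ o₀ ∷ os → val label o ∙ val label o₀ ⁻¹ ∈ₛ J

      saturated? : ∀ (H : Sub) g → Dec (Any (λ o → g ∙ (val label o ∙ val label o₀ ⁻¹) ⁻¹ ∈ₛ H) (o₀ ∷ os))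
      saturated? H g = anyL? (λ o → mem H (g ∙ (val label o ∙ val label o₀ ⁻¹) ⁻¹) ≟ᵇ true) (o₀ ∷ os)

      -- The values of the unit relative to `o₀`, filled up to whole cosets of `H`. Filling up costs
      -- nothing, because the set attained before is already invariant under `H`.
      saturation : Sub → A → Bool
      saturation H g = does (saturated? H g)

      saturation-sound : ∀ {H g} → saturation H g ≡ true → ∃ λ o → o ∈ o₀ ∷ os × g ∙ (val label o ∙ val label o₀ ⁻¹) ⁻¹ ∈ₛ H
      saturation-sound {H} {g} h = find (does⁻ (saturated? H g) h)

      saturation-complete : ∀ {H g o} → o ∈ o₀ ∷ os → g ∙ (val label o ∙ val label o₀ ⁻¹) ⁻¹ ∈ₛ H → saturation H g ≡ true
      saturation-complete {H} {g} o∈ h = does⁺ (saturated? H g) (lose o∈ h)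

    -- `s` collects the values of the base options, so that `X` stays inside `J` although the values
    -- themselves need not lie there. `H` is the subgroup covered so far.
    record State (J : Sub) (φ z : ℕ) (is : List Idx) : Set where
      field
        done : List Lab
        order : Order done is
        H : Sub
        X : A → Bool
        F : List (Fin t)
        s x₀ : A
        F-size : length F ≤ length done * φ + z
        H⊆J : H ⊆ₛ J
        X⊆J : ∀ {x} → X x ≡ true → x ∈ₛ J
        X-inv : Invariant X H
        X-point : X x₀ ≡ true
        real : ∀ {x} → X x ≡ true → Real done F (s ∙ x)

    module _ {J : Sub} {φ z : ℕ} where

      abstract
        -- `dyson` is applied to `X` and the saturated values of the unit, and its period becomes
        -- the new `H`. To realise x ∙ y, the part of y lying in `H` is passed back to the earlier
        -- units.
        step : ∀ {i is} (S : State J φ z (i ∷ is)) (u : Unit J φ (State.F S) i) →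
          Σ (State J φ z is) λ S' → State.H S ⊆ₛ State.H S' ×
            size (State.X S) + size (Unit.saturation u (State.H S)) ≤ size (State.X S') + size (mem (State.H S'))
        step {i} {is} S u = record
          { done = label ∷ done ; order = advance order ; H = P.K ; X = P.Z ; F = F' ++ F ; s = s ∙ val label o₀ ; x₀ = proj₁ P.Z-point
          ; F-size = ≤-trans (≤-reflexive (length-++ F')) (≤-trans (+-mono-≤ F'-size F-size) (≤-reflexive (sym (+-assoc φ _ z))))
          ; H⊆J = λ {a} h → subst (_∈ₛ J) (solveG (proj₁ P.Z-point ∷ᵛ a ∷ᵛ []ᵛ) (v0 ⊕ v1 ⊕ ⊖ v0) v1 refl)
              (mem-∙⁻¹ J (Z⊆J (P.Z-inv (proj₂ P.Z-point) h)) (Z⊆J (proj₂ P.Z-point)))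
          ; X⊆J = Z⊆J ; X-inv = P.Z-inv ; X-point = proj₂ P.Z-point
          ; real = λ Zg → real' (P.Z⊆X+Y Zg) } , P.H⊆K , P.large
          where
            open State S
            open Unit u
            Y : A → Bool
            Y = saturation H
            iY : Invariant Y H
            iY {x} {h} p Hh with saturation-sound {H} p
            ... | o , o∈ , q = saturation-complete {H} o∈ (subst (_∈ₛ H) (solveG (x ∷ᵛ (val label o ∙ val label o₀ ⁻¹) ∷ᵛ h ∷ᵛ []ᵛ) (v0 ⊕ ⊖ v1 ⊕ v2) (v0 ⊕ v2 ⊕ ⊖ v1) refl) (mem-∙ H q Hh))
            Yε : Y ε ≡ true
            Yε = saturation-complete {H} {ε} (here refl) (subst (_∈ₛ H) (solveG (val label o₀ ∷ᵛ []ᵛ) 𝟎 (𝟎 ⊕ ⊖ (v0 ⊕ ⊖ v0)) refl) (mem-ε H))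
            module P = PeriodicPart (dyson (size Y) X Y H ≤-refl X-inv iY X-point Yε)
            Y⊆J : ∀ {y} → Y y ≡ true → y ∈ₛ J
            Y⊆J {y} p with saturation-sound {H} p
            ... | o , o∈ , q = subst (_∈ₛ J) (solveG (y ∷ᵛ (val label o ∙ val label o₀ ⁻¹) ∷ᵛ []ᵛ) (v0 ⊕ ⊖ v1 ⊕ v1) v0 refl) (mem-∙ J (H⊆J q) (diff o∈))
            Z⊆J : ∀ {g} → P.Z g ≡ true → g ∈ₛ J
            Z⊆J {g} p with P.Z⊆X+Y p
            ... | x , y , Xx , Yy , eq = subst (_∈ₛ J) (sym eq) (mem-∙ J (X⊆J Xx) (Y⊆J Yy))
            real' : ∀ {g} → (∃₂ λ x y → X x ≡ true × Y y ≡ true × g ≡ x ∙ y) → Real (label ∷ done) (F' ++ F) (s ∙ val label o₀ ∙ g)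
            real' {g} (x , y , Xx , Yy , refl) with saturation-sound {H} Yy
            ... | o , o∈ , q with ok o∈
            ...   | vo , uo , o⊆ = subst (Real (label ∷ done) (F' ++ F))
                    (solveG (val label o ∷ᵛ val label o₀ ∷ᵛ s ∷ᵛ x ∷ᵛ y ∷ᵛ []ᵛ) (v0 ⊕ (v2 ⊕ (v3 ⊕ (v4 ⊕ ⊖ (v0 ⊕ ⊖ v1))))) (v2 ⊕ v1 ⊕ (v3 ⊕ v4)) refl)
                    (real-∷ vo uo o⊆ F'-disjoint (real (X-inv Xx q)))

      -- Put p = (β + 1)(l + 1); the target is p h'' - l h''. From 2 j ≤ p h and 2 h ≤ h'' follows 3
      -- j ≤ (3 / 4) p h'', and 4 l h ≤ j gives 8 l ≤ p, so the loss of l h'' is affordable.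
      jump-bound : ∀ {j β l h h''} → 1 ≤ h → 2 * j ≤ suc β * (suc l * h) → 4 * (l * h) ≤ j → 2 * h ≤ h'' → 3 * j ≤ β * (suc l * h'') + h''
      jump-bound {j} {β} {l} {suc h'} {h''} _ a b c = *-cancelˡ-≤ 8 (+-cancelʳ-≤ (8 * (l * h'')) _ _ (begin
        8 * (3 * j) + 8 * (l * h'') ≤⟨ +-mono-≤ {8 * (3 * j)} {7 * (p * h'')} e1 e2 ⟩
        7 * (p * h'') + p * h'' ≡⟨ eq β l h'' ⟩
        8 * (β * (suc l * h'') + h'') + 8 * (l * h'') ∎))
        where
          open ≤-Reasoning
          h = suc h'
          p = suc β * suc l
          eq : ∀ β l h'' → 7 * (suc β * suc l * h'') + suc β * suc l * h'' ≡ 8 * (β * (suc l * h'') + h'') + 8 * (l * h'')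
          eq = solve-∀
          a' : 2 * j ≤ p * h
          a' = ≤-trans a (≤-reflexive (sym (*-assoc (suc β) (suc l) h)))
          e1 : 8 * (3 * j) ≤ 7 * (p * h'')
          e1 = begin
            8 * (3 * j) ≤⟨ slack (4 * j) (eq1 j) ⟩
            14 * (2 * j) ≤⟨ *-monoʳ-≤ 14 a' ⟩
            14 * (p * h) ≡⟨ eq2 p h ⟩
            7 * (p * (2 * h)) ≤⟨ *-monoʳ-≤ 7 (*-monoʳ-≤ p c) ⟩
            7 * (p * h'') ∎
            where
              eq1 : ∀ j → 8 * (3 * j) + 4 * j ≡ 14 * (2 * j)
              eq1 = solve-∀
              eq2 : ∀ p h → 14 * (p * h) ≡ 7 * (p * (2 * h))
              eq2 = solve-∀
          8l≤p : 8 * l ≤ p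
          8l≤p = *-cancelʳ-≤ (8 * l) p h (begin
            8 * l * h ≡⟨ eq3 l h ⟩
            2 * (4 * (l * h)) ≤⟨ *-monoʳ-≤ 2 b ⟩
            2 * j ≤⟨ a' ⟩
            p * h ∎)
            where
              eq3 : ∀ l h → 8 * l * h ≡ 2 * (4 * (l * h))
              eq3 = solve-∀
          e2 : 8 * (l * h'') ≤ p * h''
          e2 = ≤-trans (≤-reflexive (sym (*-assoc 8 l h''))) (*-monoˡ-≤ h'' 8l≤p)

      Covered : List Idx → (K : ℕ) → Set
      Covered is K = Σ (State J φ z is) λ S → J ⊆ₛ State.H S ⊎ K ≤ size (mem (State.H S))

      module _ (l K : ℕ) (oracle : ∀ i is (S : State J φ z (i ∷ is)) → ∀ {g} → g ∈ₛ J → mem (State.H S) g ≡ false → size (mem (State.H S)) < K →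
                ((u : Unit J φ (State.F S) i) → (2 + l) * size (mem (State.H S)) ≤ size (Unit.saturation u (State.H S)) →
                  4 * (l * size (mem (State.H S))) ≤ size (mem J) → ⊥) → ⊥) where

        -- With β = |is| − r, the potential β (l + 1) |H| + |X| never drops below 3 |J|: a unit either enlarges X by (l + 1) |H| or at least doubles H.
        run : ∀ r β is (S : State J φ z is) → length is ≡ β + r → 3 * size (mem J) ≤ β * (suc l * size (mem (State.H S))) + size (State.X S) →
          (∀ is' → r ≤ length is' → Covered is' K → ⊥) → ⊥
        run r β is S len potential k with ⊆ₛ-or-witness J (State.H S)
        ... | inj₁ J⊆H = k is (≤-trans (m≤n+m r β) (≤-reflexive (sym len))) (S , inj₁ J⊆H)
        ... | inj₂ (g , gJ , gH) with K ≤? size (mem (State.H S))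
        ...   | yes K≤ = k is (≤-trans (m≤n+m r β) (≤-reflexive (sym len))) (S , inj₂ K≤)
        -- With the budget spent, the potential says 3 |J| ≤ |X| ≤ |J|, which is absurd; so this
        -- case does not arise.
        run r zero is S len potential k | inj₂ (g , gJ , gH) | no K≰ = <⇒≱ (size>0 gJ) (+-cancelʳ-≤ (2 * j) j 0 (≤-trans
            (≤-trans (≤-reflexive (eq j)) potential) (≤-trans (size-⊆ (λ _ → State.X⊆J S)) (m≤m+n j (j + 0)))))
          where
            j = size (mem J)
            eq : ∀ j → j + 2 * j ≡ 3 * j
            eq = solve-∀
        run r (suc β) (i ∷ is) S len potential k | inj₂ (g , gJ , gH) | no K≰ = oracle i is S gJ gH (≰⇒> K≰) λ u grow jump →
          run r β is (proj₁ (step S u)) (suc-injective len) (next u grow jump (⊆ₛ-or-witness (State.H (proj₁ (step S u))) (State.H S))) k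
          where
            open ≤-Reasoning
            j = size (mem J)
            h = size (mem (State.H S))
            x = size (State.X S)
            eq : ∀ j → j + 2 * j ≡ 3 * j
            eq = solve-∀
            next : ∀ u → (2 + l) * h ≤ size (Unit.saturation u (State.H S)) → 4 * (l * h) ≤ j →
              (let S' = proj₁ (step S u)) → (State.H S' ⊆ₛ State.H S ⊎ ∃ λ g → g ∈ₛ State.H S' × mem (State.H S) g ≡ false) →
              3 * j ≤ β * (suc l * size (mem (State.H S'))) + size (State.X S')
            next u grow jump (inj₁ back) = begin
              3 * j ≤⟨ potential ⟩
              (suc l * h + β * (suc l * h)) + x ≡⟨ eq' (suc l * h) (β * (suc l * h)) x ⟩
              β * (suc l * h) + (x + suc l * h) ≤⟨ +-mono-≤ (*-monoʳ-≤ (β) (*-monoʳ-≤ (suc l) h≤h')) x≤x' ⟩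
              β * (suc l * h') + x' ∎
              where
                S' = proj₁ (step S u)
                h' = size (mem (State.H S'))
                x' = size (State.X S')
                h≤h' : h ≤ h'
                h≤h' = size-⊆ (λ _ → proj₁ (proj₂ (step S u)))
                h'≤h : h' ≤ h
                h'≤h = size-⊆ (λ _ → back)
                eq' : ∀ a b c → (a + b) + c ≡ b + (c + a)
                eq' = solve-∀
                x≤x' : x + suc l * h ≤ x'
                x≤x' = +-cancelʳ-≤ h _ _ (begin
                  x + suc l * h + h ≡⟨ eq'' x l h ⟩
                  x + (2 + l) * h ≤⟨ +-monoʳ-≤ x grow ⟩
                  x + size (Unit.saturation u (State.H S)) ≤⟨ proj₂ (proj₂ (step S u)) ⟩
                  x' + h' ≤⟨ +-monoʳ-≤ x' h'≤h ⟩
                  x' + h ∎)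
                  where
                    eq'' : ∀ x l h → x + suc l * h + h ≡ x + (2 + l) * h
                    eq'' = solve-∀
            next u grow jump (inj₂ (g' , g'∈ , g'∉)) = begin
              3 * j ≤⟨ jump-bound {β = β} {l} {h} (size>0 (mem-ε (State.H S))) two jump (lagrange₂ {State.H S} {State.H S'} (proj₁ (proj₂ (step S u))) g'∈ g'∉) ⟩
              β * (suc l * h') + h' ≤⟨ +-monoʳ-≤ _ (size-invariant {State.X S'} {State.H S'} (State.X-inv S') (State.X-point S')) ⟩
              β * (suc l * h') + size (State.X S') ∎
              where
                S' = proj₁ (step S u)
                h' = size (mem (State.H S'))
                -- This is why the potential is measured against 3 |J|: after the subtraction of |X|
                -- ≤ |J|, enough remains for `jump-bound`.
                two : 2 * j ≤ suc (β) * (suc l * h)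
                two = +-cancelʳ-≤ j _ _ (begin
                  2 * j + j ≡⟨ trans (+-comm (2 * j) j) (eq j) ⟩
                  3 * j ≤⟨ potential ⟩
                  suc (β) * (suc l * h) + x ≤⟨ +-monoʳ-≤ _ (size-⊆ (λ _ → State.X⊆J S)) ⟩
                  suc (β) * (suc l * h) + j ∎)

    two-cosets : ∀ {J φ F i} (u : Unit J φ F i) (H : Sub) {o} → o ∈ Unit.o₀ u ∷ Unit.os u → mem H (val (Unit.label u) o ∙ val (Unit.label u) (Unit.o₀ u) ⁻¹) ≡ false →
      2 * size (mem H) ≤ size (Unit.saturation u H)
    two-cosets {J} {φ} {F} {i} u H {o} o∈ notin = begin
      size (mem H) + (size (mem H) + 0) ≡⟨ cong (size (mem H) +_) (trans (+-identityʳ _) (sym (size-shift (mem H) (w ⁻¹)))) ⟩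
      size (mem H) + size (λ a → mem H (a ∙ w ⁻¹)) ≡⟨ sym (sumN-+ (allFin m) _ _) ⟩
      sumN (allFin m) (λ a → b2n (mem H a) + b2n (mem H (a ∙ w ⁻¹))) ≤⟨ sumN-mono (allFin m) (λ {a} _ → each a) ⟩
      size (Unit.saturation u H) ∎
      where
        open ≤-Reasoning
        w : A
        w = val (Unit.label u) o ∙ val (Unit.label u) (Unit.o₀ u) ⁻¹
        b≤ : ∀ {b} → b ≡ true → 1 ≤ b2n b
        b≤ refl = ≤-refl
        each : ∀ a → b2n (mem H a) + b2n (mem H (a ∙ w ⁻¹)) ≤ b2n (Unit.saturation u H a)
        each a with mem H a in p | mem H (a ∙ w ⁻¹) in q
        ... | false | false = z≤n
        ... | false | true = b≤ (Unit.saturation-complete u {H} {a} o∈ q)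
        ... | true | false = b≤ (Unit.saturation-complete u {H} {a} (here refl) (subst (_∈ₛ H) (solveG (a ∷ᵛ val (Unit.label u) (Unit.o₀ u) ∷ᵛ []ᵛ) v0 (v0 ⊕ ⊖ (v1 ⊕ ⊖ v1)) refl) p))
        ... | true | true = ⊥-elim (T⇒F⇒⊥ (subst (_∈ₛ H) (solveG (a ∷ᵛ w ∷ᵛ []ᵛ) (v0 ⊕ ⊖ (v0 ⊕ ⊖ v1)) v1 refl) (mem-∙⁻¹ H p q)) notin)

    -- Pairs of values with |X| distinct differences modulo H need at least √|X| values modulo H.
    square-bound : ∀ {J φ F i} (u : Unit J φ F i) (H : Sub) {X : Set} (xs : List X) (lo hi : X → Opt) →
      (∀ {x} → x ∈ xs → lo x ∈ Unit.o₀ u ∷ Unit.os u × hi x ∈ Unit.o₀ u ∷ Unit.os u) →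
      (∀ (p : X → Bool) → (∀ {x y} → p x ≡ true → p y ≡ true → (val (Unit.label u) (hi x) ∙ val (Unit.label u) (lo x) ⁻¹) ∙ (val (Unit.label u) (hi y) ∙ val (Unit.label u) (lo y) ⁻¹) ⁻¹ ∈ₛ H) → sumN xs (b2n ∘ p) ≤ 1) →
      length xs * (size (mem H) * size (mem H)) ≤ size (Unit.saturation u H) * size (Unit.saturation u H)
    square-bound {J} {φ} {F} {i} u H {X} xs lo hi opts atMost1 = begin
      length xs * (h * h) ≡⟨ sym (sumN-const xs (h * h)) ⟩
      sumN xs (λ _ → h * h) ≡⟨ sumN-cong xs (λ {x} _ → sym (trans (product (λ a → mem H (a ∙ A' x ⁻¹)) (λ b → mem H (b ∙ B' x ⁻¹))) (cong₂ _*_ (size-shift (mem H) _) (size-shift (mem H) _)))) ⟩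
      sumN xs (λ x → sumN U (λ a → sumN U (λ b → b2n (hit x a b)))) ≡⟨ sumN-swap xs U _ ⟩
      sumN U (λ a → sumN xs (λ x → sumN U (λ b → b2n (hit x a b)))) ≡⟨ sumN-cong U (λ {a} _ → sumN-swap xs U _) ⟩
      sumN U (λ a → sumN U (λ b → sumN xs (λ x → b2n (hit x a b)))) ≤⟨ sumN-mono U (λ {a} _ → sumN-mono U (λ {b} _ → each a b)) ⟩
      sumN U (λ a → sumN U (λ b → b2n (Y a ∧ Y b))) ≡⟨ product Y Y ⟩
      size Y * size Y ∎
      where
        open ≤-Reasoning
        U : List A
        U = allFin m
        h : ℕ
        h = size (mem H)
        Y : A → Bool
        Y = Unit.saturation u H
        v₀ : A
        v₀ = val (Unit.label u) (Unit.o₀ u)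
        A' B' : X → A
        A' x = val (Unit.label u) (lo x) ∙ v₀ ⁻¹
        B' x = val (Unit.label u) (hi x) ∙ v₀ ⁻¹
        hit : X → A → A → Bool
        hit x a b = mem H (a ∙ A' x ⁻¹) ∧ mem H (b ∙ B' x ⁻¹)
        product : ∀ (p q : A → Bool) → sumN U (λ a → sumN U (λ b → b2n (p a ∧ q b))) ≡ size p * size q
        product p q = trans (sumN-cong U (λ {a} _ → trans (sumN-cong U (λ {b} _ → b2n-∧ (p a) (q b))) (sumN-*ˡ U (b2n (p a)) (b2n ∘ q)))) (sumN-*ʳ U (size q) (b2n ∘ p))
          where
            b2n-∧ : ∀ a b → b2n (a ∧ b) ≡ b2n a * b2n b
            b2n-∧ true b = sym (+-identityʳ _)
            b2n-∧ false b = refl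
        b≤ : ∀ {b} → b ≡ true → 1 ≤ b2n b
        b≤ refl = ≤-refl
        -- A pair of values determines the difference modulo `H`, so at most one index hits a given
        -- pair.
        hit-diff : ∀ {a b x y} → hit x a b ≡ true → hit y a b ≡ true → (val (Unit.label u) (hi x) ∙ val (Unit.label u) (lo x) ⁻¹) ∙ (val (Unit.label u) (hi y) ∙ val (Unit.label u) (lo y) ⁻¹) ⁻¹ ∈ₛ H
        hit-diff {a} {b} {x} {y} p q = subst (_∈ₛ H) (solveG (a ∷ᵛ b ∷ᵛ val (Unit.label u) (lo x) ∷ᵛ val (Unit.label u) (hi x) ∷ᵛ val (Unit.label u) (lo y) ∷ᵛ val (Unit.label u) (hi y) ∷ᵛ v₀ ∷ᵛ []ᵛ)
            (((v0 ⊕ ⊖ (v2 ⊕ ⊖ v6)) ⊕ ⊖ (v0 ⊕ ⊖ (v4 ⊕ ⊖ v6))) ⊕ ⊖ ((v1 ⊕ ⊖ (v3 ⊕ ⊖ v6)) ⊕ ⊖ (v1 ⊕ ⊖ (v5 ⊕ ⊖ v6))))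
            ((v3 ⊕ ⊖ v2) ⊕ ⊖ (v5 ⊕ ⊖ v4)) refl)
          (mem-∙⁻¹ H (mem-∙⁻¹ H (∧-elimˡ p) (∧-elimˡ q)) (mem-∙⁻¹ H (∧-elimʳ {mem H (a ∙ A' x ⁻¹)} p) (∧-elimʳ {mem H (a ∙ A' y ⁻¹)} q)))
        each : ∀ a b → sumN xs (λ x → b2n (hit x a b)) ≤ b2n (Y a ∧ Y b)
        each a b with sumN xs (λ x → b2n (hit x a b)) in eq
        ... | zero = z≤n
        ... | suc _ with sumN-positive xs (λ x → b2n (hit x a b)) (≤-trans (s≤s z≤n) (≤-reflexive (sym eq)))
        ...   | x , x∈ , pos = ≤-trans (≤-trans (≤-reflexive (sym eq)) (atMost1 (λ x → hit x a b) (λ {x} {y} p q → hit-diff {a} {b} {x} {y} p q)))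
                  (b≤ (∧-intro (Unit.saturation-complete u {H} {a} (proj₁ (opts x∈)) (∧-elimˡ hx)) (Unit.saturation-complete u {H} {b} (proj₂ (opts x∈)) (∧-elimʳ {mem H (a ∙ A' x ⁻¹)} hx))))
                where
                  hx : hit x a b ≡ true
                  hx = b2n-positive pos

    saturation-⊆ : ∀ {J φ F i} (u : Unit J φ F i) {H} → H ⊆ₛ J → ∀ g → Unit.saturation u H g ≡ true → g ∈ₛ J
    saturation-⊆ {J} u {H} H⊆J y p with Unit.saturation-sound u {H} p
    ... | o , o∈ , q = subst (_∈ₛ J) (solveG (y ∷ᵛ (val (Unit.label u) o ∙ val (Unit.label u) (Unit.o₀ u) ⁻¹) ∷ᵛ []ᵛ) (v0 ⊕ ⊖ v1 ⊕ v1) v0 refl) (mem-∙ J (H⊆J q) (Unit.diff u o∈))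

  -- Congruence modulo `J`, classes of `τ`, and balanced placements.

  module Balance (J : Sub) where

    infix 4 _≈_
    _≈_ : A → A → Set
    a ≈ b = a ∙ b ⁻¹ ∈ₛ J

    ≈-refl : ∀ {a} → a ≈ a
    ≈-refl {a} = subst (_∈ₛ J) (sym (∙-invʳ a)) (mem-ε J)

    ≈-trans : ∀ {a b e} → a ≈ b → b ≈ e → a ≈ e
    ≈-trans {a} {b} {e} p q = subst (_∈ₛ J) (solveG (a ∷ᵛ b ∷ᵛ e ∷ᵛ []ᵛ) (v0 ⊕ ⊖ v1 ⊕ (v1 ⊕ ⊖ v2)) (v0 ⊕ ⊖ v2) refl) (mem-∙ J p q)

    ≈-∙ : ∀ {a b e g} → a ≈ b → e ≈ g → a ∙ e ≈ b ∙ g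
    ≈-∙ {a} {b} {e} {g} p q = subst (_∈ₛ J) (solveG (a ∷ᵛ b ∷ᵛ e ∷ᵛ g ∷ᵛ []ᵛ) (v0 ⊕ ⊖ v1 ⊕ (v2 ⊕ ⊖ v3)) (v0 ⊕ v2 ⊕ ⊖ (v1 ⊕ v3)) refl) (mem-∙ J p q)

    ≈-· : ∀ k {a b} → a ≈ b → k · a ≈ k · b
    ≈-· k {a} {b} p = subst (_∈ₛ J) (trans (·-∙ k a (b ⁻¹)) (cong (k · a ∙_) (·-⁻¹ k b))) (mem-· J k p)

    ≈-∈ : ∀ {a b} → a ≈ b → b ∈ₛ J → a ∈ₛ J
    ≈-∈ {a} {b} p q = subst (_∈ₛ J) (solveG (a ∷ᵛ b ∷ᵛ []ᵛ) (v0 ⊕ ⊖ v1 ⊕ v1) v0 refl) (mem-∙ J p q)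

    ∈-≈ : ∀ {a b} → a ∈ₛ J → b ∈ₛ J → a ≈ b
    ∈-≈ = mem-∙⁻¹ J

    ≈-∑ : ∀ {X : Set} (xs : List X) {f g : X → A} → (∀ {x} → x ∈ xs → f x ≈ g x) → ∑ xs f ≈ ∑ xs g
    ≈-∑ [] h = ≈-refl
    ≈-∑ (x ∷ xs) h = ≈-∙ (h (here refl)) (≈-∑ xs (h ∘ there))

    data Similar : List A → List A → Set where
      [] : Similar [] []
      _∷_ : ∀ {a b as bs} → a ≈ b → Similar as bs → Similar (a ∷ as) (b ∷ bs)

    Similar-refl : ∀ as → Similar as as
    Similar-refl [] = []
    Similar-refl (a ∷ as) = ≈-refl ∷ Similar-refl as

    weighted : List ℕ → List A → A
    weighted (k ∷ ks) (a ∷ as) = k · a ∙ weighted ks as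
    weighted _ _ = ε

    weighted-≈ : ∀ ks {as bs} → Similar as bs → weighted ks as ≈ weighted ks bs
    weighted-≈ [] s = ≈-refl
    weighted-≈ (k ∷ ks) [] = ≈-refl
    weighted-≈ (k ∷ ks) (p ∷ s) = ≈-∙ (≈-· k p) (weighted-≈ ks s)

    weighted-map : ∀ {X : Set} (xs : List X) (D : X → ℕ) (θ : X → A) → ∑ xs (λ x → D x · θ x) ≡ weighted (map D xs) (map θ xs)
    weighted-map [] D θ = refl
    weighted-map (x ∷ xs) D θ = cong (D x · θ x ∙_) (weighted-map xs D θ)

    multiple-weighted : ∀ d ks as → (∀ {a} → a ∈ as → d · a ∈ₛ J) → d · weighted ks as ∈ₛ J
    multiple-weighted d [] as h = subst (_∈ₛ J) (sym (·-ε d)) (mem-ε J)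
    multiple-weighted d (k ∷ ks) [] h = subst (_∈ₛ J) (sym (·-ε d)) (mem-ε J)
    multiple-weighted d (k ∷ ks) (a ∷ as) h = subst (_∈ₛ J) (sym (trans (·-∙ d (k · a) _) (cong (_∙ d · weighted ks as) (·-comm d k a))))
      (mem-∙ J (mem-· J k (h (here refl))) (multiple-weighted d ks as (h ∘ there)))
      where
        ·-comm : ∀ d k a → d · (k · a) ≡ k · (d · a)
        ·-comm d k a = trans (sym (·-* d k a)) (trans (cong (_· a) (*-comm d k)) (·-* k d a))

    -- d sums with the same weights over similar lists cancel, because d kills every entry modulo J.
    balanced-rows : ∀ {X : Set} d (B : List X) (f : X → A) ks as → length B ≡ d → (∀ {a} → a ∈ as → d · a ∈ₛ J) → (∀ {x} → x ∈ B → f x ≈ weighted ks as) → ∑ B f ∈ₛ J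
    balanced-rows d B f ks as len h s = ≈-∈ (≈-∑ B s) (subst (_∈ₛ J) (sym (trans (∑-const B _) (cong (_· weighted ks as) len))) (multiple-weighted d ks as h))

    module Classmates {V : Set} (τ : V → A) where
      class : A → List V → List V
      class g W = fil (λ x → mem J (τ x ∙ g ⁻¹)) W

      -- `g` runs over all elements rather than over representatives, so every vertex is counted |J|
      -- times.
      class-total : ∀ W → sumN (allFin m) (λ g → length (class g W)) ≡ length W * size (mem J)
      class-total W = begin
        sumN (allFin m) (λ g → length (class g W)) ≡⟨ sumN-cong (allFin m) (λ {g} _ → length-fil _ W) ⟩
        sumN (allFin m) (λ g → sumN W (λ x → b2n (mem J (τ x ∙ g ⁻¹)))) ≡⟨ sumN-swap (allFin m) W _ ⟩
        sumN W (λ x → sumN (allFin m) (λ g → b2n (mem J (τ x ∙ g ⁻¹)))) ≡⟨ sumN-cong W (λ {x} _ → size-reflect (mem J) (τ x)) ⟩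
        sumN W (λ _ → size (mem J)) ≡⟨ sumN-const W _ ⟩
        length W * size (mem J) ∎
        where open ≡-Reasoning

      -- The division-free form of an average: some class among m / |J| has at least the mean size.
      large-class : ∀ W → ∃ λ g → length W * size (mem J) ≤ m * length (class g W)
      large-class W = go (allFin m) refl
        where
          go : ∀ as → as ≡ allFin m → ∃ λ g → length W * size (mem J) ≤ m * length (class g W)
          go [] eq = ε , ≤-trans (≤-reflexive (trans (sym (class-total W)) (cong (λ l → sumN l (λ g → length (class g W))) (sym eq)))) z≤n
          go (a ∷ as) eq with averaging (λ g → length (class g W)) a as
          ... | g , _ , le = g , ≤-trans (≤-reflexive (trans (sym (class-total W)) (cong (λ l → sumN l (λ g → length (class g W))) (sym eq))))
                (≤-trans le (≤-reflexive (cong (_* length (class g W)) (trans (cong length eq) (length-tabulate {n = m} id)))))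

      same-class : ∀ {g W x y} → x ∈ class g W → y ∈ class g W → τ x ≈ τ y
      same-class {g} {W} {x} {y} p q = subst (_∈ₛ J) (solveG (τ x ∷ᵛ τ y ∷ᵛ g ∷ᵛ []ᵛ) (v0 ⊕ ⊖ v2 ⊕ ⊖ (v1 ⊕ ⊖ v2)) (v0 ⊕ ⊖ v1) refl) (mem-∙⁻¹ J (proj₂ (∈-fil⁻ W p)) (proj₂ (∈-fil⁻ W q)))

      classmates : ∀ j W → Unique W → m * j < length W → ∃₂ λ x₁ xs → x₁ ∈ W × length xs ≡ j × Unique xs × xs ⊆ W × (∀ {x} → x ∈ xs → τ x ≈ τ x₁)
      classmates j W uW big with large-class W
      ... | g , le = pick (class g W) id (fil-unique uW) (*-cancelˡ-< m j _ (≤-trans big (≤-trans (≤-trans (≤-reflexive (sym (*-identityʳ _))) (*-monoʳ-≤ (length W) (size>0 (mem-ε J)))) le)))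
        where
          pick : ∀ C → C ⊆ class g W → Unique C → j < length C → ∃₂ λ x₁ xs → x₁ ∈ W × length xs ≡ j × Unique xs × xs ⊆ W × (∀ {x} → x ∈ xs → τ x ≈ τ x₁)
          pick (x₁ ∷ C) C⊆ u lt = x₁ , take j (x₁ ∷ C) , fil⊆ W (C⊆ (here refl)) , length-take≤ j (x₁ ∷ C) (<⇒≤ lt) , unique-take j u , (λ z → fil⊆ W (C⊆ (take⊆ j (x₁ ∷ C) z))) ,
            (λ {x} x∈ → same-class {g} {W} (C⊆ (take⊆ j (x₁ ∷ C) x∈)) (C⊆ (here refl)))

      -- At most m / |J| classes occur and each small one contributes fewer than `M` vertices; the
      -- factor |J| is again the multiplicity in `class-total`.
      small-classes : ∀ M W → Unique W → length (fil (λ x → does (suc (length (class (τ x) W)) ≤? M)) W) * size (mem J) ≤ m * M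
      small-classes M W uW = begin
        length S * size (mem J) ≡⟨ sym (class-total S) ⟩
        sumN (allFin m) (λ g → length (class g S)) ≤⟨ sumN-bound (allFin m) M (λ {g} _ → each g (class g S) refl) ⟩
        length (allFin m) * M ≡⟨ cong (_* M) (length-tabulate {n = m} id) ⟩
        m * M ∎
        where
          open ≤-Reasoning
          S : List V
          S = fil (λ x → does (suc (length (class (τ x) W)) ≤? M)) W
          each : ∀ g C → C ≡ class g S → length (class g S) ≤ M
          each g [] eq = ≤-trans (≤-reflexive (cong length (sym eq))) z≤n
          each g (x ∷ C) eq = ≤-trans (unique-⊆-length (fil-unique {p = λ y → mem J (τ y ∙ g ⁻¹)} (fil-unique uW)) (λ {y} y∈ → ∈-fil⁺ (fil⊆ W (fil⊆ S y∈)) (same-class {g} {S} y∈ x∈)))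
              (<⇒≤ (does⁻ (suc (length (class (τ x) W)) ≤? M) (proj₂ (∈-fil⁻ W (fil⊆ S x∈)))))
            where
              x∈ : x ∈ class g S
              x∈ = subst (x ∈_) eq (here refl)

    module GroupPlacement {n t : ℕ} (D : Fin n → ℕ) (Δ : ℕ) (D≤ : ∀ a → D a ≤ Δ) (τ : Fin t → A) (d' : ℕ) where
      open Classmates τ
      open Classes {Fin n} {ℕ} _≟ⁿ_

      d : ℕ
      d = suc d'

      -- The bounded remainder need not cancel by itself, so balance is relative to a placement with
      -- constant `τ₀`. For all of G the constant placement sums to 2 e(G) τ₀, which vanishes.
      record Placed (rest : List (Fin n)) (W : List (Fin t)) : Set where
        field
          ps : List (Fin n × Fin t)
          covers : ∀ {a} → a ∈ rest → a ∈ map proj₁ ps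
          inside : map proj₁ ps ⊆ rest
          unique₁ : Unique (map proj₁ ps)
          unique₂ : Unique (map proj₂ ps)
          host : map proj₂ ps ⊆ W
          τ₀ : A
          dτ₀ : d · τ₀ ∈ₛ J
          balanced : ∑ ps (λ p → D (proj₁ p) · τ (proj₂ p)) ≈ ∑ ps (λ p → D (proj₁ p) · τ₀)

      proj₁-zip : ∀ {X Y : Set} (as : List X) (xs : List Y) → length as ≡ length xs → map proj₁ (zip as xs) ≡ as
      proj₁-zip [] [] e = refl
      proj₁-zip (a ∷ as) (x ∷ xs) e = cong (a ∷_) (proj₁-zip as xs (suc-injective e))

      proj₂-zip : ∀ {X Y : Set} (as : List X) (xs : List Y) → length as ≡ length xs → map proj₂ (zip as xs) ≡ xs
      proj₂-zip [] [] e = refl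
      proj₂-zip (a ∷ as) (x ∷ xs) e = cong (x ∷_) (proj₂-zip as xs (suc-injective e))

      -- Groups of d vertices of equal degree go to d hosts of equal τ; the bounded remainder goes to a single class.
      place-groups : ∀ fuel (rest : List (Fin n)) → length rest ≤ fuel → Unique rest → ∀ W → Unique W → (∀ {x} → x ∈ W → d · τ x ∈ₛ J) →
        length rest + suc (m * (suc Δ * d)) ≤ length W → Placed rest W
      place-groups fuel rest le u W uW dτ big with suc Δ * d ≤? length rest
      ... | no small = last (classmates (length rest) W uW (≤-trans (s≤s (*-monoʳ-≤ m (<⇒≤ (≰⇒> small)))) (≤-trans (m≤n+m _ _) big)))
        where
          last : (∃₂ λ x₁ xs → x₁ ∈ W × length xs ≡ length rest × Unique xs × xs ⊆ W × (∀ {x} → x ∈ xs → τ x ≈ τ x₁)) → Placed rest W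
          last (x₁ , xs , x₁∈ , len , uxs , xs⊆ , same) = record
            { ps = zip rest xs ; covers = subst (_ ∈_) (sym p₁) ; inside = subst (_ ∈_) p₁ ; unique₁ = subst Unique (sym p₁) u ; unique₂ = subst Unique (sym p₂) uxs
            ; host = λ h → xs⊆ (subst (_ ∈_) p₂ h) ; τ₀ = τ x₁ ; dτ₀ = dτ x₁∈
            ; balanced = ≈-∑ (zip rest xs) (λ {p} p∈ → ≈-· (D (proj₁ p)) (same (subst (proj₂ p ∈_) p₂ (∈-map⁺ proj₂ p∈)))) }
            where
              p₁ = proj₁-zip rest xs (sym len)
              p₂ = proj₂-zip rest xs (sym len)
      place-groups zero rest le u W uW dτ big | yes large = ⊥-elim (<⇒≱ (≤-trans (s≤s z≤n) large) le)
      place-groups (suc fuel) rest le u W uW dτ big | yes large = group (pigeonhole 0 D (upTo (suc Δ)) rest (λ {a} _ → ∈-upTo⁺ (s≤s (D≤ a))))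
          (classmates d W uW (≤-trans (s≤s (*-monoʳ-≤ m (≤-trans (≤-reflexive (sym (*-identityˡ d))) (*-monoˡ-≤ d (s≤s (z≤n {Δ})))))) (≤-trans (m≤n+m _ _) big)))
        where
          open ≤-Reasoning
          group : (∃ λ D₀ → length rest ≤ length (upTo (suc Δ)) * length (classOf D D₀ rest)) → (∃₂ λ x₁ xs → x₁ ∈ W × length xs ≡ d × Unique xs × xs ⊆ W × (∀ {x} → x ∈ xs → τ x ≈ τ x₁)) → Placed rest W
          group (D₀ , le₀) (x₁ , xs , x₁∈ , len , uxs , xs⊆ , same) = record
            { ps = zip as xs ++ R.ps
            ; covers = λ {a} a∈ → subst (a ∈_) (sym m₁) (split a a∈)
            ; inside = λ {a} h → case ∈-++⁻ as (subst (a ∈_) m₁ h) of λ { (inj₁ p) → as⊆ p ; (inj₂ q) → ∖⊆ rest as (R.inside q) }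
            ; unique₁ = subst Unique (sym m₁) (unique-++ uas R.unique₁ (λ { (p , q) → proj₂ (∈-∖⁻ rest as (R.inside q)) p }))
            ; unique₂ = subst Unique (sym m₂) (unique-++ uxs R.unique₂ (λ { (p , q) → proj₂ (∈-∖⁻ W xs (R.host q)) p }))
            ; host = λ {x} h → case ∈-++⁻ xs (subst (x ∈_) m₂ h) of λ { (inj₁ p) → xs⊆ p ; (inj₂ q) → ∖⊆ W xs (R.host q) }
            ; τ₀ = R.τ₀ ; dτ₀ = R.dτ₀
            ; balanced = subst₂ _≈_ (sym (∑-++ (zip as xs) R.ps _)) (sym (∑-++ (zip as xs) R.ps _)) (≈-∙ (∈-≈ (cancels (λ p → τ (proj₂ p)) (τ x₁) (dτ x₁∈) (λ {p} p∈ → same (subst (proj₂ p ∈_) p₂ (∈-map⁺ proj₂ p∈)))) (cancels (λ _ → R.τ₀) R.τ₀ R.dτ₀ (λ _ → ≈-refl))) R.balanced) }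
            where
              C as : List (Fin n)
              C = classOf D D₀ rest
              as = take d C
              -- `rest` has at least (Δ + 1) d vertices and there are Δ + 1 possible degrees.
              d≤C : d ≤ length C
              d≤C = *-cancelˡ-≤ (suc Δ) (≤-trans large (≤-trans le₀ (≤-reflexive (cong (_* length C) (length-upTo (suc Δ))))))
              len-as : length as ≡ d
              len-as = length-take≤ d C d≤C
              uas : Unique as
              uas = unique-take d (fil-unique u)
              as⊆ : as ⊆ rest
              as⊆ z = fil⊆ rest (take⊆ d C z)
              p₁ = proj₁-zip as xs (trans len-as (sym len))
              p₂ = proj₂-zip as xs (trans len-as (sym len))
              rest' : List (Fin n)
              rest' = rest ∖ as
              shrink : length rest' + d ≤ length rest
              shrink = begin
                length rest' + d ≡⟨ cong (length rest' +_) (sym len-as) ⟩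
                length rest' + length as ≡⟨ sym (length-++ rest') ⟩
                length (rest' ++ as) ≤⟨ unique-⊆-length (unique-++ (∖-unique as u) uas (λ { (p , q) → proj₂ (∈-∖⁻ rest as p) q })) (λ {a} h → case ∈-++⁻ rest' h of λ { (inj₁ p) → ∖⊆ rest as p ; (inj₂ q) → as⊆ q }) ⟩
                length rest ∎
              e : ∀ a b c → a + b + c ≡ a + c + b
              e = solve-∀
              others : Placed rest' (W ∖ xs)
              others = place-groups fuel rest' (≤-pred (≤-trans (≤-trans (≤-trans (s≤s (m≤m+n (length rest') d')) (≤-reflexive (sym (+-suc (length rest') d')))) shrink) le)) (∖-unique as u) (W ∖ xs) (∖-unique xs uW) (λ x∈ → dτ (∖⊆ W xs x∈))
                (+-cancelʳ-≤ d _ _ (begin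
                  length rest' + suc (m * (suc Δ * d)) + d ≡⟨ e (length rest') (suc (m * (suc Δ * d))) d ⟩
                  length rest' + d + suc (m * (suc Δ * d)) ≤⟨ +-monoˡ-≤ _ shrink ⟩
                  length rest + suc (m * (suc Δ * d)) ≤⟨ big ⟩
                  length W ≤⟨ length-∖ xs uW ⟩
                  length (W ∖ xs) + length xs ≡⟨ cong (length (W ∖ xs) +_) len ⟩
                  length (W ∖ xs) + d ∎))
              module R = Placed others
              m₁ : map proj₁ (zip as xs ++ R.ps) ≡ as ++ map proj₁ R.ps
              m₁ = trans (map-++ proj₁ (zip as xs) R.ps) (cong (_++ map proj₁ R.ps) p₁)
              m₂ : map proj₂ (zip as xs ++ R.ps) ≡ xs ++ map proj₂ R.ps
              m₂ = trans (map-++ proj₂ (zip as xs) R.ps) (cong (_++ map proj₂ R.ps) p₂)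
              split : ∀ a → a ∈ rest → a ∈ as ++ map proj₁ R.ps
              split a a∈ with mem? _≟_ a as
              ... | yes p = ∈-++⁺ˡ p
              ... | no ¬p = ∈-++⁺ʳ as (R.covers (∈-∖⁺ {R = as} a∈ ¬p))
              cancels : (θ : Fin n × Fin t → A) (g : A) → d · g ∈ₛ J → (∀ {p} → p ∈ zip as xs → θ p ≈ g) → ∑ (zip as xs) (λ p → D (proj₁ p) · θ p) ∈ₛ J
              cancels θ g dg h = balanced-rows d (zip as xs) (λ p → D (proj₁ p) · θ p) (D₀ ∷ []) (g ∷ []) len-zip (λ { (here refl) → dg })
                (λ {p} p∈ → subst (D (proj₁ p) · θ p ≈_) (trans (cong (_· g) (proj₂ (∈-classOf D D₀ rest (take⊆ d C (subst (proj₁ p ∈_) p₁ (∈-map⁺ proj₁ p∈)))))) (sym (∙-idʳ _))) (≈-· (D (proj₁ p)) (h p∈)))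
                where
                  len-zip : length (zip as xs) ≡ d
                  len-zip = trans (sym (length-map proj₁ (zip as xs))) (trans (cong length p₁) len-as)

  -- Gadgets

  record HostData : Set where
    field
      {t} : ℕ
      c : Fin t → Fin t → A
      c-sym : ∀ x y → c x y ≡ c y x
      d' : ℕ

  module Host (hostData : HostData) where
    open HostData hostData

    V : Set
    V = Fin t

    d : ℕ
    d = suc d'

    record Gadget (W : List V) : Set where
      field
        x y : V
        us : List V
        us-length : length us ≡ d
        distinct : Unique (x ∷ y ∷ us)
        inside : x ∷ y ∷ us ⊆ W
      δ : A
      δ = ∑ us (c x) ∙ ∑ us (c y) ⁻¹
      vertices : List V
      vertices = x ∷ y ∷ us
    open Gadget public using (δ; vertices)

    vertices-length : ∀ {W} (g : Gadget W) → length (vertices g) ≡ 2 + d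
    vertices-length g = cong (2 +_) (Gadget.us-length g)

    gadget-⊆ : ∀ {W W'} → W ⊆ W' → Gadget W → Gadget W'
    gadget-⊆ s g = record { x = Gadget.x g ; y = Gadget.y g ; us = Gadget.us g ; us-length = Gadget.us-length g ; distinct = Gadget.distinct g ; inside = λ z → s (Gadget.inside g z) }

    Confined : (A → Set) → List V → Set
    Confined D W = ∀ (g : Gadget W) → D (δ g)

    distinct⇒unique : ∀ {x y : V} {us} → x ≢ y → x ∉ us → y ∉ us → Unique us → Unique (x ∷ y ∷ us)
    distinct⇒unique x≢y x∉ y∉ u = unique-cons (λ { (here e) → x≢y e ; (there h) → x∉ h }) (unique-cons y∉ u)

    -- Two gadgets with the same `x`, `y` and the same d - 1 further vertices differ only in `u` and
    -- `u'`; their differences are subtracted.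
    quadrangle : ∀ {D W} → Confined D W → Unique W → 4 + d' ≤ length W → ∀ {x y u u'} → x ∈ W → y ∈ W → u ∈ W → u' ∈ W →
      x ≢ y → x ≢ u → x ≢ u' → y ≢ u → y ≢ u' → u ≢ u' →
      ∃₂ λ δ₁ δ₂ → D δ₁ × D δ₂ × c x u ∙ c y u ⁻¹ ∙ c x u' ⁻¹ ∙ c y u' ≡ δ₁ ∙ δ₂ ⁻¹
    quadrangle {D} {W} conf uW big {x} {y} {u} {u'} x∈ y∈ u∈ u'∈ xy xu xu' yu yu' uu' with freshes (x ∷ y ∷ u ∷ u' ∷ []) d' uW big
    ... | rs , len , urs , rs⊆ , dis = _ , _ , conf (gad u u∈ xu yu (λ h → dis (h , there (there (here refl))))) , conf (gad u' u'∈ xu' yu' (λ h → dis (h , there (there (there (here refl)))))) ,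
          solveG (c x u ∷ᵛ c y u ∷ᵛ c x u' ∷ᵛ c y u' ∷ᵛ ∑ rs (c x) ∷ᵛ ∑ rs (c y) ∷ᵛ []ᵛ)
            (v0 ⊕ ⊖ v1 ⊕ ⊖ v2 ⊕ v3) ((v0 ⊕ v4) ⊕ ⊖ (v1 ⊕ v5) ⊕ ⊖ ((v2 ⊕ v4) ⊕ ⊖ (v3 ⊕ v5))) refl
      where
        gad : ∀ w → w ∈ W → x ≢ w → y ≢ w → w ∉ rs → Gadget W
        gad w w∈ xw yw w∉ = record
          { x = x ; y = y ; us = w ∷ rs ; us-length = cong suc len
          ; distinct = distinct⇒unique xy (λ { (here e) → xw e ; (there h) → dis (h , here refl) }) (λ { (here e) → yw e ; (there h) → dis (h , there (here refl)) }) (unique-cons w∉ urs)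
          ; inside = λ { (here refl) → x∈ ; (there (here refl)) → y∈ ; (there (there (here refl))) → w∈ ; (there (there (there h))) → rs⊆ h } }

    record Structured (J : Sub) (W : List V) : Set where
      field
        κ : A
        τ : V → A
        dτ : ∀ {x} → x ∈ W → d · τ x ∈ₛ J
        c≈ : ∀ {x y} → x ∈ W → y ∈ W → x ≢ y → c x y ∙ (κ ∙ τ x ∙ τ y) ⁻¹ ∈ₛ J

    -- With base points p, q, x₀ one may take τ x = c x p − c x₀ p.
    structure : ∀ {J W} → Confined (_∈ₛ J) W → Unique W → 5 + d ≤ length W →
      ∃₂ λ p q → Structured J (W ∖ (p ∷ q ∷ []))
    structure {J} {W} conf uW big = go (freshes [] 3 uW (≤-trans (m≤m+n 3 (2 + d)) big))
      where
        go : (∃ λ us → length us ≡ 3 × Unique us × us ⊆ W × Disjoint us []) → ∃₂ λ p q → Structured J (W ∖ (p ∷ q ∷ []))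
        go (p ∷ q ∷ x₀ ∷ [] , refl , ((p≢q ∷ p≢x₀ ∷ []) ∷ (q≢x₀ ∷ []) ∷ [] ∷ []) , us⊆ , _) = p , q , record { κ = κ ; τ = τ ; dτ = dτ ; c≈ = c≈ }
          where
            W' : List V
            W' = W ∖ (p ∷ q ∷ [])
            κ : A
            -- Two quadrangles give c x u ≡ c x p + c q u - c q p and c u q ≡ c u p - c x₀ p + c x₀
            -- q; substituting the second into the first leaves this constant.
            κ = c x₀ p ∙ c x₀ q ∙ c q p ⁻¹
            τ : V → A
            τ x = c x p ∙ c x₀ p ⁻¹
            p∈ = us⊆ (here refl)
            q∈ = us⊆ (there (here refl))
            x₀∈ = us⊆ (there (there (here refl)))
            in-W : ∀ {x} → x ∈ W' → x ∈ W
            in-W = ∖⊆ W (p ∷ q ∷ [])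
            ≢p : ∀ {x} → x ∈ W' → x ≢ p
            ≢p x∈ refl = proj₂ (∈-∖⁻ W (p ∷ q ∷ []) x∈) (here refl)
            ≢q : ∀ {x} → x ∈ W' → x ≢ q
            ≢q x∈ refl = proj₂ (∈-∖⁻ W (p ∷ q ∷ []) x∈) (there (here refl))
            big4 : 4 + d' ≤ length W
            big4 = ≤-trans (m≤n+m (4 + d') 2) big
            quad : ∀ {x y u u'} → x ∈ W → y ∈ W → u ∈ W → u' ∈ W → x ≢ y → x ≢ u → x ≢ u' → y ≢ u → y ≢ u' → u ≢ u' → c x u ∙ c y u ⁻¹ ∙ c x u' ⁻¹ ∙ c y u' ∈ₛ J
            quad x∈ y∈ u∈ u'∈ a b e f g h with quadrangle conf uW big4 x∈ y∈ u∈ u'∈ a b e f g h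
            ... | δ₁ , δ₂ , j₁ , j₂ , eq = subst (_∈ₛ J) (sym eq) (mem-∙⁻¹ J j₁ j₂)
            swapped : ∀ {u} → u ∈ W' → c u p ∙ c x₀ p ⁻¹ ∙ c u q ⁻¹ ∙ c x₀ q ∈ₛ J
            swapped {u} u∈ with u ≟ x₀
            ... | yes refl = subst (_∈ₛ J) (solveG (c u p ∷ᵛ c u q ∷ᵛ []ᵛ) 𝟎 (v0 ⊕ ⊖ v0 ⊕ ⊖ v1 ⊕ v1) refl) (mem-ε J)
            ... | no ne = quad (in-W u∈) x₀∈ p∈ q∈ ne (≢p u∈) (≢q u∈) (p≢x₀ ∘ sym) (q≢x₀ ∘ sym) p≢q
            c≈ : ∀ {x y} → x ∈ W' → y ∈ W' → x ≢ y → c x y ∙ (κ ∙ τ x ∙ τ y) ⁻¹ ∈ₛ J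
            c≈ {x} {u} x∈ u∈ ne = subst (_∈ₛ J) (trans (cong (λ z → c x u ∙ z ⁻¹ ∙ c x p ⁻¹ ∙ c q p ∙ (c u p ∙ c x₀ p ⁻¹ ∙ c u q ⁻¹ ∙ c x₀ q) ⁻¹) (c-sym q u))
                (solveG (c x u ∷ᵛ c u q ∷ᵛ c x p ∷ᵛ c q p ∷ᵛ c u p ∷ᵛ c x₀ p ∷ᵛ c x₀ q ∷ᵛ []ᵛ)
                  (v0 ⊕ ⊖ v1 ⊕ ⊖ v2 ⊕ v3 ⊕ ⊖ (v4 ⊕ ⊖ v5 ⊕ ⊖ v1 ⊕ v6)) (v0 ⊕ ⊖ ((v5 ⊕ v6 ⊕ ⊖ v3) ⊕ (v2 ⊕ ⊖ v5) ⊕ (v4 ⊕ ⊖ v5))) refl))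
                (mem-∙⁻¹ J (quad (in-W x∈) q∈ (in-W u∈) p∈ (≢q x∈) ne (≢p x∈) (λ e → ≢q u∈ (sym e)) (λ e → p≢q (sym e)) (≢p u∈)) (swapped u∈))
            -- In the gadget on `x`, `x₀` the terms κ and τ u cancel for each of the d vertices u,
            -- so its difference is congruent to d · τ x.
            dτ : ∀ {x} → x ∈ W' → d · τ x ∈ₛ J
            dτ {x} x∈ with x ≟ x₀
            ... | yes refl = subst (_∈ₛ J) (trans (sym (·-ε d)) (cong (d ·_) (sym (∙-invʳ (c x p))))) (mem-ε J)
            ... | no ne with freshes (x ∷ x₀ ∷ []) d (∖-unique (p ∷ q ∷ []) uW) (+-cancelʳ-≤ 2 _ _ (≤-trans (≤-trans (≤-reflexive (+-comm (2 + d) 2)) (≤-trans (n≤1+n _) big)) (length-∖ (p ∷ q ∷ []) uW)))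
            ...   | us , len , uus , us⊆' , dis = subst (_∈ₛ J) (solveG (δ gad ∷ᵛ (d · τ x) ∷ᵛ []ᵛ) (v0 ⊕ ⊖ (v0 ⊕ ⊖ v1)) v1 refl) (mem-∙⁻¹ J (conf gad) (subst (_∈ₛ J) eq (mem-∑ J us {λ u → c x u ∙ c x₀ u ⁻¹ ∙ τ x ⁻¹} each)))
              where
                gad : Gadget W
                gad = record { x = x ; y = x₀ ; us = us ; us-length = len
                  ; distinct = distinct⇒unique ne (λ h → dis (h , here refl)) (λ h → dis (h , there (here refl))) uus
                  ; inside = λ { (here refl) → in-W x∈ ; (there (here refl)) → x₀∈ ; (there (there h)) → in-W (us⊆' h) } }
                x₀∈W' : x₀ ∈ W'
                x₀∈W' = ∈-∖⁺ {R = p ∷ q ∷ []} x₀∈ (λ { (here e) → p≢x₀ (sym e) ; (there (here e)) → q≢x₀ (sym e) })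
                each : ∀ {u} → u ∈ us → c x u ∙ c x₀ u ⁻¹ ∙ τ x ⁻¹ ∈ₛ J
                each {u} u∈ = subst (_∈ₛ J) (solveG (c x u ∷ᵛ c x₀ u ∷ᵛ κ ∷ᵛ c x p ∷ᵛ c x₀ p ∷ᵛ τ u ∷ᵛ []ᵛ)
                    (v0 ⊕ ⊖ (v2 ⊕ (v3 ⊕ ⊖ v4) ⊕ v5) ⊕ ⊖ (v1 ⊕ ⊖ (v2 ⊕ (v4 ⊕ ⊖ v4) ⊕ v5))) (v0 ⊕ ⊖ v1 ⊕ ⊖ (v3 ⊕ ⊖ v4)) refl)
                  (mem-∙⁻¹ J (c≈ x∈ (us⊆' u∈) (λ { refl → dis (u∈ , here refl) })) (c≈ x₀∈W' (us⊆' u∈) (λ { refl → dis (u∈ , there (here refl)) })))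
                eq : ∑ us (λ u → c x u ∙ c x₀ u ⁻¹ ∙ τ x ⁻¹) ≡ δ gad ∙ (d · τ x) ⁻¹
                eq = begin
                  ∑ us (λ u → c x u ∙ c x₀ u ⁻¹ ∙ τ x ⁻¹) ≡⟨ ∑-∙ us _ _ ⟩
                  ∑ us (λ u → c x u ∙ c x₀ u ⁻¹) ∙ ∑ us (λ u → τ x ⁻¹) ≡⟨ cong₂ _∙_ (trans (∑-∙ us _ _) (cong (∑ us (c x) ∙_) (∑-⁻¹ us (c x₀)))) (trans (∑-⁻¹ us (λ _ → τ x)) (cong _⁻¹ (trans (∑-const us (τ x)) (cong (_· τ x) len)))) ⟩
                  ∑ us (c x) ∙ ∑ us (c x₀) ⁻¹ ∙ (d · τ x) ⁻¹ ∎
                  where open ≡-Reasoning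
        go (p ∷ q ∷ x₀ ∷ _ ∷ _ , () , _)

    -- Colourings whose gadget differences form a bounded set.

    open Classes {V} {A} _≟_

    infixl 6 _⊕ₗ_
    _⊕ₗ_ : List A → List A → List A
    xs ⊕ₗ ys = concatMap (λ a → map (a ∙_) ys) xs

    ∈-⊕ₗ : ∀ {a b xs ys} → a ∈ xs → b ∈ ys → a ∙ b ∈ xs ⊕ₗ ys
    ∈-⊕ₗ {a} {b} {xs} {ys} a∈ b∈ = ∈-concatMap⁺ (λ a → map (a ∙_) ys) (lose a∈ (∈-map⁺ (a ∙_) b∈))

    length-⊕ₗ : ∀ xs ys → length (xs ⊕ₗ ys) ≡ length xs * length ys
    length-⊕ₗ [] ys = refl
    length-⊕ₗ (x ∷ xs) ys = trans (length-++ (map (x ∙_) ys)) (cong₂ _+_ (length-map (x ∙_) ys) (length-⊕ₗ xs ys))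

    ⊖ₗ : List A → List A
    ⊖ₗ = map _⁻¹

    fold-⊕ : ℕ → List A → List A
    fold-⊕ zero xs = [ ε ]
    fold-⊕ (suc k) xs = xs ⊕ₗ fold-⊕ k xs

    length-fold-⊕ : ∀ k xs → length (fold-⊕ k xs) ≡ length xs ^ k
    length-fold-⊕ zero xs = refl
    length-fold-⊕ (suc k) xs = trans (length-⊕ₗ xs _) (cong (length xs *_) (length-fold-⊕ k xs))

    ∑-∈-fold : ∀ {X : Set} (us : List X) {f : X → A} {xs} → (∀ {u} → u ∈ us → f u ∈ xs) → ∑ us f ∈ fold-⊕ (length us) xs
    ∑-∈-fold [] h = here refl
    ∑-∈-fold (u ∷ us) h = ∈-⊕ₗ (h (here refl)) (∑-∈-fold us (h ∘ there))

    -- The translates φ x + i g with i < s are distinct for distinct values of φ x, because d φ is constant on U.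
    few-values : ∀ (φ : V → A) (U : List V) w g s → (∀ {x} → x ∈ U → d · φ x ≡ w) → (∀ j → 1 ≤ j → j < s → (d * j) · g ≢ ε) →
      ∃ λ v → length U * s ≤ m * length (classOf φ v U)
    few-values φ U w g s dφ free = go (allFin m) refl
      where
        hit : A → V → Fin s → Bool
        hit a x i = does (a ≟ φ x ∙ toℕ i · g)
        N : A → ℕ
        N a = sumN U (λ x → sumN (allFin s) (λ i → b2n (hit a x i)))
        -- Two hits with i < j give (j - i) · g = φ x - φ x', which is annihilated by d.
        ordered : ∀ {a x x'} (i j : ℕ) → j < s → x ∈ U → x' ∈ U → a ≡ φ x ∙ i · g → a ≡ φ x' ∙ j · g → i < j → ⊥
        ordered {a} {x} {x'} i j j<s x∈ x'∈ p q i<j = free (j ∸ i) (m<n⇒0<n∸m i<j) (≤-<-trans (m∸n≤m j i) j<s) (begin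
            (d * (j ∸ i)) · g ≡⟨ ·-* d (j ∸ i) g ⟩
            d · ((j ∸ i) · g) ≡⟨ cong (d ·_) diff ⟩
            d · (φ x ∙ φ x' ⁻¹) ≡⟨ trans (·-∙ d _ _) (cong (d · φ x ∙_) (·-⁻¹ d (φ x'))) ⟩
            d · φ x ∙ (d · φ x') ⁻¹ ≡⟨ cong₂ (λ y z → y ∙ z ⁻¹) (dφ x∈) (dφ x'∈) ⟩
            w ∙ w ⁻¹ ≡⟨ ∙-invʳ w ⟩
            ε ∎)
          where
            open ≡-Reasoning
            diff : (j ∸ i) · g ≡ φ x ∙ φ x' ⁻¹
            diff = ∙-cancelʳ (φ x' ∙ i · g) (begin
              (j ∸ i) · g ∙ (φ x' ∙ i · g) ≡⟨ solveG ((j ∸ i) · g ∷ᵛ φ x' ∷ᵛ (i · g) ∷ᵛ []ᵛ) (v0 ⊕ (v1 ⊕ v2)) (v1 ⊕ (v0 ⊕ v2)) refl ⟩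
              φ x' ∙ ((j ∸ i) · g ∙ i · g) ≡⟨ cong (φ x' ∙_) (trans (sym (·-+ (j ∸ i) i g)) (cong (_· g) (m∸n+n≡m (<⇒≤ i<j)))) ⟩
              φ x' ∙ j · g ≡⟨ trans (sym q) p ⟩
              φ x ∙ i · g ≡⟨ solveG (φ x ∷ᵛ φ x' ∷ᵛ (i · g) ∷ᵛ []ᵛ) (v0 ⊕ v2) (v0 ⊕ ⊖ v1 ⊕ (v1 ⊕ v2)) refl ⟩
              φ x ∙ φ x' ⁻¹ ∙ (φ x' ∙ i · g) ∎)
        index-unique : ∀ {a x x'} (i j : Fin s) → x ∈ U → x' ∈ U → a ≡ φ x ∙ toℕ i · g → a ≡ φ x' ∙ toℕ j · g → toℕ i ≡ toℕ j
        index-unique i j x∈ x'∈ p q with <-cmp (toℕ i) (toℕ j)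
        ... | tri≈ _ e _ = e
        ... | tri< lt _ _ = ⊥-elim (ordered (toℕ i) (toℕ j) (toℕ<n j) x∈ x'∈ p q lt)
        ... | tri> _ _ gt = ⊥-elim (ordered (toℕ j) (toℕ i) (toℕ<n i) x'∈ x∈ q p gt)
        total : length U * s ≡ sumN (allFin m) N
        total = begin
          length U * s ≡⟨ sym (sumN-const U s) ⟩
          sumN U (λ _ → s) ≡⟨ sumN-cong U (λ {x} _ → inner x) ⟩
          sumN U (λ x → sumN (allFin m) (λ a → sumN (allFin s) (λ i → b2n (hit a x i)))) ≡⟨ sumN-swap U (allFin m) _ ⟩
          sumN (allFin m) N ∎
          where
            open ≡-Reasoning
            inner : ∀ x → s ≡ sumN (allFin m) (λ a → sumN (allFin s) (λ i → b2n (hit a x i)))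
            inner x = begin
              s ≡⟨ sym (trans (*-identityʳ _) (length-tabulate {n = s} id)) ⟩
              length (allFin s) * 1 ≡⟨ sym (sumN-const (allFin s) 1) ⟩
              sumN (allFin s) (λ _ → 1) ≡⟨ sumN-cong (allFin s) (λ {i} _ → sym (trans (sumN-cong (allFin m) (λ {a} _ → b2n≡if (hit a x i))) (sumN-single (allFin m) (φ x ∙ toℕ i · g) (λ _ → 1) (allFin⁺ m) (∈-allFin _)))) ⟩
              sumN (allFin s) (λ i → sumN (allFin m) (λ a → b2n (hit a x i))) ≡⟨ sumN-swap (allFin s) (allFin m) _ ⟩
              sumN (allFin m) (λ a → sumN (allFin s) (λ i → b2n (hit a x i))) ∎
              where
                b2n≡if : ∀ b → b2n b ≡ (if b then 1 else 0)
                b2n≡if true = refl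
                b2n≡if false = refl
        go : ∀ as → as ≡ allFin m → ∃ λ v → length U * s ≤ m * length (classOf φ v U)
        go [] eq = ε , ≤-trans (≤-reflexive (trans total (cong (λ l → sumN l N) (sym eq)))) z≤n
        go (a₀ ∷ as) eq with averaging N a₀ as
        ... | a , _ , le = finish (N a ≟ⁿ 0)
          where
            bound : length U * s ≤ m * N a
            bound = ≤-trans (≤-reflexive (trans total (cong (λ l → sumN l N) (sym eq)))) (≤-trans le (≤-reflexive (cong (_* N a) (trans (cong length eq) (length-tabulate {n = m} id)))))
            finish : Dec (N a ≡ 0) → ∃ λ v → length U * s ≤ m * length (classOf φ v U)
            finish (yes z) = ε , ≤-trans bound (≤-trans (≤-reflexive (trans (cong (m *_) z) (*-zeroʳ m))) z≤n)
            finish (no nz) with sumN-positive U _ (n≢0⇒n>0 nz)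
            ... | x₁ , x₁∈ , h₁ with sumN-positive (allFin s) (λ i → b2n (hit a x₁ i)) h₁
            ...   | i₁ , _ , h₂ = φ x₁ , ≤-trans bound (*-monoʳ-≤ m Na≤)
              where
                hit₁ : a ≡ φ x₁ ∙ toℕ i₁ · g
                hit₁ = does⁻ (a ≟ φ x₁ ∙ toℕ i₁ · g) (b2n-positive h₂)
                one : ∀ {x} → x ∈ U → sumN (allFin s) (λ i → b2n (hit a x i)) ≤ b2n (does (φ x ≟ φ x₁))
                one {x} x∈ with φ x ≟ φ x₁
                ... | yes _ = sumN-atMost1 (allFin s) (hit a x) (allFin⁺ s) (λ {i} {j} p q → toℕ-injective (index-unique i j x∈ x∈ (does⁻ (a ≟ φ x ∙ toℕ i · g) p) (does⁻ (a ≟ φ x ∙ toℕ j · g) q)))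
                ... | no ne = ≤-reflexive (sumN-0 (allFin s) (λ {i} _ → cong b2n (¬T⇒F (λ p → ne (same i (does⁻ (a ≟ φ x ∙ toℕ i · g) p))))))
                  where
                    same : ∀ i → a ≡ φ x ∙ toℕ i · g → φ x ≡ φ x₁
                    same i p = ∙-cancelʳ (toℕ i · g) (trans (sym p) (trans hit₁ (cong (λ k → φ x₁ ∙ k · g) (index-unique i₁ i x₁∈ x∈ hit₁ p))))
                Na≤ : N a ≤ length (classOf φ (φ x₁) U)
                Na≤ = ≤-trans (sumN-mono U one) (≤-reflexive (sym (length-fil _ U)))

    module _ (D : List A) {W : List V} (conf : Confined (_∈ D) W) (uW : Unique W) (big : 6 + d ≤ length W) where
      -- Bounded sets in place of the subgroup used in `structure`: `D₁` holds the quadrangles, `D₂`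
      -- their differences, and `D₃` the elements d · (c x p - c x₀ p).
      D₁ D₂ D₃ : List A
      D₁ = D ⊕ₗ ⊖ₗ D
      D₂ = D₁ ⊕ₗ ⊖ₗ D₁
      D₃ = D ⊕ₗ ⊖ₗ (fold-⊕ d D₂)

      length-D₁ : length D₁ ≡ length D * length D
      length-D₁ = trans (length-⊕ₗ D (⊖ₗ D)) (cong (length D *_) (length-map _⁻¹ D))

      spread : ℕ
      spread = length D * ((length D * length D) * (length D * length D)) ^ d

      length-D₃ : length D₃ ≡ spread
      length-D₃ = trans (length-⊕ₗ D _) (cong (length D *_) (trans (length-map _⁻¹ (fold-⊕ d D₂)) (trans (length-fold-⊕ d D₂) (cong (_^ d) (trans (length-⊕ₗ D₁ _) (trans (cong (length D₁ *_) (length-map _⁻¹ D₁)) (cong₂ _*_ length-D₁ length-D₁)))))))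

      quad : ∀ {x y u u'} → x ∈ W → y ∈ W → u ∈ W → u' ∈ W → x ≢ y → x ≢ u → x ≢ u' → y ≢ u → y ≢ u' → u ≢ u' → c x u ∙ c y u ⁻¹ ∙ c x u' ⁻¹ ∙ c y u' ∈ D₁
      quad x∈ y∈ u∈ u'∈ a b e f g h = from (quadrangle conf uW (≤-trans (m≤n+m (4 + d') 3) big) x∈ y∈ u∈ u'∈ a b e f g h)
        where
          from : ∀ {w} → (∃₂ λ δ₁ δ₂ → δ₁ ∈ D × δ₂ ∈ D × w ≡ δ₁ ∙ δ₂ ⁻¹) → w ∈ D₁
          from (δ₁ , δ₂ , j₁ , j₂ , eq) = subst (_∈ D₁) (sym eq) (∈-⊕ₗ j₁ (∈-map⁺ _⁻¹ j₂))

      module Base (p q x₀ : V) (p∈ : p ∈ W) (q∈ : q ∈ W) (x₀∈ : x₀ ∈ W) (p≢q : p ≢ q) (p≢x₀ : p ≢ x₀) (q≢x₀ : q ≢ x₀) where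
        R W' : List V
        R = p ∷ q ∷ x₀ ∷ []
        W' = W ∖ R
        in-W : ∀ {x} → x ∈ W' → x ∈ W
        in-W = ∖⊆ W R
        ≢R : ∀ {x y} → x ∈ W' → y ∈ R → x ≢ y
        ≢R x∈ y∈ refl = proj₂ (∈-∖⁻ W R x∈) y∈
        big' : 2 + d ≤ length W'
        big' = +-cancelʳ-≤ 3 _ _ (≤-trans (≤-trans (≤-reflexive (+-comm (2 + d) 3)) (≤-trans (n≤1+n _) big)) (length-∖ R uW))

        colour : ∀ {x u} → x ∈ W' → u ∈ W' → x ≢ u → c x u ∙ c q u ⁻¹ ∙ c x p ⁻¹ ∙ c q p ∈ D₁
        colour x∈ u∈ ne = quad (in-W x∈) q∈ (in-W u∈) p∈ (≢R x∈ (there (here refl))) ne (≢R x∈ (here refl)) (λ e → ≢R u∈ (there (here refl)) (sym e)) (p≢q ∘ sym) (≢R u∈ (here refl))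

        -- As for d · τ in `structure`, the gadget on `x`, `x₀` computes d · (c x p - c x₀ p), now
        -- with an error in `D₂` for each of its d vertices u.
        multiple : ∀ {x} → x ∈ W' → d · c x p ∈ map (d · c x₀ p ∙_) D₃
        multiple {x} x∈ with freshes (x ∷ []) d (∖-unique R uW) (≤-trans (n≤1+n (1 + d)) big')
        ... | us , len , uus , us⊆ , dis = subst (_∈ map (d · c x₀ p ∙_) D₃) eq
              (∈-map⁺ (d · c x₀ p ∙_) (∈-⊕ₗ (conf gad) (∈-map⁺ _⁻¹ (subst (λ k → ∑ us diff ∈ fold-⊕ k D₂) len (∑-∈-fold us each)))))
          where
            gad : Gadget W
            gad = record { x = x ; y = x₀ ; us = us ; us-length = len
              ; distinct = distinct⇒unique (≢R x∈ (there (there (here refl)))) (λ h → dis (h , here refl)) (λ h → ≢R (us⊆ h) (there (there (here refl))) refl) uus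
              ; inside = λ { (here refl) → in-W x∈ ; (there (here refl)) → x₀∈ ; (there (there h)) → in-W (us⊆ h) } }
            γ : V → V → A
            γ x u = c x u ∙ c q u ⁻¹ ∙ c x p ⁻¹ ∙ c q p
            diff : V → A
            diff u = γ x u ∙ γ x₀ u ⁻¹
            each : ∀ {u} → u ∈ us → diff u ∈ D₂
            each {u} u∈ = ∈-⊕ₗ (colour x∈ (us⊆ u∈) (λ { refl → dis (u∈ , here refl) }))
              (∈-map⁺ _⁻¹ (quad x₀∈ q∈ (in-W (us⊆ u∈)) p∈ (q≢x₀ ∘ sym) (λ e → ≢R (us⊆ u∈) (there (there (here refl))) (sym e)) (p≢x₀ ∘ sym) (λ e → ≢R (us⊆ u∈) (there (here refl)) (sym e)) (p≢q ∘ sym) (≢R (us⊆ u∈) (here refl))))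
            sum-diff : ∑ us diff ≡ ∑ us (c x) ∙ ∑ us (c x₀) ⁻¹ ∙ (d · c x p ∙ (d · c x₀ p) ⁻¹) ⁻¹
            sum-diff = begin
              ∑ us diff ≡⟨ ∑-cong us (λ {u} _ → solveG (c x u ∷ᵛ c q u ∷ᵛ c x p ∷ᵛ c q p ∷ᵛ c x₀ u ∷ᵛ c x₀ p ∷ᵛ []ᵛ) ((v0 ⊕ ⊖ v1 ⊕ ⊖ v2 ⊕ v3) ⊕ ⊖ (v4 ⊕ ⊖ v1 ⊕ ⊖ v5 ⊕ v3)) (v0 ⊕ ⊖ v4 ⊕ ⊖ (v2 ⊕ ⊖ v5)) refl) ⟩
              ∑ us (λ u → c x u ∙ c x₀ u ⁻¹ ∙ (c x p ∙ c x₀ p ⁻¹) ⁻¹) ≡⟨ ∑-∙ us _ _ ⟩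
              ∑ us (λ u → c x u ∙ c x₀ u ⁻¹) ∙ ∑ us (λ u → (c x p ∙ c x₀ p ⁻¹) ⁻¹) ≡⟨ cong₂ _∙_ (trans (∑-∙ us _ _) (cong (∑ us (c x) ∙_) (∑-⁻¹ us (c x₀))))
                (trans (∑-⁻¹ us (λ _ → c x p ∙ c x₀ p ⁻¹)) (cong _⁻¹ (trans (∑-const us _) (trans (cong (_· (c x p ∙ c x₀ p ⁻¹)) len) (trans (·-∙ d _ _) (cong (d · c x p ∙_) (·-⁻¹ d _))))))) ⟩
              ∑ us (c x) ∙ ∑ us (c x₀) ⁻¹ ∙ (d · c x p ∙ (d · c x₀ p) ⁻¹) ⁻¹ ∎
              where open ≡-Reasoning
            eq : d · c x₀ p ∙ (δ gad ∙ ∑ us diff ⁻¹) ≡ d · c x p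
            eq = trans (cong (λ z → d · c x₀ p ∙ (δ gad ∙ z ⁻¹)) sum-diff)
              (solveG (d · c x₀ p ∷ᵛ d · c x p ∷ᵛ ∑ us (c x) ∷ᵛ ∑ us (c x₀) ∷ᵛ []ᵛ) (v0 ⊕ ((v2 ⊕ ⊖ v3) ⊕ ⊖ (v2 ⊕ ⊖ v3 ⊕ ⊖ (v1 ⊕ ⊖ v0)))) v1 refl)

        module _ (g : A) (s Kc : ℕ) (free : ∀ j → 1 ≤ j → j < s → (d * j) · g ≢ ε) (1≤s : 1 ≤ s) (m≤ : m ≤ Kc * s) where
          -- Two rounds: `D₃` bounds the number of values of d · c x p, and once this is fixed,
          -- `few-values` yields a large class of c x p at the cost m / s ≤ `Kc`.
          refine : ∀ (U : List V) → U ⊆ W' → ∃ λ v → length U ≤ spread * Kc * length (classOf (λ x → c x p) v U)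
          refine U U⊆ = v , (begin
              length U ≤⟨ proj₂ hole ⟩
              length (map (d · c x₀ p ∙_) D₃) * length U₁ ≡⟨ cong (_* length U₁) (trans (length-map _ D₃) length-D₃) ⟩
              spread * length U₁ ≤⟨ *-monoʳ-≤ spread (*-cancelʳ-≤ _ _ s {{>-nonZero 1≤s}} (begin
                 length U₁ * s ≤⟨ proj₂ values ⟩
                 m * length U₂ ≤⟨ *-monoˡ-≤ (length U₂) m≤ ⟩
                 Kc * s * length U₂ ≡⟨ e Kc s (length U₂) ⟩
                 Kc * length U₂ * s ∎)) ⟩
              spread * (Kc * length U₂) ≤⟨ *-monoʳ-≤ spread (*-monoʳ-≤ Kc smaller) ⟩
              spread * (Kc * length (classOf (λ x → c x p) v U)) ≡⟨ sym (*-assoc spread Kc _) ⟩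
              spread * Kc * length (classOf (λ x → c x p) v U) ∎)
            where
              open ≤-Reasoning
              hole : ∃ λ w → length U ≤ length (map (d · c x₀ p ∙_) D₃) * length (classOf (λ x → d · c x p) w U)
              hole = pigeonhole ε (λ x → d · c x p) (map (d · c x₀ p ∙_) D₃) U (λ x∈ → multiple (U⊆ x∈))
              U₁ : List V
              U₁ = classOf (λ x → d · c x p) (proj₁ hole) U
              values : ∃ λ v → length U₁ * s ≤ m * length (classOf (λ x → c x p) v U₁)
              values = few-values (λ x → c x p) U₁ (proj₁ hole) g s (λ x∈ → proj₂ (∈-classOf (λ x → d · c x p) (proj₁ hole) U x∈)) free
              v : A
              v = proj₁ values
              U₂ : List V
              U₂ = classOf (λ x → c x p) v U₁
              e : ∀ a b c → a * b * c ≡ a * c * b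
              e = solve-∀
              smaller : length U₂ ≤ length (classOf (λ x → c x p) v U)
              smaller = subst₂ _≤_ (sym (trans (length-fil _ U₁) (sumN-fil _ U _))) (sym (length-fil _ U))
                (sumN-mono U (λ {x} _ → drop-if (does (d · c x p ≟ proj₁ hole)) (b2n (does (c x p ≟ v)))))
                where
                  drop-if : ∀ b n → (if b then n else 0) ≤ n
                  drop-if true n = ≤-refl
                  drop-if false n = z≤n

      -- Where both c x p and c x q are constant, the quadrangle on x, q, y, p determines c x y up
      -- to an element of `D₁`.
      few-colours : ∀ g s Kc → (∀ j → 1 ≤ j → j < s → (d * j) · g ≢ ε) → 1 ≤ s → m ≤ Kc * s →
        ∃₂ λ U qs → Unique U × U ⊆ W × length W ≤ 3 + (spread * Kc) * (spread * Kc) * length U × length qs ≡ length D * length D ×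
          (∀ {x y} → x ∈ U → y ∈ U → x ≢ y → c x y ∈ qs)
      few-colours g s Kc free 1≤s m≤ = go (freshes [] 3 uW (≤-trans (m≤m+n 3 (3 + d)) big))
        where
          go : (∃ λ us → length us ≡ 3 × Unique us × us ⊆ W × Disjoint us []) → ∃₂ λ U qs → Unique U × U ⊆ W × length W ≤ 3 + (spread * Kc) * (spread * Kc) * length U × length qs ≡ length D * length D ×
            (∀ {x y} → x ∈ U → y ∈ U → x ≢ y → c x y ∈ qs)
          go (p ∷ q ∷ x₀ ∷ _ ∷ _ , () , _)
          go (p ∷ q ∷ x₀ ∷ [] , refl , ((p≢q ∷ p≢x₀ ∷ []) ∷ (q≢x₀ ∷ []) ∷ [] ∷ []) , us⊆ , _) =
            U₂ , map (v ∙ v' ∙ c q p ⁻¹ ∙_) D₁ , fil-unique (fil-unique (∖-unique B.R uW)) , (λ z → B.in-W (fil⊆ B.W' (fil⊆ U₁ z))) , bound , trans (length-map _ D₁) length-D₁ , colours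
            where
              p∈ = us⊆ (here refl)
              q∈ = us⊆ (there (here refl))
              x₀∈ = us⊆ (there (there (here refl)))
              module B = Base p q x₀ p∈ q∈ x₀∈ p≢q p≢x₀ q≢x₀
              module B' = Base q p x₀ q∈ p∈ x₀∈ (p≢q ∘ sym) q≢x₀ p≢x₀
              first = B.refine g s Kc free 1≤s m≤ B.W' id
              v = proj₁ first
              U₁ : List V
              U₁ = classOf (λ x → c x p) v B.W'
              swapR : ∀ {x} → x ∈ B.W' → x ∈ B'.W'
              swapR x∈ = ∈-∖⁺ {R = B'.R} (B.in-W x∈) (λ { (here e) → B.≢R x∈ (there (here refl)) e ; (there (here e)) → B.≢R x∈ (here refl) e ; (there (there h)) → B.≢R x∈ (there (there h)) refl })
              second = B'.refine g s Kc free 1≤s m≤ U₁ (λ z → swapR (fil⊆ B.W' z))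
              v' = proj₁ second
              U₂ : List V
              U₂ = classOf (λ x → c x q) v' U₁
              open ≤-Reasoning
              bound : length W ≤ 3 + (spread * Kc) * (spread * Kc) * length U₂
              bound = begin
                length W ≤⟨ length-∖ B.R uW ⟩
                length B.W' + 3 ≡⟨ +-comm _ 3 ⟩
                3 + length B.W' ≤⟨ +-monoʳ-≤ 3 (proj₂ first) ⟩
                3 + spread * Kc * length U₁ ≤⟨ +-monoʳ-≤ 3 (*-monoʳ-≤ (spread * Kc) (proj₂ second)) ⟩
                3 + spread * Kc * (spread * Kc * length U₂) ≡⟨ cong (3 +_) (sym (*-assoc (spread * Kc) (spread * Kc) _)) ⟩
                3 + (spread * Kc) * (spread * Kc) * length U₂ ∎
              colours : ∀ {x y} → x ∈ U₂ → y ∈ U₂ → x ≢ y → c x y ∈ map (v ∙ v' ∙ c q p ⁻¹ ∙_) D₁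
              colours {x} {y} x∈ y∈ ne = subst (_∈ map (v ∙ v' ∙ c q p ⁻¹ ∙_) D₁) eq (∈-map⁺ (v ∙ v' ∙ c q p ⁻¹ ∙_) (B.colour (fil⊆ B.W' x∈₁) (fil⊆ B.W' (fil⊆ U₁ y∈)) ne))
                where
                  x∈₁ : x ∈ U₁
                  x∈₁ = fil⊆ U₁ x∈
                  xp : c x p ≡ v
                  xp = proj₂ (∈-classOf (λ x → c x p) v B.W' x∈₁)
                  yq : c q y ≡ v'
                  yq = trans (c-sym q y) (proj₂ (∈-classOf (λ x → c x q) v' U₁ y∈))
                  eq : v ∙ v' ∙ c q p ⁻¹ ∙ (c x y ∙ c q y ⁻¹ ∙ c x p ⁻¹ ∙ c q p) ≡ c x y
                  eq = trans (cong₂ (λ a b → v ∙ v' ∙ c q p ⁻¹ ∙ (c x y ∙ a ⁻¹ ∙ b ⁻¹ ∙ c q p)) yq xp)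
                    (solveG (v ∷ᵛ v' ∷ᵛ c q p ∷ᵛ c x y ∷ᵛ []ᵛ) (v0 ⊕ v1 ⊕ ⊖ v2 ⊕ (v3 ⊕ ⊖ v1 ⊕ ⊖ v0 ⊕ v2)) v3 refl)

    data Chain (New : List A → A → Set) {W : List V} : List (Gadget W) → Set where
      [] : Chain New []
      _∷_ : ∀ {g gs} → New (map δ gs) (δ g) → Chain New gs → Chain New (g ∷ gs)

    support : ∀ {W} → List (Gadget W) → List V
    support = concatMap vertices

    support-length : ∀ {W} (gs : List (Gadget W)) → length (support gs) ≡ length gs * (2 + d)
    support-length [] = refl
    support-length (g ∷ gs) = trans (length-++ (vertices g)) (cong₂ _+_ (vertices-length g) (support-length gs))

    support-⊆ : ∀ {W} (gs : List (Gadget W)) → support gs ⊆ W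
    support-⊆ (g ∷ gs) z∈ with ∈-++⁻ (vertices g) z∈
    ... | inj₁ p = Gadget.inside g p
    ... | inj₂ q = support-⊆ gs q

    -- Greedy choice of disjoint gadgets. Getting stuck is as useful as success: it confines the
    -- differences of all gadgets outside a small support.
    gather : (New : List A → A → Set) (W : List V) → ∀ j →
      ((gs : List (Gadget W)) → Chain New gs → Unique (support gs) →
         (length gs ≡ j ⊎ (length gs < j × (∀ (g : Gadget (W ∖ support gs)) → ¬ New (map δ gs) (δ g)))) → ⊥) → ⊥
    gather New W zero k = k [] [] [] (inj₁ refl)
    gather New W (suc j) k = gather New W j next
      where
        next : (gs : List (Gadget W)) → Chain New gs → Unique (support gs) →
          (length gs ≡ j ⊎ (length gs < j × (∀ (g : Gadget (W ∖ support gs)) → ¬ New (map δ gs) (δ g)))) → ⊥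
        next gs ch u (inj₂ (lt , stuck)) = k gs ch u (inj₂ (m≤n⇒m≤1+n lt , stuck))
        next gs ch u (inj₁ refl) = em {∃ λ (g : Gadget (W ∖ support gs)) → New (map δ gs) (δ g)} λ
          { (inj₁ (g , new)) → k (gadget-⊆ (∖⊆ W (support gs)) g ∷ gs) (new ∷ ch)
              (unique-++ (Gadget.distinct g) u (λ { (p , q) → proj₂ (∈-∖⁻ W (support gs) (Gadget.inside g p)) q })) (inj₁ refl)
          ; (inj₂ none) → k gs ch u (inj₂ (≤-refl , λ g new → none (g , new))) }

    -- The graph to be embedded and its far-apart balls.

    record SetupData : Set where
      field
        G : Defs.Graph
        Δ : ℕ
        1≤Δ : 1 ≤ Δ
        deg≤Δ : ∀ a → GraphSums.degree G a ≤ Δ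
        K₁ : ℕ
        sel : Balls.Selection G Δ 1≤Δ deg≤Δ K₁ d'
        annihilates : ∀ a → Defs.e G · a ≡ ε
        absent : ∀ (f : Fin (Defs.n G) → V) → Injective _≡_ _≡_ f → ∑ (Defs.edges G) (λ e → c (f (proj₁ e)) (f (proj₂ e))) ≡ ε → ⊥
        m≤ : m ≤ K₁ * length (Balls.Selection.vs sel)
        1≤n : 1 ≤ Defs.n G

    module Setup (setupData : SetupData) where
      open SetupData setupData
      open Defs.Graph G using (n; adj) renaming (sym to adj-sym)
      open GraphSums G
      open Balls G Δ 1≤Δ
      open Balls.Selection sel
      open EdgeSums isCommutativeMonoid

      Edges : List (VG × VG)
      Edges = Defs.edges G

      weight : (VG → V) → VG × VG → A
      weight f e = c (f (proj₁ e)) (f (proj₂ e))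

      copy : (VG → V) → A
      copy f = ∑ Edges (weight f)

      k : ℕ
      k = length vs

      touch : VG → VG × VG → Bool
      touch v e = (proj₁ e ∈ᵇ N[ v ]) ∨ (proj₂ e ∈ᵇ N[ v ])

      N-unique : ∀ a → Unique N[ a ]
      N-unique a = unique-cons (λ h → adj⇒≢ (∈-nbrs⁻ h) refl) (nbrs-unique a)

      k≤n : k ≤ n
      k≤n = ≤-trans (unique-⊆-length vs-unique (λ {a} _ → ∈-allFin a)) (≤-reflexive (length-tabulate {n = n} id))

      touch⁻ : ∀ {v a b} → touch v (a , b) ≡ true → a ∈ N[ v ] ⊎ b ∈ N[ v ]
      touch⁻ {v} {a} {b} h with ∨-elim {a ∈ᵇ N[ v ]} h
      ... | inj₁ p = inj₁ (∈ᵇ⇒∈ {R = N[ v ]} p)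
      ... | inj₂ p = inj₂ (∈ᵇ⇒∈ {R = N[ v ]} p)

      touch⁺ˡ : ∀ {v a b} → a ∈ N[ v ] → touch v (a , b) ≡ true
      touch⁺ˡ {v} {a} {b} h rewrite ∈⇒∈ᵇ {R = N[ v ]} h = refl

      touch-sym : ∀ v a b → touch v (a , b) ≡ touch v (b , a)
      touch-sym v a b = ∨-comm (a ∈ᵇ N[ v ]) (b ∈ᵇ N[ v ])

      ∑-pick : ∀ {X : Set} (xs : List X) (q : X → Bool) (F : X → A) {x₀} → Unique xs → x₀ ∈ xs → q x₀ ≡ true → (∀ {x} → x ∈ xs → q x ≡ true → x ≡ x₀) →
        ∑ xs (λ x → if q x then F x else ε) ≡ F x₀
      ∑-pick (x ∷ xs) q F (x∉ ∷ u) (here refl) qx only rewrite qx = trans (cong (F x ∙_) (∑-ε xs zero')) (∙-idʳ _)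
        where
          zero' : ∀ {y} → y ∈ xs → (if q y then F y else ε) ≡ ε
          zero' {y} y∈ with q y in eq
          ... | false = refl
          ... | true = ⊥-elim (lookupAll x∉ y∈ (sym (only (there y∈) eq)))
      ∑-pick (x ∷ xs) q F (x∉ ∷ u) (there x₀∈) qx₀ only with q x in eq
      ... | true = ⊥-elim (lookupAll x∉ x₀∈ (only (here refl) eq))
      ... | false = trans (∙-idˡ _) (∑-pick xs q F u x₀∈ qx₀ (only ∘ there))

      -- The vertices outside all balls; in the constant case their hosts are fixed before anything
      -- is moved.
      Z : List VG
      Z = allFin n ∖ concatMap N[_] vs

      Z-unique : Unique Z
      Z-unique = ∖-unique (concatMap N[_] vs) (allFin⁺ n)

      ∈-Z⊎ : ∀ a → a ∈ Z ⊎ ∃ λ v → v ∈ vs × a ∈ N[ v ]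
      ∈-Z⊎ a with mem? _≟_ a (concatMap N[_] vs)
      ... | yes p = inj₂ (find (∈-concatMap⁻ N[_] {xs = vs} p))
      ... | no ¬p = inj₁ (∈-∖⁺ {R = concatMap N[_] vs} (∈-allFin a) ¬p)

      Z-disjoint : ∀ {a v} → v ∈ vs → a ∈ N[ v ] → a ∉ Z
      Z-disjoint v∈ a∈ h = proj₂ (∈-∖⁻ (allFin n) (concatMap N[_] vs) h) (∈-concatMap⁺ N[_] (lose v∈ a∈))

      same-ball : ∀ {v v' a} → v ∈ vs → v' ∈ vs → a ∈ N[ v ] → a ∈ N[ v' ] → v' ≡ v
      same-ball {v} {v'} v∈ v'∈ p q with v' ≟ v
      ... | yes e = e
      ... | no ne = ⊥-elim (proj₁ (vs-far v'∈ v∈ ne q p) refl)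

      adjacent-ball : ∀ {v v' a b} → v ∈ vs → v' ∈ vs → a ∈ N[ v ] → b ∈ N[ v' ] → adj a b ≡ true → v' ≡ v
      adjacent-ball {v} {v'} {a} {b} v∈ v'∈ p q h with v' ≟ v
      ... | yes e = e
      ... | no ne = ⊥-elim (T⇒F⇒⊥ (trans (adj-sym b a) h) (proj₂ (vs-far v'∈ v∈ ne q p)))

      -- An edge leaving a ball ends in `Z`. The edges at one ball therefore have a sum that ignores
      -- where the other balls are placed.
      near-ball : ∀ {v a b} → v ∈ vs → a ∈ N[ v ] → adj a b ≡ true → b ∈ N[ v ] ⊎ b ∈ Z
      near-ball {v} {a} {b} v∈ p h with ∈-Z⊎ b
      ... | inj₁ z = inj₂ z
      ... | inj₂ (v' , v'∈ , q) = inj₁ (subst (λ w → b ∈ N[ w ]) (adjacent-ball v∈ v'∈ p q h) q)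

      touch-unique : ∀ {v v' e} → v ∈ vs → v' ∈ vs → e ∈ Edges → touch v e ≡ true → touch v' e ≡ true → v' ≡ v
      touch-unique {v} {v'} {a , b} v∈ v'∈ e∈ p q with touch⁻ {v} {a} {b} p | touch⁻ {v'} {a} {b} q
      ... | inj₁ x | inj₁ y = same-ball v∈ v'∈ x y
      ... | inj₂ x | inj₂ y = same-ball v∈ v'∈ x y
      ... | inj₁ x | inj₂ y = adjacent-ball v∈ v'∈ x y (edge⇒adj e∈)
      ... | inj₂ x | inj₁ y = adjacent-ball v∈ v'∈ x y (trans (adj-sym b a) (edge⇒adj e∈))

      untouched : VG × VG → Bool
      untouched e = not (does (anyL? (λ v → touch v e ≟ᵇ true) vs))

      Opt : Set
      Opt = V × List V

      verts : Opt → List V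
      verts (x , us) = x ∷ us

      open BoundedConstants Δ 1≤Δ d K₁ using (ℓ; L; φ; B; 2+d≤φ; Kc; X; Cm; reserve; CA)

      -- Colourings that are constant modulo J

      record PlacementData : Set where
        field
          U₁ : List V
          uU₁ : Unique U₁
          z : VG → V
          zl : List V
          z-map : map z Z ≡ zl
          zl-unique : Unique zl
          U₁-zl : Disjoint U₁ zl

      module Placement (placementData : PlacementData) where
        open PlacementData placementData

        Valid : VG → Opt → Set
        Valid v o = v ∈ vs × length (proj₂ o) ≡ d × verts o ⊆ U₁

        place : VG → Opt → VG → V
        place v o = overlay z N[ v ] (verts o)

        val : VG → Opt → A
        val v o = ∑ (fil (touch v) Edges) (weight (place v o))

        length-N : ∀ {v o} → Valid v o → length N[ v ] ≡ length (verts o)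
        length-N (v∈ , len , _) = cong suc (trans (vs-degree v∈) (sym len))

        module Final (ps : List (VG × Opt)) (valid : All (λ p → Valid (proj₁ p) (proj₂ p)) ps) (ps-unique : Unique (map proj₁ ps))
          (ps-vs : ∀ {v} → v ∈ vs → v ∈ map proj₁ ps) (distinct : Unique (concatMap (verts ∘ proj₂) ps)) where
          gl : List (VG × Opt) → List VG
          gl = concatMap (λ p → N[ proj₁ p ])
          hl : List (VG × Opt) → List V
          hl = concatMap (λ p → verts (proj₂ p))

          f : VG → V
          f = overlay z (gl ps) (hl ps)

          f-local : ∀ qs → All (λ p → Valid (proj₁ p) (proj₂ p)) qs → Unique (map proj₁ qs) → ∀ {v o} → (v , o) ∈ qs → ∀ {a} → a ∈ N[ v ] → overlay z (gl qs) (hl qs) a ≡ place v o a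
          f-local (q ∷ qs) (w ∷ ws) u (here refl) a∈ = overlay-++ˡ z z N[ proj₁ q ] (verts (proj₂ q)) (length-N w) a∈
          f-local (q ∷ qs) (w ∷ ws) (u ∷ us) (there p∈) {a} a∈ = trans (overlay-++ʳ z N[ proj₁ q ] (verts (proj₂ q)) (length-N w)
            (λ a∈' → lookupAll u (∈-map⁺ proj₁ p∈) (same-ball (proj₁ (lookupAll ws p∈)) (proj₁ w) a∈ a∈'))) (f-local qs ws us p∈ a∈)

          ∉gl : ∀ qs → All (λ p → Valid (proj₁ p) (proj₂ p)) qs → ∀ {a} → a ∈ Z → a ∉ gl qs
          ∉gl qs ws a∈ h with find (∈-concatMap⁻ (λ p → N[ proj₁ p ]) {xs = qs} h)
          ... | p , p∈ , a∈' = Z-disjoint (proj₁ (lookupAll ws p∈)) a∈' a∈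

          f-Z : ∀ {a} → a ∈ Z → f a ≡ z a
          f-Z a∈ = overlay-∉ z (gl ps) (hl ps) (∉gl ps valid a∈)

          place-Z : ∀ {v o a} → v ∈ vs → a ∈ Z → place v o a ≡ z a
          place-Z {v} {o} v∈ a∈ = overlay-∉ z N[ v ] (verts o) (λ h → Z-disjoint v∈ h a∈)

          f-edge : ∀ {v o a b} → (v , o) ∈ ps → adj a b ≡ true → touch v (a , b) ≡ true → weight f (a , b) ≡ weight (place v o) (a , b)
          f-edge {v} {o} {a} {b} p∈ h th with touch⁻ {v} {a} {b} th
          ... | inj₁ a∈ = cong₂ c (f-local ps valid ps-unique p∈ a∈) (other (near-ball v∈ a∈ h))
            where
              v∈ = proj₁ (lookupAll valid p∈)
              other : ∀ {b} → b ∈ N[ v ] ⊎ b ∈ Z → f b ≡ place v o b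
              other (inj₁ q) = f-local ps valid ps-unique p∈ q
              other (inj₂ q) = trans (f-Z q) (sym (place-Z {v} {o} v∈ q))
          ... | inj₂ b∈ = cong₂ c (other (near-ball v∈ b∈ (trans (adj-sym b a) h))) (f-local ps valid ps-unique p∈ b∈)
            where
              v∈ = proj₁ (lookupAll valid p∈)
              other : ∀ {b} → b ∈ N[ v ] ⊎ b ∈ Z → f b ≡ place v o b
              other (inj₁ q) = f-local ps valid ps-unique p∈ q
              other (inj₂ q) = trans (f-Z q) (sym (place-Z {v} {o} v∈ q))

          ps-Unique : ∀ (qs : List (VG × Opt)) → Unique (map proj₁ qs) → Unique qs
          ps-Unique qs u = unique-map⁻ u

          pointwise : ∀ {e} → e ∈ Edges → weight f e ≡ (if untouched e then weight z e else ε) ∙ ∑ ps (λ p → if touch (proj₁ p) e then weight (place (proj₁ p) (proj₂ p)) e else ε)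
          pointwise {e@(a , b)} e∈ with anyL? (λ v → touch v e ≟ᵇ true) vs
          ... | yes any with find any
          ...   | v , v∈ , th with ∈-map⁻ proj₁ (ps-vs v∈)
          ...     | (.v , o) , p∈ , refl = sym (trans (∙-idˡ _) (trans (∑-pick ps (λ p → touch (proj₁ p) e) (λ p → weight (place (proj₁ p) (proj₂ p)) e) (ps-Unique ps ps-unique) p∈ th
                    (λ {q} q∈ th' → unique-map-injective proj₁ ps-unique q∈ p∈ (touch-unique {e = e} v∈ (proj₁ (lookupAll valid q∈)) e∈ th th'))) (sym (f-edge p∈ (edge⇒adj e∈) th))))
          pointwise {e@(a , b)} e∈ | no none = trans (cong₂ c (in-Z a (λ v a∈ → touch⁺ˡ {v} {a} {b} a∈)) (in-Z b (λ v b∈ → trans (touch-sym v a b) (touch⁺ˡ {v} {b} {a} b∈))))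
                (sym (trans (cong (weight z e ∙_) (∑-ε ps (λ {p} p∈ → cong (λ q → if q then weight (place (proj₁ p) (proj₂ p)) e else ε) (¬T⇒F (λ th → none (lose (proj₁ (lookupAll valid p∈)) th)))))) (∙-idʳ _)))
            where
              in-Z : ∀ a → (∀ v → a ∈ N[ v ] → touch v e ≡ true) → f a ≡ z a
              in-Z a h with ∈-Z⊎ a
              ... | inj₁ q = f-Z q
              ... | inj₂ (v , v∈ , a∈) = ⊥-elim (none (lose v∈ (h v a∈)))

          -- No edge meets two balls, so the sum splits into a part that never changes and one value
          -- per ball.
          copy-f : copy f ≡ ∑ (fil untouched Edges) (weight z) ∙ ∑ ps (λ p → val (proj₁ p) (proj₂ p))
          copy-f = begin
            ∑ Edges (weight f) ≡⟨ ∑-cong Edges pointwise ⟩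
            ∑ Edges (λ e → (if untouched e then weight z e else ε) ∙ ∑ ps (λ p → if touch (proj₁ p) e then weight (place (proj₁ p) (proj₂ p)) e else ε)) ≡⟨ ∑-∙ Edges _ _ ⟩
            ∑ Edges (λ e → if untouched e then weight z e else ε) ∙ ∑ Edges (λ e → ∑ ps (λ p → if touch (proj₁ p) e then weight (place (proj₁ p) (proj₂ p)) e else ε)) ≡⟨ cong₂ _∙_ (sym (∑-fil untouched Edges (weight z))) (∑-swap Edges ps _) ⟩
            ∑ (fil untouched Edges) (weight z) ∙ ∑ ps (λ p → ∑ Edges (λ e → if touch (proj₁ p) e then weight (place (proj₁ p) (proj₂ p)) e else ε)) ≡⟨ cong (∑ (fil untouched Edges) (weight z) ∙_) (∑-cong ps (λ {p} _ → sym (∑-fil (touch (proj₁ p)) Edges (weight (place (proj₁ p) (proj₂ p)))))) ⟩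
            ∑ (fil untouched Edges) (weight z) ∙ ∑ ps (λ p → val (proj₁ p) (proj₂ p)) ∎
            where open ≡-Reasoning

          length-gl : ∀ qs → All (λ p → Valid (proj₁ p) (proj₂ p)) qs → length (gl qs) ≡ length (hl qs)
          length-gl [] [] = refl
          length-gl (q ∷ qs) (w ∷ ws) = trans (length-++ N[ proj₁ q ]) (trans (cong₂ _+_ (length-N w) (length-gl qs ws)) (sym (length-++ (verts (proj₂ q)))))

          gl-unique : Unique (gl ps)
          gl-unique = unique-concatMap (λ p → N[ proj₁ p ]) ps (ps-Unique ps ps-unique) (λ p → N-unique (proj₁ p))
            (λ {p} {q} p∈ q∈ ne a b → ne (unique-map-injective proj₁ ps-unique p∈ q∈ (same-ball (proj₁ (lookupAll valid q∈)) (proj₁ (lookupAll valid p∈)) b a)))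

          hl⊆ : ∀ {x} → x ∈ hl ps → x ∈ U₁
          hl⊆ h with find (∈-concatMap⁻ (λ p → verts (proj₂ p)) {xs = ps} h)
          ... | p , p∈ , x∈ = proj₂ (proj₂ (lookupAll valid p∈)) x∈

          map-f : map f (gl ps ++ Z) ≡ hl ps ++ zl
          map-f = trans (map-++ f (gl ps) Z) (cong₂ _++_ (map-overlay z (gl ps) (hl ps) (length-gl ps valid) gl-unique)
            (trans (map-cong-local (tabAll {xs = Z} (λ a∈ → f-Z a∈))) z-map))

          covers : ∀ a → a ∈ gl ps ++ Z
          covers a with ∈-Z⊎ a
          ... | inj₁ q = ∈-++⁺ʳ (gl ps) q
          ... | inj₂ (v , v∈ , a∈) with ∈-map⁻ proj₁ (ps-vs v∈)
          ...   | p , p∈ , refl = ∈-++⁺ˡ (∈-concatMap⁺ (λ p → N[ proj₁ p ]) (lose p∈ a∈))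

          f-injective : Injective _≡_ _≡_ f
          f-injective {a} {b} e = unique-map-injective f {gl ps ++ Z} (subst Unique (sym map-f) (unique-++ distinct zl-unique (λ { (p , q) → U₁-zl (hl⊆ p , q) }))) (covers a) (covers b) e

          f-range : ∀ a → f a ∈ U₁ ⊎ f a ∈ zl
          f-range a with ∈-++⁻ (hl ps) (subst (f a ∈_) map-f (∈-map⁺ f (covers a)))
          ... | inj₁ p = inj₁ (hl⊆ p)
          ... | inj₂ p = inj₂ p

        -- Only the host of `v` differs, so `star` reduces the change to the edges at `v`, whose
        -- other ends sit on `us`.
        val-δ : ∀ {v x y us} → v ∈ vs → length us ≡ d → val v (x , us) ≡ val v (y , us) ∙ (∑ us (c x) ∙ ∑ us (c y) ⁻¹)
        val-δ {v} {x} {y} {us} v∈ len = ∙-cancelʳ (val v (y , us) ⁻¹) (begin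
          val v (x , us) ∙ val v (y , us) ⁻¹ ≡⟨ cong (val v (x , us) ∙_) (sym (∑-⁻¹ (fil (touch v) Edges) (weight fy))) ⟩
          val v (x , us) ∙ ∑ (fil (touch v) Edges) (λ e → weight fy e ⁻¹) ≡⟨ sym (∑-∙ (fil (touch v) Edges) (weight fx) (λ e → weight fy e ⁻¹)) ⟩
          ∑ (fil (touch v) Edges) (λ e → weight fx e ∙ weight fy e ⁻¹) ≡⟨ ∑-fil (touch v) Edges (λ e → weight fx e ∙ weight fy e ⁻¹) ⟩
          ∑ Edges (λ e → D (proj₁ e) (proj₂ e)) ≡⟨ star v D D-sym D-supp ⟩
          ∑ (nbrs v) (D v) ≡⟨ ∑-cong (nbrs v) D-v ⟩
          ∑ (nbrs v) (λ w → c x (g w) ∙ c y (g w) ⁻¹) ≡⟨ trans (∑-∙ (nbrs v) (c x ∘ g) (λ w → c y (g w) ⁻¹)) (cong (∑ (nbrs v) (c x ∘ g) ∙_) (∑-⁻¹ (nbrs v) (c y ∘ g))) ⟩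
          ∑ (nbrs v) (c x ∘ g) ∙ ∑ (nbrs v) (c y ∘ g) ⁻¹ ≡⟨ cong₂ (λ p q → p ∙ q ⁻¹) (on-us x) (on-us y) ⟩
          ∑ us (c x) ∙ ∑ us (c y) ⁻¹ ≡⟨ solveG (val v (y , us) ∷ᵛ (∑ us (c x) ∙ ∑ us (c y) ⁻¹) ∷ᵛ []ᵛ) v1 (v0 ⊕ v1 ⊕ ⊖ v0) refl ⟩
          val v (y , us) ∙ (∑ us (c x) ∙ ∑ us (c y) ⁻¹) ∙ val v (y , us) ⁻¹ ∎)
          where
            open ≡-Reasoning
            g fx fy : VG → V
            g = overlay z (nbrs v) us
            fx = place v (x , us)
            fy = place v (y , us)
            D : VG → VG → A
            D a b = if touch v (a , b) then weight fx (a , b) ∙ weight fy (a , b) ⁻¹ else ε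
            D-sym : ∀ a b → D a b ≡ D b a
            D-sym a b rewrite touch-sym v a b | c-sym (fx a) (fx b) | c-sym (fy a) (fy b) = refl
            D-supp : ∀ a b → adj a b ≡ true → a ≢ v → b ≢ v → D a b ≡ ε
            D-supp a b _ a≢ b≢ with touch v (a , b)
            ... | false = refl
            ... | true = trans (cong₂ (λ p q → c p q ∙ weight fy (a , b) ⁻¹) (trans (update-other g x a≢) (sym (update-other g y a≢))) (trans (update-other g x b≢) (sym (update-other g y b≢)))) (∙-invʳ _)
            D-v : ∀ {w} → w ∈ nbrs v → D v w ≡ c x (g w) ∙ c y (g w) ⁻¹
            D-v {w} w∈ rewrite touch⁺ˡ {v} {v} {w} (here refl) = cong₂ (λ p q → p ∙ q ⁻¹)
              (cong₂ c (update-same g v x) (update-other g x w≢)) (cong₂ c (update-same g v y) (update-other g y w≢))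
              where
                w≢ : w ≢ v
                w≢ e = adj⇒≢ (∈-nbrs⁻ w∈) (sym e)
            on-us : ∀ x → ∑ (nbrs v) (c x ∘ g) ≡ ∑ us (c x)
            on-us x = trans (sym (∑-map (nbrs v) g (c x))) (cong (λ l → ∑ l (c x)) (map-overlay z (nbrs v) us (trans (vs-degree v∈) (sym len)) (nbrs-unique v)))

        record ConstantData : Set where
          field
            J : Sub
            κ : A
            U₀ : List V
            const : ∀ {x y} → x ∈ U₀ → y ∈ U₀ → x ≢ y → c x y ∙ κ ⁻¹ ∈ₛ J
            U₁⊆ : U₁ ⊆ U₀
            zl⊆ : zl ⊆ U₀
            N₂ : ℕ
            IH : ∀ (H : Sub) → H ⊆ₛ J → ∀ {g} → g ∈ₛ J → mem H g ≡ false → ∀ W → Unique W → W ⊆ U₀ → N₂ ≤ length W → Confined (_∈ₛ H) W → ⊥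
            room : k * φ + φ + (N₂ + reserve n) ≤ length U₁

        -- Used vertices are put in front, so `done` is a reversed initial segment of `vs`.
        Order : List VG → List VG → Set
        Order done is = done ʳ++ is ≡ vs

        open Process (λ _ → verts) Valid val Order

        module Constant (constantData : ConstantData) where
          open ConstantData constantData

          kφ≤ : k * φ ≤ length U₁
          kφ≤ = ≤-trans (≤-trans (m≤m+n (k * φ) φ) (m≤m+n _ _)) room

          ∑-const-mod : ∀ (es : List (VG × VG)) f → (∀ {e} → e ∈ es → weight f e ∙ κ ⁻¹ ∈ₛ J) → ∑ es (weight f) ∙ (length es · κ) ⁻¹ ∈ₛ J
          ∑-const-mod es f h = subst (_∈ₛ J) (trans (∑-∙ es _ _) (cong (∑ es (weight f) ∙_) (trans (∑-⁻¹ es (λ _ → κ)) (cong _⁻¹ (∑-const es κ))))) (mem-∑ J es h)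

          -- Modulo `J` every edge has colour κ, so the value of a ball depends only on its number
          -- of edges. This makes unrelated places for the same ball comparable.
          val-const : ∀ {v o} → Valid v o → Unique (verts o) → val v o ∙ (length (fil (touch v) Edges) · κ) ⁻¹ ∈ₛ J
          val-const {v} {o} vo@(v∈ , len , o⊆) uo = ∑-const-mod (fil (touch v) Edges) (place v o) (λ e∈ → each (∈-fil⁻ Edges e∈))
            where
              map-place : map (place v o) (N[ v ] ++ Z) ≡ verts o ++ zl
              map-place = trans (map-++ (place v o) N[ v ] Z) (cong₂ _++_ (map-overlay z N[ v ] (verts o) (length-N vo) (N-unique v))
                (trans (map-cong-local (tabAll {xs = Z} (λ a∈ → overlay-∉ z N[ v ] (verts o) (λ h → Z-disjoint v∈ h a∈)))) z-map))
              inj : ∀ {a b} → a ∈ N[ v ] ++ Z → b ∈ N[ v ] ++ Z → place v o a ≡ place v o b → a ≡ b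
              inj = unique-map-injective (place v o) {N[ v ] ++ Z} (subst Unique (sym map-place) (unique-++ uo zl-unique (λ { (p , q) → U₁-zl (o⊆ p , q) })))
              range : ∀ {a} → a ∈ N[ v ] ++ Z → place v o a ∈ U₀
              range {a} a∈ with ∈-++⁻ (verts o) (subst (place v o a ∈_) map-place (∈-map⁺ (place v o) a∈))
              ... | inj₁ p = U₁⊆ (o⊆ p)
              ... | inj₂ p = zl⊆ p
              side : ∀ {b} → b ∈ N[ v ] ⊎ b ∈ Z → b ∈ N[ v ] ++ Z
              side (inj₁ p) = ∈-++⁺ˡ p
              side (inj₂ p) = ∈-++⁺ʳ N[ v ] p
              both : ∀ {a b} → adj a b ≡ true → a ∈ N[ v ] ⊎ b ∈ N[ v ] → a ∈ N[ v ] ++ Z × b ∈ N[ v ] ++ Z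
              both h (inj₁ p) = ∈-++⁺ˡ p , side (near-ball v∈ p h)
              both {a} {b} h (inj₂ p) = side (near-ball v∈ p (trans (adj-sym b a) h)) , ∈-++⁺ˡ p
              each : ∀ {e} → e ∈ Edges × touch v e ≡ true → weight (place v o) e ∙ κ ⁻¹ ∈ₛ J
              each {a , b} (e∈ , th) with both (edge⇒adj e∈) (touch⁻ {v} {a} {b} th)
              ... | p , q = const (range p) (range q) (λ eq → adj⇒≢ (edge⇒adj e∈) (inj p q eq))

          δ∈J : ∀ {W} → W ⊆ U₀ → (g : Gadget W) → δ g ∈ₛ J
          δ∈J W⊆ g with Gadget.distinct g
          ... | (_ ∷ x∉) ∷ (y∉ ∷ _) = subst (_∈ₛ J) (trans (∑-∙ us (c x) (λ u → c y u ⁻¹)) (cong (∑ us (c x) ∙_) (∑-⁻¹ us (c y))))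
              (mem-∑ J us {λ u → c x u ∙ c y u ⁻¹} (λ {u} u∈ → subst (_∈ₛ J) (solveG (c x u ∷ᵛ c y u ∷ᵛ κ ∷ᵛ []ᵛ) (v0 ⊕ ⊖ v2 ⊕ ⊖ (v1 ⊕ ⊖ v2)) (v0 ⊕ ⊖ v1) refl)
                (mem-∙⁻¹ J (const (in0 (here refl)) (in0 (there (there u∈))) (lookupAll x∉ u∈)) (const (in0 (there (here refl))) (in0 (there (there u∈))) (lookupAll y∉ u∈)))))
            where
              open Gadget g
              in0 : ∀ {w} → w ∈ x ∷ y ∷ us → w ∈ U₀
              in0 h = W⊆ (inside h)

          lo hi : ∀ {W} → Gadget W → Opt
          lo g = Gadget.y g , Gadget.us g
          hi g = Gadget.x g , Gadget.us g

          options : ∀ {W} → Gadget W → List Opt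
          options g = lo g ∷ hi g ∷ []

          hi-lo : ∀ {W v} → v ∈ vs → (g : Gadget W) → val v (hi g) ≡ val v (lo g) ∙ δ g
          hi-lo {v = v} v∈ g = val-δ {v} {Gadget.x g} {Gadget.y g} {Gadget.us g} v∈ (Gadget.us-length g)

          option-ok : ∀ {W v} → W ⊆ U₁ → v ∈ vs → (g : Gadget W) → ∀ {o} → o ∈ options g → Valid v o × Unique (verts o) × verts o ⊆ vertices g
          option-ok {W} {v} W⊆ v∈ g o∈ with Gadget.distinct g
          option-ok {W} {v} W⊆ v∈ g (here refl) | _ ∷ u = (v∈ , Gadget.us-length g , λ h → W⊆ (Gadget.inside g (there h))) , u , there
          option-ok {W} {v} W⊆ v∈ g (there (here refl)) | (_ ∷ x∉) ∷ (_ ∷ u) = (v∈ , Gadget.us-length g , λ h → W⊆ (Gadget.inside g (skip h))) , x∉ ∷ u , skip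
            where
              skip : ∀ {w} → w ∈ Gadget.x g ∷ Gadget.us g → w ∈ vertices g
              skip (here e) = here e
              skip (there h) = there (there h)

          ∈-options : ∀ {W} (gs : List (Gadget W)) {o} → o ∈ concatMap options gs → ∃ λ g → g ∈ gs × o ∈ options g
          ∈-options gs h = find (∈-concatMap⁻ options {xs = gs} h)

          -- Each gadget contributes both of its ends, with the neighbours of `v` on its own `us`.
          -- By `val-const` even options from different gadgets differ by elements of `J`.
          gadget-unit : ∀ {φ F v} → v ∈ vs → (g₀ : Gadget (U₁ ∖ F)) (gs : List (Gadget (U₁ ∖ F))) → length (g₀ ∷ gs) * (2 + d) ≤ φ → Unit J φ F v
          gadget-unit {φ} {F} {v} v∈ g₀ gs le = record
            { label = v ; advance = id ; o₀ = lo g₀ ; os = hi g₀ ∷ concatMap options gs ; F' = support (g₀ ∷ gs)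
            ; F'-size = ≤-trans (≤-reflexive (support-length (g₀ ∷ gs))) le
            ; F'-disjoint = λ { (p , q) → proj₂ (∈-∖⁻ U₁ F (support-⊆ (g₀ ∷ gs) p)) q }
            ; ok = ok' ; diff = diff' }
            where
              ok' : ∀ {o} → o ∈ concatMap options (g₀ ∷ gs) → Valid v o × Unique (verts o) × verts o ⊆ support (g₀ ∷ gs)
              ok' o∈ with ∈-options (g₀ ∷ gs) o∈
              ... | g , g∈ , o∈g with option-ok (∖⊆ U₁ F) v∈ g o∈g
              ...   | a , b , e = a , b , λ h → ∈-concatMap⁺ vertices (lose g∈ (e h))
              diff' : ∀ {o} → o ∈ concatMap options (g₀ ∷ gs) → val v o ∙ val v (lo g₀) ⁻¹ ∈ₛ J
              diff' {o} o∈ with ok' o∈ | ok' (here refl)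
              ... | a , b , _ | a' , b' , _ = subst (_∈ₛ J) (solveG (val v o ∷ᵛ val v (lo g₀) ∷ᵛ (length (fil (touch v) Edges) · κ) ∷ᵛ []ᵛ) (v0 ⊕ ⊖ v2 ⊕ ⊖ (v1 ⊕ ⊖ v2)) (v0 ⊕ ⊖ v1) refl)
                    (mem-∙⁻¹ J (val-const a b) (val-const a' b'))

          gadget-unit-two : ∀ {φ F v} (v∈ : v ∈ vs) (g₀ : Gadget (U₁ ∖ F)) (le : 1 * (2 + d) ≤ φ) (H : Sub) → mem H (δ g₀) ≡ false →
            2 * size (mem H) ≤ size (Unit.saturation (gadget-unit {φ} {F} {v} v∈ g₀ [] le) H)
          gadget-unit-two {φ} {F} {v} v∈ g₀ le H h = two-cosets (gadget-unit {φ} {F} {v} v∈ g₀ [] le) H (there (here refl))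
            (trans (cong (mem H) (trans (cong (_∙ val v (lo g₀) ⁻¹) (hi-lo v∈ g₀)) (solveG (val v (lo g₀) ∷ᵛ δ g₀ ∷ᵛ []ᵛ) (v0 ⊕ v1 ⊕ ⊖ v0) v1 refl))) h)

          Fresh : Sub → List A → A → Set
          Fresh H ds a = All (λ b → mem H (a ∙ b ⁻¹) ≡ false) ds

          chain-atMost1 : ∀ {W} (H : Sub) (gs : List (Gadget W)) → Chain (Fresh H) gs → ∀ (p : Gadget W → Bool) → (∀ {g g'} → p g ≡ true → p g' ≡ true → δ g ∙ δ g' ⁻¹ ∈ₛ H) → sumN gs (b2n ∘ p) ≤ 1
          chain-atMost1 H [] [] p h = z≤n
          chain-atMost1 H (g ∷ gs) (new ∷ ch) p h with p g in eq
          ... | false = chain-atMost1 H gs ch p h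
          ... | true = ≤-reflexive (cong suc (sumN-0 gs (λ {g'} g'∈ → cong b2n (¬T⇒F (λ q → T⇒F⇒⊥ (h eq q) (lookupAll new (∈-map⁺ δ g'∈)))))))

          gadget-unit-square : ∀ {φ F v} (v∈ : v ∈ vs) (g₀ : Gadget (U₁ ∖ F)) (gs : List (Gadget (U₁ ∖ F))) (le : length (g₀ ∷ gs) * (2 + d) ≤ φ) (H : Sub) → Chain (Fresh H) (g₀ ∷ gs) →
            length (g₀ ∷ gs) * (size (mem H) * size (mem H)) ≤ size (Unit.saturation (gadget-unit {φ} {F} {v} v∈ g₀ gs le) H) * size (Unit.saturation (gadget-unit {φ} {F} {v} v∈ g₀ gs le) H)
          gadget-unit-square {φ} {F} {v} v∈ g₀ gs le H ch = square-bound (gadget-unit {φ} {F} {v} v∈ g₀ gs le) H {Gadget (U₁ ∖ F)} (g₀ ∷ gs) lo hi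
            (λ {x} g∈ → member {x} g∈ (here refl) , member {x} g∈ (there (here refl)))
            (λ p h → chain-atMost1 H (g₀ ∷ gs) ch p (λ {g} {g'} a b → subst (_∈ₛ H) (cong₂ (λ y w → y ∙ w ⁻¹) (d≡ g) (d≡ g')) (h a b)))
            where
              member : ∀ {g : Gadget (U₁ ∖ F)} {o} → g ∈ g₀ ∷ gs → o ∈ options g → o ∈ lo g₀ ∷ hi g₀ ∷ concatMap options gs
              member g∈ o∈ = ∈-concatMap⁺ options {xs = g₀ ∷ gs} (lose g∈ o∈)
              d≡ : ∀ (g : Gadget (U₁ ∖ F)) → val v (hi g) ∙ val v (lo g) ⁻¹ ≡ δ g
              d≡ g = trans (cong (_∙ val v (lo g) ⁻¹) (hi-lo v∈ g)) (solveG (val v (lo g) ∷ᵛ δ g ∷ᵛ []ᵛ) (v0 ⊕ v1 ⊕ ⊖ v0) v1 refl)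

          -- The remaining balls go anywhere. A completed copy has sum in `J`, since e(G) · κ
          -- vanishes, so the correction still required lies in `J` and can be realised.
          finish : ∀ is done F s → done ʳ++ is ≡ vs → length F ≤ length done * φ → k * φ ≤ length U₁ → (∀ {g} → g ∈ₛ J → Real done F (s ∙ g)) → ⊥
          finish [] done F s order _ _ real = absent F₁.f F₁.f-injective (trans (F₁.copy-f) (trans (cong (base ∙_) R₁.total) (solveG (base ∷ᵛ s ∷ᵛ []ᵛ) (v0 ⊕ (v1 ⊕ ⊖ (v0 ⊕ v1))) 𝟎 refl)))
            where
              base : A
              base = ∑ (fil untouched Edges) (weight z)
              u-done : Unique done
              u-done = proj₁ (unique-ʳ++ done (subst Unique (sym order) vs-unique))
              in-done : ∀ {v} → v ∈ vs → v ∈ done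
              in-done {v} v∈ with ∈-ʳ++ done (subst (v ∈_) (sym order) v∈)
              ... | inj₁ p = p
              module FinalOf {g : A} (r : Real done F g) = Final (Real.choice r) (Real.valid r) (subst Unique (sym (Real.indices r)) u-done)
                (λ {v} v∈ → subst (v ∈_) (sym (Real.indices r)) (in-done v∈)) (Real.distinct r)
              module R₀ = Real (real (mem-ε J))
              module F₀ = FinalOf (real (mem-ε J))
              range : ∀ a → F₀.f a ∈ U₀
              range a with F₀.f-range a
              ... | inj₁ p = U₁⊆ p
              ... | inj₂ p = zl⊆ p
              base∈ : base ∙ s ∈ₛ J
              base∈ = subst (_∈ₛ J) (trans (cong₂ (λ x y → x ∙ y ⁻¹) (trans F₀.copy-f (cong (base ∙_) R₀.total)) (annihilates κ)) (solveG (base ∷ᵛ s ∷ᵛ []ᵛ) ((v0 ⊕ (v1 ⊕ 𝟎)) ⊕ ⊖ 𝟎) (v0 ⊕ v1) refl))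
                (∑-const-mod Edges F₀.f (λ {e} e∈ → const (range (proj₁ e)) (range (proj₂ e)) (λ eq → adj⇒≢ (edge⇒adj e∈) (F₀.f-injective eq))))
              module R₁ = Real (real (mem-⁻¹ J base∈))
              module F₁ = FinalOf (real (mem-⁻¹ J base∈))
          finish (i ∷ is) done F s order F-size big real = go (freshes F (1 + d) uU₁ space)
            where
              open ≤-Reasoning
              count : length done + suc (length is) ≡ k
              count = trans (sym (length-ʳ++ done)) (cong length order)
              space : length F + (1 + d) ≤ length U₁
              space = begin
                length F + (1 + d) ≤⟨ +-mono-≤ F-size (≤-trans (n≤1+n (1 + d)) 2+d≤φ) ⟩
                length done * φ + φ ≡⟨ +-comm (length done * φ) φ ⟩
                suc (length done) * φ ≤⟨ *-monoˡ-≤ φ (≤-trans (m≤m+n (suc (length done)) (length is)) (≤-reflexive (trans (sym (+-suc (length done) (length is))) count))) ⟩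
                k * φ ≤⟨ big ⟩
                length U₁ ∎
              i∈ : i ∈ vs
              i∈ = subst (i ∈_) order (∈-ʳ++⁺ʳ done (here refl))
              go : (∃ λ us → length us ≡ 1 + d × Unique us × us ⊆ U₁ × Disjoint us F) → ⊥
              go (x ∷ us , len , u , us⊆ , dis) = finish is (i ∷ done) ((x ∷ us) ++ F) (s ∙ val i (x , us)) order
                (≤-trans (≤-reflexive (trans (length-++ (x ∷ us)) (cong (_+ length F) len))) (+-mono-≤ (≤-trans (n≤1+n (1 + d)) 2+d≤φ) F-size)) big
                (λ {g} g∈ → subst (Real (i ∷ done) ((x ∷ us) ++ F)) (solveG (val i (x , us) ∷ᵛ s ∷ᵛ g ∷ᵛ []ᵛ) (v0 ⊕ (v1 ⊕ v2)) (v1 ⊕ v0 ⊕ v2) refl)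
                  (real-∷ (i∈ , suc-injective len , us⊆) u id dis (real g∈)))

          -- `suc o` is any positive multiple of the order of `a`. Using only the multiples below it
          -- makes membership decidable and asks for no more than `o` gadgets with difference `a`.
          adjoin : (H : Sub) (a : A) (o : ℕ) → suc o · a ≡ ε → Sub
          adjoin H a o oa = record { mem = λ g → does (in? g) ; mem-ε = does⁺ (in? ε) (fzero , subst (_∈ₛ H) (solveG []ᵛ 𝟎 (𝟎 ⊕ ⊖ 𝟎) refl) (mem-ε H)) ; mem-∙ = λ {g} {g'} p q → does⁺ (in? (g ∙ g')) (sum g g' (does⁻ (in? g) p) (does⁻ (in? g') q)) }
            where
              in? : (g : A) → Dec (∃ λ (i : Fin (suc o)) → g ∙ (toℕ i · a) ⁻¹ ∈ₛ H)
              in? g = any? (λ i → mem H (g ∙ (toℕ i · a) ⁻¹) ≟ᵇ true)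
              reduce : ∀ j → j · a ≡ (j % suc o) · a
              reduce j = begin
                j · a ≡⟨ cong (_· a) (m≡m%n+[m/n]*n j (suc o)) ⟩
                (j % suc o + j / suc o * suc o) · a ≡⟨ ·-+ (j % suc o) _ a ⟩
                (j % suc o) · a ∙ (j / suc o * suc o) · a ≡⟨ cong ((j % suc o) · a ∙_) (trans (·-* (j / suc o) (suc o) a) (trans (cong ((j / suc o) ·_) oa) (·-ε (j / suc o)))) ⟩
                (j % suc o) · a ∙ ε ≡⟨ ∙-idʳ _ ⟩
                (j % suc o) · a ∎
                where open ≡-Reasoning
              sum : ∀ g g' → (∃ λ (i : Fin (suc o)) → g ∙ (toℕ i · a) ⁻¹ ∈ₛ H) → (∃ λ (i : Fin (suc o)) → g' ∙ (toℕ i · a) ⁻¹ ∈ₛ H) → ∃ λ (i : Fin (suc o)) → g ∙ g' ∙ (toℕ i · a) ⁻¹ ∈ₛ H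
              sum g g' (i , p) (j , q) = fromℕ< (m%n<n (toℕ i + toℕ j) (suc o)) , subst (_∈ₛ H)
                (trans (solveG (g ∷ᵛ g' ∷ᵛ toℕ i · a ∷ᵛ toℕ j · a ∷ᵛ []ᵛ) ((v0 ⊕ ⊖ v2) ⊕ (v1 ⊕ ⊖ v3)) (v0 ⊕ v1 ⊕ ⊖ (v2 ⊕ v3)) refl)
                  (cong (λ w → g ∙ g' ∙ w ⁻¹) (trans (sym (·-+ (toℕ i) (toℕ j) a)) (trans (reduce (toℕ i + toℕ j)) (cong (_· a) (sym (toℕ-fromℕ< (m%n<n (toℕ i + toℕ j) (suc o)))))))))
                (mem-∙ H p q)

          adjoin⁻ : ∀ {H a o oa g} → g ∈ₛ adjoin H a o oa → ∃ λ (i : Fin (suc o)) → g ∙ (toℕ i · a) ⁻¹ ∈ₛ H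
          adjoin⁻ {H} {a} {o} {oa} {g} h = does⁻ (any? (λ (i : Fin (suc o)) → mem H (g ∙ (toℕ i · a) ⁻¹) ≟ᵇ true)) h

          adjoin⁺ : ∀ {H a o oa g} (j : ℕ) → j < suc o → g ∙ (j · a) ⁻¹ ∈ₛ H → g ∈ₛ adjoin H a o oa
          adjoin⁺ {H} {a} {o} {oa} {g} j j< h = does⁺ (any? (λ (i : Fin (suc o)) → mem H (g ∙ (toℕ i · a) ⁻¹) ≟ᵇ true)) (fromℕ< j< , subst (λ i → g ∙ (i · a) ⁻¹ ∈ₛ H) (sym (toℕ-fromℕ< j<)) h)

          -- `j` counts the gadgets with difference `a` built in so far; between two rounds `a` is ε
          -- and `j` is 0.
          record Cover (is : List VG) (H : Sub) (a : A) (j : ℕ) : Set where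
            field
              done : List VG
              order : done ʳ++ is ≡ vs
              F : List V
              s : A
              F-size : length F ≤ length done * φ
              real : ∀ {h i} → h ∈ₛ H → i ≤ j → Real done F (s ∙ h ∙ i · a)

          add-gadgets : ∀ {W} → W ⊆ U₁ → ∀ {H a} is (gs : List (Gadget W)) j → (C : Cover is H a j) → length gs ≤ length is → (∀ {g} → g ∈ gs → δ g ≡ a) → Unique (support gs) → Disjoint (support gs) (Cover.F C) →
            ∃ λ is' → length is ≡ length gs + length is' × Σ (Cover is' H a (length gs + j)) λ C' → ∀ {x} → x ∈ Cover.F C' → x ∈ Cover.F C ⊎ x ∈ support gs
          add-gadgets W⊆ is [] j C _ _ _ _ = is , refl , C , inj₁
          add-gadgets {W} W⊆ {H} {a} (i ∷ is) (g ∷ gs) j C (s≤s le) eqs u dis with add-gadgets W⊆ is gs (suc j) C₁ le (eqs ∘ there) (unique-++⁻ʳ (vertices g) u)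
              (λ { (p , q) → case ∈-++⁻ (vertices g) q of λ { (inj₁ r) → unique-++-disj (vertices g) u (r , p) ; (inj₂ r) → dis (∈-++⁺ʳ (vertices g) p , r) } })
            where
              open Cover C
              i∈ : i ∈ vs
              i∈ = subst (i ∈_) order (∈-ʳ++⁺ʳ done (here refl))
              use : ∀ {o b} → o ∈ options g → Real done F b → Real (i ∷ done) (vertices g ++ F) (val i o ∙ b)
              use o∈ r with option-ok W⊆ i∈ g o∈
              ... | vo , uo , o⊆ = real-∷ vo uo o⊆ (λ { (p , q) → dis (∈-++⁺ˡ p , q) }) r
              real' : ∀ {h i'} → h ∈ₛ H → i' ≤ suc j → Real (i ∷ done) (vertices g ++ F) (s ∙ val i (lo g) ∙ h ∙ i' · a)
              real' {h} {zero} h∈ _ = subst (Real (i ∷ done) (vertices g ++ F)) (solveG (val i (lo g) ∷ᵛ s ∷ᵛ h ∷ᵛ []ᵛ) (v0 ⊕ (v1 ⊕ v2 ⊕ 𝟎)) (v1 ⊕ v0 ⊕ v2 ⊕ 𝟎) refl) (use (here refl) (real {i = 0} h∈ z≤n))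
              real' {h} {suc i'} h∈ (s≤s le) = subst (Real (i ∷ done) (vertices g ++ F))
                (trans (cong (_∙ (s ∙ h ∙ i' · a)) (trans (hi-lo i∈ g) (cong (val i (lo g) ∙_) (eqs (here refl)))))
                  (solveG (val i (lo g) ∷ᵛ s ∷ᵛ h ∷ᵛ a ∷ᵛ i' · a ∷ᵛ []ᵛ) ((v0 ⊕ v3) ⊕ (v1 ⊕ v2 ⊕ v4)) (v1 ⊕ v0 ⊕ v2 ⊕ (v3 ⊕ v4)) refl))
                (use (there (here refl)) (real h∈ le))
              C₁ : Cover is H a (suc j)
              C₁ = record { done = i ∷ done ; order = order ; F = vertices g ++ F ; s = s ∙ val i (lo g)
                ; F-size = ≤-trans (≤-reflexive (trans (length-++ (vertices g)) (cong (_+ length F) (vertices-length g)))) (+-mono-≤ 2+d≤φ F-size) ; real = real' }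
          ... | is' , len , C' , F⊆ = is' , cong suc len , subst (Cover is' H a) (+-suc (length gs) j) C' , λ x∈ → keep (F-subst (+-suc (length gs) j) C' x∈)
            where
              F-subst : ∀ {j j'} (e : j ≡ j') (C : Cover is' H a j) {x} → x ∈ Cover.F (subst (Cover is' H a) e C) → x ∈ Cover.F C
              F-subst refl C x∈ = x∈
              keep : ∀ {x} → x ∈ Cover.F C' → x ∈ Cover.F C ⊎ x ∈ vertices g ++ support gs
              keep x∈ with F⊆ x∈
              ... | inj₂ q = inj₂ (∈-++⁺ʳ (vertices g) q)
              ... | inj₁ q with ∈-++⁻ (vertices g) q
              ...   | inj₁ r = inj₂ (∈-++⁺ˡ r)
              ...   | inj₂ r = inj₁ r

          -- All gadget differences have order at most T: each of them is either killed by deleting few vertices or available T times.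
          small-orders : ∀ T → (Ds : List A) → (∀ {a} → a ∈ Ds → ∃ λ (o : Fin T) → suc (toℕ o) · a ≡ ε) → ∀ W → Unique W → W ⊆ U₁ → N₂ + length Ds * (T * (2 + d)) ≤ length W →
            ∀ is H → H ⊆ₛ J → (C : Cover is H ε 0) → Disjoint W (Cover.F C) → length Ds * T ≤ length is → (∀ (g : Gadget W) → δ g ∈ Ds ⊎ δ g ∈ₛ H) → ⊥
          small-orders T [] orders W uW W⊆ big is H H⊆J C dis balls cov with ⊆ₛ-or-witness J H
          -- All listed differences are used up, so `W` is confined to the proper subgroup `H`,
          -- which `IH` excludes.
          ... | inj₂ (g , gJ , gH) = IH H H⊆J gJ gH W uW (λ z → U₁⊆ (W⊆ z)) (≤-trans (≤-reflexive (sym (+-identityʳ N₂))) big) (λ g → case cov g of λ { (inj₂ h) → h })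
          ... | inj₁ J⊆H = finish is (Cover.done C) (Cover.F C) (Cover.s C) (Cover.order C) (Cover.F-size C) kφ≤
                  (λ {g} g∈ → subst (Real (Cover.done C) (Cover.F C)) (∙-idʳ _) (Cover.real C {i = 0} (J⊆H g∈) z≤n))
          small-orders T (a ∷ Ds) orders W uW W⊆ big is H H⊆J C dis balls cov = gather (λ _ b → b ≡ a) W T next
            where
              open ≤-Reasoning
              all-eq : ∀ (gs : List (Gadget W)) → Chain (λ _ b → b ≡ a) gs → ∀ {g} → g ∈ gs → δ g ≡ a
              all-eq (g ∷ gs) (e ∷ ch) (here refl) = e
              all-eq (g ∷ gs) (e ∷ ch) (there h) = all-eq gs ch h
              reassoc : ∀ a b c → a + (b + c) ≡ a + c + b
              reassoc = solve-∀
              remaining : ∀ (gs : List (Gadget W)) → length gs ≤ T → N₂ + length Ds * (T * (2 + d)) ≤ length (W ∖ support gs)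
              remaining gs le = +-cancelʳ-≤ (T * (2 + d)) _ _ (begin
                N₂ + length Ds * (T * (2 + d)) + T * (2 + d) ≡⟨ sym (reassoc N₂ (T * (2 + d)) _) ⟩
                N₂ + suc (length Ds) * (T * (2 + d)) ≤⟨ big ⟩
                length W ≤⟨ length-∖ (support gs) uW ⟩
                length (W ∖ support gs) + length (support gs) ≤⟨ +-monoʳ-≤ _ (≤-trans (≤-reflexive (support-length gs)) (*-monoˡ-≤ (2 + d) le)) ⟩
                length (W ∖ support gs) + T * (2 + d) ∎)
              next : (gs : List (Gadget W)) → Chain (λ _ b → b ≡ a) gs → Unique (support gs) →
                (length gs ≡ T ⊎ (length gs < T × (∀ (g : Gadget (W ∖ support gs)) → ¬ (δ g ≡ a)))) → ⊥
              next gs ch u (inj₂ (lt , stuck)) = small-orders T Ds (orders ∘ there) (W ∖ support gs) (∖-unique (support gs) uW) (λ z → W⊆ (∖⊆ W (support gs) z)) (remaining gs (<⇒≤ lt))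
                is H H⊆J C (λ { (p , q) → dis (∖⊆ W (support gs) p , q) }) (≤-trans (m≤n+m _ T) balls)
                (λ g → case cov (gadget-⊆ (∖⊆ W (support gs)) g) of λ { (inj₁ (here e)) → ⊥-elim (stuck g e) ; (inj₁ (there h)) → inj₁ h ; (inj₂ h) → inj₂ h })
              next gs ch u (inj₁ refl) with orders (here refl)
              ... | o , oa with add-gadgets W⊆ is gs 0 (lift C) (≤-trans (m≤m+n (length gs) _) balls) (all-eq gs ch) u (λ { (p , q) → dis (support-⊆ gs p , q) })
                where
                  lift : Cover is H ε 0 → Cover is H a 0
                  lift C = record { done = done ; order = order ; F = F ; s = s ; F-size = F-size ; real = λ { {h} {zero} h∈ le → real {h} {0} h∈ z≤n } }
                    where open Cover C
              ...   | is' , len , C' , F⊆ = small-orders T Ds (orders ∘ there) (W ∖ support gs) (∖-unique (support gs) uW) (λ z → W⊆ (∖⊆ W (support gs) z)) (remaining gs ≤-refl)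
                    is' H' H'⊆J C'' (λ { (p , q) → case F⊆ q of λ { (inj₁ r) → dis (∖⊆ W (support gs) p , r) ; (inj₂ r) → proj₂ (∈-∖⁻ W (support gs) p) r } })
                    (+-cancelˡ-≤ (length gs) _ _ (≤-trans balls (≤-reflexive len)))
                    (λ g → case cov (gadget-⊆ (∖⊆ W (support gs)) g) of λ { (inj₁ (here e)) → inj₂ (subst (_∈ₛ H') (sym e) a∈H') ; (inj₁ (there h)) → inj₁ h ; (inj₂ h) → inj₂ (H⊆H' h) })
                where
                  H' : Sub
                  H' = adjoin H a (toℕ o) oa
                  H⊆H' : H ⊆ₛ H'
                  H⊆H' {b} h = adjoin⁺ {H} {a} {toℕ o} {oa} 0 (s≤s z≤n) (subst (_∈ₛ H) (solveG (b ∷ᵛ []ᵛ) v0 (v0 ⊕ ⊖ 𝟎) refl) h)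
                  a∈J : a ∈ₛ J
                  a∈J = from gs ch o
                    where
                      from : ∀ (gs : List (Gadget W)) → Chain (λ _ b → b ≡ a) gs → Fin (length gs) → a ∈ₛ J
                      from (g ∷ _) (e ∷ _) _ = subst (_∈ₛ J) e (δ∈J (λ z → U₁⊆ (W⊆ z)) g)
                  a∈H' : a ∈ₛ H'
                  a∈H' = adjoin-gen (toℕ o) oa
                    where
                      adjoin-gen : ∀ o oa → a ∈ₛ adjoin H a o oa
                      adjoin-gen zero oa = subst (_∈ₛ adjoin H a 0 oa) (sym (trans (sym (∙-idʳ a)) oa)) (mem-ε (adjoin H a 0 oa))
                      adjoin-gen (suc o) oa = adjoin⁺ {H} {a} {suc o} {oa} 1 (s≤s (s≤s z≤n)) (subst (_∈ₛ H) (solveG (a ∷ᵛ []ᵛ) 𝟎 (v0 ⊕ ⊖ (v0 ⊕ 𝟎)) refl) (mem-ε H))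
                  H'⊆J : H' ⊆ₛ J
                  H'⊆J {b} h with adjoin⁻ {H} {a} {toℕ o} {oa} h
                  ... | i , p = subst (_∈ₛ J) (solveG (b ∷ᵛ toℕ i · a ∷ᵛ []ᵛ) (v0 ⊕ ⊖ v1 ⊕ v1) v0 refl) (mem-∙ J (H⊆J p) (mem-· J (toℕ i) a∈J))
                  C'' : Cover is' H' ε 0
                  C'' = record { done = Cover.done C' ; order = Cover.order C' ; F = Cover.F C' ; s = Cover.s C' ; F-size = Cover.F-size C' ; real = real' }
                    where
                      real' : ∀ {h i} → h ∈ₛ H' → i ≤ 0 → Real (Cover.done C') (Cover.F C') (Cover.s C' ∙ h ∙ i · ε)
                      real' {h} {zero} h∈ _ with adjoin⁻ {H} {a} {toℕ o} {oa} h∈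
                      ... | i , p = subst (Real (Cover.done C') (Cover.F C')) (solveG (Cover.s C' ∷ᵛ h ∷ᵛ toℕ i · a ∷ᵛ []ᵛ) (v0 ⊕ (v1 ⊕ ⊖ v2) ⊕ v2) (v0 ⊕ v1 ⊕ 𝟎) refl)
                        (Cover.real C' {i = toℕ i} p (≤-trans (≤-trans (≤-pred (toℕ<n i)) (<⇒≤ (toℕ<n o))) (m≤m+n (length gs) 0)))

          -- Bounded difference sets are impossible; covering `J`.

          open ≤-Reasoning

          -- So many gadgets for each of `B` differences use up no more than the `k` available
          -- balls.
          T : ℕ
          T = k / B

          -- The distinct multiples of `a` limit the values of c x p, hence the colours on a set of
          -- linear size. A monochromatic copy then contradicts `absent`.
          large-order : ∀ (D : List A) → length D ≡ B → ∀ W → Unique W → W ⊆ U₁ → N₂ + reserve n ≤ length W → Confined (_∈ D) W →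
            ∀ a → (∀ (o : Fin T) → suc (toℕ o) · a ≢ ε) → ⊥
          large-order D lenD W uW W⊆ big conf a free = go (few-colours D conf uW big₆ a s Kc free' (s≤s z≤n) m≤')
            where
              s : ℕ
              -- For j < s the product d * j is at most `T`, so the multiples of `a` are free; and d
              -- * s > `T` yields m ≤ Kc * s.
              s = suc (T / d)
              big₁₀ : 10 + d + X * X * (Cm * n) ≤ length W
              big₁₀ = ≤-trans (≤-trans (m≤n+m _ (n * (2 + d))) (m≤n+m _ N₂)) big
              big₆ : 6 + d ≤ length W
              big₆ = ≤-trans (≤-trans (m≤n+m (6 + d) 4) (m≤m+n _ _)) big₁₀
              free' : ∀ j → 1 ≤ j → j < s → (d * j) · a ≢ ε
              free' (suc j) _ (s≤s j≤) eq = free (fromℕ< dj<) (trans (cong (λ i → suc i · a) (toℕ-fromℕ< dj<)) eq)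
                where
                  dj< : pred (d * suc j) < T
                  dj< = begin
                    suc (pred (d * suc j)) ≡⟨⟩
                    d * suc j ≤⟨ *-monoʳ-≤ d j≤ ⟩
                    d * (T / d) ≡⟨ *-comm d (T / d) ⟩
                    T / d * d ≤⟨ m/n*n≤m T d ⟩
                    T ∎
              T<ds : suc T ≤ d * s
              T<ds = begin
                suc T ≡⟨ cong suc (m≡m%n+[m/n]*n T d) ⟩
                suc (T % d) + T / d * d ≤⟨ +-monoˡ-≤ (T / d * d) (m%n<n T d) ⟩
                d + T / d * d ≡⟨ *-comm s d ⟩
                d * s ∎
              k≤BT : k ≤ B * suc T
              k≤BT = begin
                k ≡⟨ m≡m%n+[m/n]*n k B ⟩
                k % B + T * B ≤⟨ +-monoˡ-≤ (T * B) (<⇒≤ (m%n<n k B)) ⟩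
                B + T * B ≡⟨ *-comm (suc T) B ⟩
                B * suc T ∎
              m≤' : m ≤ Kc * s
              m≤' = begin
                m ≤⟨ m≤ ⟩
                K₁ * k ≤⟨ *-monoʳ-≤ K₁ (≤-trans k≤BT (*-monoʳ-≤ B T<ds)) ⟩
                K₁ * (B * (d * s)) ≡⟨ e K₁ B d s ⟩
                Kc * s ∎
                where
                  e : ∀ a b c d → a * (b * (c * d)) ≡ a * (b * c) * d
                  e = solve-∀
              spread≡ : spread D conf uW big₆ ≡ B * ((B * B) * (B * B)) ^ d
              spread≡ = cong (λ b → b * ((b * b) * (b * b)) ^ d) lenD
              go : (∃₂ λ U qs → Unique U × U ⊆ W × length W ≤ 3 + (spread D conf uW big₆ * Kc) * (spread D conf uW big₆ * Kc) * length U × length qs ≡ length D * length D ×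
                (∀ {x y} → x ∈ U → y ∈ U → x ≢ y → c x y ∈ qs)) → ⊥
              go (U , qs , uU , _ , le , len-qs , coloured) = proj₂ (monochromatic-copy Δ 1≤Δ (B * B)) ≤-refl G 1≤n deg≤Δ c c-sym U uU enough qs (trans len-qs (cong₂ _*_ lenD lenD)) coloured
                  (λ q f inj mono → absent f inj (trans (∑-cong Edges (λ {e} e∈ → mono (proj₁ e) (proj₂ e) (edge⇒adj e∈))) (trans (∑-const Edges q) (annihilates q))))
                where
                  le' : length W ≤ 3 + X * X * length U
                  le' = subst (λ w → length W ≤ 3 + (w * Kc) * (w * Kc) * length U) spread≡ le
                  enough : Cm * n ≤ length U
                  enough with Cm * n ≤? length U
                  ... | yes p = p
                  ... | no ¬p = ⊥-elim (<⇒≱ (s≤s (s≤s (s≤s (s≤s z≤n)))) (+-cancelʳ-≤ (X * X * (Cm * n)) (10 + d) 3 (≤-trans big₁₀ (≤-trans le' (+-monoʳ-≤ 3 (*-monoʳ-≤ (X * X) (<⇒≤ (≰⇒> ¬p))))))))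

          bounded : ∀ (D : List A) → length D ≤ B → ∀ W → Unique W → W ⊆ U₁ → N₂ + reserve n ≤ length W → Confined (_∈ D) W → ⊥
          -- Padding to exactly `B` elements makes the number of colours and the loss in
          -- `few-colours` constants.
          bounded D₀ lenD₀ W uW W⊆ big conf₀ with pad D₀ ε lenD₀
          ... | D , lenD , D₀⊆ = go (anyL? (λ a → ¬? (small? a)) D)
            where
              small? : (a : A) → Dec (∃ λ (o : Fin T) → suc (toℕ o) · a ≡ ε)
              small? a = any? (λ o → suc (toℕ o) · a ≟ ε)
              conf : Confined (_∈ D) W
              conf g = D₀⊆ (conf₀ g)
              cover₀ : Cover vs trivial ε 0
              cover₀ = record { done = [] ; order = refl ; F = [] ; s = ε ; F-size = z≤n ; real = λ {h} {i} h∈ i≤ → record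
                { choice = [] ; indices = refl ; valid = [] ; distinct = [] ; within = λ () ; total = sym (trans (cong₂ (λ x y → ε ∙ x ∙ y) (∈-trivial h∈) (·-ε i)) (solveG []ᵛ (𝟎 ⊕ 𝟎 ⊕ 𝟎) 𝟎 refl)) } }
              BT≤k : length D * T ≤ k
              BT≤k = ≤-trans (≤-reflexive (trans (cong (_* T) lenD) (*-comm B T))) (m/n*n≤m k B)
              go : Dec (Any (λ a → ¬ (∃ λ (o : Fin T) → suc (toℕ o) · a ≡ ε)) D) → ⊥
              go (yes p) with find p
              ... | a , _ , ¬small = large-order D lenD W uW W⊆ big conf a (λ o e → ¬small (o , e))
              go (no ¬p) = small-orders T D (λ {a} a∈ → decidable-stable (small? a) (λ ¬small → ¬p (lose a∈ ¬small))) W uW W⊆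
                (begin
                  N₂ + length D * (T * (2 + d)) ≡⟨ cong (N₂ +_) (sym (*-assoc (length D) T (2 + d))) ⟩
                  N₂ + length D * T * (2 + d) ≤⟨ +-monoʳ-≤ N₂ (≤-trans (*-monoˡ-≤ (2 + d) (≤-trans BT≤k k≤n)) (m≤m+n _ _)) ⟩
                  N₂ + reserve n ≤⟨ big ⟩
                  length W ∎)
                vs trivial (λ h → subst (_∈ₛ J) (sym (∈-trivial h)) (mem-ε J)) cover₀ (λ { (_ , ()) }) BT≤k (λ g → inj₁ (conf g))

          F≤kφ : ∀ {i is} (S : State J φ 0 (i ∷ is)) → length (State.F S) ≤ k * φ
          F≤kφ S = ≤-trans (State.F-size S) (≤-trans (≤-reflexive (+-identityʳ _)) (*-monoˡ-≤ φ (≤-trans (m≤m+n (length (State.done S)) _) (≤-reflexive (trans (sym (length-ʳ++ (State.done S))) (cong length (State.order S)))))))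

          index∈ : ∀ {i is} (S : State J φ 0 (i ∷ is)) → i ∈ vs
          index∈ S = subst (_ ∈_) (State.order S) (∈-ʳ++⁺ʳ (State.done S) (here refl))

          -- If the search for `L` differences new modulo `H` gets stuck, all differences lie in
          -- fewer than `L` cosets of a small `H`, which `bounded` refutes. Otherwise a unit has
          -- values in 4 ℓ + 2 cosets; as these lie in `J`, the last premise holds as well.
          rich : ∀ i is (S : State J φ 0 (i ∷ is)) → ∀ {g} → g ∈ₛ J → mem (State.H S) g ≡ false → size (mem (State.H S)) < ℓ →
            ((u : Unit J φ (State.F S) i) → (2 + ℓ) * size (mem (State.H S)) ≤ size (Unit.saturation u (State.H S)) → 4 * (ℓ * size (mem (State.H S))) ≤ size (mem J) → ⊥) → ⊥
          rich i is S _ _ h<ℓ ret = gather (Fresh H) W₀ L next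
            where
              H : Sub
              H = State.H S
              F W₀ : List V
              F = State.F S
              W₀ = U₁ ∖ F
              h : ℕ
              h = size (mem H)
              next : (gs : List (Gadget W₀)) → Chain (Fresh H) gs → Unique (support gs) →
                (length gs ≡ L ⊎ (length gs < L × (∀ (g : Gadget (W₀ ∖ support gs)) → ¬ Fresh H (map δ gs) (δ g)))) → ⊥
              next [] ch u (inj₁ lenL) = <⇒≱ (*-mono-≤ {1} {4 * ℓ + 2} (≤-trans (s≤s z≤n) (m≤n+m 2 (4 * ℓ))) (≤-trans (s≤s z≤n) (m≤n+m 2 (4 * ℓ)))) (≤-reflexive (sym lenL))
              next (g₀ ∷ gs) ch u (inj₁ lenL) = ret unit (≤-trans (*-monoˡ-≤ h (≤-trans (≤-reflexive (+-comm 2 ℓ)) (+-monoˡ-≤ 2 (m≤m+n ℓ _)))) many-values)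
                  (≤-trans (≤-trans (≤-reflexive (sym (*-assoc 4 ℓ h))) (*-monoˡ-≤ h (m≤m+n (4 * ℓ) 2))) (≤-trans many-values (size-⊆ (saturation-⊆ unit {H} (State.H⊆J S)))))
                where
                  le : length (g₀ ∷ gs) * (2 + d) ≤ φ
                  le = ≤-reflexive (cong (_* (2 + d)) lenL)
                  unit : Unit J φ F i
                  unit = gadget-unit {φ} {F} {i} (index∈ S) g₀ gs le
                  e : ∀ a h → a * h * (a * h) ≡ a * a * (h * h)
                  e = solve-∀
                  many-values : (4 * ℓ + 2) * h ≤ size (Unit.saturation unit H)
                  many-values = square-root-≤ (≤-trans (≤-reflexive (trans (e (4 * ℓ + 2) h) (cong (_* (h * h)) (sym lenL)))) (gadget-unit-square {φ} {F} {i} (index∈ S) g₀ gs le H ch))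
              next gs ch u (inj₂ (lt , stuck)) = bounded D lenD (W₀ ∖ support gs) (∖-unique (support gs) (∖-unique F uU₁)) (λ x∈ → ∖⊆ U₁ F (∖⊆ W₀ (support gs) x∈)) big conf
                where
                  Hs : List A
                  Hs = fil (mem H) (allFin m)
                  D : List A
                  D = concatMap (λ b → map (b ∙_) Hs) (map δ gs)
                  lenD : length D ≤ B
                  lenD = ≤-trans (≤-reflexive (len (map δ gs))) (≤-trans (*-mono-≤ (≤-trans (≤-reflexive (length-map δ gs)) (<⇒≤ lt)) (<⇒≤ h<ℓ)) (n≤1+n _))
                    where
                      len : ∀ (bs : List A) → length (concatMap (λ b → map (b ∙_) Hs) bs) ≡ length bs * h
                      len [] = refl
                      len (b ∷ bs) = trans (length-++ (map (b ∙_) Hs)) (cong₂ _+_ (trans (length-map (b ∙_) Hs) (length-fil (mem H) (allFin m))) (len bs))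
                  big : N₂ + reserve n ≤ length (W₀ ∖ support gs)
                  big = +-cancelˡ-≤ (k * φ + φ) _ _ (begin
                    k * φ + φ + (N₂ + reserve n) ≤⟨ room ⟩
                    length U₁ ≤⟨ length-∖ F uU₁ ⟩
                    length W₀ + length F ≤⟨ +-mono-≤ (length-∖ (support gs) (∖-unique F uU₁)) (F≤kφ S) ⟩
                    length (W₀ ∖ support gs) + length (support gs) + k * φ ≤⟨ +-monoˡ-≤ (k * φ) (+-monoʳ-≤ (length (W₀ ∖ support gs)) (≤-trans (≤-reflexive (support-length gs)) (*-monoˡ-≤ (2 + d) (<⇒≤ lt)))) ⟩
                    length (W₀ ∖ support gs) + φ + k * φ ≡⟨ e (length (W₀ ∖ support gs)) φ (k * φ) ⟩
                    k * φ + φ + length (W₀ ∖ support gs) ∎)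
                    where
                      e : ∀ a b c → a + b + c ≡ c + b + a
                      e = solve-∀
                  conf : Confined (_∈ D) (W₀ ∖ support gs)
                  conf g with anyL? (λ b → mem H (δ g ∙ b ⁻¹) ≟ᵇ true) (map δ gs)
                  ... | no none = ⊥-elim (stuck g (tabAll (λ b∈ → ¬T⇒F (λ q → none (lose b∈ q)))))
                  ... | yes p with find p
                  ...   | b , b∈ , q = subst (_∈ D) (solveG (b ∷ᵛ δ g ∷ᵛ []ᵛ) (v0 ⊕ (v1 ⊕ ⊖ v0)) v1 refl) (∈-concatMap⁺ (λ b → map (b ∙_) Hs) (lose b∈ (∈-map⁺ (b ∙_) (∈-fil⁺ (∈-allFin (δ g ∙ b ⁻¹)) q))))

          -- Meant for `H` with at least `ℓ` elements, where one gadget with difference outside `H`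
          -- already adds enough. If there is none, the remaining hosts are confined to `H`, against
          -- `IH`.
          simple : ∀ i is (S : State J φ 0 (i ∷ is)) → ∀ {g} → g ∈ₛ J → mem (State.H S) g ≡ false → size (mem (State.H S)) < suc m →
            ((u : Unit J φ (State.F S) i) → (2 + 0) * size (mem (State.H S)) ≤ size (Unit.saturation u (State.H S)) → 4 * (0 * size (mem (State.H S))) ≤ size (mem J) → ⊥) → ⊥
          simple i is S gJ gH _ ret = em {∃ λ (g : Gadget (U₁ ∖ State.F S)) → mem (State.H S) (δ g) ≡ false} λ
            { (inj₁ (g , g∉)) → ret (gadget-unit {φ} {State.F S} {i} (index∈ S) g [] one) (gadget-unit-two {φ} {State.F S} {i} (index∈ S) g one (State.H S) g∉) z≤n
            ; (inj₂ none) → IH (State.H S) (State.H⊆J S) gJ gH (U₁ ∖ State.F S) (∖-unique (State.F S) uU₁) (λ z → U₁⊆ (∖⊆ U₁ (State.F S) z)) big (λ g → from (bool (mem (State.H S) (δ g))) (λ q → none (g , q))) }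
            where
              one : 1 * (2 + d) ≤ φ
              one = ≤-trans (≤-reflexive (*-identityˡ (2 + d))) 2+d≤φ
              from : ∀ {b} → b ≡ true ⊎ b ≡ false → ¬ (b ≡ false) → b ≡ true
              from (inj₁ p) _ = p
              from (inj₂ p) q = ⊥-elim (q p)
              big : N₂ ≤ length (U₁ ∖ State.F S)
              big = +-cancelˡ-≤ (k * φ) _ _ (begin
                k * φ + N₂ ≤⟨ +-mono-≤ (m≤m+n (k * φ) φ) (m≤m+n N₂ _) ⟩
                k * φ + φ + (N₂ + reserve n) ≤⟨ room ⟩
                length U₁ ≤⟨ length-∖ (State.F S) uU₁ ⟩
                length (U₁ ∖ State.F S) + length (State.F S) ≤⟨ +-monoʳ-≤ (length (U₁ ∖ State.F S)) (F≤kφ S) ⟩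
                length (U₁ ∖ State.F S) + k * φ ≡⟨ +-comm _ (k * φ) ⟩
                k * φ + length (U₁ ∖ State.F S) ∎)

          covered : ∀ is (S : State J φ 0 is) → J ⊆ₛ State.H S → ⊥
          covered is S J⊆H = finish is done F s order (≤-trans F-size (≤-reflexive (+-identityʳ _))) kφ≤
            (λ {g} g∈ → real (subst (λ w → State.X S w ≡ true) (solveG (x₀ ∷ᵛ g ∷ᵛ []ᵛ) (v0 ⊕ (v1 ⊕ ⊖ v0)) v1 refl) (X-inv X-point (J⊆H (mem-∙⁻¹ J g∈ (X⊆J X-point))))))
            where open State S

          initial : State J φ 0 vs
          initial = record { done = [] ; order = refl ; H = trivial ; X = mem trivial ; F = [] ; s = ε ; x₀ = ε ; F-size = z≤n
            ; H⊆J = λ h → subst (_∈ₛ J) (sym (∈-trivial h)) (mem-ε J) ; X⊆J = λ h → subst (_∈ₛ J) (sym (∈-trivial h)) (mem-ε J)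
            ; X-inv = λ p q → mem-∙ trivial p q ; X-point = mem-ε trivial
            ; real = λ h → record { choice = [] ; indices = refl ; valid = [] ; distinct = [] ; within = λ () ; total = sym (trans (cong (ε ∙_) (∈-trivial h)) (∙-idˡ ε)) } }

          j≤ : size (mem J) ≤ K₁ * k
          j≤ = ≤-trans (size≤m (mem J)) m≤

          -- Half of the balls bring `H` up to `ℓ` elements by `rich`, and the other half finish by
          -- `simple`, each worth |H| ≥ `ℓ`. If `J` has fewer than `ℓ` elements, `rich` alone covers
          -- it.
          impossible : ⊥
          impossible with ℓ ≤? size (mem J)
          ... | no small = run ℓ ℓ rich 0 k vs initial (sym (+-identityʳ k)) potential λ
                { is' _ (S , inj₁ J⊆H) → covered is' S J⊆H
                ; is' _ (S , inj₂ ℓ≤) → small (≤-trans ℓ≤ (size-⊆ (λ _ → State.H⊆J S))) }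
            where
              potential : 3 * size (mem J) ≤ k * (suc ℓ * size (mem trivial)) + size (mem trivial)
              potential = begin
                3 * size (mem J) ≤⟨ *-monoʳ-≤ 3 j≤ ⟩
                3 * (K₁ * k) ≤⟨ slack (6 * (K₁ * k)) (e K₁ k) ⟩
                k * (ℓ * 1) ≤⟨ *-monoʳ-≤ k (*-mono-≤ (n≤1+n ℓ) (size>0 {mem trivial} {ε} (mem-ε trivial))) ⟩
                k * (suc ℓ * size (mem trivial)) ≤⟨ m≤m+n _ _ ⟩
                k * (suc ℓ * size (mem trivial)) + size (mem trivial) ∎
                where
                  e : ∀ a k → 3 * (a * k) + 6 * (a * k) ≡ k * (9 * a * 1)
                  e = solve-∀
          ... | yes large = run ℓ ℓ rich r β vs initial (sym (trans (+-comm β r) (m∸n+n≡m β≤k))) potential λ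
                { is' _ (S , inj₁ J⊆H) → covered is' S J⊆H
                ; is' r≤ (S , inj₂ ℓ≤) → run 0 (suc m) simple 0 (length is') is' S (sym (+-identityʳ _)) (potential₂ is' S r≤ ℓ≤) λ
                    { is'' _ (S' , inj₁ J⊆H) → covered is'' S' J⊆H
                    ; is'' _ (S' , inj₂ m<) → <⇒≱ m< (size≤m (mem (State.H S'))) } }
            where
              β r : ℕ
              β = k / 2
              r = k ∸ β
              β2≤k : β * 2 ≤ k
              β2≤k = m/n*n≤m k 2
              β≤k : β ≤ k
              β≤k = ≤-trans (≤-trans (m≤m+n β (β + 0)) (≤-reflexive (*-comm 2 β))) β2≤k
              k≤ : k ≤ 1 + β * 2
              k≤ = ≤-trans (≤-reflexive (m≡m%n+[m/n]*n k 2)) (+-monoˡ-≤ (β * 2) (≤-pred (m%n<n k 2)))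
              -- 9 `K₁` ≤ |J| ≤ `K₁` k rules out k ≤ 1.
              1≤β : 1 ≤ β
              1≤β with β in eq
              ... | suc _ = s≤s z≤n
              ... | zero = ⊥-elim (absurd K₁ (≤-trans large j≤) (≤-trans k≤ (≤-reflexive (cong (λ b → 1 + b * 2) eq))) (≤-trans (size>0 (mem-ε J)) j≤))
                where
                  absurd : ∀ K → 9 * K ≤ K * k → k ≤ 1 → 1 ≤ K * k → ⊥
                  absurd (suc K) p q w = <⇒≱ (slack (7 + 8 * K) (e K)) (≤-trans p (≤-trans (*-monoʳ-≤ (suc K) q) (≤-reflexive (*-identityʳ _))))
                    where
                      e : ∀ K → suc (suc K) + (7 + 8 * K) ≡ 9 * suc K
                      e = solve-∀
              k≤3β : k ≤ 3 * β
              k≤3β = ≤-trans k≤ (≤-trans (+-monoˡ-≤ (β * 2) 1≤β) (≤-reflexive (e β)))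
                where
                  e : ∀ b → b + b * 2 ≡ 3 * b
                  e = solve-∀
              -- This fixes the factor 9 in `ℓ`: 3 |J| ≤ 3 `K₁` k, and k ≤ 3 β.
              3j≤ : 3 * size (mem J) ≤ β * ℓ
              3j≤ = begin
                3 * size (mem J) ≤⟨ *-monoʳ-≤ 3 (≤-trans j≤ (*-monoʳ-≤ K₁ k≤3β)) ⟩
                3 * (K₁ * (3 * β)) ≡⟨ e K₁ β ⟩
                β * ℓ ∎
                where
                  e : ∀ a b → 3 * (a * (3 * b)) ≡ b * (9 * a)
                  e = solve-∀
              β≤r : β ≤ r
              β≤r = +-cancelʳ-≤ β β r (≤-trans (≤-reflexive (e β)) (≤-trans β2≤k (≤-reflexive (sym (m∸n+n≡m β≤k)))))
                where
                  e : ∀ b → b + b ≡ b * 2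
                  e = solve-∀
              potential : 3 * size (mem J) ≤ β * (suc ℓ * size (mem trivial)) + size (mem trivial)
              potential = ≤-trans 3j≤ (≤-trans (*-monoʳ-≤ β (≤-trans (≤-reflexive (sym (*-identityʳ ℓ))) (*-mono-≤ (n≤1+n ℓ) (size>0 {mem trivial} {ε} (mem-ε trivial))))) (m≤m+n _ _))
              potential₂ : ∀ is' (S : State J φ 0 is') → r ≤ length is' → ℓ ≤ size (mem (State.H S)) → 3 * size (mem J) ≤ length is' * (1 * size (mem (State.H S))) + size (State.X S)
              potential₂ is' S r≤ ℓ≤ = ≤-trans 3j≤ (≤-trans (*-mono-≤ (≤-trans β≤r r≤) (≤-trans ℓ≤ (≤-reflexive (sym (*-identityˡ _))))) (m≤m+n _ _))

      -- Hosts for `Z` are set aside. What is left has room for `k` units, one further family of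
      -- gadgets, and the sets to which `bounded` and `IH` are applied.
      phase-A : (J : Sub) (κ : A) (U₀ : List V) → Unique U₀ → (∀ {x y} → x ∈ U₀ → y ∈ U₀ → x ≢ y → c x y ∙ κ ⁻¹ ∈ₛ J) →
        (N₂ : ℕ) → (∀ (H : Sub) → H ⊆ₛ J → ∀ {g} → g ∈ₛ J → mem H g ≡ false → ∀ W → Unique W → W ⊆ U₀ → N₂ ≤ length W → Confined (_∈ₛ H) W → ⊥) →
        CA * n + N₂ ≤ length U₀ → ⊥
      phase-A J κ U₀ uU₀ const N₂ IH big = go (freshes [] (length Z) uU₀ Z≤)
        where
          open ≤-Reasoning
          Z≤n : length Z ≤ n
          Z≤n = ≤-trans (length-filter _ (allFin n)) (≤-reflexive (length-tabulate {n = n} id))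
          split : ∀ φ d x n k → (1 + φ + φ + (2 + d) + (10 + d) + x) * n ≡ n + (n * φ + (φ * n + (n * (2 + d) + ((10 + d) * n + x * n))))
          split = solve-∀
          n≤U₀ : n + (k * φ + φ + (N₂ + reserve n)) ≤ length U₀
          n≤U₀ = begin
            n + (k * φ + φ + (N₂ + (n * (2 + d) + (10 + d + X * X * (Cm * n))))) ≤⟨ +-monoʳ-≤ n (+-mono-≤ (+-mono-≤ (*-monoˡ-≤ φ k≤n) (≤-trans (≤-reflexive (sym (*-identityʳ φ))) (*-monoʳ-≤ φ 1≤n))) (+-monoʳ-≤ N₂ (+-monoʳ-≤ (n * (2 + d)) (+-mono-≤ (≤-trans (≤-reflexive (sym (*-identityʳ (10 + d)))) (*-monoʳ-≤ (10 + d) 1≤n)) (≤-reflexive (sym (*-assoc (X * X) Cm n))))))) ⟩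
            n + (n * φ + φ * n + (N₂ + (n * (2 + d) + ((10 + d) * n + X * X * Cm * n)))) ≡⟨ e n (n * φ) (φ * n) N₂ (n * (2 + d)) ((10 + d) * n + X * X * Cm * n) ⟩
            n + (n * φ + (φ * n + (n * (2 + d) + ((10 + d) * n + X * X * Cm * n)))) + N₂ ≡⟨ cong (_+ N₂) (sym (split φ d (X * X * Cm) n k)) ⟩
            CA * n + N₂ ≤⟨ big ⟩
            length U₀ ∎
            where
              e : ∀ n a b N c f → n + (a + b + (N + (c + f))) ≡ n + (a + (b + (c + f))) + N
              e = solve-∀
          Z≤ : 0 + length Z ≤ length U₀
          Z≤ = ≤-trans Z≤n (≤-trans (m≤m+n n _) n≤U₀)
          point : ∀ (l : List V) → 1 ≤ length l → V
          point (x ∷ _) _ = x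
          go : (∃ λ us → length us ≡ length Z × Unique us × us ⊆ U₀ × Disjoint us []) → ⊥
          go (zl , len , u , zl⊆ , _) = Placement.Constant.impossible
              (record { U₁ = U₀ ∖ zl ; uU₁ = ∖-unique zl uU₀ ; z = overlay (λ _ → v₀) Z zl ; zl = zl ; z-map = map-overlay (λ _ → v₀) Z zl (sym len) Z-unique ; zl-unique = u ; U₁-zl = λ { (p , q) → proj₂ (∈-∖⁻ U₀ zl p) q } })
              (record { J = J ; κ = κ ; U₀ = U₀ ; const = const ; U₁⊆ = ∖⊆ U₀ zl ; zl⊆ = zl⊆ ; N₂ = N₂ ; IH = IH
                ; room = +-cancelˡ-≤ n _ _ (≤-trans n≤U₀ (≤-trans (length-∖ zl uU₀) (≤-trans (+-monoʳ-≤ (length (U₀ ∖ zl)) (≤-trans (≤-reflexive len) Z≤n)) (≤-reflexive (+-comm _ n))))) })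
            where
              v₀ : V
              v₀ = point U₀ (≤-trans 1≤n (≤-trans (m≤m+n n _) n≤U₀))

      ∑-reindex : ∀ (xs : List VG) (F : VG → A) → Unique xs → (∀ a → a ∈ xs) → ∑ (allFin n) F ≡ ∑ xs F
      ∑-reindex xs F u cov = begin
        ∑ (allFin n) F ≡⟨ ∑-cong (allFin n) (λ {a} _ → sym (∑-single xs a (λ _ → F a) u (cov a))) ⟩
        ∑ (allFin n) (λ a → ∑ xs (λ x → if does (x ≟ a) then F a else ε)) ≡⟨ ∑-swap (allFin n) xs _ ⟩
        ∑ xs (λ x → ∑ (allFin n) (λ a → if does (x ≟ a) then F a else ε)) ≡⟨ ∑-cong xs (λ {x} _ → trans (∑-cong (allFin n) (λ {a} _ → flip x a)) (∑-single (allFin n) x F (allFin⁺ n) (∈-allFin x))) ⟩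
        ∑ xs F ∎
        where
          open ≡-Reasoning
          flip : ∀ x a → (if does (x ≟ a) then F a else ε) ≡ (if does (a ≟ x) then F a else ε)
          flip x a with x ≟ a | a ≟ x
          ... | yes _ | yes _ = refl
          ... | no _ | no _ = refl
          ... | yes e | no ne = ⊥-elim (ne (sym e))
          ... | no ne | yes e = ⊥-elim (ne (sym e))

      -- Splitting the edges by moved centres.

      at : VG → VG × VG → Bool
      at v e = does (proj₁ e ≟ v) ∨ does (proj₂ e ≟ v)

      avoids : List VG → VG × VG → Bool
      avoids acts e = not (does (anyL? (λ v → at v e ≟ᵇ true) acts))

      at⁻ : ∀ {v a b} → at v (a , b) ≡ true → a ≡ v ⊎ b ≡ v
      at⁻ {v} {a} {b} h with ∨-elim {does (a ≟ v)} h
      ... | inj₁ p = inj₁ (does⁻ (a ≟ v) p)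
      ... | inj₂ p = inj₂ (does⁻ (b ≟ v) p)

      at⁺ˡ : ∀ {v b} → at v (v , b) ≡ true
      at⁺ˡ {v} {b} rewrite does⁺ (v ≟ v) refl = refl

      at-sym : ∀ v a b → at v (a , b) ≡ at v (b , a)
      at-sym v a b = ∨-comm (does (a ≟ v)) (does (b ≟ v))

      avoids⁻ : ∀ {acts a b} → avoids acts (a , b) ≡ true → a ∉ acts × b ∉ acts
      avoids⁻ {acts} {a} {b} h with anyL? (λ v → at v (a , b) ≟ᵇ true) acts
      ... | no ¬p = (λ p → ¬p (lose p (at⁺ˡ {a} {b}))) , (λ p → ¬p (lose p (trans (at-sym b a b) (at⁺ˡ {b} {a}))))

      module _ (acts : List VG) (u : Unique acts) (independent : ∀ {v v'} → v ∈ acts → v' ∈ acts → adj v v' ≡ false) (f : VG → V) where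
        at-centre : ∀ {v} → ∑ (fil (at v) Edges) (weight f) ≡ ∑ (nbrs v) (λ w → c (f v) (f w))
        at-centre {v} = trans (∑-fil (at v) Edges (weight f)) (trans (star v D D-sym D-supp) (∑-cong (nbrs v) (λ {w} _ → cong (λ b → if b then weight f (v , w) else ε) (at⁺ˡ {v} {w}))))
          where
            D : VG → VG → A
            D a b = if at v (a , b) then weight f (a , b) else ε
            D-sym : ∀ a b → D a b ≡ D b a
            D-sym a b rewrite at-sym v a b | c-sym (f a) (f b) = refl
            D-supp : ∀ a b → adj a b ≡ true → a ≢ v → b ≢ v → D a b ≡ ε
            D-supp a b _ a≢ b≢ = cong (λ q → if q then weight f (a , b) else ε) (¬T⇒F (λ h → case at⁻ {v} {a} {b} h of λ { (inj₁ e) → a≢ e ; (inj₂ e) → b≢ e }))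

        only-one : ∀ {v v' a b} → v ∈ acts → v' ∈ acts → adj a b ≡ true → at v (a , b) ≡ true → at v' (a , b) ≡ true → v' ≡ v
        only-one {v} {v'} {a} {b} v∈ v'∈ h p q with at⁻ {v} {a} {b} p | at⁻ {v'} {a} {b} q
        ... | inj₁ refl | inj₁ refl = refl
        ... | inj₂ refl | inj₂ refl = refl
        ... | inj₁ refl | inj₂ refl = ⊥-elim (T⇒F⇒⊥ h (independent v∈ v'∈))
        ... | inj₂ refl | inj₁ refl = ⊥-elim (T⇒F⇒⊥ h (independent v'∈ v∈))

        -- Moved centres are pairwise nonadjacent, so an edge has at most one of them as an end.
        -- Here whole neighbourhoods stay put, unlike in `Final`.
        centre-decomposition : copy f ≡ ∑ (fil (avoids acts) Edges) (weight f) ∙ ∑ acts (λ v → ∑ (nbrs v) (λ w → c (f v) (f w)))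
        centre-decomposition = begin
          ∑ Edges (weight f) ≡⟨ ∑-cong Edges pointwise ⟩
          ∑ Edges (λ e → (if avoids acts e then weight f e else ε) ∙ ∑ acts (λ v → if at v e then weight f e else ε)) ≡⟨ ∑-∙ Edges _ _ ⟩
          ∑ Edges (λ e → if avoids acts e then weight f e else ε) ∙ ∑ Edges (λ e → ∑ acts (λ v → if at v e then weight f e else ε)) ≡⟨ cong₂ _∙_ (sym (∑-fil (avoids acts) Edges (weight f))) (∑-swap Edges acts _) ⟩
          ∑ (fil (avoids acts) Edges) (weight f) ∙ ∑ acts (λ v → ∑ Edges (λ e → if at v e then weight f e else ε)) ≡⟨ cong (∑ (fil (avoids acts) Edges) (weight f) ∙_) (∑-cong acts (λ {v} _ → trans (sym (∑-fil (at v) Edges (weight f))) at-centre)) ⟩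
          ∑ (fil (avoids acts) Edges) (weight f) ∙ ∑ acts (λ v → ∑ (nbrs v) (λ w → c (f v) (f w))) ∎
          where
            open ≡-Reasoning
            pointwise : ∀ {e} → e ∈ Edges → weight f e ≡ (if avoids acts e then weight f e else ε) ∙ ∑ acts (λ v → if at v e then weight f e else ε)
            pointwise {e} e∈ with anyL? (λ v → at v e ≟ᵇ true) acts
            ... | yes any with find any
            ...   | v , v∈ , th = sym (trans (∙-idˡ _) (∑-pick acts (λ v → at v e) (λ _ → weight f e) u v∈ th (λ v'∈ th' → only-one {a = proj₁ e} {b = proj₂ e} v∈ v'∈ (edge⇒adj e∈) th th')))
            pointwise {e} e∈ | no none = sym (trans (cong (weight f e ∙_) (∑-ε acts (λ {v} v∈ → cong (λ q → if q then weight f e else ε) (¬T⇒F (λ th → none (lose v∈ th)))))) (∙-idʳ _))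

      -- Subgroups of large index

      -- `φᴮ` counts x, y and d rows of d hosts. A class with `Mᴮ` vertices still has a free one
      -- when 2 + d * d are taken. `cᴮ` is twice the cost of a descent per element of `J`: two base
      -- points and 3 |J| units. `C₀` covers `structure` and the placement of the remaining
      -- vertices.
      φᴮ Mᴮ cᴮ C₀ : ℕ
      φᴮ = 2 + d * d
      Mᴮ = 3 + d * d
      cᴮ = 2 * (2 + 3 * φᴮ)
      C₀ = (5 + d) + (2 + K₁ * (suc Δ * d))

      -- `u` counts the vertices discarded so far. Old and new losses are each at most m * `Mᴮ` / h,
      -- and the next subgroup has at most h / 2 elements, so the bound on u * h reproduces itself:
      -- the total loss stays linear however long the descent.
      Claim : ℕ → Set
      Claim h = ∀ (J : Sub) W u → size (mem J) ≡ h → Unique W → Confined (_∈ₛ J) W → u * h ≤ m * Mᴮ → C₀ * n + cᴮ * h + m * Mᴮ ≤ length W + u → 3 * h * d ≤ k → ⊥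

      record BundledData : Set where
        field
          J : Sub
          W : List V
          uW : Unique W
          S : Structured J W
          bundles : List (List VG)
          bundles-unique : Unique bundles
          bundle-length : ∀ {B} → B ∈ bundles → length B ≡ d
          bundle-unique : ∀ {B} → B ∈ bundles → Unique B
          bundle-⊆ : ∀ {B} → B ∈ bundles → B ⊆ vs
          bundle-disjoint : ∀ {B B' v} → B ∈ bundles → B' ∈ bundles → v ∈ B → v ∈ B' → B ≡ B'

      module Bundled (bundledData : BundledData) where
        open BundledData bundledData
        open Structured S
        open Balance J
        open Classmates τ

        -- A bundle with its rows. The first vertex of the bundle is the one that moves and its
        -- neighbours occupy the first row; the neighbours of the other members occupy the further
        -- rows.
        Lab : Set
        Lab = List VG × List (List V)

        Row : List V → List V → Set
        Row u r = length r ≡ d × Similar (map τ r) (map τ u)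

        Valid : Lab → V → Set
        Valid (B , rows) x = length rows ≡ d × (∀ {r} → r ∈ rows → Row (firstRow rows) r) × x ∷ concat rows ⊆ W

        val : Lab → V → A
        val (B , rows) x = ∑ (firstRow rows) (c x)

        vertsᴮ : Lab → V → List V
        vertsᴮ (B , rows) x = x ∷ concat rows

        Order : List Lab → List (List VG) → Set
        Order done is = map proj₁ done ʳ++ is ≡ bundles

        open Process vertsᴮ Valid val Order

        -- Drawn entry by entry from the classes of the `us`; `R` grows with each entry, whence the
        -- demand |R| + |us| on every class.
        similar-row : ∀ Wᵣ → Unique Wᵣ → ∀ us R → (∀ {u} → u ∈ us → length R + length us < length (class (τ u) Wᵣ)) →
          ∃ λ r → length r ≡ length us × Similar (map τ r) (map τ us) × Unique r × r ⊆ Wᵣ × Disjoint r R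
        similar-row Wᵣ uWᵣ [] R h = [] , refl , [] , [] , (λ ()) , λ { (() , _) }
        similar-row Wᵣ uWᵣ (u ∷ us) R h with fresh {W = class (τ u) Wᵣ} R (fil-unique uWᵣ) (≤-<-trans (m≤m+n _ _) (h (here refl)))
        ... | x , x∈ , x∉ with similar-row Wᵣ uWᵣ us (x ∷ R) (λ {w} w∈ → ≤-<-trans (≤-reflexive (sym (+-suc (length R) (length us)))) (h (there w∈)))
        ...   | r , len , sim , ur , r⊆ , dis = x ∷ r , cong suc len , proj₂ (∈-fil⁻ Wᵣ x∈) ∷ sim , unique-cons (λ p → dis (p , here refl)) ur ,
                (λ { (here refl) → fil⊆ Wᵣ x∈ ; (there p) → r⊆ p }) , λ { (here refl , q) → x∉ q ; (there p , q) → dis (p , there q) }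

        similar-rows : ∀ Wᵣ → Unique Wᵣ → ∀ j us R → length us ≡ d → (∀ {u} → u ∈ us → length R + j * d < length (class (τ u) Wᵣ)) →
          ∃ λ rs → length rs ≡ j × (∀ {r} → r ∈ rs → Row us r) × Unique (concat rs) × concat rs ⊆ Wᵣ × Disjoint (concat rs) R × length (concat rs) ≡ j * d
        similar-rows Wᵣ uWᵣ zero us R len h = [] , refl , (λ ()) , [] , (λ ()) , (λ { (() , _) }) , refl
        similar-rows Wᵣ uWᵣ (suc j) us R len h with similar-row Wᵣ uWᵣ us R (λ u∈ → ≤-<-trans (+-monoʳ-≤ (length R) (≤-trans (≤-reflexive len) (m≤m+n d (j * d)))) (h u∈))
        ... | r , lr , sim , ur , r⊆ , dis with similar-rows Wᵣ uWᵣ j us (r ++ R) len (λ u∈ → ≤-<-trans (≤-reflexive (trans (cong (_+ j * d) (trans (length-++ r) (cong (_+ length R) (trans lr len)))) (e d (length R) (j * d)))) (h u∈))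
          where
            e : ∀ a b c → a + b + c ≡ b + (a + c)
            e = solve-∀
        ...   | rs , l , rows , u , rs⊆ , dis' , total = r ∷ rs , cong suc l , (λ { (here refl) → trans lr len , sim ; (there p) → rows p }) ,
                unique-++ ur u (λ { (p , q) → dis' (q , ∈-++⁺ˡ p) }) ,
                (λ q → case ∈-++⁻ r q of λ { (inj₁ p) → r⊆ p ; (inj₂ p) → rs⊆ p }) ,
                (λ { (p , q) → case ∈-++⁻ r p of λ { (inj₁ a) → dis (a , q) ; (inj₂ a) → dis' (a , ∈-++⁺ʳ r q) } }) ,
                trans (length-++ r) (cong₂ _+_ (trans lr len) total)

        -- The d − 1 further rows make the classes of τ at the u's occur d times each, so that a unit is balanced modulo J.
        bundled-unit : ∀ {F B} (g : Gadget (W ∖ F)) → δ g ∈ₛ J → (∀ {u} → u ∈ Gadget.us g → Mᴮ ≤ length (class (τ u) (W ∖ F))) →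
          Σ (Unit J φᴮ F B) λ u → ∀ (H : Sub) → mem H (δ g) ≡ false → 2 * size (mem H) ≤ size (Unit.saturation u H)
        bundled-unit {F} {B} g δ∈ large with similar-rows (W ∖ F) (∖-unique F uW) d' (Gadget.us g) (vertices g) (Gadget.us-length g)
            (λ u∈ → ≤-trans (≤-reflexive (trans (cong (λ k → suc (k + d' * d)) (vertices-length g)) (e d (d' * d)))) (large u∈))
          where
            e : ∀ d k → suc (2 + d + k) ≡ 3 + (d + k)
            e = solve-∀
        ... | rs , len , sim , u-rs , rs⊆ , dis , total = unit , λ H h → two-cosets unit H (there (here refl)) h
          where
            open Gadget g
            rows : List (List V)
            rows = us ∷ rs
            inW : ∀ {w} → w ∈ x ∷ y ∷ concat rows → w ∈ W ∖ F
            inW (here e) = inside (here e)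
            inW (there (here e)) = inside (there (here e))
            inW (there (there p)) with ∈-++⁻ us p
            ... | inj₁ q = inside (there (there q))
            ... | inj₂ q = rs⊆ q
            row-ok : ∀ {r} → r ∈ rows → Row us r
            row-ok (here refl) = us-length , Similar-refl (map τ us)
            row-ok (there p) = sim p
            unique-with : ∀ {w} → w ∈ x ∷ y ∷ [] → Unique (w ∷ concat rows)
            unique-with {w} w∈ = unique-cons (λ p → case ∈-++⁻ us p of λ { (inj₁ q) → w∉us w∈ q ; (inj₂ q) → dis (q , head∈ w∈) })
                (unique-++ (uus distinct) u-rs (λ { (p , q) → dis (q , there (there p)) }))
              where
                uus : ∀ {a b : V} {l} → Unique (a ∷ b ∷ l) → Unique l
                uus (_ ∷ _ ∷ u) = u
                head∈ : ∀ {w} → w ∈ x ∷ y ∷ [] → w ∈ x ∷ y ∷ us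
                head∈ (here e) = here e
                head∈ (there (here e)) = there (here e)
                w∉us : ∀ {w} → w ∈ x ∷ y ∷ [] → w ∉ us
                w∉us (here refl) q with distinct
                ... | (_ ∷ h) ∷ _ = lookupAll h q refl
                w∉us (there (here refl)) q with distinct
                ... | _ ∷ (h ∷ _) = lookupAll h q refl
            option : ∀ {w} → w ∈ y ∷ x ∷ [] → w ∈ x ∷ y ∷ []
            option (here e) = there (here e)
            option (there (here e)) = here e
            verts⊆ : ∀ {w} → w ∈ y ∷ x ∷ [] → w ∷ concat rows ⊆ x ∷ y ∷ concat rows
            verts⊆ (here refl) = there
            verts⊆ (there (here refl)) (here e) = here e
            verts⊆ (there (here refl)) (there p) = there (there p)
            unit : Unit J φᴮ F B
            unit = record
              { label = B , rows ; advance = id ; o₀ = y ; os = x ∷ [] ; F' = x ∷ y ∷ concat rows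
              ; F'-size = ≤-reflexive (cong (2 +_) (trans (length-++ us) (cong₂ _+_ us-length total)))
              ; F'-disjoint = λ { (p , q) → proj₂ (∈-∖⁻ W F (inW p)) q }
              ; ok = λ {w} w∈ → (cong suc len , row-ok , λ p → ∖⊆ W F (inW (verts⊆ w∈ p))) , unique-with (option w∈) , verts⊆ w∈
              ; diff = λ { (here refl) → subst (_∈ₛ J) (sym (∙-invʳ _)) (mem-ε J) ; (there (here refl)) → δ∈ } }

        actives neighbours : List Lab → List VG
        actives = concatMap (λ l → take 1 (proj₁ l))
        neighbours = concatMap (λ l → concatMap nbrs (proj₁ l))
        hosts : List Lab → List V
        hosts = concatMap (λ l → concat (proj₂ l))

        module Done (done : List Lab) (is : List (List VG)) (order : Order done is) where
          in-bundles : ∀ {l} → l ∈ done → proj₁ l ∈ bundles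
          in-bundles l∈ = subst (_ ∈_) order (∈-ʳ++⁺ˡ (map proj₁ done) (∈-map⁺ proj₁ l∈))

          labels-unique : Unique (map proj₁ done)
          labels-unique = proj₁ (unique-ʳ++ (map proj₁ done) (subst Unique (sym order) bundles-unique))

          done-unique : Unique done
          done-unique = unique-map⁻ labels-unique

          same-label : ∀ {l l' v} → l ∈ done → l' ∈ done → v ∈ proj₁ l → v ∈ proj₁ l' → l ≡ l'
          same-label p q a b = unique-map-injective proj₁ labels-unique p q (bundle-disjoint (in-bundles p) (in-bundles q) a b)

          active⁻ : ∀ {v} → v ∈ actives done → ∃ λ l → l ∈ done × v ∈ proj₁ l
          active⁻ {v} h with find (∈-concatMap⁻ (λ l → take 1 (proj₁ l)) {xs = done} h)
          ... | l , l∈ , q = l , l∈ , take⊆ 1 (proj₁ l) q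

          neighbour⁻ : ∀ {w} → w ∈ neighbours done → ∃₂ λ l v → l ∈ done × v ∈ proj₁ l × w ∈ nbrs v
          neighbour⁻ {w} h with find (∈-concatMap⁻ (λ l → concatMap nbrs (proj₁ l)) {xs = done} h)
          ... | l , l∈ , q with find (∈-concatMap⁻ nbrs {xs = proj₁ l} q)
          ...   | v , v∈ , r = l , v , l∈ , v∈ , r

          in-vs : ∀ {l v} → l ∈ done → v ∈ proj₁ l → v ∈ vs
          in-vs l∈ = bundle-⊆ (in-bundles l∈)

          actives-⊆ : ∀ {v} → v ∈ actives done → v ∈ vs
          actives-⊆ h with active⁻ h
          ... | l , l∈ , q = in-vs l∈ q

          actives-unique : Unique (actives done)
          actives-unique = unique-concatMap' done id done-unique
            where
              unique-concatMap' : ∀ ls → ls ⊆ done → Unique ls → Unique (actives ls)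
              unique-concatMap' [] s u = []
              unique-concatMap' (l ∷ ls) s (l∉ ∷ u) = unique-++ (unique-take 1 (bundle-unique (in-bundles (s (here refl))))) (unique-concatMap' ls (s ∘ there) u)
                (λ { (p , q) → case find (∈-concatMap⁻ (λ l → take 1 (proj₁ l)) {xs = ls} q) of λ { (l' , l'∈ , r) → lookupAll l∉ l'∈ (same-label (s (here refl)) (s (there l'∈)) (take⊆ 1 (proj₁ l) p) (take⊆ 1 (proj₁ l') r)) } })

          far-centres : ∀ {v v'} → v ∈ vs → v' ∈ vs → ∀ {w} → w ∈ nbrs v → w ∈ nbrs v' → v ≡ v'
          far-centres v∈ v'∈ p q = sym (same-ball v∈ v'∈ (there p) (there q))

          neighbours-unique : Unique (neighbours done)
          neighbours-unique = go done id done-unique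
            where
              block : ∀ B → B ∈ bundles → Unique (concatMap nbrs B)
              block B B∈ = unique-concatMap nbrs B (bundle-unique B∈) nbrs-unique (λ p q ne a b → ne (far-centres (bundle-⊆ B∈ p) (bundle-⊆ B∈ q) a b))
              go : ∀ ls → ls ⊆ done → Unique ls → Unique (neighbours ls)
              go [] s u = []
              go (l ∷ ls) s (l∉ ∷ u) = unique-++ (block (proj₁ l) (in-bundles (s (here refl)))) (go ls (s ∘ there) u) dis
                where
                  dis : Disjoint (concatMap nbrs (proj₁ l)) (neighbours ls)
                  dis (p , q) with find (∈-concatMap⁻ nbrs {xs = proj₁ l} p) | find (∈-concatMap⁻ (λ l → concatMap nbrs (proj₁ l)) {xs = ls} q)
                  ... | v , v∈ , a | l' , l'∈ , q' with find (∈-concatMap⁻ nbrs {xs = proj₁ l'} q')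
                  ...   | v' , v'∈ , b = lookupAll l∉ l'∈ (same-label (s (here refl)) (s (there l'∈)) v∈ (subst (_∈ proj₁ l') (sym (far-centres (in-vs (s (here refl)) v∈) (in-vs (s (there l'∈)) v'∈) a b)) v'∈))

          actives-neighbours : Disjoint (actives done) (neighbours done)
          actives-neighbours {v} (p , q) with neighbour⁻ q
          ... | l , v' , l∈ , v'∈ , r with same-ball (actives-⊆ p) (in-vs l∈ v'∈) (here refl) (there r)
          ...   | refl = adj⇒≢ (∈-nbrs⁻ r) refl

          fixed : List VG
          fixed = actives done ++ neighbours done

          rest : List VG
          rest = allFin n ∖ fixed

          -- Centres have degree d and d · θ lies in `J`. The neighbours of a bundle form d rows
          -- with the same degrees `pat` over similar values, so `balanced-rows` applies. `θ` is
          -- arbitrary because the constant `τ₀` is needed too.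
          fixed-balanced : ∀ (θ : VG → A) → (∀ {v} → v ∈ actives done → d · θ v ∈ₛ J) →
            (∀ {l} → l ∈ done → ∃ λ ts → (∀ {a} → a ∈ ts → d · a ∈ₛ J) × (∀ {v} → v ∈ proj₁ l → Similar (map θ (nbrs v)) ts)) →
            ∑ fixed (λ a → degree a · θ a) ∈ₛ J
          fixed-balanced θ act rows = subst (_∈ₛ J) (sym (trans (∑-++ (actives done) (neighbours done) _) (cong (∑ (actives done) (λ a → degree a · θ a) ∙_) (∑-concatMap done (λ l → concatMap nbrs (proj₁ l)) _))))
            (mem-∙ J (mem-∑ J (actives done) (λ {v} v∈ → subst (λ k → k · θ v ∈ₛ J) (sym (vs-degree (actives-⊆ v∈))) (act v∈))) (mem-∑ J done label))
            where
              label : ∀ {l} → l ∈ done → ∑ (concatMap nbrs (proj₁ l)) (λ a → degree a · θ a) ∈ₛ J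
              label {l} l∈ with rows l∈
              ... | ts , dts , sim = subst (_∈ₛ J) (sym (∑-concatMap (proj₁ l) nbrs _)) (balanced-rows d (proj₁ l) (λ v → ∑ (nbrs v) (λ a → degree a · θ a)) pat ts (bundle-length (in-bundles l∈)) dts
                (λ {v} v∈ → subst (_≈ weighted pat ts) (sym (trans (weighted-map (nbrs v) degree θ) (cong (λ ks → weighted ks (map θ (nbrs v))) (vs-pattern (in-vs l∈ v∈))))) (weighted-≈ pat (sim v∈))))
        module GP = GroupPlacement degree Δ deg≤Δ τ d'

        module Assembly (done : List Lab) (is : List (List VG)) (order : Order done is) (F : List V)
          (room : n + suc (m * (suc Δ * d)) + length F ≤ length W) (valid-label : ∀ {l} → l ∈ done → ∃ λ x → Valid l x) where
          open Done done is order

          placed : GP.Placed rest (W ∖ F)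
          placed = GP.place-groups n rest rest≤n (∖-unique fixed (allFin⁺ n)) (W ∖ F) (∖-unique F uW) (λ x∈ → dτ (∖⊆ W F x∈))
            (+-cancelʳ-≤ (length F) _ _ (≤-trans (+-monoˡ-≤ (length F) (+-monoˡ-≤ (suc (m * (suc Δ * d))) rest≤n)) (≤-trans room (length-∖ F uW))))
            where
              rest≤n : length rest ≤ n
              rest≤n = ≤-trans (length-filter _ (allFin n)) (≤-reflexive (length-tabulate {n = n} id))
          module Pl = GP.Placed placed

          rest' : List VG
          rest' = map proj₁ Pl.ps
          rest-hosts : List V
          rest-hosts = map proj₂ Pl.ps

          head : ∀ (l : List V) → 0 < length l → V
          head (x ∷ _) _ = x

          zf : VG → V
          zf = overlay (λ _ → head W (≤-trans (s≤s z≤n) (≤-trans (m≤n+m _ n) (≤-trans (m≤m+n _ (length F)) room)))) (neighbours done ++ rest') (hosts done ++ rest-hosts)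

          length-concat : ∀ {X : Set} (ls : List (List X)) j → (∀ {l} → l ∈ ls → length l ≡ j) → length (concat ls) ≡ length ls * j
          length-concat [] j h = refl
          length-concat (l ∷ ls) j h = trans (length-++ l) (cong₂ _+_ (h (here refl)) (length-concat ls j (h ∘ there)))

          nbrs-length : ∀ {l v} → l ∈ done → v ∈ proj₁ l → length (nbrs v) ≡ d
          nbrs-length l∈ v∈ = vs-degree (in-vs l∈ v∈)

          block-length : ∀ {l} → l ∈ done → length (concatMap nbrs (proj₁ l)) ≡ length (concat (proj₂ l))
          block-length {l} l∈ with valid-label l∈
          ... | x , len , rows , _ = trans (trans (length-concat (map nbrs (proj₁ l)) d each) (cong (_* d) (trans (length-map nbrs (proj₁ l)) (trans (bundle-length (in-bundles l∈)) (sym len))))) (sym (length-concat (proj₂ l) d (λ r∈ → proj₁ (rows r∈))))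
            where
              each : ∀ {ws} → ws ∈ map nbrs (proj₁ l) → length ws ≡ d
              each h with ∈-map⁻ nbrs h
              ... | v , v∈ , refl = nbrs-length l∈ v∈

          rest'-fixed : ∀ {a} → a ∈ rest' → a ∉ fixed
          rest'-fixed h = proj₂ (∈-∖⁻ (allFin n) fixed (Pl.inside h))

          lengths : length (neighbours done ++ rest') ≡ length (hosts done ++ rest-hosts)
          lengths = trans (length-++ (neighbours done)) (trans (cong₂ _+_ (length-concatMap done (λ l → concatMap nbrs (proj₁ l)) (λ l → concat (proj₂ l)) block-length) (trans (length-map proj₁ Pl.ps) (sym (length-map proj₂ Pl.ps)))) (sym (length-++ (hosts done))))

          nr-unique : Unique (neighbours done ++ rest')
          nr-unique = unique-++ neighbours-unique Pl.unique₁ (λ { (p , q) → rest'-fixed q (∈-++⁺ʳ (actives done) p) })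

          zf-map : map zf (neighbours done ++ rest') ≡ hosts done ++ rest-hosts
          zf-map = map-overlay _ (neighbours done ++ rest') (hosts done ++ rest-hosts) lengths nr-unique

          covers : ∀ a → a ∈ actives done ++ (neighbours done ++ rest')
          covers a with mem? _≟_ a fixed
          ... | no ¬p = ∈-++⁺ʳ (actives done) (∈-++⁺ʳ (neighbours done) (Pl.covers (∈-∖⁺ {R = fixed} (∈-allFin a) ¬p)))
          ... | yes p with ∈-++⁻ (actives done) p
          ...   | inj₁ q = ∈-++⁺ˡ q
          ...   | inj₂ q = ∈-++⁺ʳ (actives done) (∈-++⁺ˡ q)

          all-unique : Unique (actives done ++ (neighbours done ++ rest'))
          all-unique = unique-++ actives-unique nr-unique (λ { (p , q) → case ∈-++⁻ (neighbours done) q of λ { (inj₁ r) → actives-neighbours (p , r) ; (inj₂ r) → rest'-fixed r (∈-++⁺ˡ p) } })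

          module Choice {g : A} (r : Real done F g) where
            open Real r
            xs : List V
            xs = map proj₂ choice

            f : VG → V
            f = overlay zf (actives done) xs

            actives≡ : actives done ≡ concatMap (λ p → take 1 (proj₁ (proj₁ p))) choice
            actives≡ = trans (cong actives (sym indices)) (concatMap-map (λ l → take 1 (proj₁ l)) proj₁ choice)

            label∈ : ∀ {p} → p ∈ choice → proj₁ p ∈ done
            label∈ p∈ = subst (_ ∈_) indices (∈-map⁺ proj₁ p∈)

            take-length : ∀ {p} → p ∈ choice → length (take 1 (proj₁ (proj₁ p))) ≡ 1
            take-length {p} p∈ = length-take≤ 1 (proj₁ (proj₁ p)) (≤-trans (s≤s z≤n) (≤-reflexive (sym (bundle-length (in-bundles (label∈ p∈))))))

            actives-length : length (actives done) ≡ length xs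
            actives-length = trans (cong length actives≡) (trans (length-concatMap choice (λ p → take 1 (proj₁ (proj₁ p))) (λ p → proj₂ p ∷ []) take-length) (cong length (concatMap-[] proj₂ choice)))

            f-actives : map f (actives done) ≡ xs
            f-actives = map-overlay zf (actives done) xs actives-length actives-unique

            f-other : ∀ {a} → a ∉ actives done → f a ≡ zf a
            f-other = overlay-∉ zf (actives done) xs

            f-nr : map f (neighbours done ++ rest') ≡ hosts done ++ rest-hosts
            f-nr = trans (map-cong-local (tabAll (λ {a} a∈ → f-other (λ q → unique-++-disj (actives done) all-unique (q , a∈))))) zf-map

            f-map : map f (actives done ++ (neighbours done ++ rest')) ≡ xs ++ (hosts done ++ rest-hosts)
            f-map = trans (map-++ f (actives done) _) (cong₂ _++_ f-actives f-nr)

            hosts≡ : hosts done ≡ concatMap (λ p → concat (proj₂ (proj₁ p))) choice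
            hosts≡ = trans (cong hosts (sym indices)) (concatMap-map (λ l → concat (proj₂ l)) proj₁ choice)

            xs-hosts-unique : Unique (xs ++ hosts done)
            xs-hosts-unique = subst (λ l → Unique (xs ++ l)) (sym hosts≡) (unique-separate choice proj₂ (λ p → concat (proj₂ (proj₁ p))) distinct)

            xs-hosts-within : ∀ {x} → x ∈ xs ++ hosts done → x ∈ F × x ∈ W
            xs-hosts-within {x} h = from (∈-++⁻ xs h)
              where
                inside : ∀ {p} → p ∈ choice → x ∈ vertsᴮ (proj₁ p) (proj₂ p) → x ∈ F × x ∈ W
                inside {p} p∈ q = within (∈-concatMap⁺ (λ p → vertsᴮ (proj₁ p) (proj₂ p)) (lose p∈ q)) , proj₂ (proj₂ (lookupAll valid p∈)) q
                from : x ∈ xs ⊎ x ∈ hosts done → x ∈ F × x ∈ W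
                from (inj₁ a) with ∈-map⁻ proj₂ a
                ... | p , p∈ , refl = inside p∈ (here refl)
                from (inj₂ a) with find (∈-concatMap⁻ (λ p → concat (proj₂ (proj₁ p))) {xs = choice} (subst (x ∈_) hosts≡ a))
                ... | p , p∈ , q = inside p∈ (there q)

            host-unique : Unique (xs ++ (hosts done ++ rest-hosts))
            host-unique = subst Unique (++-assoc xs (hosts done) rest-hosts) (unique-++ xs-hosts-unique Pl.unique₂ (λ { (p , q) → proj₂ (∈-∖⁻ W F (Pl.host q)) (proj₁ (xs-hosts-within p)) }))

            f-injective : Injective _≡_ _≡_ f
            f-injective {a} {b} e = unique-map-injective f {actives done ++ (neighbours done ++ rest')} (subst Unique (sym f-map) host-unique) (covers a) (covers b) e

            f-range : ∀ a → f a ∈ W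
            f-range a = from (∈-++⁻ (xs ++ hosts done) (subst (f a ∈_) (trans f-map (sym (++-assoc xs (hosts done) rest-hosts))) (∈-map⁺ f (covers a))))
              where
                from : ∀ {x} → x ∈ xs ++ hosts done ⊎ x ∈ rest-hosts → x ∈ W
                from (inj₁ p) = proj₂ (xs-hosts-within p)
                from (inj₂ p) = ∖⊆ W F (Pl.host p)

            f-block : ∀ {l} → l ∈ done → map f (concatMap nbrs (proj₁ l)) ≡ concat (proj₂ l)
            f-block l∈ = map-split-concat f done (λ l → concatMap nbrs (proj₁ l)) (λ l → concat (proj₂ l)) block-length
              (proj₁ (map-split f (neighbours done) (hosts done) (length-concatMap done (λ l → concatMap nbrs (proj₁ l)) (λ l → concat (proj₂ l)) block-length) f-nr)) l∈

            row-of : ∀ (B : List VG) (rows : List (List V)) → length B ≡ length rows → (∀ {v} → v ∈ B → length (nbrs v) ≡ d) → (∀ {r} → r ∈ rows → length r ≡ d) → map f (concatMap nbrs B) ≡ concat rows →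
              ∀ {v} → v ∈ B → ∃ λ r → r ∈ rows × map f (nbrs v) ≡ r
            row-of (v ∷ B) (r ∷ rows) len lv lr e (here refl) = r , here refl , proj₁ (map-split f (nbrs v) r (trans (lv (here refl)) (sym (lr (here refl)))) e)
            row-of (v ∷ B) (r ∷ rows) len lv lr e (there v∈) = later (row-of B rows (suc-injective len) (lv ∘ there) (lr ∘ there) (proj₂ (map-split f (nbrs v) r (trans (lv (here refl)) (sym (lr (here refl)))) e)) v∈)
              where
                later : ∀ {ws} → (∃ λ r' → r' ∈ rows × ws ≡ r') → ∃ λ r' → r' ∈ r ∷ rows × ws ≡ r'
                later (r' , r'∈ , eq) = r' , there r'∈ , eq

            base : A
            base = ∑ (fil (avoids (actives done)) Edges) (weight zf)

            copy-f : copy f ≡ base ∙ ∑ choice (λ p → val (proj₁ p) (proj₂ p))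
            copy-f = trans (centre-decomposition (actives done) actives-unique independent f) (cong₂ _∙_
                (∑-cong (fil (avoids (actives done)) Edges) (λ {e} e∈ → let (a∉ , b∉) = avoids⁻ {actives done} {proj₁ e} {proj₂ e} (proj₂ (∈-fil⁻ Edges e∈)) in cong₂ c (f-other a∉) (f-other b∉)))
                (trans (cong (λ l → ∑ l centre) actives≡) (trans (∑-concatMap choice (λ p → take 1 (proj₁ (proj₁ p))) centre) (∑-cong choice (λ {p} p∈ → one p p∈)))))
              where
                centre : VG → A
                centre v = ∑ (nbrs v) (λ w → c (f v) (f w))
                independent : ∀ {v v'} → v ∈ actives done → v' ∈ actives done → adj v v' ≡ false
                independent {v} {v'} p q = ¬T⇒F (λ h → adj⇒≢ h (sym (adjacent-ball (actives-⊆ p) (actives-⊆ q) (here refl) (here refl) h)))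
                single : ∀ (B : List VG) (rows : List (List V)) x → length B ≡ d → length rows ≡ d → (∀ {v} → v ∈ B → length (nbrs v) ≡ d) → (∀ {r} → r ∈ rows → length r ≡ d) →
                  map f (take 1 B) ≡ x ∷ [] → map f (concatMap nbrs B) ≡ concat rows → ∑ (take 1 B) centre ≡ ∑ (firstRow rows) (c x)
                single (v ∷ B) (r ∷ rows) x _ _ lv lr e₁ e₂ = trans (∙-idʳ _) (trans (sym (∑-map (nbrs v) f (c (f v)))) (cong₂ (λ l y → ∑ l (c y))
                  (proj₁ (map-split f (nbrs v) r (trans (lv (here refl)) (sym (lr (here refl)))) e₂)) (∷-injectiveˡ e₁)))
                one : ∀ p → p ∈ choice → ∑ (take 1 (proj₁ (proj₁ p))) centre ≡ val (proj₁ p) (proj₂ p)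
                one p p∈ = single (proj₁ (proj₁ p)) (proj₂ (proj₁ p)) (proj₂ p) (bundle-length (in-bundles (label∈ p∈))) (proj₁ (lookupAll valid p∈)) (nbrs-length (label∈ p∈)) (λ r∈ → proj₁ (proj₁ (proj₂ (lookupAll valid p∈)) r∈))
                  (map-split-concat f choice (λ p → take 1 (proj₁ (proj₁ p))) (λ p → proj₂ p ∷ []) take-length (trans (cong (map f) (sym actives≡)) (trans f-actives (sym (concatMap-[] proj₂ choice)))) p∈)
                  (f-block (label∈ p∈))

            -- Modulo `J` the sum is that of degree a · τ (f a), since e(G) · κ vanishes. The fixed
            -- vertices cancel. The others are congruent to the constant placement with `τ₀`, where
            -- the total is 2 e(G) · τ₀ = 0 and the fixed part cancels again.
            copy∈J : copy f ∈ₛ J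
            copy∈J = ≈-∈ approx (subst (_∈ₛ J) (sym split-sum) (mem-∙ J fixed∈ rest∈))
              where
                approx : copy f ≈ ∑ Edges (λ e → κ ∙ τ (f (proj₁ e)) ∙ τ (f (proj₂ e)))
                approx = ≈-∑ Edges (λ {e} e∈ → c≈ (f-range (proj₁ e)) (f-range (proj₂ e)) (λ eq → adj⇒≢ (edge⇒adj e∈) (f-injective eq)))
                θ : VG → A
                θ a = τ (f a)
                degree-sums : ∀ (θ : VG → A) → ∑ Edges (λ e → θ (proj₁ e) ∙ θ (proj₂ e)) ≡ ∑ fixed (λ a → degree a · θ a) ∙ ∑ rest' (λ a → degree a · θ a)
                degree-sums θ = trans (handshake (λ a _ → θ a)) (trans (∑-cong (allFin n) (λ {a} _ → ∑-const (nbrs a) (θ a)))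
                  (trans (∑-reindex (actives done ++ (neighbours done ++ rest')) (λ a → degree a · θ a) all-unique covers)
                    (trans (cong (λ l → ∑ l (λ a → degree a · θ a)) (sym (++-assoc (actives done) (neighbours done) rest'))) (∑-++ fixed rest' _))))
                split-sum : ∑ Edges (λ e → κ ∙ τ (f (proj₁ e)) ∙ τ (f (proj₂ e))) ≡ ∑ fixed (λ a → degree a · θ a) ∙ ∑ rest' (λ a → degree a · θ a)
                split-sum = trans (trans (∑-cong Edges (λ _ → ∙-assoc _ _ _)) (trans (∑-∙ Edges (λ _ → κ) _) (trans (cong (_∙ ∑ Edges (λ e → θ (proj₁ e) ∙ θ (proj₂ e))) (trans (∑-const Edges κ) (annihilates κ))) (∙-idˡ _)))) (degree-sums θ)
                fixed∈ : ∑ fixed (λ a → degree a · θ a) ∈ₛ J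
                fixed∈ = fixed-balanced θ (λ {v} _ → dτ (f-range v)) rows
                  where
                    rows : ∀ {l} → l ∈ done → ∃ λ ts → (∀ {a} → a ∈ ts → d · a ∈ₛ J) × (∀ {v} → v ∈ proj₁ l → Similar (map θ (nbrs v)) ts)
                    rows {l} l∈ with valid-label l∈
                    ... | x , len , row , ⊆W = map τ (firstRow (proj₂ l)) , dts , sim
                      where
                        first⊆ : ∀ (rs : List (List V)) {y} → y ∈ firstRow rs → y ∈ concat rs
                        first⊆ (r ∷ rs) h = ∈-++⁺ˡ h
                        dts : ∀ {a} → a ∈ map τ (firstRow (proj₂ l)) → d · a ∈ₛ J
                        dts h with ∈-map⁻ τ h
                        ... | y , y∈ , refl = dτ (⊆W (there (first⊆ (proj₂ l) y∈)))
                        sim : ∀ {v} → v ∈ proj₁ l → Similar (map θ (nbrs v)) (map τ (firstRow (proj₂ l)))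
                        sim {v} v∈ = from (row-of (proj₁ l) (proj₂ l) (trans (bundle-length (in-bundles l∈)) (sym len)) (nbrs-length l∈) (λ r∈ → proj₁ (row r∈)) (f-block l∈) v∈)
                          where
                            from : (∃ λ r → r ∈ proj₂ l × map f (nbrs v) ≡ r) → Similar (map θ (nbrs v)) (map τ (firstRow (proj₂ l)))
                            from (r , r∈ , eq) = subst (λ ys → Similar ys (map τ (firstRow (proj₂ l)))) (trans (cong (map τ) (sym eq)) (sym (map-∘ (nbrs v)))) (proj₂ (row r∈))
                const-similar : ∀ (ws : List VG) {j} → length ws ≡ j → Similar (map (λ _ → Pl.τ₀) ws) (replicate j Pl.τ₀)
                const-similar [] refl = []
                const-similar (w ∷ ws) refl = ≈-refl ∷ const-similar ws refl
                const-rows : ∀ {a} j → a ∈ replicate j Pl.τ₀ → d · a ∈ₛ J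
                const-rows (suc j) (here refl) = Pl.dτ₀
                const-rows (suc j) (there h) = const-rows j h
                fixed₀ : ∑ fixed (λ a → degree a · Pl.τ₀) ∈ₛ J
                fixed₀ = fixed-balanced (λ _ → Pl.τ₀) (λ _ → Pl.dτ₀) (λ {l} l∈ → replicate d Pl.τ₀ , const-rows d , (λ {v} v∈ → const-similar (nbrs v) (nbrs-length l∈ v∈)))
                all₀ : ∑ Edges (λ e → Pl.τ₀ ∙ Pl.τ₀) ≡ ε
                all₀ = trans (∑-∙ Edges (λ _ → Pl.τ₀) (λ _ → Pl.τ₀)) (trans (cong₂ _∙_ (trans (∑-const Edges Pl.τ₀) (annihilates Pl.τ₀)) (trans (∑-const Edges Pl.τ₀) (annihilates Pl.τ₀))) (∙-idˡ ε))
                rest₀ : ∑ rest' (λ a → degree a · Pl.τ₀) ∈ₛ J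
                rest₀ = subst (_∈ₛ J) (trans (cong (_∙ ∑ fixed (λ a → degree a · Pl.τ₀) ⁻¹) (trans (sym all₀) (degree-sums (λ _ → Pl.τ₀))))
                  (solveG (∑ fixed (λ a → degree a · Pl.τ₀) ∷ᵛ ∑ rest' (λ a → degree a · Pl.τ₀) ∷ᵛ []ᵛ) (v0 ⊕ v1 ⊕ ⊖ v0) v1 refl)) (mem-∙⁻¹ J (mem-ε J) fixed₀)
                f-rest : ∀ {p} → p ∈ Pl.ps → f (proj₁ p) ≡ proj₂ p
                f-rest {p} p∈ = pairwise Pl.ps (proj₂ (map-split f (neighbours done) (hosts done) (length-concatMap done (λ l → concatMap nbrs (proj₁ l)) (λ l → concat (proj₂ l)) block-length) f-nr)) p∈
                  where
                    pairwise : ∀ (ps : List (VG × V)) → map f (map proj₁ ps) ≡ map proj₂ ps → ∀ {p} → p ∈ ps → f (proj₁ p) ≡ proj₂ p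
                    pairwise (p ∷ ps) e (here refl) = ∷-injectiveˡ e
                    pairwise (p ∷ ps) e (there h) = pairwise ps (∷-injectiveʳ e) h
                rest∈ : ∑ rest' (λ a → degree a · θ a) ∈ₛ J
                rest∈ = subst (_∈ₛ J) (sym (trans (∑-map Pl.ps proj₁ (λ a → degree a · θ a)) (∑-cong Pl.ps (λ {p} p∈ → cong (λ y → degree (proj₁ p) · τ y) (f-rest p∈)))))
                  (≈-∈ Pl.balanced (subst (_∈ₛ J) (∑-map Pl.ps proj₁ (λ a → degree a · Pl.τ₀)) rest₀))

        -- By `copy∈J` every realised copy misses zero by an element of `J`; that correction is
        -- itself realised.
        finish : ∀ done is F s → Order done is → n + suc (m * (suc Δ * d)) + length F ≤ length W → (∀ {g} → g ∈ₛ J → Real done F (s ∙ g)) → ⊥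
        finish done is F s order room real = absent C₁.f C₁.f-injective (trans C₁.copy-f (trans (cong (C₁.base ∙_) (Real.total r₁)) (solveG (C₁.base ∷ᵛ s ∷ᵛ []ᵛ) (v0 ⊕ (v1 ⊕ ⊖ (v0 ⊕ v1))) 𝟎 refl)))
          where
            r₀ : Real done F (s ∙ ε)
            r₀ = real (mem-ε J)
            valid-label : ∀ {l} → l ∈ done → ∃ λ x → Valid l x
            valid-label l∈ with ∈-map⁻ proj₁ (subst (_ ∈_) (sym (Real.indices r₀)) l∈)
            ... | (l , x) , p∈ , refl = x , lookupAll (Real.valid r₀) p∈
            module As = Assembly done is order F room valid-label
            module C₀ = As.Choice r₀
            base∈ : C₀.base ∙ s ∈ₛ J
            base∈ = subst (_∈ₛ J) (trans C₀.copy-f (trans (cong (C₀.base ∙_) (Real.total r₀)) (cong (C₀.base ∙_) (∙-idʳ s)))) C₀.copy∈J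
            r₁ : Real done F (s ∙ (C₀.base ∙ s) ⁻¹)
            r₁ = real (mem-⁻¹ J base∈)
            module C₁ = As.Choice r₁

        -- u bounds the vertices lost so far by discarding small classes; W₀ is W together with the two base points of S.
        record StepData : Set where
          field
            u : ℕ
            IH : ∀ {h'} → h' < size (mem J) → Claim h'
            W₀ : List V
            W⊆W₀ : W ⊆ W₀
            W₀≤ : length W₀ ≤ length W + 2
            conf : Confined (_∈ₛ J) W₀
            lost : u * size (mem J) ≤ m * Mᴮ
            big : C₀ * n + cᴮ * size (mem J) + m * Mᴮ ≤ length W₀ + u
            balls : 3 * size (mem J) * d ≤ k
            bundles-count : length bundles ≡ 3 * size (mem J)

        module Step (stepData : StepData) where
          open StepData stepData
          open ≤-Reasoning
          h b : ℕ
          h = size (mem J)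
          -- A unit adds at least |H| ≥ 1 values, so 3 |J| units meet the initial potential.
          b = 3 * h
          1≤h : 1 ≤ h
          1≤h = size>0 {mem J} {ε} (mem-ε J)

          order-length : ∀ (done : List Lab) is → Order done is → length done + length is ≡ b
          order-length done is order = trans (cong (_+ length is) (sym (length-map proj₁ done))) (trans (sym (length-ʳ++ (map proj₁ done))) (trans (cong length order) bundles-count))

          F-small : ∀ {is} (st : State J φᴮ 0 is) → length (State.F st) ≤ b * φᴮ
          F-small {is} st = ≤-trans (State.F-size st) (≤-trans (≤-reflexive (+-identityʳ _)) (*-monoˡ-≤ φᴮ (≤-trans (m≤m+n (length (State.done st)) (length is)) (≤-reflexive (order-length (State.done st) is (State.order st))))))

          -- When h is at least halved, half of cᴮ * h is set free; it pays for two base points and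
          -- the hosts of all `b` units.
          spare : ∀ h' → 2 * h' ≤ h → cᴮ * h' + (2 + b * φᴮ) ≤ cᴮ * h
          spare h' 2h'≤h = begin
            cᴮ * h' + (2 + b * φᴮ) ≤⟨ +-monoʳ-≤ (cᴮ * h') (+-monoˡ-≤ (b * φᴮ) (≤-trans (≤-reflexive (sym (*-identityʳ 2))) (*-monoʳ-≤ 2 1≤h))) ⟩
            cᴮ * h' + (2 * h + 3 * h * φᴮ) ≡⟨ e₁ φᴮ h h' ⟩
            (2 + 3 * φᴮ) * (2 * h') + (2 + 3 * φᴮ) * h ≤⟨ +-monoˡ-≤ _ (*-monoʳ-≤ (2 + 3 * φᴮ) 2h'≤h) ⟩
            (2 + 3 * φᴮ) * h + (2 + 3 * φᴮ) * h ≡⟨ e₂ φᴮ h ⟩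
            cᴮ * h ∎
            where
              e₁ : ∀ φ h h' → 2 * (2 + 3 * φ) * h' + (2 * h + 3 * h * φ) ≡ (2 + 3 * φ) * (2 * h') + (2 + 3 * φ) * h
              e₁ = solve-∀
              e₂ : ∀ φ h → (2 + 3 * φ) * h + (2 + 3 * φ) * h ≡ 2 * (2 + 3 * φ) * h
              e₂ = solve-∀

          -- Vertices in classes below `Mᴮ` may lack similar rows and are discarded first. If the
          -- gadgets on the rest all have differences in `H`, the induction hypothesis applies to
          -- `H`, with the discarded vertices added to `u`.
          oracle : ∀ i is (st : State J φᴮ 0 (i ∷ is)) → ∀ {g} → g ∈ₛ J → mem (State.H st) g ≡ false → size (mem (State.H st)) < suc m →
            ((w : Unit J φᴮ (State.F st) i) → (2 + 0) * size (mem (State.H st)) ≤ size (Unit.saturation w (State.H st)) → 4 * (0 * size (mem (State.H st))) ≤ size (mem J) → ⊥) → ⊥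
          oracle i is st {g} gJ gH _ ret = em {∃ λ (a : Gadget Wb) → mem H (δ a) ≡ false} λ
              { (inj₁ (a , a∉)) → let (w , two) = bundled-unit {F} {i} (gadget-⊆ Wb⊆ a) (conf (gadget-⊆ (λ x∈ → in-W (Wb⊆ x∈)) a)) (λ {y} y∈ → large y (Gadget.inside a (there (there y∈)))) in ret w (two H a∉) z≤n
              ; (inj₂ none) → IH {h'} (≤-trans (≤-trans (≤-reflexive (+-comm 1 h')) (+-monoʳ-≤ h' (≤-trans 1≤h' (≤-reflexive (sym (+-identityʳ h')))))) 2h'≤h) H Wb (u + s) refl (fil-unique uWr) (λ a → from (bool (mem H (δ a))) (λ r → none (a , r))) lost' big'
                  (≤-trans (*-monoˡ-≤ d (*-monoʳ-≤ 3 (≤-trans (m≤m+n h' (h' + 0)) 2h'≤h))) balls) }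
            where
              H : Sub
              H = State.H st
              F Wr Sm Wb : List V
              F = State.F st
              Wr = W ∖ F
              uWr : Unique Wr
              uWr = ∖-unique F uW
              small? : V → Bool
              small? x = does (suc (length (class (τ x) Wr)) ≤? Mᴮ)
              Sm = fil small? Wr
              Wb = fil (not ∘ small?) Wr
              Wb⊆ : Wb ⊆ Wr
              Wb⊆ = fil⊆ Wr
              in-W : ∀ {x} → x ∈ Wr → x ∈ W₀
              in-W x∈ = W⊆W₀ (∖⊆ W F x∈)
              from : ∀ {b} → b ≡ true ⊎ b ≡ false → ¬ (b ≡ false) → b ≡ true
              from (inj₁ p) _ = p
              from (inj₂ p) q = ⊥-elim (q p)
              large : ∀ y → y ∈ Wb → Mᴮ ≤ length (class (τ y) Wr)
              large y y∈ = not-small (suc (length (class (τ y) Wr)) ≤? Mᴮ) (proj₂ (∈-fil⁻ Wr y∈))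
                where
                  not-small : (dec : Dec (suc (length (class (τ y) Wr)) ≤ Mᴮ)) → not (does dec) ≡ true → Mᴮ ≤ length (class (τ y) Wr)
                  not-small (no ¬p) _ = ≤-pred (≰⇒> ¬p)
              h' s : ℕ
              h' = size (mem H)
              s = length Sm
              1≤h' : 1 ≤ h'
              1≤h' = size>0 {mem H} {ε} (mem-ε H)
              2h'≤h : 2 * h' ≤ h
              2h'≤h = lagrange₂ {H} {J} {g} (State.H⊆J st) gJ gH
              lost' : (u + s) * h' ≤ m * Mᴮ
              lost' = *-cancelˡ-≤ 2 (begin
                2 * ((u + s) * h') ≡⟨ e₁ u s h' ⟩
                (u + s) * (2 * h') ≤⟨ *-monoʳ-≤ (u + s) 2h'≤h ⟩
                (u + s) * h ≡⟨ *-distribʳ-+ h u s ⟩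
                u * h + s * h ≤⟨ +-mono-≤ lost (small-classes Mᴮ Wr uWr) ⟩
                m * Mᴮ + m * Mᴮ ≡⟨ cong (m * Mᴮ +_) (sym (+-identityʳ _)) ⟩
                2 * (m * Mᴮ) ∎)
                where
                  e₁ : ∀ u s h → 2 * ((u + s) * h) ≡ (u + s) * (2 * h)
                  e₁ = solve-∀
              big' : C₀ * n + cᴮ * h' + m * Mᴮ ≤ length Wb + (u + s)
              big' = +-cancelʳ-≤ (2 + b * φᴮ) _ _ (begin
                C₀ * n + cᴮ * h' + m * Mᴮ + (2 + b * φᴮ) ≡⟨ e₂ (C₀ * n) (cᴮ * h') (m * Mᴮ) (2 + b * φᴮ) ⟩
                C₀ * n + (cᴮ * h' + (2 + b * φᴮ)) + m * Mᴮ ≤⟨ +-monoˡ-≤ (m * Mᴮ) (+-monoʳ-≤ (C₀ * n) (spare h' 2h'≤h)) ⟩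
                C₀ * n + cᴮ * h + m * Mᴮ ≤⟨ big ⟩
                length W₀ + u ≤⟨ +-monoˡ-≤ u (W₀≤) ⟩
                length W + 2 + u ≤⟨ +-monoˡ-≤ u (+-monoˡ-≤ 2 (length-∖ F uW)) ⟩
                length Wr + length F + 2 + u ≤⟨ +-monoˡ-≤ u (+-monoˡ-≤ 2 (+-mono-≤ (≤-reflexive (sym (length-fil-not small? Wr))) (F-small st))) ⟩
                s + length Wb + b * φᴮ + 2 + u ≡⟨ e₃ s (length Wb) (b * φᴮ) u ⟩
                length Wb + (u + s) + (2 + b * φᴮ) ∎)
                where
                  e₂ : ∀ a b c e → a + b + c + e ≡ a + (b + e) + c
                  e₂ = solve-∀
                  e₃ : ∀ s w f u → s + w + f + 2 + u ≡ w + (u + s) + (2 + f)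
                  e₃ = solve-∀

          initial : State J φᴮ 0 bundles
          initial = record { done = [] ; order = refl ; H = trivial ; X = mem trivial ; F = [] ; s = ε ; x₀ = ε ; F-size = z≤n
            ; H⊆J = λ h → subst (_∈ₛ J) (sym (∈-trivial h)) (mem-ε J) ; X⊆J = λ h → subst (_∈ₛ J) (sym (∈-trivial h)) (mem-ε J)
            ; X-inv = λ p q → mem-∙ trivial p q ; X-point = mem-ε trivial
            ; real = λ h → record { choice = [] ; indices = refl ; valid = [] ; distinct = [] ; within = λ () ; total = sym (trans (cong (ε ∙_) (∈-trivial h)) (∙-idˡ ε)) } }

          potential : 3 * h ≤ b * (1 * size (mem trivial)) + size (mem trivial)
          potential = ≤-trans (≤-trans (≤-reflexive (sym (*-identityʳ b))) (*-monoʳ-≤ b (≤-trans (size>0 {mem trivial} {ε} (mem-ε trivial)) (≤-reflexive (sym (*-identityˡ _)))))) (m≤m+n _ _)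

          room : ∀ {is} (st : State J φᴮ 0 is) → n + suc (m * (suc Δ * d)) + length (State.F st) ≤ length W
          room st = +-cancelʳ-≤ 2 _ _ (begin
            n + suc (m * (suc Δ * d)) + length (State.F st) + 2 ≤⟨ +-monoˡ-≤ 2 (+-mono-≤ (+-mono-≤ (≤-reflexive (sym (*-identityˡ n))) (+-mono-≤ {1} {n} 1≤n (*-monoˡ-≤ (suc Δ * d) (≤-trans m≤ (*-monoʳ-≤ K₁ k≤n))))) (F-small st)) ⟩
            1 * n + (n + K₁ * n * (suc Δ * d)) + b * φᴮ + 2 ≡⟨ e₁ n K₁ (suc Δ * d) (b * φᴮ) ⟩
            (2 + K₁ * (suc Δ * d)) * n + (0 + (2 + b * φᴮ)) ≤⟨ +-mono-≤ (*-monoˡ-≤ n (m≤n+m (2 + K₁ * (suc Δ * d)) (5 + d))) (≤-trans (≤-reflexive (cong (_+ (2 + b * φᴮ)) (sym (*-zeroʳ cᴮ)))) (spare 0 z≤n)) ⟩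
            C₀ * n + cᴮ * h ≤⟨ +-cancelʳ-≤ (m * Mᴮ) _ _ (≤-trans big (+-monoʳ-≤ (length W₀) u≤)) ⟩
            length W₀ ≤⟨ W₀≤ ⟩
            length W + 2 ∎)
            where
              e₁ : ∀ n K x f → 1 * n + (n + K * n * x) + f + 2 ≡ (2 + K * x) * n + (0 + (2 + f))
              e₁ = solve-∀
              u≤ : u ≤ m * Mᴮ
              u≤ = ≤-trans (≤-trans (≤-reflexive (sym (*-identityʳ u))) (*-monoʳ-≤ u 1≤h)) lost

          impossible : ⊥
          impossible = run 0 (suc m) oracle 0 b bundles initial (trans bundles-count (sym (+-identityʳ b))) potential λ
            { is' _ (st , inj₁ J⊆H) → finish (State.done st) is' (State.F st) (State.s st) (State.order st) (room st)
                (λ {g} g∈ → State.real st (subst (λ w → State.X st w ≡ true) (solveG (State.x₀ st ∷ᵛ g ∷ᵛ []ᵛ) (v0 ⊕ (v1 ⊕ ⊖ v0)) v1 refl)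
                  (State.X-inv st (State.X-point st) (J⊆H (mem-∙⁻¹ J g∈ (State.X⊆J st (State.X-point st)))))))
            ; is' _ (st , inj₂ m<) → <⇒≱ m< (size≤m (mem (State.H st))) }

      open Chunks {VG} d' using (chunk; length-chunk; chunk-length; chunk-⊆; chunk-unique; chunk-disjoint; chunks-unique)
      open ≤-Reasoning

      phase-B : ∀ h → Acc _<_ h → Claim h
      phase-B h (acc rec) J W u refl uW conf lost big balls = go (structure {J} conf uW enough)
        where
          enough : 5 + d ≤ length W
          enough = begin
            5 + d ≡⟨ sym (*-identityʳ (5 + d)) ⟩
            (5 + d) * 1 ≤⟨ *-mono-≤ (m≤m+n (5 + d) (2 + K₁ * (suc Δ * d))) 1≤n ⟩
            C₀ * n ≤⟨ m≤m+n _ _ ⟩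
            C₀ * n + cᴮ * size (mem J) ≤⟨ +-cancelʳ-≤ (m * Mᴮ) _ _ (≤-trans big (+-monoʳ-≤ (length W) (≤-trans (≤-trans (≤-reflexive (sym (*-identityʳ u))) (*-monoʳ-≤ u (size>0 {mem J} {ε} (mem-ε J)))) lost))) ⟩
            length W ∎
          go : (∃₂ λ p q → Structured J (W ∖ (p ∷ q ∷ []))) → ⊥
          b : ℕ
          b = 3 * size (mem J)
          go (p , q , S) = Bundled.Step.impossible
            (record { J = J ; W = W ∖ (p ∷ q ∷ []) ; uW = ∖-unique (p ∷ q ∷ []) uW ; S = S ; bundles = chunk b vs ; bundles-unique = chunks-unique b vs balls vs-unique
              ; bundle-length = chunk-length b vs balls ; bundle-unique = chunk-unique b vs vs-unique ; bundle-⊆ = chunk-⊆ b vs ; bundle-disjoint = chunk-disjoint b vs vs-unique })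
            (record { u = u ; IH = λ {h'} lt → phase-B h' (rec lt) ; W₀ = W ; W⊆W₀ = ∖⊆ W (p ∷ q ∷ []) ; W₀≤ = length-∖ (p ∷ q ∷ []) uW ; conf = conf
              ; lost = lost ; big = big ; balls = balls ; bundles-count = length-chunk b vs })

      -- The descent on `J`.

      open MainConstants Δ 1≤Δ d K₁ using (CB; K'; stage; C)

      1≤K' : 1 ≤ K'
      1≤K' = *-mono-≤ {1} {3 * d} (s≤s z≤n) (positive K₁ m≤)
        where
          positive : ∀ K → m ≤ K * k → 1 ≤ K
          positive zero h = ≤-trans (size>0 {mem full} {ε} refl) (≤-trans (size≤m (mem full)) h)
          positive (suc K) h = s≤s z≤n

      stage-≥ : ∀ j → CB ≤ stage j
      stage-≥ zero = ≤-refl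
      stage-≥ (suc j) = ≤-trans (m≤n+m CB 2) (m≤n+m (2 + CB) _)

      few : ∀ (J : Sub) W → Unique W → Confined (_∈ₛ J) W → CB * n ≤ length W → 3 * size (mem J) * d ≤ k → ⊥
      few J W uW conf big balls = phase-B (size (mem J)) (<-wellFounded (size (mem J))) J W 0 refl uW conf z≤n
          (begin
            C₀ * n + cᴮ * size (mem J) + m * Mᴮ ≤⟨ +-mono-≤ (+-monoʳ-≤ (C₀ * n) (*-monoʳ-≤ cᴮ (≤-trans (size≤m (mem J)) m≤n))) (*-monoˡ-≤ Mᴮ m≤n) ⟩
            C₀ * n + cᴮ * (K₁ * n) + K₁ * n * Mᴮ ≡⟨ e C₀ cᴮ K₁ Mᴮ n ⟩
            CB * n ≤⟨ big ⟩
            length W ≡⟨ sym (+-identityʳ _) ⟩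
            length W + 0 ∎) balls
        where
          m≤n : m ≤ K₁ * n
          m≤n = ≤-trans m≤ (*-monoʳ-≤ K₁ k≤n)
          e : ∀ a c K M n → a * n + c * (K * n) + K * n * M ≡ (a + c * K + K * M) * n
          e = solve-∀

      -- While J has bounded index, restricting to a class of τ makes the colouring constant modulo J.
      main : ∀ j (J : Sub) W → Unique W → Confined (_∈ₛ J) W → stage j * n ≤ length W → 3 * size (mem J) * d ≤ 2 ^ j * k → ⊥
      main zero J W uW conf big balls = few J W uW conf big (≤-trans balls (≤-reflexive (*-identityˡ k)))
      main (suc j) J W uW conf big balls with 3 * size (mem J) * d ≤? k
      ... | yes enough = few J W uW conf (≤-trans (*-monoˡ-≤ n (stage-≥ (suc j))) big) enough
      ... | no many-cosets = go (structure {J} conf uW 5+d≤)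
        where
          h : ℕ
          h = size (mem J)
          2+CB≤ : (2 + CB) * n ≤ length W
          2+CB≤ = ≤-trans (*-monoˡ-≤ n (m≤n+m (2 + CB) (K' * (CA + stage j)))) big
          5+d≤ : 5 + d ≤ length W
          5+d≤ = ≤-trans (≤-trans (≤-reflexive (sym (*-identityʳ (5 + d)))) (*-mono-≤ (≤-trans (≤-trans (m≤m+n (5 + d) _) (≤-trans (m≤m+n _ _) (m≤m+n _ _))) (m≤n+m CB 2)) 1≤n)) 2+CB≤
          go : (∃₂ λ p q → Structured J (W ∖ (p ∷ q ∷ []))) → ⊥
          -- A proper subgroup has at most half the elements, which matches the loss of one factor 2
          -- from stage to stage.
          smaller : ∀ (H : Sub) → H ⊆ₛ J → ∀ {a} → a ∈ₛ J → mem H a ≡ false → ∀ X → Unique X → stage j * n ≤ length X → Confined (_∈ₛ H) X → ⊥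
          smaller H H⊆J aJ aH X uX bigX confX = main j H X uX confX bigX (*-cancelˡ-≤ 2 (begin
            2 * (3 * size (mem H) * d) ≡⟨ e (size (mem H)) d ⟩
            3 * (2 * size (mem H)) * d ≤⟨ *-monoˡ-≤ d (*-monoʳ-≤ 3 (lagrange₂ {H} {J} H⊆J aJ aH)) ⟩
            3 * h * d ≤⟨ balls ⟩
            2 * 2 ^ j * k ≡⟨ *-assoc 2 (2 ^ j) k ⟩
            2 * (2 ^ j * k) ∎))
            where
              e : ∀ a d → 2 * (3 * a * d) ≡ 3 * (2 * a) * d
              e = solve-∀
          go (p , q , S) = in-class (proj₁ (large-class W')) (class (proj₁ (large-class W')) W') (fil-unique uW') (fil⊆ W') (λ x∈ → proj₂ (∈-fil⁻ {p = λ x → mem J (τ x ∙ proj₁ (large-class W') ⁻¹)} W' x∈)) (proj₂ (large-class W'))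
            where
              open Structured S
              open Balance J using (module Classmates; _≈_; ≈-trans; ≈-∙; ≈-refl)
              open Classmates τ
              W' : List V
              W' = W ∖ (p ∷ q ∷ [])
              uW' : Unique W'
              uW' = ∖-unique (p ∷ q ∷ []) uW
              in-class : ∀ (g : A) (U₀ : List V) → Unique U₀ → U₀ ⊆ W' → (∀ {x} → x ∈ U₀ → τ x ≈ g) → length W' * h ≤ m * length U₀ → ⊥
              in-class g U₀ uU₀ U₀⊆ τ≈ size-bound = phase-A J (κ ∙ g ∙ g) U₀ uU₀ const (stage j * n) (λ H H⊆J aJ aH X uX _ bigX confX → smaller H H⊆J aJ aH X uX bigX confX) enough
                where
                  const : ∀ {x y} → x ∈ U₀ → y ∈ U₀ → x ≢ y → c x y ∙ (κ ∙ g ∙ g) ⁻¹ ∈ₛ J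
                  const {x} {y} x∈ y∈ ne = ≈-trans {c x y} {κ ∙ τ x ∙ τ y} {κ ∙ g ∙ g} (c≈ (U₀⊆ x∈) (U₀⊆ y∈) ne) (≈-∙ {κ ∙ τ x} {κ ∙ g} {τ y} {g} (≈-∙ {κ} {κ} {τ x} {g} (≈-refl {κ}) (τ≈ x∈)) (τ≈ y∈))
                  -- `many-cosets` gives 3 d |J| > k, hence m / |J| < 3 d `K₁` = `K'`; so the
                  -- largest class loses at most this factor.
                  W'≤ : length W' ≤ K' * length U₀
                  W'≤ = *-cancelʳ-≤ _ _ h {{>-nonZero (size>0 {mem J} {ε} (mem-ε J))}} (begin
                    length W' * h ≤⟨ size-bound ⟩
                    m * length U₀ ≤⟨ *-monoˡ-≤ (length U₀) (≤-trans m≤ (*-monoʳ-≤ K₁ (<⇒≤ (≰⇒> many-cosets)))) ⟩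
                    K₁ * (3 * h * d) * length U₀ ≡⟨ e K₁ h d (length U₀) ⟩
                    3 * d * K₁ * length U₀ * h ∎)
                    where
                      e : ∀ K h d u → K * (3 * h * d) * u ≡ 3 * d * K * u * h
                      e = solve-∀
                  enough : CA * n + stage j * n ≤ length U₀
                  enough = *-cancelˡ-≤ K' {{>-nonZero 1≤K'}} (≤-trans (+-cancelʳ-≤ 2 _ _ (begin
                    K' * (CA * n + stage j * n) + 2 ≡⟨ cong (_+ 2) (e K' CA (stage j) n) ⟩
                    K' * (CA + stage j) * n + 2 ≤⟨ +-monoʳ-≤ (K' * (CA + stage j) * n) (≤-trans (≤-reflexive (sym (*-identityʳ 2))) (*-mono-≤ {2} {2 + CB} (m≤m+n 2 CB) 1≤n)) ⟩
                    K' * (CA + stage j) * n + (2 + CB) * n ≡⟨ sym (*-distribʳ-+ n (K' * (CA + stage j)) (2 + CB)) ⟩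
                    stage (suc j) * n ≤⟨ big ⟩
                    length W ≤⟨ length-∖ (p ∷ q ∷ []) uW ⟩
                    length W' + 2 ∎)) W'≤)
                    where
                      e : ∀ K a s n → K * (a * n + s * n) ≡ K * (a + s) * n
                      e = solve-∀
      contradiction-at : C * n ≤ t → ⊥
      contradiction-at le = main K' full (allFin t) (allFin⁺ t) (λ _ → refl) (≤-trans le (≤-reflexive (sym (length-tabulate {n = t} id)))) (begin
        3 * size (mem full) * d ≤⟨ *-monoˡ-≤ d (*-monoʳ-≤ 3 (≤-trans (size≤m (mem full)) m≤)) ⟩
        3 * (K₁ * k) * d ≡⟨ e K₁ k d ⟩
        K' * k ≤⟨ *-monoˡ-≤ k (<⇒≤ (n<2^n K')) ⟩
        2 ^ K' * k ∎)
        where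
          e : ∀ K k d → 3 * (K * k) * d ≡ 3 * d * K * k
          e = solve-∀

-- Transport to the given group, finite search, and the theorem.

open Defs using (FiniteAbelianGroup; Colouring; copySum)

module Transport (Γ : FiniteAbelianGroup) where
  open FiniteAbelianGroup Γ renaming (refl to ≈-refl; sym to ≈-sym; trans to ≈-trans)
  open Inverse enum using (to; from; to-cong; from-cong; inverse; strictlyInverseˡ; strictlyInverseʳ)

  finAb : FinAb
  finAb = record
    { ord = order ; _∙ᶠ_ = λ i j → from (to i ∙ to j) ; εᶠ = from ε ; _⁻¹ᶠ = λ i → from (to i ⁻¹)
    ; isAbelianGroup = record { isGroup = record { isMonoid = record { isSemigroup = record { isMagma = record { isEquivalence = ≡-isEquivalence ; ∙-cong = cong₂ (λ i j → from (to i ∙ to j)) }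
        ; assoc = λ i j l → from-cong (≈-trans (∙-cong (strictlyInverseˡ _) ≈-refl) (≈-trans (assoc _ _ _) (∙-cong ≈-refl (≈-sym (strictlyInverseˡ _))))) }
        ; identity = (λ i → trans (from-cong (≈-trans (∙-cong (strictlyInverseˡ _) ≈-refl) (identityˡ _))) (strictlyInverseʳ i)) , (λ i → trans (from-cong (≈-trans (∙-cong ≈-refl (strictlyInverseˡ _)) (identityʳ _))) (strictlyInverseʳ i)) }
        ; inverse = (λ i → from-cong (≈-trans (∙-cong (strictlyInverseˡ _) ≈-refl) (inverseˡ _))) , (λ i → from-cong (≈-trans (∙-cong ≈-refl (strictlyInverseˡ _)) (inverseʳ _)))
        ; ⁻¹-cong = cong (λ i → from (to i ⁻¹)) }
      ; comm = λ i j → from-cong (comm _ _) } }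

  open Group finAb using (∑) renaming (ε to ε')

  -- `step` stands for the folding function of `copySum`, compared with the group operation only up
  -- to the equality of the group.
  to-∑ : ∀ {X : Set} (es : List X) (w : X → Carrier) (step : X → Carrier → Carrier) → (∀ e a → step e a ≈ w e ∙ a) → to (∑ es (from ∘ w)) ≈ foldr step ε es
  to-∑ [] w step h = strictlyInverseˡ ε
  to-∑ (e ∷ es) w step h = ≈-trans (strictlyInverseˡ _) (≈-trans (∙-cong (strictlyInverseˡ _) (to-∑ es w step h)) (≈-sym (h e _)))

  zero-sum : ∀ (G : Defs.Graph) {t} (col : Colouring Γ t) (f : Fin (Defs.n G) → Fin t) →
    ∑ (Defs.edges G) (λ e → from (Colouring.col col (f (proj₁ e)) (f (proj₂ e)))) ≡ ε' → copySum Γ G col f ≈ ε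
  zero-sum G col f h = ≈-trans (≈-sym (to-∑ (Defs.edges G) (λ e → Colouring.col col (f (proj₁ e)) (f (proj₂ e))) _ (λ _ _ → ≈-refl)))
    (≈-trans (to-cong h) (strictlyInverseˡ ε))

module Search (Γ : FinAb) (G : Defs.Graph) {t : ℕ} (c : Fin t → Fin t → Fin (FinAb.ord Γ)) where
  open Group Γ

  total : (Fin (Defs.n G) → Fin t) → A
  total f = ∑ (Defs.edges G) (λ e → c (f (proj₁ e)) (f (proj₂ e)))

  ZeroSum : (Fin (Defs.n G) → Fin t) → Set
  ZeroSum f = (∀ a b → f a ≡ f b → a ≡ b) × total f ≡ ε

  zeroSum? : ∀ f → Dec (ZeroSum f)
  zeroSum? f = all? (λ a → all? (λ b → (f a ≟ f b) →-dec (a ≟ b))) ×-dec (total f ≟ ε)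

  -- There are finitely many maps, coded as numbers through `finToFun`, so a zero-sum copy can be
  -- searched for; this turns the refutation of `absent` into a witness.
  find-copy : ((∀ f → Injective _≡_ _≡_ f → total f ≡ ε → ⊥) → ⊥) → ∃ λ f → Injective _≡_ _≡_ f × total f ≡ ε
  find-copy main with any? (λ i → zeroSum? (finToFun i))
  ... | yes (i , inj , z) = finToFun i , (λ {a} {b} → inj a b) , z
  ... | no none = ⊥-elim (main (λ f inj z → none (funToFin f , (λ a b e → inj (trans (sym (finToFun-funToFin f a)) (trans e (finToFun-funToFin f b)))) ,
        trans (∑-cong (Defs.edges G) (λ {e} _ → cong₂ c (finToFun-funToFin f (proj₁ e)) (finToFun-funToFin f (proj₂ e)))) z)))

open Defs using (Graph; MaxDegree; ZeroSumRamseyAtMost; ZeroSumProperty; e; v)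

theorem1p2 : (Δ : ℕ) → 1 ≤ Δ → ∃ λ (C : ℕ) →
    (G : Graph) → MaxDegree G Δ → (Γ : FiniteAbelianGroup) →
    FiniteAbelianGroup.order Γ ∣ e G →
    ZeroSumRamseyAtMost Γ G (C * v G)
-- The successor makes the number of vertices of the complete graph positive.
theorem1p2 Δ 1≤Δ = suc total , result
  where
    K₁ : ℕ
    K₁ = selection-constant Δ
    constant : ℕ → ℕ
    constant d' = MainConstants.C Δ 1≤Δ (suc d') K₁
    total : ℕ
    -- The common degree of the selected vertices depends on G but is at most Δ; summing over all
    -- its possible values leaves a constant that depends on Δ alone.
    total = sumN (upTo Δ) constant
    result : (G : Graph) → MaxDegree G Δ → (Γ : FiniteAbelianGroup) → FiniteAbelianGroup.order Γ ∣ e G → ZeroSumRamseyAtMost Γ G (suc total * v G)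
    result G (deg≤ , i , deg-i) Γ order∣e = suc total * v G , *-mono-≤ {1} {suc total} (s≤s z≤n) (1≤n i) , ≤-refl , property
      where
        open GraphSums G using (degree; degree≡deg; degree-sum)
        1≤n : ∀ {j} → Fin j → 1 ≤ j
        1≤n fzero = s≤s z≤n
        1≤n (fsuc _) = s≤s z≤n
        deg≤Δ : ∀ a → degree a ≤ Δ
        deg≤Δ a = ≤-trans (≤-reflexive (degree≡deg a)) (deg≤ a)
        1≤e : 1 ≤ e G
        1≤e = half (e G) (≤-trans (≤-trans 1≤Δ (≤-reflexive (sym (trans (degree≡deg i) deg-i)))) (≤-trans (sumN-member degree (∈-allFin i)) (≤-reflexive degree-sum)))
          where
            half : ∀ k → 1 ≤ 2 * k → 1 ≤ k
            half (suc k) _ = s≤s z≤n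
        d' : ℕ
        d' = proj₁ (selection G Δ 1≤Δ deg≤Δ 1≤e)
        sel : Balls.Selection G Δ 1≤Δ deg≤Δ K₁ d'
        sel = proj₂ (selection G Δ 1≤Δ deg≤Δ 1≤e)
        open Balls.Selection sel using (vs; vs-degree; many)
        d'<Δ : d' < Δ
        d'<Δ = from vs id (≤-trans 1≤e many)
          where
            from : ∀ l → l ⊆ vs → 1 ≤ K₁ * length l → d' < Δ
            from [] _ h = ⊥-elim (<⇒≱ h (≤-reflexive (*-zeroʳ K₁)))
            from (a ∷ _) l⊆ _ = ≤-trans (≤-reflexive (sym (vs-degree (l⊆ (here refl))))) (deg≤Δ a)
        property : ZeroSumProperty Γ G (suc total * v G)
        property col = let (f , inj , z) = Search.find-copy finAb G colour (λ absent →
                             Group.Host.Setup.contradiction-at finAb (record { c = colour ; c-sym = colour-sym ; d' = d' })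
                               (record { G = G ; Δ = Δ ; 1≤Δ = 1≤Δ ; deg≤Δ = deg≤Δ ; K₁ = K₁ ; sel = sel ; annihilates = λ a → Group.∣⇒annihilates finAb a order∣e
                                 ; absent = absent ; m≤ = ≤-trans (∣⇒≤ {{>-nonZero 1≤e}} order∣e) many ; 1≤n = 1≤n i })
                               (*-monoˡ-≤ (v G) (≤-trans (sumN-member constant (∈-upTo⁺ d'<Δ)) (n≤1+n total))))
                       in f , inj , zero-sum G col f z
          where
            open Transport Γ using (finAb; zero-sum)
            colour : Fin (suc total * v G) → Fin (suc total * v G) → Fin (FiniteAbelianGroup.order Γ)
            colour x y = Inverse.from (FiniteAbelianGroup.enum Γ) (Colouring.col col x y)
            colour-sym : ∀ x y → colour x y ≡ colour y x
            colour-sym x y = Inverse.from-cong (FiniteAbelianGroup.enum Γ) (Colouring.colSym col x y)
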